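{- Let $\lambda,\nu$ be strict partitions with $\lambda\subset\nu$, let $S$ be a shifted Young tableau of shape $\lambda$ and $T$ a shifted Young tableau of shape $\nu/\lambda$, both with entries in $X=\{1'<1<2'<2<\cdots\}$. Then $(S^J\cup T)^J=T^J\cup S_T$. Consequently, the diagram $\widetilde{\mathcal Y}(\lambda)\times\widetilde{\mathcal Y}(\nu/\lambda)\xrightarrow{\Sigma}\bigsqcup_{\mu\subset\nu}\widetilde{\mathcal Y}(\mu)\times\widetilde{\mathcal Y}(\nu/\mu)$, with vertical maps $\varphi_\lambda$ and $\varphi$ and bottom map $J:\widetilde{\mathcal Y}_-(\lambda)\times\widetilde{\mathcal Y}(\nu/\lambda)\to\bigsqcup_{\mu\subset\nu}\widetilde{\mathcal Y}_-(\mu)\times\widetilde{\mathcal Y}(\nu/\mu)$, commutes: $J\circ\varphi_\lambda=\varphi\circ\Sigma$.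
   Context: Shifted shapes: for a strict partition $\lambda$, $S(\lambda)=\{(i,j):1\le i\le\ell(\lambda),\ i\le j\le\lambda_i+i-1\}$ (matrix coordinates), main diagonal $\{(i,i)\}$, $\lambda/\mu=S(\lambda)\setminus S(\mu)$; normal shape means $\mu=\emptyset$; $\lambda/\mu$ extends $\mu/\nu$ when $\nu\subseteq\mu\subseteq\lambda$. Alphabets: $X=\{1'<1<2'<2<\cdots\}$, $-X=\{\cdots<-2'<-2<-1'<-1\}$, $\overline{X}=\{\cdots<-1'<-1<0'<0<1'<1<\cdots\}$; bold $\mathbf{k}$ means $k$ or $k'$; $|x|$ removes the prime. A shifted Young tableau (SYT) is a filling of a skew shifted shape weakly increasing along rows and columns, each column with at most one unprimed $k$, each row with at most one $k'$. $\widetilde{\mathcal Y}(\lambda/\mu)$, $\widetilde{\mathcal Y}_-(\lambda/\mu)$: SYTs of shape $\lambda/\mu$ with entries in $X$, resp. $-X$. $*$-operation: $a^*=-a'$, $(a')^*=-a$ for unprimed $a$, with $-(-\mathbf a)=\mathbf a$. For an SYT $T$ of shape $\lambda/\mu$, $T^*$ has box $(\lambda_1-j+1,\lambda_1-i+1)$ filled with $(T_{i,j})^*$ for each box $(i,j)$ of $T$. Shifted jeu de taquin: for an empty inner corner $c$, let $x,y$ be the entries east and south of $c$; if only one exists move it into $c$; if both, move $x$ if $|x|<|y|$ or ($|x|=|y|$ and $x$ primed), else move $y$; diagonal exceptions: if $c=(i,i)$ with $a'$ at $(i,i+1)$ and $a$ at $(i+1,i+1)$, the result is $a,a$ at $(i,i),(i,i+1)$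 and $(i+1,i+1)$ vacated; with $a',a'$ the result is $a',a$ and $(i+1,i+1)$ vacated. Continue with the vacated box until it has no east or south neighbor, then remove it. Iterating to normal shape yields the rectification $\mathrm{Rect}(T)$. $T^J:=\mathrm{Rect}(T^*)$. Shifted tableau switching $\Sigma(S,T)=({}^ST,S_T)$ for SYTs with $T$ extending $S$: boxes labelled $\mathbf a$-boxes / $\mathbf b$-boxes; switches at an $\mathbf a$-box $c=(i,j)$ with entry $\alpha$, $E=(i,j+1)$, $S'=(i+1,j)$: (S3) $j=i$, $E$ a $\mathbf b$-box with entry $b'$, $(i+1,i+1)$ a $\mathbf b$-box with entry $\beta$: new entries $\beta$ at $(i,i)$, $b$ at $(i,i+1)$ ($\mathbf b$-boxes), $\alpha$ at $(i+1,i+1)$. (S4) $j=i+1$, $\alpha=a$, $(i,i)$ an $\mathbf a$-box with entry $\alpha_0$, $S'=(i+1,i+1)$ a $\mathbf b$-box with entry $\beta$, $E$ not a $\mathbf b$-box: new entries $\beta$ at $(i,i)$, $a'$ at $(i,i+1)$, $\alpha_0$ at $(i+1,i+1)$. (S7) as (S4) but $E$ a $\mathbf b$-box with entry $b$ (unchanged). (S5) $E,S'$ both $\mathbf b$-boxes, $E$ entry $b'$: interchange $c,E$. (S6) $E,S'$ both $\mathbf b$-boxes, $E$ entry $b$, not (S7): interchange $c,S'$. (S1) only $E$ a $\mathbf b$-box, not (S3): interchange $c,E$. (S2) only $S'$ a $\mathbf b$-box, not (S4): interchange $c,S'$. Fully switched: no $\mathbf a$-box has a $\mathbf b$-box as east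 or south neighbor; otherwise choose $\Box(U)$ = easternmost $\mathbf a$-box with entry $a$ having a $\mathbf b$-box as east or south neighbor, or if none the southernmost such with entry $a'$, and apply the applicable switch (map $\sigma$). The shifted switching process applies $\sigma$ until fully switched. For $(S,T)$: for letters $i$ of $S$ from largest to smallest and, for each, letters $j$ of $T$ from smallest to largest, apply the process in the current filling to (current $S$-boxes with entries $\mathbf i$, current $T$-boxes with entries $\mathbf j$); $S_T$ and ${}^ST$ are the final $S$- and $T$-labelled fillings. Maps: $\varphi_\lambda(S,T)=(S^J,T)$ on $\widetilde{\mathcal Y}(\lambda)\times\widetilde{\mathcal Y}(\nu/\lambda)$, and $\varphi=\bigcup_{\mu\subset\nu}\varphi_\mu$. For $(S',T)$ with $S'\in\widetilde{\mathcal Y}_-(\lambda)$, $T\in\widetilde{\mathcal Y}(\nu/\lambda)$, $J(S',T)$ is the pair (subtableau of $(S'\cup T)^J$ formed by its negative entries, subtableau formed by its positive entries). -}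

module Defs where

-- Shifted tableaux, shifted jeu de taquin, the *-operation, T^J, and
-- shifted tableau switching, following the definitions in the paper.
-- Conventions: positions are 0-indexed (row i, column j),
-- a filling is a function ℕ → ℕ → Maybe Letter (nothing = no box).

open import Data.Nat using (ℕ; zero; suc; _<_; _≤_; _∸_; _<ᵇ_; _≡ᵇ_)
open import Data.Integer as ℤ using (ℤ; +_; -[1+_])
open import Data.Bool using (Bool; true; false; if_then_else_; _∧_)
open import Data.Maybe using (Maybe; just; nothing)
open import Data.List using (List; []; _∷_; map; concatMap; upTo; downFrom)
open import Data.Product using (Σ; _×_; _,_; ∃)
open import Data.Sum using (_⊎_)
open import Data.Empty using (⊥)
open import Relation.Nullary using (¬_; does)
open import Relation.Binary.PropositionalEquality using (_≡_)

-- Letters of the alphabet  X̄ = {… < -1' < -1 < 0' < 0 < 1' < 1 < …}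

record Letter : Set where
  constructor mk
  field
    val    : ℤ
    primed : Bool
open Letter public

rank : Letter → ℤ
rank (mk v true)  = (ℤ.+ 2 ℤ.* v) ℤ.- ℤ.+ 1
rank (mk v false) = ℤ.+ 2 ℤ.* v

_≤L_ : Letter → Letter → Set
x ≤L y = rank x ℤ.≤ rank y

InX : Letter → Set
InX x = ℤ.+ 1 ℤ.≤ val x

starL : Letter → Letter
starL (mk v false) = mk (ℤ.- v) true
starL (mk v true)  = mk (ℤ.- v) false

data IsStrict : List ℕ → Set where
  nil  : IsStrict []
  one  : ∀ {m} → 0 < m → IsStrict (m ∷ [])
  cons : ∀ {m n μ} → n < m → IsStrict (n ∷ μ) → IsStrict (m ∷ n ∷ μ)

-- inS λ i j : (i , j) ∈ S(λ)   (0-indexed: i < ℓ(λ), i ≤ j < λ_i + i)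
inS : List ℕ → ℕ → ℕ → Set
inS []      i       j       = ⊥
inS (m ∷ μ) zero    j       = j < m
inS (m ∷ μ) (suc i) zero    = ⊥
inS (m ∷ μ) (suc i) (suc j) = inS μ i j

_⊑_ : List ℕ → List ℕ → Set
μ ⊑ λ′ = ∀ i j → inS μ i j → inS λ′ i j

head0 : List ℕ → ℕ
head0 []      = 0
head0 (m ∷ _) = m

Filling : Set
Filling = ℕ → ℕ → Maybe Letter

IsBox : Filling → ℕ → ℕ → Set
IsBox F i j = ∃ λ x → F i j ≡ just x

_≐_ : Filling → Filling → Set
F ≐ G = ∀ i j → F i j ≡ G i j

ShapeOf : Filling → List ℕ → List ℕ → Set
ShapeOf F λ′ μ = ∀ i j →
  (IsBox F i j → inS λ′ i j × ¬ inS μ i j) × (inS λ′ i j → ¬ inS μ i j → IsBox F i j)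

record SYT (λ′ μ : List ℕ) (F : Filling) : Set where
  field
    shape    : ShapeOf F λ′ μ
    entries  : ∀ i j x → F i j ≡ just x → InX x
    rowWeak  : ∀ i j j′ x y → j < j′ → F i j ≡ just x → F i j′ ≡ just y → x ≤L y
    colWeak  : ∀ i i′ j x y → i < i′ → F i j ≡ just x → F i′ j ≡ just y → x ≤L y
    colUnpr  : ∀ i i′ j x → i < i′ → F i j ≡ just x → F i′ j ≡ just x → primed x ≡ true
    rowPrim  : ∀ i j j′ x → j < j′ → F i j ≡ just x → F i j′ ≡ just x → primed x ≡ false

Bounded : ℕ → Filling → Set
Bounded N F = ∀ i j x → F i j ≡ just x → val x ℤ.≤ ℤ.+ N

upd : Filling → ℕ → ℕ → Maybe Letter → Filling
upd F i j v i′ j′ = if (i ≡ᵇ i′) ∧ (j ≡ᵇ j′) then v else F i′ j′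

-- union of fillings (used for fillings with disjoint supports)
_∪F_ : Filling → Filling → Filling
(F ∪F G) i j with F i j
... | just x  = just x
... | nothing = G i j

negPart : Filling → Filling
negPart F i j with F i j
... | nothing = nothing
... | just x  = if does (val x ℤ.<? ℤ.+ 0) then just x else nothing

posPart : Filling → Filling
posPart F i j with F i j
... | nothing = nothing
... | just x  = if does (ℤ.+ 0 ℤ.<? val x) then just x else nothing

-- The * operation on tableaux: box (i , j) goes to (L-1-j , L-1-i)
-- (0-indexed version of (λ1-j+1 , λ1-i+1)), L = λ_1 of the outer shape.

star : ℕ → Filling → Filling
star L F i j =
  if (i <ᵇ L) ∧ (j <ᵇ L)
  then Data.Maybe.map starL (F (L ∸ 1 ∸ j) (L ∸ 1 ∸ i))
  else nothing

Exc : Filling → ℕ → ℕ → Set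
Exc F i j = (i ≡ j) × (∃ λ a → F i (suc i) ≡ just (mk a true)
                        × ∃ λ p → F (suc i) (suc i) ≡ just (mk a p))

-- which of the east entry x / south entry y is moved: x iff PrefEast x y
PrefEast : Letter → Letter → Set
PrefEast x y = (val x ℤ.< val y) ⊎ ((val x ≡ val y) × (primed x ≡ true))

-- Slide F i j R : sliding the vacated box (i , j) through F until it has
-- no east or south neighbour (and is then removed) yields R.
data Slide : Filling → ℕ → ℕ → Filling → Set where
  stop  : ∀ {F i j} → F i (suc j) ≡ nothing → F (suc i) j ≡ nothing → Slide F i j F
  excU  : ∀ {F i a R} → F i (suc i) ≡ just (mk a true) → F (suc i) (suc i) ≡ just (mk a false) →
          Slide (upd (upd (upd F i i (just (mk a false))) i (suc i) (just (mk a false)))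
                     (suc i) (suc i) nothing) (suc i) (suc i) R →
          Slide F i i R
  excP  : ∀ {F i a R} → F i (suc i) ≡ just (mk a true) → F (suc i) (suc i) ≡ just (mk a true) →
          Slide (upd (upd (upd F i i (just (mk a true))) i (suc i) (just (mk a false)))
                     (suc i) (suc i) nothing) (suc i) (suc i) R →
          Slide F i i R
  east  : ∀ {F i j x R} → F i (suc j) ≡ just x → F (suc i) j ≡ nothing → ¬ Exc F i j →
          Slide (upd (upd F i j (just x)) i (suc j) nothing) i (suc j) R → Slide F i j R
  south : ∀ {F i j y R} → F i (suc j) ≡ nothing → F (suc i) j ≡ just y →
          Slide (upd (upd F i j (just y)) (suc i) j nothing) (suc i) j R → Slide F i j R
  bothE : ∀ {F i j x y R} → F i (suc j) ≡ just x → F (suc i) j ≡ just y → PrefEast x y →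
          ¬ Exc F i j →
          Slide (upd (upd F i j (just x)) i (suc j) nothing) i (suc j) R → Slide F i j R
  bothS : ∀ {F i j x y R} → F i (suc j) ≡ just x → F (suc i) j ≡ just y → ¬ PrefEast x y →
          ¬ Exc F i j →
          Slide (upd (upd F i j (just y)) (suc i) j nothing) (suc i) j R → Slide F i j R

RemoveCorner : List ℕ → ℕ → ℕ → List ℕ → Set
RemoveCorner μ ci cj μ′ =
  IsStrict μ′ × inS μ ci cj × ¬ inS μ′ ci cj × (μ′ ⊑ μ) ×
  (∀ i j → inS μ i j → inS μ′ i j ⊎ ((i ≡ ci) × (j ≡ cj)))

-- Rect μ F R : R is obtained from F (a skew tableau with inner shape μ)
-- by jeu de taquin slides into inner corners until normal shape.
data Rect : List ℕ → Filling → Filling → Set where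
  done : ∀ {F} → Rect [] F F
  step : ∀ {μ μ′ ci cj F F′ R} → RemoveCorner μ ci cj μ′ → Slide F ci cj F′ →
         Rect μ′ F′ R → Rect μ F R

-- JRel L F R :  R = F^J = Rect(F^*), where L = λ_1 for the outer shape of F
JRel : ℕ → Filling → Filling → Set
JRel L F R = Σ (List ℕ) λ α → Σ (List ℕ) λ μ →
  IsStrict α × IsStrict μ × (μ ⊑ α) × ShapeOf (star L F) α μ × Rect μ (star L F) R

-- Shifted tableau switching.  A = current a-boxes, B = current b-boxes.

Cand : Filling → Filling → ℕ → ℕ → Letter → Set
Cand A B i j α = (A i j ≡ just α) × (IsBox B i (suc j) ⊎ IsBox B (suc i) j)

data Chosen (A B : Filling) (i j : ℕ) : Set where
  unpr : ∀ {a} → Cand A B i j (mk a false) →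
         (∀ i′ j′ a′ → Cand A B i′ j′ (mk a′ false) → j′ ≤ j) → Chosen A B i j
  prim : ∀ {a} → (∀ i′ j′ a′ → ¬ Cand A B i′ j′ (mk a′ false)) →
         Cand A B i j (mk a true) →
         (∀ i′ j′ a′ → Cand A B i′ j′ (mk a′ true) → i′ ≤ i) → Chosen A B i j

FullySwitched : Filling → Filling → Set
FullySwitched A B = ∀ i j α → ¬ Cand A B i j α

swapA : Filling → ℕ → ℕ → ℕ → ℕ → Letter → Filling
swapA A ci cj di dj α = upd (upd A ci cj nothing) di dj (just α)

swapB : Filling → ℕ → ℕ → ℕ → ℕ → Letter → Filling
swapB B ci cj di dj β = upd (upd B di dj nothing) ci cj (just β)

-- conditions of (S3), (S4)/(S7) used in the "not (S·)" side conditions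
S3cond : Filling → ℕ → ℕ → Letter → Set
S3cond B i j x = (j ≡ i) × (primed x ≡ true) × IsBox B (suc i) (suc i)

S4cond : Filling → ℕ → ℕ → Letter → Set
S4cond A i j α = (j ≡ suc i) × (primed α ≡ false) × IsBox A i i

data SwitchAt (A B : Filling) : ℕ → ℕ → Filling → Filling → Set where
  S3 : ∀ {i α b β} → A i i ≡ just α → B i (suc i) ≡ just (mk b true) →
       B (suc i) (suc i) ≡ just β →
       SwitchAt A B i i
         (upd (upd A i i nothing) (suc i) (suc i) (just α))
         (upd (upd (upd B (suc i) (suc i) nothing) i i (just β)) i (suc i) (just (mk b false)))
  S4 : ∀ {i a α₀ β} → A i (suc i) ≡ just (mk a false) → A i i ≡ just α₀ →
       B (suc i) (suc i) ≡ just β → B i (suc (suc i)) ≡ nothing →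
       SwitchAt A B i (suc i)
         (upd (upd (upd A i i nothing) i (suc i) (just (mk a true))) (suc i) (suc i) (just α₀))
         (upd (upd B (suc i) (suc i) nothing) i i (just β))
  S7 : ∀ {i a α₀ β b} → A i (suc i) ≡ just (mk a false) → A i i ≡ just α₀ →
       B (suc i) (suc i) ≡ just β → B i (suc (suc i)) ≡ just (mk b false) →
       SwitchAt A B i (suc i)
         (upd (upd (upd A i i nothing) i (suc i) (just (mk a true))) (suc i) (suc i) (just α₀))
         (upd (upd B (suc i) (suc i) nothing) i i (just β))
  S5 : ∀ {i j α b β} → A i j ≡ just α → B i (suc j) ≡ just (mk b true) →
       B (suc i) j ≡ just β →
       SwitchAt A B i j (swapA A i j i (suc j) α) (swapB B i j i (suc j) (mk b true))
  S6 : ∀ {i j α b β} → A i j ≡ just α → B i (suc j) ≡ just (mk b false) →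
       B (suc i) j ≡ just β → ¬ S4cond A i j α →
       SwitchAt A B i j (swapA A i j (suc i) j α) (swapB B i j (suc i) j β)
  S1 : ∀ {i j α x} → A i j ≡ just α → B i (suc j) ≡ just x → B (suc i) j ≡ nothing →
       ¬ S3cond B i j x →
       SwitchAt A B i j (swapA A i j i (suc j) α) (swapB B i j i (suc j) x)
  S2 : ∀ {i j α y} → A i j ≡ just α → B i (suc j) ≡ nothing → B (suc i) j ≡ just y →
       ¬ S4cond A i j α →
       SwitchAt A B i j (swapA A i j (suc i) j α) (swapB B i j (suc i) j y)

data Process : Filling → Filling → Filling → Filling → Set where
  fin  : ∀ {A B} → FullySwitched A B → Process A B A B
  next : ∀ {A B A′ B′ A″ B″ i j} → Chosen A B i j → SwitchAt A B i j A′ B′ →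
         Process A′ B′ A″ B″ → Process A B A″ B″

restrict : ℕ → Filling → Filling
restrict k F i j with F i j
... | nothing = nothing
... | just x  = if does (val x ℤ.≟ ℤ.+ k) then just x else nothing

delete : ℕ → Filling → Filling
delete k F i j with F i j
... | nothing = nothing
... | just x  = if does (val x ℤ.≟ ℤ.+ k) then nothing else just x

pairs : ℕ → List (ℕ × ℕ)
pairs N = concatMap (λ k → map (λ l → (k , l)) (map suc (upTo N))) (map suc (downFrom N))

data Loop : List (ℕ × ℕ) → Filling → Filling → Filling → Filling → Set where
  lnil  : ∀ {S T} → Loop [] S T S T
  lcons : ∀ {k l ps S T A′ B′ S″ T″} →
          Process (restrict k S) (restrict l T) A′ B′ →
          Loop ps (delete k S ∪F A′) (delete l T ∪F B′) S″ T″ →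
          Loop ((k , l) ∷ ps) S T S″ T″

-- Switch N S T TS ST :  Σ(S , T) = (TS , ST) = (^S T , S_T), letters ≤ N
Switch : ℕ → Filling → Filling → Filling → Filling → Set
Switch N S T TS ST = Loop (pairs N) S T ST TS

-- A standardized tableau is the word of the contents of its boxes together with
-- its letters.  On contents, slides and switches obey the same local rule: two
-- successive boxes are exchanged iff the exchange is again a chain of shapes.
-- Hence switching chains is a symmetric involution, and by dual equivalence (a
-- check on chains of four boxes) rectification does not depend on the inner
-- tableau that is used.  So T ↦ T^J is evacuation on contents, an involution,
-- and the evacuation of a concatenation is obtained by switching: for S^J
-- followed by T this yields T^J followed by S_T.  The letters need no separate
-- computation: values are carried along unchanged, and a tableau is determined
-- by its contents, its values and one bit per value, the primedness of the
-- first letter of that value.  Slides and switches preserve these bits.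

module Submission where

open import Defs
open import Data.Nat hiding (compare; less; equal; greater)
open import Data.Nat.Properties
open import Data.Integer as ℤ using (ℤ)
import Data.Integer.Properties as ℤₚ
open import Data.Integer.Tactic.RingSolver using (solve-∀)
open import Data.Bool using (Bool; true; false; if_then_else_; _∧_; _∨_; not)
open import Data.Bool.Properties using (not-involutive)
open import Data.Maybe as Maybe using (Maybe; just; nothing; _<∣>_)
open import Data.Maybe.Properties using (just-injective)
open import Data.List using (List; []; _∷_; map; concatMap; upTo; downFrom; applyUpTo; cartesianProduct; _++_; reverse; length)
open import Data.List.Properties
  using (reverse-++; reverse-involutive; unfold-reverse; ∷-injective; ∷-injectiveˡ; ∷-injectiveʳ; ∷ʳ-injectiveʳ;
         ++-assoc; ++-identityʳ; map-++; map-applyUpTo; length-reverse)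
open import Data.List.Relation.Unary.All as All using (All; []; _∷_)
open import Data.List.Relation.Unary.All.Properties using (++⁺; ++⁻ˡ; ++⁻ʳ; map⁺)
open import Data.List.Relation.Unary.Any using () renaming (here to hereₐ; there to thereₐ)
open import Data.List.Membership.Propositional using (_∈_)
open import Data.List.Membership.Propositional.Properties using (∈-upTo⁺; ∈-cartesianProduct⁺)
open import Data.Vec using (Vec; lookup) renaming ([] to []ᵥ; _∷_ to _∷ᵥ_)
open import Data.Fin using (Fin; toℕ) renaming (zero to fzero; suc to fsuc)
open import Data.Fin.Properties using (pigeonhole; any?; all?; ¬∀⟶∃¬; toℕ<n; toℕ≤pred[n])
open import Data.Product using (Σ; _×_; _,_; proj₁; proj₂; ∃)
open import Data.Sum using (_⊎_; inj₁; inj₂)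
open import Data.Unit using (⊤; tt)
open import Data.Empty using (⊥; ⊥-elim)
open import Relation.Nullary
open import Relation.Binary.Definitions using (tri<; tri≈; tri>)
open import Relation.Binary.PropositionalEquality

-- Independence of the inner tableau is not enough for evacuation: the shape of the outcome is
-- needed too. Every chain is therefore continued by an auxiliary word `z` up to a staircase. There
-- the part above an inner shape rectifies to the complementary shape, which settles the one letter
-- left open in the induction for `evac`. The finite check is made for contents below 12 only,
-- because five contents always miss one of six consecutive pairs, and such a gap can be closed. The
-- other obstacle is the main diagonal. On contents the exceptional slide and the switches S3, S4,
-- S7 are ordinary steps at 0, 1, 0, but they change primes, and S4 and S7 move two a-boxes at once.
-- A switching process is therefore read twice: each a-box slides through the run of b-boxes, and
-- each b-box slides through the starred and reversed run of a-boxes. In the first reading S3 is the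
-- exceptional slide, in the second S4 and S7 are. The first reading yields the primes of the b-run,
-- the second those of the a-run.

-- Near and far contents

isZero : ℕ → Bool
isZero zero    = true
isZero (suc _) = false

-- True when the contents differ by at most 1. Two boxes added in succession commute exactly when
-- their contents are not near. The boolean form lets the finite check compute.
near : ℕ → ℕ → Bool
near zero    b       = isZero (pred b)
near (suc a) zero    = isZero a
near (suc a) (suc b) = near a b

near-sym : ∀ a b → near a b ≡ near b a
near-sym zero zero = refl
near-sym zero (suc zero) = refl
near-sym zero (suc (suc b)) = refl
near-sym (suc zero) zero = refl
near-sym (suc (suc a)) zero = refl
near-sym (suc a) (suc b) = near-sym a b

near⇒ : ∀ a b → near a b ≡ true → (a ≡ b) ⊎ (suc a ≡ b) ⊎ (a ≡ suc b)
near⇒ zero zero e = inj₁ refl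
near⇒ zero (suc zero) e = inj₂ (inj₁ refl)
near⇒ (suc zero) zero e = inj₂ (inj₂ refl)
near⇒ (suc a) (suc b) e with near⇒ a b e
... | inj₁ p = inj₁ (cong suc p)
... | inj₂ (inj₁ p) = inj₂ (inj₁ (cong suc p))
... | inj₂ (inj₂ p) = inj₂ (inj₂ (cong suc p))

near-refl : ∀ a → near a a ≡ true
near-refl zero = refl
near-refl (suc a) = near-refl a

near-suc : ∀ a → near a (suc a) ≡ true
near-suc zero = refl
near-suc (suc a) = near-suc a

near-pred : ∀ a → near (suc a) a ≡ true
near-pred a = trans (near-sym (suc a) a) (near-suc a)

far⇒ : ∀ a b → near a b ≡ false → (2 + a ≤ b) ⊎ (2 + b ≤ a)
far⇒ zero (suc (suc b)) e = inj₁ (s≤s (s≤s z≤n))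
far⇒ (suc (suc a)) zero e = inj₂ (s≤s (s≤s z≤n))
far⇒ (suc a) (suc b) e with far⇒ a b e
... | inj₁ p = inj₁ (s≤s p)
... | inj₂ p = inj₂ (s≤s p)

⇒far : ∀ a b → 2 + a ≤ b → near a b ≡ false
⇒far zero (suc zero) (s≤s ())
⇒far zero (suc (suc b)) p = refl
⇒far (suc a) (suc b) (s≤s p) = ⇒far a b p

far-≢ : ∀ {a b} → near a b ≡ false → a ≢ b
far-≢ {a} e refl with trans (sym (near-refl a)) e
... | ()

far-≢suc : ∀ {a b} → near a b ≡ false → suc a ≢ b
far-≢suc {a} e refl with trans (sym (near-suc a)) e
... | ()

far-≢pred : ∀ {a b} → near a b ≡ false → a ≢ suc b
far-≢pred {a} {b} e = λ { refl → case-⊥ (trans (sym (near-pred b)) e) }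
  where case-⊥ : true ≡ false → ⊥
        case-⊥ ()

far-sym : ∀ {a b} → near a b ≡ false → near b a ≡ false
far-sym {a} {b} e = trans (near-sym b a) e

-- Switching of words of contents

-- The local jeu de taquin rule on contents: of two successive boxes with
-- contents s and c, the pair is exchanged iff it commutes.
emit₁ carry₁ : ℕ → ℕ → ℕ
emit₁  s c = if near s c then s else c
carry₁ s c = if near s c then c else s

emit : ℕ → List ℕ → List ℕ
emit s []      = []
emit s (c ∷ w) = emit₁ s c ∷ emit (carry₁ s c) w

carry : ℕ → List ℕ → ℕ
carry s []      = s
carry s (c ∷ w) = carry (carry₁ s c) w

-- A chain of shapes below a given shape is listed downwards, a chain above
-- it upwards; lower and upper are the two halves after switching.
lower : List ℕ → List ℕ → List ℕ
lower []      w = w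
lower (s ∷ X) w = lower X (emit s w)

upper : List ℕ → List ℕ → List ℕ
upper []      w = []
upper (s ∷ X) w = carry s w ∷ upper X (emit s w)

emit₁-carry₁ : ∀ s c → emit₁ s c ≡ carry₁ c s
emit₁-carry₁ s c rewrite near-sym c s with near s c
... | true = refl
... | false = refl

-- The local rule fills a grid with one cell for each pair of letters of `X` and `w`. The
-- definitions evaluate it line by line along `X`; this lemma and `upper-∷` peel off the line of a
-- letter of `w` instead. Both orders agree by the symmetry `emit₁-carry₁`.
lower-∷ : ∀ X c w → lower X (c ∷ w) ≡ carry c X ∷ lower (emit c X) w
lower-∷ [] c w = refl
lower-∷ (s ∷ X) c w rewrite lower-∷ X (emit₁ s c) (emit (carry₁ s c) w)
  | emit₁-carry₁ s c | sym (emit₁-carry₁ c s) = refl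

upper-∷ : ∀ X c w → upper X (c ∷ w) ≡ upper (emit c X) w
upper-∷ [] c w = refl
upper-∷ (s ∷ X) c w rewrite upper-∷ X (emit₁ s c) (emit (carry₁ s c) w)
  | emit₁-carry₁ s c | sym (emit₁-carry₁ c s) = refl

lower-[] : ∀ X → lower X [] ≡ []
lower-[] [] = refl
lower-[] (s ∷ X) = lower-[] X

upper-[] : ∀ X → upper X [] ≡ X
upper-[] [] = refl
upper-[] (s ∷ X) = cong (s ∷_) (upper-[] X)

-- Transposing the grid of local exchanges turns emitted letters into carried ones.
lower≡upper : ∀ X w → lower X w ≡ upper w X
lower≡upper X [] = lower-[] X
lower≡upper X (c ∷ w) = trans (lower-∷ X c w) (cong (carry c X ∷_) (lower≡upper (emit c X) w))

lower-++ʳ : ∀ X u v → lower X (u ++ v) ≡ lower X u ++ lower (upper X u) v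
lower-++ʳ X [] v rewrite lower-[] X | upper-[] X = refl
lower-++ʳ X (c ∷ u) v rewrite lower-∷ X c (u ++ v) | lower-∷ X c u | upper-∷ X c u
  = cong (carry c X ∷_) (lower-++ʳ (emit c X) u v)

upper-++ʳ : ∀ X u v → upper X (u ++ v) ≡ upper (upper X u) v
upper-++ʳ X [] v rewrite upper-[] X = refl
upper-++ʳ X (c ∷ u) v rewrite upper-∷ X c (u ++ v) | upper-∷ X c u = upper-++ʳ (emit c X) u v

lower-++ˡ : ∀ X Y w → lower (X ++ Y) w ≡ lower Y (lower X w)
lower-++ˡ [] Y w = refl
lower-++ˡ (s ∷ X) Y w = lower-++ˡ X Y (emit s w)

upper-++ˡ : ∀ X Y w → upper (X ++ Y) w ≡ upper X w ++ upper Y (lower X w)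
upper-++ˡ [] Y w = refl
upper-++ˡ (s ∷ X) Y w = cong (carry s w ∷_) (upper-++ˡ X Y (emit s w))

emit-++ : ∀ s u v → emit s (u ++ v) ≡ emit s u ++ emit (carry s u) v
emit-++ s [] v = refl
emit-++ s (c ∷ u) v = cong (emit₁ s c ∷_) (emit-++ (carry₁ s c) u v)

carry-++ : ∀ s u v → carry s (u ++ v) ≡ carry (carry s u) v
carry-++ s [] v = refl
carry-++ s (c ∷ u) v = carry-++ (carry₁ s c) u v

local-involutive : ∀ s c → (emit₁ (carry₁ s c) (emit₁ s c) ≡ c) × (carry₁ (carry₁ s c) (emit₁ s c) ≡ s)
local-involutive s c with near s c in e
... | true rewrite trans (near-sym c s) e = refl , refl
... | false rewrite e = refl , refl

reverse-∷ : ∀ {A : Set} (x : A) xs → reverse (x ∷ xs) ≡ reverse xs ++ x ∷ []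
reverse-∷ = unfold-reverse

-- The local rule is an involution, so a hole that runs back through the reversed word undoes the
-- exchanges in the opposite order.
emit-inverse : ∀ s w →
  (emit (carry s w) (reverse (emit s w)) ≡ reverse w) × (carry (carry s w) (reverse (emit s w)) ≡ s)
emit-inverse s [] = refl , refl
emit-inverse s (c ∷ w)
  rewrite reverse-∷ (emit₁ s c) (emit (carry₁ s c) w) | reverse-∷ c w
        | emit-++ (carry (carry₁ s c) w) (reverse (emit (carry₁ s c) w)) (emit₁ s c ∷ [])
        | carry-++ (carry (carry₁ s c) w) (reverse (emit (carry₁ s c) w)) (emit₁ s c ∷ [])
        | proj₁ (emit-inverse (carry₁ s c) w) | proj₂ (emit-inverse (carry₁ s c) w)
        | proj₁ (local-involutive s c) | proj₂ (local-involutive s c) = refl , refl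

lower-[_] : ∀ c X → lower X (c ∷ []) ≡ carry c X ∷ []
lower-[ c ] X rewrite lower-∷ X c [] | lower-[] (emit c X) = refl

upper-[_] : ∀ c X → upper X (c ∷ []) ≡ emit c X
upper-[ c ] X rewrite upper-∷ X c [] | upper-[] (emit c X) = refl

switch-involutive : ∀ X w →
  (lower (reverse (lower X w)) (reverse (upper X w)) ≡ reverse X) ×
  (upper (reverse (lower X w)) (reverse (upper X w)) ≡ reverse w)
switch-involutive [] w = lower-[] (reverse w) , upper-[] (reverse w)
switch-involutive (s ∷ X) w
  rewrite reverse-∷ (carry s w) (upper X (emit s w)) | reverse-∷ s X
        | lower-++ʳ (reverse (lower X (emit s w))) (reverse (upper X (emit s w))) (carry s w ∷ [])
        | upper-++ʳ (reverse (lower X (emit s w))) (reverse (upper X (emit s w))) (carry s w ∷ [])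
        | proj₁ (switch-involutive X (emit s w)) | proj₂ (switch-involutive X (emit s w))
        | lower-[ carry s w ] (reverse (emit s w)) | upper-[ carry s w ] (reverse (emit s w))
        | proj₁ (emit-inverse s w) | proj₂ (emit-inverse s w) = refl , refl

-- Strict partitions as diagonal profiles, and chains of shapes

-- Shapes: a strict partition is recorded by the number h c of its boxes on
-- the c-th diagonal, i.e. the number of its parts exceeding c.  The box of
-- content c addable to h lies in row h c.

Shape : Set
Shape = ℕ → ℕ

∅ : Shape
∅ _ = 0

inc : ℕ → Shape → Shape
inc c h d = if c ≡ᵇ d then suc (h d) else h d

infixl 6 _⊕_
_⊕_ : Shape → List ℕ → Shape
h ⊕ []      = h
h ⊕ (c ∷ w) = inc c h ⊕ w

-- The difference of `h d` and `h (suc d)` counts the parts equal to `suc d`, so this is strictness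
-- of the partition. A bound on the parts is expressed separately, by `h L ≡ 0`.
Prof : Shape → Set
Prof h = ∀ d → (h d ≡ h (suc d)) ⊎ (h d ≡ suc (h (suc d)))

data Up (h : Shape) : List ℕ → Set where
  end : Prof h → Up h []
  _▸_ : ∀ {c w} → Prof h → Up (inc c h) w → Up h (c ∷ w)
infixr 5 _▸_

≡ᵇ-refl : ∀ n → (n ≡ᵇ n) ≡ true
≡ᵇ-refl zero = refl
≡ᵇ-refl (suc n) = ≡ᵇ-refl n

≢⇒≡ᵇ : ∀ {m n} → m ≢ n → (m ≡ᵇ n) ≡ false
≢⇒≡ᵇ {zero} {zero} p = ⊥-elim (p refl)
≢⇒≡ᵇ {zero} {suc n} p = refl
≢⇒≡ᵇ {suc m} {zero} p = refl
≢⇒≡ᵇ {suc m} {suc n} p = ≢⇒≡ᵇ (λ e → p (cong suc e))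

inc-same : ∀ c h → inc c h c ≡ suc (h c)
inc-same c h rewrite ≡ᵇ-refl c = refl

inc-diff : ∀ {c d} h → c ≢ d → inc c h d ≡ h d
inc-diff {c} {d} h p rewrite ≢⇒≡ᵇ p = refl

inc-cong : ∀ c {h g} → h ≗ g → inc c h ≗ inc c g
inc-cong c e d with c ≡ᵇ d
... | true = cong suc (e d)
... | false = e d

inc-comm : ∀ s c h → inc s (inc c h) ≗ inc c (inc s h)
inc-comm s c h d with s ≡ᵇ d | c ≡ᵇ d
... | true | true = refl
... | true | false = refl
... | false | true = refl
... | false | false = refl

⊕-cong : ∀ w {h g} → h ≗ g → h ⊕ w ≗ g ⊕ w
⊕-cong [] e = e
⊕-cong (c ∷ w) e = ⊕-cong w (inc-cong c e)

⊕-++ : ∀ h u v → h ⊕ (u ++ v) ≡ h ⊕ u ⊕ v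
⊕-++ h [] v = refl
⊕-++ h (c ∷ u) v = ⊕-++ (inc c h) u v

Prof-cong : ∀ {h g} → h ≗ g → Prof h → Prof g
Prof-cong e p d with p d
... | inj₁ q = inj₁ (trans (sym (e d)) (trans q (e (suc d))))
... | inj₂ q = inj₂ (trans (sym (e d)) (trans q (cong suc (e (suc d)))))

Up-cong : ∀ {h g w} → h ≗ g → Up h w → Up g w
Up-cong e (end p) = end (Prof-cong e p)
Up-cong e (_▸_ {c} p u) = Prof-cong e p ▸ Up-cong (inc-cong c e) u

Up-Prof : ∀ {h w} → Up h w → Prof h
Up-Prof (end p) = p
Up-Prof (p ▸ _) = p

Up-drop : ∀ u {h v} → Up h (u ++ v) → Up (h ⊕ u) v
Up-drop [] p = p
Up-drop (c ∷ u) (_ ▸ p) = Up-drop u p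

Up-take : ∀ u {h v} → Up h (u ++ v) → Up h u
Up-take [] p = end (Up-Prof p)
Up-take (c ∷ u) (q ▸ p) = q ▸ Up-take u p

Up-++ : ∀ {u h v} → Up h u → Up (h ⊕ u) v → Up h (u ++ v)
Up-++ (end _) q = q
Up-++ (p ▸ u) q = p ▸ Up-++ u q

Up-end : ∀ {h} w → Up h w → Prof (h ⊕ w)
Up-end [] (end p) = p
Up-end (c ∷ w) (_ ▸ u) = Up-end w u

-- Shapes at two successive diagonals decide Prof; a far pair s, c never
-- meets the same two diagonals.
Prof-exchange : ∀ h s c → near s c ≡ false → Prof h → Prof (inc c (inc s h)) → Prof (inc c h)
Prof-exchange h s c f p q d with s ≟ d | s ≟ suc d
... | yes refl | _ rewrite inc-diff {c} {d} h (λ e → far-≢ f (sym e)) | inc-diff {c} {suc d} h (λ e → far-≢suc f (sym e)) = p d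
... | no _ | yes refl rewrite inc-diff {c} {d} h (λ e → far-≢pred f (cong suc (sym e))) | inc-diff {c} {suc d} h (λ e → far-≢ f (sym e)) = p d
... | no a | no b with q d
... | r rewrite ≢⇒≡ᵇ a | ≢⇒≡ᵇ b = r

Up-exchange : ∀ {h s c w} → near s c ≡ false → Up h (s ∷ c ∷ w) → Up h (c ∷ s ∷ w)
Up-exchange {h} {s} {c} f (p ▸ q ▸ r) =
  p ▸ Prof-exchange h s c f p (Up-Prof r) ▸ Up-cong (inc-comm c s h) r

Up-local : ∀ {h s c w} → Up h (s ∷ c ∷ w) → Up h (emit₁ s c ∷ carry₁ s c ∷ w)
Up-local {s = s} {c} u with near s c in e
... | true = u
... | false = Up-exchange e u

Up-emit : ∀ {h} s w v → Up h (s ∷ w ++ v) → Up h (emit s w ++ carry s w ∷ v)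
Up-emit s [] v u = u
Up-emit s (c ∷ w) v u with Up-local u
... | p ▸ q = p ▸ Up-emit (carry₁ s c) w v q

Up-++ˡ : ∀ u {h v v′} → Up h (u ++ v) → (∀ g → Up g v → Up g v′) → Up h (u ++ v′)
Up-++ˡ [] p f = f _ p
Up-++ˡ (c ∷ u) (q ▸ p) f = q ▸ Up-++ˡ u p f

-- Switching only ever exchanges far letters, and such an exchange keeps all intermediate shapes
-- strict. The spectator `v` allows the use inside longer chains.
Up-switch : ∀ X {h} w v → Up h (reverse X ++ w ++ v) → Up h (lower X w ++ reverse (upper X w) ++ v)
Up-switch [] w v u = u
Up-switch (s ∷ X) w v u
  rewrite reverse-∷ s X | reverse-∷ (carry s w) (upper X (emit s w))
        | ++-assoc (reverse X) (s ∷ []) (w ++ v)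
        | ++-assoc (reverse (upper X (emit s w))) (carry s w ∷ []) v
  = Up-switch X (emit s w) (carry s w ∷ v) (Up-++ˡ (reverse X) u λ g → Up-emit s w v)

⊕-local : ∀ h s c → h ⊕ (emit₁ s c ∷ carry₁ s c ∷ []) ≗ h ⊕ (s ∷ c ∷ [])
⊕-local h s c d with near s c
... | true = refl
... | false = inc-comm s c h d

⊕-emit : ∀ h s w → h ⊕ (emit s w) ⊕ (carry s w ∷ []) ≗ h ⊕ (s ∷ w)
⊕-emit h s [] d = refl
⊕-emit h s (c ∷ w) d = trans (⊕-emit (inc (emit₁ s c) h) (carry₁ s c) w d) (⊕-cong w (⊕-local h s c) d)

⊕-switch : ∀ X h w → h ⊕ lower X w ⊕ reverse (upper X w) ≗ h ⊕ reverse X ⊕ w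
⊕-switch [] h w d = refl
⊕-switch (s ∷ X) h w d
  rewrite reverse-∷ s X | reverse-∷ (carry s w) (upper X (emit s w))
    | ⊕-++ (h ⊕ lower X (emit s w)) (reverse (upper X (emit s w))) (carry s w ∷ [])
    | ⊕-++ h (reverse X) (s ∷ [])
  = trans (inc-cong (carry s w) (⊕-switch X h (emit s w)) d) (⊕-emit (h ⊕ reverse X) s w d)

-- The geometric content: the cell east of a box addable on the diagonal `c` is the next free cell
-- of the diagonal `suc c`. In the same way `addable-south` makes the cell south of it the next free
-- one on the diagonal before.
addable-east : ∀ {h c} → Prof h → Prof (inc c h) → h c ≡ h (suc c)
addable-east {h} {c} p q with p c | q c
... | inj₁ e | _ = e
... | inj₂ e | r rewrite inc-same c h | inc-diff {c} {suc c} h (λ e → 1+n≢n (sym e)) with r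
... | inj₁ f = ⊥-elim (<-irrefl (trans (sym f) (cong suc e)) (m≤n⇒m≤1+n ≤-refl))
... | inj₂ f = trans (suc-injective f) refl

addable-south : ∀ {h c} → Prof h → Prof (inc (suc c) h) → h c ≡ suc (h (suc c))
addable-south {h} {c} p q with p c | q c
... | inj₂ e | _ = e
... | inj₁ e | r rewrite inc-same (suc c) h | inc-diff {suc c} {c} h 1+n≢n with r
... | inj₁ f = f
... | inj₂ f = ⊥-elim (<-irrefl (trans (sym e) f) (m≤n⇒m≤1+n ≤-refl))

-- Repeated contents in a chain

eqᵇ : ℕ → ℕ → Bool
eqᵇ x y = not (x <ᵇ y) ∧ not (y <ᵇ x)

eqᵇ⇒≡ : ∀ x y → eqᵇ x y ≡ true → x ≡ y
eqᵇ⇒≡ zero zero e = refl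
eqᵇ⇒≡ (suc x) (suc y) e = cong suc (eqᵇ⇒≡ x y e)

eqᵇ-refl : ∀ x → eqᵇ x x ≡ true
eqᵇ-refl zero = refl
eqᵇ-refl (suc x) = eqᵇ-refl x

-- Between two boxes of the same diagonal c there are boxes of the diagonals
-- c+1 and c-1; `again c up dn` looks for the next box of diagonal c.
again : ℕ → Bool → Bool → List ℕ → Bool
again c up dn []      = true
again c up dn (d ∷ w) =
  if eqᵇ d c then up ∧ dn else again c (up ∨ (near d c ∧ (c <ᵇ d))) (dn ∨ (near d c ∧ (d <ᵇ c))) w

-- A necessary condition for being a chain that does not mention the starting shape, hence testable
-- on words alone. On the main diagonal no box of smaller content can be asked for, whence the flag
-- `isZero c`.
spaced : List ℕ → Bool
spaced []      = true
spaced (c ∷ w) = again c false (isZero c) w ∧ spaced w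

<ᵇ-suc : ∀ c → (c <ᵇ suc c) ≡ true
<ᵇ-suc zero = refl
<ᵇ-suc (suc c) = <ᵇ-suc c

-- An unset flag certifies that the profile beside `c` is still as the last box of content `c` left
-- it: higher than on the next diagonal, or level with the previous one. Either fact forbids another
-- box of content `c`.
again-Up : ∀ {g w} c up dn → Up g w →
  (up ≡ false → g c ≡ suc (g (suc c))) →
  (dn ≡ false → Σ ℕ λ b → c ≡ suc b × g b ≡ g c) →
  again c up dn w ≡ true
again-Up c up dn (end _) E S = refl
again-Up {g} c up dn (_▸_ {d} {w} p u) E S with eqᵇ d c in e
again-Up {g} c up dn (_▸_ {d} {w} p u) E S | true with eqᵇ⇒≡ d c e
again-Up {g} c false dn (p ▸ u) E S | true | refl =
  ⊥-elim (1+n≢n (trans (sym (E refl)) (addable-east p (Up-Prof u))))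
again-Up {g} c true true (p ▸ u) E S | true | refl = refl
again-Up {g} c true false (p ▸ u) E S | true | refl with S refl
... | b , refl , f = ⊥-elim (1+n≢n (trans (sym (addable-south p (Up-Prof u))) f))
again-Up {g} c up dn (_▸_ {d} {w} p u) E S | false = again-Up c _ _ u (E′ up E) (S′ dn S)
  where
  d≢c : d ≢ c
  d≢c refl with trans (sym (eqᵇ-refl d)) e
  ... | ()
  E′ : ∀ up → (up ≡ false → g c ≡ suc (g (suc c))) → (up ∨ (near d c ∧ (c <ᵇ d))) ≡ false → inc d g c ≡ suc (inc d g (suc c))
  E′ true E ()
  E′ false E with d ≟ suc c
  ... | yes refl rewrite near-pred c | <ᵇ-suc c = λ ()
  ... | no n rewrite inc-diff {d} {c} g d≢c | inc-diff {d} {suc c} g n = λ _ → E refl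
  S′ : ∀ dn → (dn ≡ false → Σ ℕ λ b → c ≡ suc b × g b ≡ g c) → (dn ∨ (near d c ∧ (d <ᵇ c))) ≡ false → Σ ℕ λ b → c ≡ suc b × inc d g b ≡ inc d g c
  S′ true S ()
  S′ false S with S refl
  ... | b , refl , f with d ≟ b
  ...   | yes refl rewrite near-suc b | <ᵇ-suc b = λ ()
  ...   | no n = λ _ → b , refl , trans (inc-diff {d} {b} g n) (trans f (sym (inc-diff {d} {suc b} g d≢c)))

inc-south : ∀ c {g} → Prof g → Prof (inc c g) → isZero c ≡ false → Σ ℕ λ b → c ≡ suc b × inc c g b ≡ inc c g c
inc-south (suc b) {g} p q _ = b , refl , trans (inc-diff {suc b} {b} g 1+n≢n) (trans (addable-south p q) (sym (inc-same (suc b) g)))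

spaced-Up : ∀ {g} w → Up g w → spaced w ≡ true
spaced-Up [] u = refl
spaced-Up {g} (c ∷ w) (p ▸ u)
  rewrite again-Up c false (isZero c) u
    (λ _ → trans (inc-same c g) (cong suc (trans (addable-east p (Up-Prof u)) (sym (inc-diff {c} {suc c} g (λ e → 1+n≢n (sym e)))))))
    (inc-south c p (Up-Prof u)) = spaced-Up w u

-- Elementary dual equivalence and its finite check

-- An elementary dual equivalence exchanges two successive boxes of a chain of
-- four boxes (listed downwards) whose contents lie on both sides of the
-- content of a neighbouring third box, the fourth one being bounded by it.
between : ℕ → ℕ → ℕ → Bool
between b x y = ((x <ᵇ b) ∧ (b <ᵇ y)) ∨ ((y <ᵇ b) ∧ (b <ᵇ x))

maxᵇ : ℕ → ℕ → ℕ
maxᵇ a b = if a <ᵇ b then b else a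

data Place : Set where
  top mid bot : Place

exchange : Place → List ℕ → List ℕ
exchange top (x ∷ y ∷ a ∷ b ∷ []) = y ∷ x ∷ a ∷ b ∷ []
exchange mid (a ∷ x ∷ y ∷ b ∷ []) = a ∷ y ∷ x ∷ b ∷ []
exchange bot (a ∷ b ∷ x ∷ y ∷ []) = a ∷ b ∷ y ∷ x ∷ []
exchange _ w = w

admits : Place → List ℕ → Bool
admits top (x ∷ y ∷ b ∷ a ∷ []) = (a <ᵇ b) ∧ between b x y
admits mid (b ∷ x ∷ y ∷ a ∷ []) = between (maxᵇ a b) x y
admits bot (a ∷ b ∷ x ∷ y ∷ []) = (a <ᵇ b) ∧ between b x y
admits _ _ = false

sameᵇ : List ℕ → List ℕ → Bool
sameᵇ [] [] = true
sameᵇ (x ∷ u) (y ∷ v) = eqᵇ x y ∧ sameᵇ u v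
sameᵇ _ _ = false

elementary : List ℕ → List ℕ → Bool
elementary p q = ((admits top p ∧ sameᵇ q (exchange top p)) ∨ (admits mid p ∧ sameᵇ q (exchange mid p)))
               ∨ (admits bot p ∧ sameᵇ q (exchange bot p))

passesᵇ : ℕ → List ℕ → List ℕ → Bool
passesᵇ c p q = eqᵇ (carry c p) (carry c q) ∧ elementary (emit c p) (emit c q)

-- The invariant that makes equivalent words indistinguishable for everything that passes through
-- them: the same letter comes out, and the words left behind are again equivalent, possibly at
-- another place. The tests `spaced` discard words that no chain contains.
closedAt : Place → List ℕ → ℕ → Bool
closedAt m p c = not (admits m p ∧ (spaced (reverse p ++ c ∷ []) ∧ spaced (reverse (exchange m p) ++ c ∷ [])))
  ∨ passesᵇ c p (exchange m p)

closed : Place → Vec ℕ 5 → Bool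
closed m (x ∷ᵥ y ∷ᵥ z ∷ᵥ t ∷ᵥ c ∷ᵥ []ᵥ) = closedAt m (x ∷ y ∷ z ∷ t ∷ []) c

allBelow : ℕ → (ℕ → Bool) → Bool
allBelow zero    P = true
allBelow (suc n) P = P n ∧ allBelow n P

-- The test `admits` comes before the loop over `c` because it discards most words, which shortens
-- the evaluation in `closedBelow-12`.
closedBelow : ℕ → Place → Bool
closedBelow N m = allBelow N λ x → allBelow N λ y → allBelow N λ z → allBelow N λ t →
  not (admits m (x ∷ y ∷ z ∷ t ∷ [])) ∨ allBelow N λ c → closed m (x ∷ᵥ y ∷ᵥ z ∷ᵥ t ∷ᵥ c ∷ᵥ []ᵥ)

closedBelow-12 : ∀ m → closedBelow 12 m ≡ true
closedBelow-12 top = refl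
closedBelow-12 mid = refl
closedBelow-12 bot = refl

∧-split : ∀ {a b} → a ∧ b ≡ true → a ≡ true × b ≡ true
∧-split {true} {true} e = refl , refl

allBelow⇒ : ∀ n P → allBelow n P ≡ true → ∀ x → x < n → P x ≡ true
allBelow⇒ (suc n) P e x (s≤s x≤n) with x ≟ n
... | yes refl = proj₁ (∧-split e)
... | no x≢n = allBelow⇒ n P (proj₂ (∧-split {P n} e)) x (≤∧≢⇒< x≤n x≢n)

not-∨ : ∀ {a b} → not a ∨ b ≡ true → a ≡ true → b ≡ true
not-∨ {true} e refl = e

unadmitted : ∀ m p c → admits m p ≡ false → closedAt m p c ≡ true
unadmitted m p c e rewrite e = refl

closed-below : ∀ N m → closedBelow N m ≡ true → ∀ t → (∀ i → lookup t i < N) → closed m t ≡ true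
closed-below N m h (x ∷ᵥ y ∷ᵥ z ∷ᵥ t ∷ᵥ c ∷ᵥ []ᵥ) b = cases (admits m (x ∷ y ∷ z ∷ t ∷ [])) refl
  where
  cases : ∀ a → admits m (x ∷ y ∷ z ∷ t ∷ []) ≡ a → closedAt m (x ∷ y ∷ z ∷ t ∷ []) c ≡ true
  cases false e = unadmitted m (x ∷ y ∷ z ∷ t ∷ []) c e
  cases true e = allBelow⇒ N (λ c → closed m (x ∷ᵥ y ∷ᵥ z ∷ᵥ t ∷ᵥ c ∷ᵥ []ᵥ))
    (not-∨ (allBelow⇒ N _ (allBelow⇒ N _ (allBelow⇒ N _ (allBelow⇒ N _ h
       x (b fzero)) y (b (fsuc fzero))) z (b (fsuc (fsuc fzero)))) t (b (fsuc (fsuc (fsuc fzero))))) e)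
    c (b (fsuc (fsuc (fsuc (fsuc fzero)))))

-- Reduction to contents below 12

-- Closes the gap at v, v+1; on numbers avoiding these two values it preserves
-- order, nearness and zero.
squeeze : ℕ → ℕ → ℕ
squeeze zero    zero    = zero
squeeze zero    (suc x) = x
squeeze (suc v) zero    = zero
squeeze (suc v) (suc x) = suc (squeeze v x)

data Avoids : ℕ → ℕ → Set where
  below : ∀ {v} → Avoids (suc v) 0
  above : ∀ {x} → Avoids 0 (2 + x)
  shift : ∀ {v x} → Avoids v x → Avoids (suc v) (suc x)

avoids : ∀ v x → x ≢ v → x ≢ suc v → Avoids v x
avoids zero zero p q = ⊥-elim (p refl)
avoids zero (suc zero) p q = ⊥-elim (q refl)
avoids zero (suc (suc x)) p q = above
avoids (suc v) zero p q = below
avoids (suc v) (suc x) p q = shift (avoids v x (λ e → p (cong suc e)) (λ e → q (cong suc e)))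

squeeze-isZero : ∀ {v x} → Avoids v x → isZero (squeeze v x) ≡ isZero x
squeeze-isZero below = refl
squeeze-isZero above = refl
squeeze-isZero (shift a) = refl

squeeze-< : ∀ {v x y} → Avoids v x → Avoids v y → (squeeze v x <ᵇ squeeze v y) ≡ (x <ᵇ y)
squeeze-< below below = refl
squeeze-< below (shift b) = refl
squeeze-< above above = refl
squeeze-< (shift a) below = refl
squeeze-< (shift a) (shift b) = squeeze-< a b

squeeze-near : ∀ {v x y} → Avoids v x → Avoids v y → near (squeeze v x) (squeeze v y) ≡ near x y
squeeze-near below below = refl
squeeze-near below (shift b) = squeeze-isZero b
squeeze-near above above = refl
squeeze-near (shift a) below = squeeze-isZero a
squeeze-near (shift a) (shift b) = squeeze-near a b

module _ (v : ℕ) where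
  private φ = squeeze v

  φ-eq : ∀ {x y} → Avoids v x → Avoids v y → eqᵇ (φ x) (φ y) ≡ eqᵇ x y
  φ-eq a b rewrite squeeze-< a b | squeeze-< b a = refl

  φ-emit₁ : ∀ {s c} → Avoids v s → Avoids v c →
    (emit₁ (φ s) (φ c) ≡ φ (emit₁ s c)) × (carry₁ (φ s) (φ c) ≡ φ (carry₁ s c)) ×
    Avoids v (emit₁ s c) × Avoids v (carry₁ s c)
  φ-emit₁ {s} {c} a b rewrite squeeze-near a b with near s c
  ... | true = refl , refl , a , b
  ... | false = refl , refl , b , a

  φ-emit : ∀ {s w} → Avoids v s → All (Avoids v) w →
    (emit (φ s) (map φ w) ≡ map φ (emit s w)) × (carry (φ s) (map φ w) ≡ φ (carry s w)) ×
    All (Avoids v) (emit s w) × Avoids v (carry s w)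
  φ-emit a [] = refl , refl , [] , a
  φ-emit {s} {c ∷ w} a (b ∷ bs) with φ-emit₁ a b
  ... | e , f , g , h rewrite e | f with φ-emit h bs
  ... | e′ , f′ , g′ , h′ rewrite e′ | f′ = refl , refl , g ∷ g′ , h′

  φ-again : ∀ {c w} up dn → Avoids v c → All (Avoids v) w → again (φ c) up dn (map φ w) ≡ again c up dn w
  φ-again up dn a [] = refl
  φ-again {c} {d ∷ w} up dn a (b ∷ bs)
    rewrite φ-eq b a | squeeze-near b a | squeeze-< a b | squeeze-< b a
          | φ-again {c} {w} (up ∨ (near d c ∧ (c <ᵇ d))) (dn ∨ (near d c ∧ (d <ᵇ c))) a bs = refl

  φ-spaced : ∀ {w} → All (Avoids v) w → spaced (map φ w) ≡ spaced w
  φ-spaced [] = refl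
  φ-spaced {c ∷ w} (a ∷ as) rewrite squeeze-isZero a | φ-again false (isZero c) a as | φ-spaced as = refl

  φ-between : ∀ {b x y} → Avoids v b → Avoids v x → Avoids v y → between (φ b) (φ x) (φ y) ≡ between b x y
  φ-between b x y rewrite squeeze-< x b | squeeze-< b y | squeeze-< y b | squeeze-< b x = refl

  φ-max : ∀ {a b} → Avoids v a → Avoids v b → (maxᵇ (φ a) (φ b) ≡ φ (maxᵇ a b)) × Avoids v (maxᵇ a b)
  φ-max {a} {b} p q rewrite squeeze-< p q with a <ᵇ b
  ... | true = refl , q
  ... | false = refl , p

  φ-admits : ∀ m {w} → All (Avoids v) w → admits m (map φ w) ≡ admits m w
  φ-admits top (a ∷ b ∷ c ∷ d ∷ []) rewrite squeeze-< d c | φ-between c a b = refl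
  φ-admits mid (b ∷ x ∷ y ∷ a ∷ []) rewrite proj₁ (φ-max a b) = φ-between (proj₂ (φ-max a b)) x y
  φ-admits bot (a ∷ b ∷ x ∷ y ∷ []) rewrite squeeze-< a b | φ-between b x y = refl
  φ-admits top [] = refl
  φ-admits top (_ ∷ []) = refl
  φ-admits top (_ ∷ _ ∷ []) = refl
  φ-admits top (_ ∷ _ ∷ _ ∷ []) = refl
  φ-admits top (_ ∷ _ ∷ _ ∷ _ ∷ _ ∷ _) = refl
  φ-admits mid [] = refl
  φ-admits mid (_ ∷ []) = refl
  φ-admits mid (_ ∷ _ ∷ []) = refl
  φ-admits mid (_ ∷ _ ∷ _ ∷ []) = refl
  φ-admits mid (_ ∷ _ ∷ _ ∷ _ ∷ _ ∷ _) = refl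
  φ-admits bot [] = refl
  φ-admits bot (_ ∷ []) = refl
  φ-admits bot (_ ∷ _ ∷ []) = refl
  φ-admits bot (_ ∷ _ ∷ _ ∷ []) = refl
  φ-admits bot (_ ∷ _ ∷ _ ∷ _ ∷ _ ∷ _) = refl

  φ-same : ∀ {p q} → All (Avoids v) p → All (Avoids v) q → sameᵇ (map φ p) (map φ q) ≡ sameᵇ p q
  φ-same [] [] = refl
  φ-same [] (_ ∷ _) = refl
  φ-same (_ ∷ _) [] = refl
  φ-same (a ∷ as) (b ∷ bs) rewrite φ-eq a b | φ-same as bs = refl

  -- only lists of length four occur
  φ-elementary : ∀ {p q} → All (Avoids v) p → All (Avoids v) q → length p ≡ 4 →
    elementary (map φ p) (map φ q) ≡ elementary p q
  φ-elementary {a ∷ b ∷ c ∷ d ∷ []} A@(a′ ∷ b′ ∷ c′ ∷ d′ ∷ []) B refl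
    rewrite φ-admits top A | φ-admits mid A | φ-admits bot A
          | φ-same B (b′ ∷ a′ ∷ c′ ∷ d′ ∷ []) | φ-same B (a′ ∷ c′ ∷ b′ ∷ d′ ∷ [])
          | φ-same B (a′ ∷ b′ ∷ d′ ∷ c′ ∷ []) = refl

  emit-length : ∀ s w → length (emit s w) ≡ length w
  emit-length s [] = refl
  emit-length s (c ∷ w) = cong suc (emit-length _ w)

  exchange-All : ∀ {P : ℕ → Set} m {a b c d} → All P (a ∷ b ∷ c ∷ d ∷ []) → All P (exchange m (a ∷ b ∷ c ∷ d ∷ []))
  exchange-All top (a ∷ b ∷ c ∷ d ∷ []) = b ∷ a ∷ c ∷ d ∷ []
  exchange-All mid (a ∷ b ∷ c ∷ d ∷ []) = a ∷ c ∷ b ∷ d ∷ []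
  exchange-All bot (a ∷ b ∷ c ∷ d ∷ []) = a ∷ b ∷ d ∷ c ∷ []

  exchange-map : ∀ m a b c d → exchange m (map φ (a ∷ b ∷ c ∷ d ∷ [])) ≡ map φ (exchange m (a ∷ b ∷ c ∷ d ∷ []))
  exchange-map top a b c d = refl
  exchange-map mid a b c d = refl
  exchange-map bot a b c d = refl

  four-spaced : ∀ {p c} → All (Avoids v) p → length p ≡ 4 → Avoids v c →
    spaced (reverse (map φ p) ++ φ c ∷ []) ≡ spaced (reverse p ++ c ∷ [])
  four-spaced (a ∷ b ∷ c ∷ d ∷ []) refl e = φ-spaced (d ∷ c ∷ b ∷ a ∷ e ∷ [])

  exchange-length : ∀ m a b c d → length (exchange m (a ∷ b ∷ c ∷ d ∷ [])) ≡ 4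
  exchange-length top a b c d = refl
  exchange-length mid a b c d = refl
  exchange-length bot a b c d = refl

  φ-passes : ∀ p q {c} → All (Avoids v) p → All (Avoids v) q → length p ≡ 4 → Avoids v c →
    passesᵇ (φ c) (map φ p) (map φ q) ≡ passesᵇ c p q
  φ-passes p q {c} A B l C with φ-emit C A | φ-emit C B
  ... | e , f , g , h | e′ , f′ , g′ , h′
    rewrite e | f | e′ | f′ | φ-eq h h′ | φ-elementary g g′ (trans (emit-length c p) l) = refl

  φ-closed : ∀ m {x y z t c} → All (Avoids v) (x ∷ y ∷ z ∷ t ∷ []) → Avoids v c →
    closedAt m (map φ (x ∷ y ∷ z ∷ t ∷ [])) (φ c) ≡ closedAt m (x ∷ y ∷ z ∷ t ∷ []) c
  φ-closed m {x} {y} {z} {t} {c} A C = cong₂ (λ a b → not a ∨ b)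
    (cong₂ _∧_ (φ-admits m A) (cong₂ _∧_ (four-spaced A refl C)
      (trans (cong (λ q → spaced (reverse q ++ φ c ∷ [])) (exchange-map m x y z t))
             (four-spaced (exchange-All m A) (exchange-length m x y z t) C))))
    (trans (cong (passesᵇ (φ c) (map φ p)) (exchange-map m x y z t))
      (φ-passes p (exchange m p) A (exchange-All m A) refl C))
    where p = x ∷ y ∷ z ∷ t ∷ []

halve : ℕ → ℕ
halve zero = zero
halve (suc zero) = zero
halve (suc (suc n)) = suc (halve n)

halve-eq : ∀ i → halve (i + i) ≡ i × halve (suc (i + i)) ≡ i
halve-eq zero = refl , refl
halve-eq (suc i) rewrite +-suc i i = cong suc (proj₁ (halve-eq i)) , cong suc (proj₂ (halve-eq i))

-- Among the six pairs {2i, 2i+1} one is missed by five numbers.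
free-pair : (t : Vec ℕ 5) → Σ (Fin 6) λ i → ∀ j → halve (lookup t j) ≢ toℕ i
free-pair t with all? (λ i → any? (λ j → halve (lookup t j) ≟ toℕ i))
... | yes p with pigeonhole (s≤s (s≤s (s≤s (s≤s (s≤s (s≤s z≤n)))))) (λ i → proj₁ (p i))
...   | i , j , i<j , e = ⊥-elim (<-irrefl (trans (sym (proj₂ (p i))) (trans (cong (λ k → halve (lookup t k)) e) (proj₂ (p j)))) i<j)
free-pair t | no ¬p with ¬∀⟶∃¬ 6 _ (λ i → any? (λ j → halve (lookup t j) ≟ toℕ i)) ¬p
... | i , n = i , λ j e → n (j , e)

squeeze-≤ : ∀ v n x → v ≤ n → x ≤ suc n → squeeze v x ≤ n
squeeze-≤ zero n zero p q = z≤n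
squeeze-≤ zero n (suc x) p (s≤s q) = q
squeeze-≤ (suc v) (suc n) zero p q = z≤n
squeeze-≤ (suc v) (suc n) (suc x) (s≤s p) (s≤s q) = s≤s (squeeze-≤ v n x p q)

-- Induction on the bound. Beyond 12 one of the pairs 2i, 2i+1 with i at most 5 is missed by the
-- five contents; closing this gap lowers the bound by one and changes no comparison, nearness or
-- zero that `closed` inspects.
closed-all : ∀ m n t → (∀ i → lookup t i < n) → closed m t ≡ true
closed-all m n t b with n ≤? 12
... | yes n≤12 = closed-below 12 m (closedBelow-12 m) t (λ i → ≤-trans (b i) n≤12)
closed-all m zero t b | no n≰ = ⊥-elim (n≰ z≤n)
closed-all m (suc n) (x ∷ᵥ y ∷ᵥ z ∷ᵥ t ∷ᵥ c ∷ᵥ []ᵥ) b | no n≰ with free-pair (x ∷ᵥ y ∷ᵥ z ∷ᵥ t ∷ᵥ c ∷ᵥ []ᵥ)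
... | i , free = trans (sym (φ-closed v m (av fzero ∷ av (fsuc fzero) ∷ av (fsuc (fsuc fzero)) ∷ av (fsuc (fsuc (fsuc fzero))) ∷ [])
                     (av (fsuc (fsuc (fsuc (fsuc fzero)))))))
                   (closed-all m n (φ x ∷ᵥ φ y ∷ᵥ φ z ∷ᵥ φ t ∷ᵥ φ c ∷ᵥ []ᵥ) smaller)
  where
  v = toℕ i + toℕ i
  φ = squeeze v
  T = x ∷ᵥ y ∷ᵥ z ∷ᵥ t ∷ᵥ c ∷ᵥ []ᵥ
  av : ∀ j → Avoids v (lookup T j)
  av j = avoids v _ (λ e → free j (trans (cong halve e) (proj₁ (halve-eq (toℕ i)))))
                    (λ e → free j (trans (cong halve e) (proj₂ (halve-eq (toℕ i)))))
  11<n : 11 < n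
  11<n = ≤-pred (≰⇒> n≰)
  i≤5 : toℕ i ≤ 5
  i≤5 = ≤-pred (toℕ<n i)
  shrinks′ : ∀ n → 11 < n → ∀ x → x < suc n → φ x < n
  -- The gap `v` is at most 5 + 5, hence below `k`, which is at least 11.
  shrinks′ (suc k) (s≤s q) x x<n = s≤s (squeeze-≤ v k x (≤-trans (+-mono-≤ i≤5 i≤5) (≤-trans (n≤1+n 10) q)) (≤-pred x<n))
  shrinks = shrinks′ n 11<n
  smaller : ∀ j → lookup (φ x ∷ᵥ φ y ∷ᵥ φ z ∷ᵥ φ t ∷ᵥ φ c ∷ᵥ []ᵥ) j < n
  smaller fzero = shrinks x (b fzero)
  smaller (fsuc fzero) = shrinks y (b (fsuc fzero))
  smaller (fsuc (fsuc fzero)) = shrinks z (b (fsuc (fsuc fzero)))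
  smaller (fsuc (fsuc (fsuc fzero))) = shrinks t (b (fsuc (fsuc (fsuc fzero))))
  smaller (fsuc (fsuc (fsuc (fsuc fzero)))) = shrinks c (b (fsuc (fsuc (fsuc (fsuc fzero)))))

-- From the finite check to arbitrary chains

sameᵇ⇒≡ : ∀ u v → sameᵇ u v ≡ true → u ≡ v
sameᵇ⇒≡ [] [] e = refl
sameᵇ⇒≡ (x ∷ u) (y ∷ v) e = cong₂ _∷_ (eqᵇ⇒≡ x y (proj₁ (∧-split e))) (sameᵇ⇒≡ u v (proj₂ (∧-split {eqᵇ x y} e)))

∨-split : ∀ {a b} → a ∨ b ≡ true → (a ≡ true) ⊎ (b ≡ true)
∨-split {true} e = inj₁ refl
∨-split {false} e = inj₂ e

elementary⇒ : ∀ p q → elementary p q ≡ true → Σ Place λ m → admits m p ≡ true × q ≡ exchange m p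
elementary⇒ p q e with ∨-split {(admits top p ∧ sameᵇ q (exchange top p)) ∨ (admits mid p ∧ sameᵇ q (exchange mid p))} e
... | inj₂ f = bot , proj₁ (∧-split f) , sameᵇ⇒≡ q _ (proj₂ (∧-split {admits bot p} f))
... | inj₁ g with ∨-split {admits top p ∧ sameᵇ q (exchange top p)} g
...   | inj₁ f = top , proj₁ (∧-split f) , sameᵇ⇒≡ q _ (proj₂ (∧-split {admits top p} f))
...   | inj₂ f = mid , proj₁ (∧-split f) , sameᵇ⇒≡ q _ (proj₂ (∧-split {admits mid p} f))

admits-length : ∀ m p → admits m p ≡ true → length p ≡ 4
admits-length top (_ ∷ _ ∷ _ ∷ _ ∷ []) e = refl
admits-length mid (_ ∷ _ ∷ _ ∷ _ ∷ []) e = refl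
admits-length bot (_ ∷ _ ∷ _ ∷ _ ∷ []) e = refl

closedAt-all : ∀ m p c → length p ≡ 4 → closedAt m p c ≡ true
closedAt-all m p@(x ∷ y ∷ z ∷ t ∷ []) c refl =
  closed-all m (suc (x + (y + (z + (t + c))))) (x ∷ᵥ y ∷ᵥ z ∷ᵥ t ∷ᵥ c ∷ᵥ []ᵥ) bound
  where
  bound : ∀ j → lookup (x ∷ᵥ y ∷ᵥ z ∷ᵥ t ∷ᵥ c ∷ᵥ []ᵥ) j < suc (x + (y + (z + (t + c))))
  bound fzero = s≤s (m≤m+n x _)
  bound (fsuc fzero) = s≤s (≤-trans (m≤m+n y _) (m≤n+m _ x))
  bound (fsuc (fsuc fzero)) = s≤s (≤-trans (≤-trans (m≤m+n z _) (m≤n+m _ y)) (m≤n+m _ x))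
  bound (fsuc (fsuc (fsuc fzero))) = s≤s (≤-trans (≤-trans (≤-trans (m≤m+n t _) (m≤n+m _ z)) (m≤n+m _ y)) (m≤n+m _ x))
  bound (fsuc (fsuc (fsuc (fsuc fzero)))) = s≤s (≤-trans (≤-trans (≤-trans (m≤n+m c t) (m≤n+m _ z)) (m≤n+m _ y)) (m≤n+m _ x))

step-closed : ∀ m p c → admits m p ≡ true → spaced (reverse p ++ c ∷ []) ≡ true →
  spaced (reverse (exchange m p) ++ c ∷ []) ≡ true →
  carry c p ≡ carry c (exchange m p) × elementary (emit c p) (emit c (exchange m p)) ≡ true
step-closed m p c a s s′ with closedAt-all m p c (admits-length m p a)
... | cl rewrite a | s | s′ with ∧-split {eqᵇ (carry c p) (carry c (exchange m p))} cl
... | e , f = eqᵇ⇒≡ _ _ e , f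

-- The letters of `w` are fed through one at a time. By the finite check each comes out the same and
-- leaves equivalent words, whose place of exchange may move; the two chains provide the required
-- spacing.
elementary-lower : ∀ m p {h} w → admits m p ≡ true → Up h (reverse p ++ w) → Up h (reverse (exchange m p) ++ w) →
  lower p w ≡ lower (exchange m p) w
elementary-lower m p [] a u u′ = trans (lower-[] p) (sym (lower-[] (exchange m p)))
elementary-lower m p {h} (c ∷ w) a u u′
  with step-closed m p c a (spaced-Up _ (Up-take (reverse p ++ c ∷ []) (assoc p u)))
         (spaced-Up _ (Up-take (reverse (exchange m p) ++ c ∷ []) (assoc (exchange m p) u′)))
  where
  assoc : ∀ q → Up h (reverse q ++ c ∷ w) → Up h ((reverse q ++ c ∷ []) ++ w)
  assoc q = subst (Up h) (sym (++-assoc (reverse q) (c ∷ []) w))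
... | e , f with elementary⇒ (emit c p) (emit c (exchange m p)) f
... | m′ , a′ , g rewrite lower-∷ p c w | lower-∷ (exchange m p) c w | e | g
  = cong (carry c (exchange m p) ∷_) (elementary-lower m′ (emit c p) w a′ (tail p u)
      (subst (λ z → Up (inc (carry c (exchange m p)) h) (reverse z ++ w)) g (tail′ u′)))
  where
  after : ∀ q → Up h (reverse q ++ c ∷ w) → Up (inc (carry c q) h) (reverse (emit c q) ++ w)
  after q v with subst (Up h) (cong₂ (λ a b → a ++ reverse b ++ w) (lower-[ c ] q) (upper-[ c ] q)) (Up-switch q (c ∷ []) w v)
  ... | _ ▸ r = r
  tail : ∀ q → Up h (reverse p ++ c ∷ w) → Up (inc (carry c (exchange m p)) h) (reverse (emit c p) ++ w)
  tail q v = subst (λ k → Up (inc k h) (reverse (emit c p) ++ w)) e (after p v)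
  tail′ : Up h (reverse (exchange m p) ++ c ∷ w) → Up (inc (carry c (exchange m p)) h) (reverse (emit c (exchange m p)) ++ w)
  tail′ = after (exchange m p)

-- Corners of shapes and existence of chains

⊕-split : ∀ w h d → (h ⊕ w) d ≡ h d + (∅ ⊕ w) d
⊕-split [] h d = sym (+-identityʳ (h d))
⊕-split (c ∷ w) h d rewrite ⊕-split w (inc c h) d | ⊕-split w (inc c ∅) d with c ≡ᵇ d
... | true = sym (+-suc (h d) _)
... | false = refl

⊕-mono : ∀ h w d → h d ≤ (h ⊕ w) d
⊕-mono h w d rewrite ⊕-split w h d = m≤m+n (h d) _

⊕-reverse : ∀ w → ∅ ⊕ reverse w ≗ ∅ ⊕ w
⊕-reverse [] d = refl
⊕-reverse (c ∷ w) d rewrite reverse-∷ c w | ⊕-++ ∅ (reverse w) (c ∷ []) | ⊕-split w (inc c ∅) d with c ≡ᵇ d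
... | true = cong suc (⊕-reverse w d)
... | false = ⊕-reverse w d

inc-cancel : ∀ c {h g} → inc c h ≗ inc c g → h ≗ g
inc-cancel c e d with c ≡ᵇ d | e d
... | true | q = suc-injective q
... | false | q = q

inc-injective : ∀ {b c} g → inc b g ≗ inc c g → b ≡ c
inc-injective {b} {c} g e with b ≟ c
... | yes p = p
... | no n = ⊥-elim (1+n≢n (trans (sym (inc-same c g)) (trans (sym (e c)) (inc-diff {b} {c} g n))))

≗-sym : ∀ {h g : Shape} → h ≗ g → g ≗ h
≗-sym e d = sym (e d)

≗-trans : ∀ {h g k : Shape} → h ≗ g → g ≗ k → h ≗ k
≗-trans e f d = trans (e d) (f d)

Prof-antitone : ∀ {h} → Prof h → ∀ t d → h (t + d) ≤ h d
Prof-antitone p zero d = ≤-refl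
Prof-antitone {h} p (suc t) d with p (t + d)
... | inj₁ e = ≤-trans (≤-reflexive (sym e)) (Prof-antitone p t d)
... | inj₂ e = ≤-trans (n≤1+n _) (≤-trans (≤-reflexive (sym e)) (Prof-antitone p t d))

Prof-≤ : ∀ {h} → Prof h → ∀ {d e} → d ≤ e → h e ≤ h d
Prof-≤ {h} p {d} {e} q = subst (λ k → h k ≤ h d) (m∸n+n≡m q) (Prof-antitone p (e ∸ d) d)

Prof-slope : ∀ {h} → Prof h → ∀ t d → h d ≤ t + h (t + d)
Prof-slope p zero d = ≤-refl
Prof-slope {h} p (suc t) d with p (t + d)
... | inj₁ e = ≤-trans (Prof-slope p t d) (≤-trans (≤-reflexive (cong (t +_) e)) (n≤1+n _))
... | inj₂ e = ≤-trans (Prof-slope p t d) (≤-reflexive (trans (cong (t +_) e) (+-suc t _)))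

Prof-bound : ∀ {h L} → Prof h → h L ≡ 0 → ∀ d → h d ≤ L ∸ d
Prof-bound {h} {L} p e d with ≤-total d L
... | inj₁ d≤L = ≤-trans (Prof-slope p (L ∸ d) d) (≤-reflexive (trans (cong (λ k → (L ∸ d) + h k) (m∸n+n≡m d≤L)) (trans (cong ((L ∸ d) +_) e) (+-identityʳ _))))
... | inj₂ L≤d = ≤-trans (Prof-≤ p L≤d) (≤-trans (≤-reflexive e) z≤n)

⊕-zero : ∀ {h w d} → (h ⊕ w) d ≡ 0 → h d ≡ 0
⊕-zero {h} {w} {d} e = n≤0⇒n≡0 (≤-trans (⊕-mono h w d) (≤-reflexive e))

letter-bound : ∀ {h c w L} → Up h (c ∷ w) → (h ⊕ (c ∷ w)) L ≡ 0 → c < L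
letter-bound {h} {c} {w} {L} (_ ▸ u) e with c <? L
... | yes p = p
... | no n = ⊥-elim (1+n≰n (≤-trans (≤-trans (s≤s z≤n) (≤-trans (≤-reflexive (sym (inc-same c h))) (Prof-≤ (Up-Prof u) (≮⇒≥ n)))) (≤-reflexive (⊕-zero {inc c h} {w} e))))

dec : ℕ → Shape → Shape
dec y h d = if y ≡ᵇ d then pred (h d) else h d

dec-same : ∀ c h → dec c h c ≡ pred (h c)
dec-same c h rewrite ≡ᵇ-refl c = refl

dec-diff : ∀ {c d} h → c ≢ d → dec c h d ≡ h d
dec-diff {c} {d} h p rewrite ≢⇒≡ᵇ p = refl

-- The last box on the diagonal `y` has neither an east nor a south neighbour, so it can be removed.
Corner : Shape → ℕ → Set
Corner h y = h y ≡ suc (h (suc y)) × (∀ b → y ≡ suc b → h b ≡ h y)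

inc-dec : ∀ {h y} → Corner h y → inc y (dec y h) ≗ h
inc-dec {h} {y} (e , _) d with y ≟ d
... | yes refl rewrite ≡ᵇ-refl y | e = refl
... | no n rewrite ≢⇒≡ᵇ n = refl

dec-Prof : ∀ {h y} → Prof h → Corner h y → Prof (dec y h)
dec-Prof {h} {y} p (e , f) d with y ≟ d
... | yes refl = inj₁ (trans (dec-same y h) (trans (cong pred e) (sym (dec-diff {y} {suc y} h (λ e → 1+n≢n (sym e))))))
... | no n with y ≟ suc d
...   | yes refl = inj₂ (trans (dec-diff {suc d} {d} h n) (trans (f d refl) (trans e (cong suc (sym (trans (dec-same (suc d) h) (cong pred e)))))))
...   | no m rewrite ≢⇒≡ᵇ n | ≢⇒≡ᵇ m = p d

inc-Corner : ∀ {h g y} → Prof g → Prof (inc y g) → inc y g ≗ h → Corner h y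
inc-Corner {h} {g} {y} p q e =
  trans (sym (e y)) (trans (inc-same y g) (cong suc (trans (addable-east p q) (trans (sym (inc-diff {y} {suc y} g (λ e → 1+n≢n (sym e)))) (e (suc y)))))) ,
  λ { b refl → trans (sym (e b)) (trans (inc-diff {suc b} {b} g 1+n≢n) (trans (addable-south p q) (trans (sym (inc-same (suc b) g)) (e (suc b))))) }

-- In a run of consecutive drops of the profile the leftmost one is a corner.
corner-below : ∀ {h} → Prof h → ∀ j → h j ≡ suc (h (suc j)) → Σ ℕ λ y → y ≤ j × Corner h y
corner-below p zero e = 0 , z≤n , e , λ _ ()
corner-below p (suc j) e with p j
... | inj₁ f = suc j , ≤-refl , e , λ { b refl → f }
... | inj₂ f with corner-below p j f
...   | y , y≤j , c = y , m≤n⇒m≤1+n y≤j , c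

-- The first drop after a level step is a corner, because the level step leaves the cell south of it
-- empty.
corner-between : ∀ {h} → Prof h → ∀ t m → h m ≡ h (suc m) → h (suc t + m) ≡ suc (h (suc (suc t + m))) →
  Σ ℕ λ b → m ≤ b × b ≤ t + m × Corner h (suc b)
corner-between p t m e f with p (suc m)
... | inj₂ g = m , ≤-refl , m≤n+m m t , g , λ { b refl → e }
corner-between p zero m e f | inj₁ g = ⊥-elim (1+n≢n (trans (sym f) g))
corner-between {h} p (suc t) m e f | inj₁ g
  with corner-between p t (suc m) g (subst (λ k → h k ≡ suc (h (suc k))) (cong suc (sym (+-suc t m))) f)
... | b , q , r , c = b , ≤-trans (n≤1+n m) q , ≤-trans r (≤-reflexive (+-suc t m)) , c

rowDown : ℕ → List ℕ
rowDown zero    = 0 ∷ []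
rowDown (suc L) = suc L ∷ rowDown L

rowShape : ℕ → Shape
rowShape L d = if d <ᵇ suc L then 1 else 0

rowShape-inc : ∀ L → inc (suc L) (rowShape L) ≗ rowShape (suc L)
rowShape-inc zero zero = refl
rowShape-inc zero (suc zero) = refl
rowShape-inc zero (suc (suc d)) = refl
rowShape-inc (suc L) zero = refl
rowShape-inc (suc L) (suc d) = rowShape-inc L d

rowShape-Prof : ∀ L → Prof (rowShape L)
rowShape-Prof zero zero = inj₂ refl
rowShape-Prof zero (suc d) = inj₁ refl
rowShape-Prof (suc L) zero = inj₁ refl
rowShape-Prof (suc L) (suc d) = rowShape-Prof L d

rowDown-shape : ∀ L → ∅ ⊕ reverse (rowDown L) ≗ rowShape L
rowDown-shape zero zero = refl
rowDown-shape zero (suc d) = refl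
rowDown-shape (suc L) d rewrite reverse-∷ (suc L) (rowDown L) | ⊕-++ ∅ (reverse (rowDown L)) (suc L ∷ [])
  = trans (inc-cong (suc L) (rowDown-shape L) d) (rowShape-inc L d)

rowDown-Up : ∀ L → Up ∅ (reverse (rowDown L))
rowDown-Up zero = (λ _ → inj₁ refl) ▸ end (Prof-cong (≗-sym (rowDown-shape zero)) (rowShape-Prof zero))
rowDown-Up (suc L) rewrite reverse-∷ (suc L) (rowDown L) =
  Up-++ (rowDown-Up L) (Prof-cong (≗-sym (rowDown-shape L)) (rowShape-Prof L)
    ▸ end (Prof-cong (≗-trans (≗-sym (rowShape-inc L)) (inc-cong (suc L) (≗-sym (rowDown-shape L)))) (rowShape-Prof (suc L))))

rowShape-≤ : ∀ {d L} → d ≤ L → rowShape L d ≡ 1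
rowShape-≤ {zero} p = refl
rowShape-≤ {suc d} (s≤s p) = rowShape-≤ p

rowShape-> : ∀ {d L} → L < d → rowShape L d ≡ 0
rowShape-> {suc zero} {zero} p = refl
rowShape-> {suc (suc d)} {zero} p = refl
rowShape-> {suc d} {suc L} (s≤s p) = rowShape-> p

-- The partition with an additional first part `suc L`. The boxes of `h` move one step down their
-- diagonals and keep their contents.
below-row : ℕ → Shape → Shape
below-row L h d = rowShape L d + h d

below-row-Prof : ∀ {L h} → Prof h → h L ≡ 0 → Prof (below-row L h)
below-row-Prof {L} {h} p e d with <-cmp d L
... | tri< d<L _ _ rewrite rowShape-≤ {d} {L} (<⇒≤ d<L) | rowShape-≤ {suc d} {L} d<L with p d
...   | inj₁ f = inj₁ (cong suc f)
...   | inj₂ f = inj₂ (cong suc f)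
below-row-Prof {L} {h} p e d | tri≈ _ refl _ rewrite rowShape-≤ {d} {d} ≤-refl | rowShape-> {suc d} {d} ≤-refl | e
  = inj₂ (cong suc (sym (n≤0⇒n≡0 (≤-trans (Prof-≤ p (n≤1+n d)) (≤-reflexive e)))))
below-row-Prof {L} {h} p e d | tri> _ _ d>L rewrite rowShape-> d>L | rowShape-> (m<n⇒m<1+n d>L) = p d

below-row-inc : ∀ L c h → inc c (below-row L h) ≗ below-row L (inc c h)
below-row-inc L c h d with c ≡ᵇ d
... | true = sym (+-suc (rowShape L d) (h d))
... | false = refl

below-row-Up : ∀ {L h w} → Up h w → (h ⊕ w) L ≡ 0 → Up (below-row L h) w
below-row-Up (end p) e = end (below-row-Prof p e)
below-row-Up {L} {h} (_▸_ {c} {w} p u) e = below-row-Prof p (⊕-zero {h} {c ∷ w} e) ▸ Up-cong (≗-sym (below-row-inc L c h)) (below-row-Up u e)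

pred-Prof : ∀ {h} → Prof h → Prof (λ d → pred (h d))
pred-Prof {h} p d with p d
... | inj₁ e = inj₁ (cong pred e)
... | inj₂ e with h (suc d)
...   | zero = inj₁ (cong pred e)
...   | suc k = inj₂ (cong pred e)

-- The first row is built box by box; the partition without its first part has a chain by induction,
-- and this chain keeps its word when it is pushed below the row.
chain-exists : ∀ L h → Prof h → h L ≡ 0 → Σ (List ℕ) λ w → Up ∅ w × ∅ ⊕ w ≗ h
chain-exists zero h p e = [] , end (λ _ → inj₁ refl) , λ d → sym (n≤0⇒n≡0 (≤-trans (Prof-≤ p (z≤n {d})) (≤-reflexive e)))
chain-exists (suc L) h p e with p L
... | inj₁ f = chain-exists L h p (trans f e)
... | inj₂ f with chain-exists L (λ d → pred (h d)) (pred-Prof p) (cong pred (trans f (cong suc e)))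
...   | w , u , q = reverse (rowDown L) ++ w ,
        Up-++ (rowDown-Up L) (Up-cong row≗ (below-row-Up u (trans (q L) (cong pred hL)))) ,
        λ d → trans (cong (λ g → g d) (⊕-++ ∅ (reverse (rowDown L)) w))
               (trans (⊕-split w (∅ ⊕ reverse (rowDown L)) d)
               (trans (cong₂ _+_ (rowDown-shape L d) (q d)) (back d)))
  where
  hL : h L ≡ 1
  hL = trans f (cong suc e)
  row≗ : below-row L ∅ ≗ ∅ ⊕ reverse (rowDown L)
  row≗ d = trans (+-identityʳ _) (sym (rowDown-shape L d))
  back : ∀ d → rowShape L d + pred (h d) ≡ h d
  back d with d ≤? L
  ... | yes q rewrite rowShape-≤ q with h d | ≤-trans (≤-reflexive (sym hL)) (Prof-≤ p q)
  ...   | suc k | _ = refl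
  back d | no q rewrite rowShape-> (≰⇒> q) = trans (cong pred z) (sym z)
    where z : h d ≡ 0
          z = n≤0⇒n≡0 (≤-trans (Prof-≤ p (≰⇒> q)) (≤-reflexive e))

sumTo : ℕ → Shape → ℕ
sumTo zero    h = 0
sumTo (suc N) h = h N + sumTo N h

sumTo-cong : ∀ N {h g} → h ≗ g → sumTo N h ≡ sumTo N g
sumTo-cong zero e = refl
sumTo-cong (suc N) e = cong₂ _+_ (e N) (sumTo-cong N e)

sumTo-inc-≥ : ∀ N {c} h → N ≤ c → sumTo N (inc c h) ≡ sumTo N h
sumTo-inc-≥ zero h p = refl
sumTo-inc-≥ (suc N) {c} h p = cong₂ _+_ (inc-diff {c} {N} h (λ { refl → 1+n≰n p })) (sumTo-inc-≥ N h (<⇒≤ p))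

sumTo-inc : ∀ N {c} h → c < N → sumTo N (inc c h) ≡ suc (sumTo N h)
sumTo-inc (suc N) {c} h (s≤s p) with c ≟ N
... | yes refl = cong₂ _+_ (inc-same c h) (sumTo-inc-≥ N h ≤-refl)
... | no n = trans (cong₂ _+_ (inc-diff {c} {N} h n) (sumTo-inc N h (≤∧≢⇒< p n))) (+-suc (h N) _)

sumTo-⊕ : ∀ N {h} w → Up h w → (h ⊕ w) N ≡ 0 → sumTo N (h ⊕ w) ≡ length w + sumTo N h
sumTo-⊕ N [] u e = refl
sumTo-⊕ N {h} (c ∷ w) v@(_ ▸ u) e = trans (sumTo-⊕ N w u e) (trans (cong (length w +_) (sumTo-inc N h (letter-bound v e))) (+-suc _ _))

finite : ∀ w → Σ ℕ λ N → ∀ d → N ≤ d → (∅ ⊕ w) d ≡ 0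
finite [] = 0 , λ _ _ → refl
finite (c ∷ w) with finite w
... | N , f = suc c + N , λ d q → trans (⊕-split w (inc c ∅) d)
    (cong₂ _+_ (inc-diff {c} {d} ∅ (λ { refl → 1+n≰n (≤-trans (m≤m+n (suc c) N) q) })) (f d (≤-trans (m≤n+m N (suc c)) q)))

same-length : ∀ u v → Up ∅ u → Up ∅ v → ∅ ⊕ u ≗ ∅ ⊕ v → length u ≡ length v
same-length u v p q e with finite u
... | N , f = trans (sym (+-identityʳ _)) (trans (cong (length u +_) (sym (z N))) (trans (sym (sumTo-⊕ N u p (f N ≤-refl)))
   (trans (sumTo-cong N e) (trans (sumTo-⊕ N v q (trans (sym (e N)) (f N ≤-refl))) (trans (cong (length v +_) (z N)) (+-identityʳ _))))))
  where
  z : ∀ N → sumTo N ∅ ≡ 0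
  z zero = refl
  z (suc N) = z N

<⇒<ᵇ≡ : ∀ {m n} → m < n → (m <ᵇ n) ≡ true
<⇒<ᵇ≡ {zero} {suc n} p = refl
<⇒<ᵇ≡ {suc m} {suc n} (s≤s p) = <⇒<ᵇ≡ p

-- Independence of the inner chain

-- Two boxes to be removed from `κ` such that the chains ending with y, z, k, l and with y, z, l, k
-- differ by an elementary dual equivalence: `z` lies between `k` and `l`, and `y` is below `z`.
record Pivot (κ : Shape) (k l : ℕ) : Set where
  field
    y z : ℕ
    core : Shape
    core-Prof : Prof core
    y-Prof : Prof (inc y core)
    shape : inc z (inc y core) ≗ κ
    y<z : y < z
    k<z : k < z
    z<l : z < l

-- Adding a box on `k` needs a level step there, adding one on `l` a drop just before it, so a
-- corner `z` lies between them. Its removal leaves a drop on the diagonal before `z`, and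
-- `corner-below` finds `y` from it.
pivot : ∀ κ k l → Prof κ → Prof (inc k κ) → Prof (inc l κ) → 2 + k ≤ l → Pivot κ k l
pivot κ k (suc l) p q r (s≤s k<l)
  with corner-between p (l ∸ suc k) k (addable-east p q)
         (subst (λ m → κ m ≡ suc (κ (suc m))) (sym (trans (sym (+-suc _ k)) (m∸n+n≡m k<l))) (addable-south p r))
... | b , k≤b , b≤ , c with corner-below (dec-Prof p c) b
        (trans (dec-diff {suc b} {b} κ 1+n≢n) (trans (proj₂ c b refl) (trans (proj₁ c) (cong suc (sym (trans (dec-same (suc b) κ) (cong pred (proj₁ c))))))))
...   | y , y≤b , c′ = record
        { y = y ; z = suc b ; core = dec y (dec (suc b) κ)
        ; core-Prof = dec-Prof (dec-Prof p c) c′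
        ; y-Prof = Prof-cong (≗-sym (inc-dec c′)) (dec-Prof p c)
        ; shape = ≗-trans (inc-cong (suc b) (inc-dec c′)) (inc-dec c)
        ; y<z = s≤s y≤b ; k<z = s≤s k≤b
        ; z<l = s≤s (≤-trans (s≤s b≤) (≤-reflexive (trans (sym (+-suc _ k)) (m∸n+n≡m k<l)))) }

reverse-∷-++ : ∀ (x : ℕ) xs ys → reverse (x ∷ xs) ++ ys ≡ reverse xs ++ x ∷ ys
reverse-∷-++ x xs ys = trans (cong (_++ ys) (reverse-∷ x xs)) (++-assoc (reverse xs) (x ∷ []) ys)

⊕-reverse-∷ : ∀ h x xs → h ⊕ reverse (x ∷ xs) ≡ inc x (h ⊕ reverse xs)
⊕-reverse-∷ h x xs = trans (cong (h ⊕_) (reverse-∷ x xs)) (⊕-++ h (reverse xs) (x ∷ []))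

Up-slide : ∀ {k X w} → Up ∅ (reverse (k ∷ X) ++ w) → Up ∅ (reverse X ++ emit k w)
Up-slide {k} {X} {w} u = Up-++ˡ (reverse X) (subst (Up ∅) (reverse-∷-++ k X w) u)
  λ g v → Up-take (emit k w) (Up-emit k w [] (subst (λ z → Up g (k ∷ z)) (sym (++-identityʳ w)) v))

Confluent : ℕ → Set
Confluent n = ∀ X Y w → length X ≡ n → length Y ≡ n → Up ∅ (reverse X ++ w) → Up ∅ (reverse Y ++ w) →
  ∅ ⊕ reverse X ≗ ∅ ⊕ reverse Y → lower X w ≡ lower Y w

-- Two chains ending with the commuting letters k and l are linked through the
-- chains V y z l k and V y z k l.
module Linking {n} (IH : Confluent n) (k l : ℕ) (X Y w : List ℕ) (lX : length X ≡ n) (lY : length Y ≡ n)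
  (κ : Shape) (pX : Prof (∅ ⊕ reverse X)) (pY : Prof (∅ ⊕ reverse Y)) (pκ : Prof κ)
  (lκ : inc l κ ≗ ∅ ⊕ reverse X) (kκ : inc k κ ≗ ∅ ⊕ reverse Y)
  (uτ : Up (inc k (∅ ⊕ reverse X)) w)
  (uX : Up ∅ (reverse X ++ k ∷ w)) (uY : Up ∅ (reverse Y ++ l ∷ w))
  (y z : ℕ) (core : Shape) (core-Prof : Prof core) (y-Prof : Prof (inc y core)) (shape : inc z (inc y core) ≗ κ)
  (adm : admits top (k ∷ l ∷ z ∷ y ∷ []) ≡ true)
  (rV : List ℕ) (uV : Up ∅ (reverse rV)) (eV : ∅ ⊕ reverse rV ≗ core) where

  zy≗ : ∅ ⊕ reverse (z ∷ y ∷ rV) ≗ κ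
  zy≗ d = trans (cong (λ g → g d) (trans (⊕-reverse-∷ ∅ z (y ∷ rV)) (cong (inc z) (⊕-reverse-∷ ∅ y rV))))
    (trans (inc-cong z (inc-cong y eV) d) (shape d))

  end≗ : ∀ m {h} → inc m κ ≗ h → h ≗ ∅ ⊕ reverse (m ∷ z ∷ y ∷ rV)
  end≗ m e d = trans (sym (e d)) (trans (sym (inc-cong m zy≗ d)) (cong (λ g → g d) (sym (⊕-reverse-∷ ∅ m (z ∷ y ∷ rV)))))

  uzy : ∀ v → Up core (y ∷ z ∷ v) → Up ∅ (reverse (z ∷ y ∷ rV) ++ v)
  uzy v u = subst (Up ∅) (sym (trans (reverse-∷-++ z (y ∷ rV) v) (reverse-∷-++ y rV (z ∷ v))))
    (Up-++ uV (Up-cong (≗-sym eV) u))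

  τ≗ : inc k (∅ ⊕ reverse X) ≗ inc l (∅ ⊕ reverse Y)
  τ≗ = ≗-trans (inc-cong k (≗-sym lκ)) (≗-trans (inc-comm k l κ) (inc-cong l kκ))

  core-lk : Up core (y ∷ z ∷ l ∷ k ∷ w)
  core-lk = core-Prof ▸ y-Prof ▸ Up-cong (≗-sym shape) (pκ ▸ Up-cong (≗-sym lκ) (pX ▸ uτ))

  core-kl : Up core (y ∷ z ∷ k ∷ l ∷ w)
  core-kl = core-Prof ▸ y-Prof ▸ Up-cong (≗-sym shape) (pκ ▸ Up-cong (≗-sym kκ) (pY ▸ Up-cong τ≗ uτ))

  -- Both chains end with the letter `a`. After `a` has slid through `w`, the induction hypothesis
  -- compares the remaining chains of length `n`, which have the same shape.
  side : ∀ a b Z → length Z ≡ n → inc b κ ≗ ∅ ⊕ reverse Z → Up ∅ (reverse Z ++ a ∷ w) → Up core (y ∷ z ∷ b ∷ a ∷ w) →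
    lower (a ∷ Z) w ≡ lower (a ∷ b ∷ z ∷ y ∷ rV) w
  side a b Z lZ e uZ u = IH Z P (emit a w) lZ lP
      (Up-slide {a} {Z} (subst (Up ∅) (sym (reverse-∷-++ a Z w)) uZ))
      (Up-slide {a} {P} (subst (Up ∅) (sym (reverse-∷-++ a P w)) uP)) (end≗ b e)
    where
    P = b ∷ z ∷ y ∷ rV
    uP : Up ∅ (reverse P ++ a ∷ w)
    uP = subst (Up ∅) (sym (reverse-∷-++ b (z ∷ y ∷ rV) (a ∷ w))) (uzy (b ∷ a ∷ w) u)
    lP : length P ≡ n
    lP = trans (sym (length-reverse P)) (trans (same-length (reverse P) (reverse Z) (Up-take (reverse P) uP)
      (Up-take (reverse Z) uZ) (≗-sym (end≗ b e))) (trans (length-reverse Z) lZ))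

  swap : lower (k ∷ l ∷ z ∷ y ∷ rV) w ≡ lower (l ∷ k ∷ z ∷ y ∷ rV) w
  swap = cong (lower rV) (elementary-lower top (k ∷ l ∷ z ∷ y ∷ []) {core} w adm core-lk core-kl)

  result : lower (k ∷ X) w ≡ lower (l ∷ Y) w
  result = trans (side k l X lX lκ uX core-lk) (trans swap (sym (side l k Y lY kκ uY core-kl)))

inc-≤ : ∀ c h d → h d ≤ inc c h d
inc-≤ c h d with c ≡ᵇ d
... | true = n≤1+n _
... | false = ≤-refl

confluence-far : ∀ {n} → Confluent n → ∀ k l X Y w → 2 + k ≤ l → length X ≡ n → length Y ≡ n →
  Up ∅ (reverse (k ∷ X) ++ w) → Up ∅ (reverse (l ∷ Y) ++ w) →
  ∅ ⊕ reverse (k ∷ X) ≗ ∅ ⊕ reverse (l ∷ Y) → lower (k ∷ X) w ≡ lower (l ∷ Y) w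
confluence-far {n} IH k l X Y w k≪l lX lY uX uY e = linked (pivot κ k l pκ (Prof-cong (≗-sym kκ) pY) (Prof-cong (≗-sym lκ) pX) k≪l)
  where
  gX = ∅ ⊕ reverse X
  gY = ∅ ⊕ reverse Y
  uX′ : Up ∅ (reverse X ++ k ∷ w)
  uX′ = subst (Up ∅) (reverse-∷-++ k X w) uX
  uY′ : Up ∅ (reverse Y ++ l ∷ w)
  uY′ = subst (Up ∅) (reverse-∷-++ l Y w) uY
  pX : Prof gX
  pX = Up-Prof (Up-drop (reverse X) uX′)
  pY : Prof gY
  pY = Up-Prof (Up-drop (reverse Y) uY′)
  uτ : Up (inc k gX) w
  uτ with Up-drop (reverse X) uX′
  ... | _ ▸ v = v
  pτ′ : Prof (inc l gY)
  pτ′ with Up-drop (reverse Y) uY′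
  ... | _ ▸ v = Up-Prof v
  e′ : inc k gX ≗ inc l gY
  e′ d = trans (cong (λ g → g d) (sym (⊕-reverse-∷ ∅ k X))) (trans (e d) (cong (λ g → g d) (⊕-reverse-∷ ∅ l Y)))
  k≢l : k ≢ l
  k≢l refl = 1+n≰n (≤-trans (n≤1+n (suc k)) k≪l)
  cl : Corner (inc k gX) l
  cl = inc-Corner pY pτ′ (≗-sym e′)
  at : ∀ {d} → k ≢ d → inc k gX d ≡ gX d
  at = inc-diff gX
  -- The box on `l` is a corner of the common shape. Removing `k` leaves the three diagonals around
  -- `l` untouched, so both boxes can be removed, which gives `κ`.
  corner : Corner gX l
  corner = trans (sym (at k≢l)) (trans (proj₁ cl) (cong suc (at (λ { refl → 1+n≰n (≤-trans (n≤1+n (suc l)) (≤-trans (n≤1+n _) k≪l)) })))) ,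
    λ { b refl → trans (sym (at (λ { refl → 1+n≰n k≪l }))) (trans (proj₂ cl b refl) (at k≢l)) }
  κ = dec l gX
  pκ : Prof κ
  pκ = dec-Prof pX corner
  lκ : inc l κ ≗ gX
  lκ = inc-dec corner
  kκ : inc k κ ≗ gY
  kκ = inc-cancel l (≗-trans (inc-comm l k κ) (≗-trans (inc-cong k lκ) e′))
  linked : Pivot κ k l → lower (k ∷ X) w ≡ lower (l ∷ Y) w
  linked pv = chained (chain-exists N core core-Prof core-N)
    where
    open Pivot pv
    N = proj₁ (finite (reverse X))
    core-N : core N ≡ 0
    core-N = n≤0⇒n≡0 (≤-trans (inc-≤ y core N) (≤-trans (inc-≤ z (inc y core) N) (≤-trans (≤-reflexive (shape N))
      (≤-trans (inc-≤ l κ N) (≤-trans (≤-reflexive (lκ N)) (≤-reflexive (proj₂ (finite (reverse X)) N ≤-refl)))))))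
    adm : admits top (k ∷ l ∷ z ∷ y ∷ []) ≡ true
    adm rewrite <⇒<ᵇ≡ y<z | <⇒<ᵇ≡ k<z | <⇒<ᵇ≡ z<l = refl
    chained : Σ (List ℕ) (λ V → Up ∅ V × ∅ ⊕ V ≗ core) → lower (k ∷ X) w ≡ lower (l ∷ Y) w
    chained (V , uV , eV) = Linking.result IH k l X Y w lX lY κ pX pY pκ lκ kκ uτ uX′ uY′ y z core core-Prof y-Prof shape adm
      (reverse V) (subst (Up ∅) (sym (reverse-involutive V)) uV)
      (λ d → trans (cong (λ v → (∅ ⊕ v) d) (reverse-involutive V)) (eV d))

-- Induction on the number of inner boxes, comparing the last boxes `k` and `l` of the two chains.
-- Equal ones cancel; far ones are linked through a pivot; near but distinct ones cannot occur,
-- since two corners of one shape never lie on adjacent diagonals.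
confluence-n : ∀ n → Confluent n
confluence-n zero [] [] w _ _ uX uY e = refl
confluence-n (suc n) (k ∷ X) (l ∷ Y) w lX lY uX uY e with k ≟ l
... | yes refl = confluence-n n X Y (emit k w) (suc-injective lX) (suc-injective lY) (Up-slide {k} {X} uX) (Up-slide {k} {Y} uY)
      (inc-cancel k λ d → trans (cong (λ g → g d) (sym (⊕-reverse-∷ ∅ k X))) (trans (e d) (cong (λ g → g d) (⊕-reverse-∷ ∅ k Y))))
... | no k≢l with near k l in f
...   | false with far⇒ k l f
...     | inj₁ p = confluence-far (confluence-n n) k l X Y w p (suc-injective lX) (suc-injective lY) uX uY e
...     | inj₂ p = sym (confluence-far (confluence-n n) l k Y X w p (suc-injective lY) (suc-injective lX) uY uX (≗-sym e))
confluence-n (suc n) (k ∷ X) (l ∷ Y) w lX lY uX uY e | no k≢l | true = ⊥-elim (clash (near⇒ k l f))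
  where
  corner : ∀ m Z → Up ∅ (reverse (m ∷ Z) ++ w) → Corner (∅ ⊕ reverse (m ∷ Z)) m
  corner m Z u with Up-drop (reverse Z) (subst (Up ∅) (reverse-∷-++ m Z w) u)
  ... | p ▸ v = inc-Corner p (Up-Prof v) (λ d → cong (λ g → g d) (sym (⊕-reverse-∷ ∅ m Z)))
  ck = corner k X uX
  cl = corner l Y uY
  cl′ : Corner (∅ ⊕ reverse (k ∷ X)) l
  cl′ = trans (e l) (trans (proj₁ cl) (cong suc (sym (e (suc l))))) , λ b q → trans (e b) (trans (proj₂ cl b q) (sym (e l)))
  clash : (k ≡ l) ⊎ (suc k ≡ l) ⊎ (k ≡ suc l) → ⊥
  clash (inj₁ p) = k≢l p
  clash (inj₂ (inj₁ refl)) = 1+n≢n (trans (sym (proj₁ ck)) (proj₂ cl′ k refl))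
  clash (inj₂ (inj₂ refl)) = 1+n≢n (trans (sym (proj₁ cl′)) (proj₂ ck l refl))

confluence : ∀ X Y w → Up ∅ (reverse X ++ w) → Up ∅ (reverse Y ++ w) →
  ∅ ⊕ reverse X ≗ ∅ ⊕ reverse Y → lower X w ≡ lower Y w
confluence X Y w uX uY e = confluence-n (length X) X Y w refl
  (trans (sym (length-reverse Y)) (trans (sym (same-length (reverse X) (reverse Y) (Up-take _ uX) (Up-take _ uY) e)) (length-reverse X))) uX uY e

-- Complements in a staircase

-- Complement in the staircase with L rows, reflected as by the *-operation.
compl : ℕ → Shape → Shape
compl L h d = (L ∸ d) ∸ h d

compl-cong : ∀ L {h g} → h ≗ g → compl L h ≗ compl L g
compl-cong L e d = cong (L ∸ d ∸_) (e d)

compl-Prof : ∀ {L h} → Prof h → h L ≡ 0 → Prof (compl L h)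
compl-Prof {L} {h} p e d with d <? L
... | no n rewrite m≤n⇒m∸n≡0 (≮⇒≥ n) | m≤n⇒m∸n≡0 (m≤n⇒m≤1+n (≮⇒≥ n)) = inj₁ (trans (0∸n≡0 (h d)) (sym (0∸n≡0 (h (suc d)))))
... | yes q rewrite +-∸-assoc 1 q with p d
...   | inj₂ f rewrite f = inj₁ refl
...   | inj₁ f rewrite f = inj₂ (+-∸-assoc 1 (Prof-bound p e (suc d)))

compl-zero : ∀ L h → compl L h L ≡ 0
compl-zero L h rewrite n∸n≡0 L = 0∸n≡0 (h L)

compl-inc : ∀ {L c h} → inc c h c ≤ L ∸ c → inc c (compl L (inc c h)) ≗ compl L h
compl-inc {L} {c} {h} p d with c ≟ d
... | no n rewrite ≢⇒≡ᵇ n = refl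
... | yes refl rewrite ≡ᵇ-refl c = sym (+-∸-assoc 1 p)

compl-compl : ∀ {L h} → (∀ d → h d ≤ L ∸ d) → compl L (compl L h) ≗ h
compl-compl f d = m∸[m∸n]≡n (f d)

-- A box removed at the upper end of a chain is added to the complement, on the same diagonal
-- because the reflection of the staircase preserves diagonals.
Up-reverse : ∀ {h w L} → Up h w → (h ⊕ w) L ≡ 0 →
  Up (compl L (h ⊕ w)) (reverse w) × compl L (h ⊕ w) ⊕ reverse w ≗ compl L h
Up-reverse (end p) e = end (compl-Prof p e) , λ d → refl
Up-reverse {h} {c ∷ w} {L} (p ▸ u) e with Up-reverse u e
... | v , q rewrite reverse-∷ c w =
    Up-++ v (Prof-cong (≗-sym q) (compl-Prof (Up-Prof u) iz) ▸ end (Prof-cong (≗-sym s) (compl-Prof p (⊕-zero {h} {c ∷ w} e)))) ,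
    λ d → trans (cong (λ g → g d) (⊕-++ (compl L (inc c h ⊕ w)) (reverse w) (c ∷ []))) (s d)
  where
  iz : inc c h L ≡ 0
  iz = ⊕-zero {inc c h} {w} e
  s : inc c (compl L (inc c h ⊕ w) ⊕ reverse w) ≗ compl L h
  s = ≗-trans (inc-cong c q) (compl-inc {L} {c} {h} (Prof-bound (Up-Prof u) iz c))

-- Passing c through a hook word exchanges the parts c and c + 1.
hookDown : Shape → ℕ → List ℕ
hookDown h zero    = 0 ∷ []
hookDown h (suc n) = if h n ≡ᵇ h (suc n) then suc n ∷ hookDown h n else hookDown h n ++ suc n ∷ []

emit-far : ∀ c w → All (λ d → near c d ≡ false) w → emit c w ≡ w × carry c w ≡ c
emit-far c [] [] = refl , refl
emit-far c (d ∷ w) (f ∷ fs) rewrite f | proj₁ (emit-far c w fs) | proj₂ (emit-far c w fs) = refl , refl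

hookDown-far : ∀ {c} h n → suc n < c → All (λ d → near c d ≡ false) (hookDown h n)
hookDown-far {suc (suc c)} h zero p = refl ∷ []
hookDown-far {zero} h zero ()
hookDown-far {suc zero} h zero (s≤s ())
hookDown-far {c} h (suc n) p with h n ≡ᵇ h (suc n)
... | true = far-sym {suc n} {c} (⇒far (suc n) c p) ∷ hookDown-far h n (<⇒≤ p)
... | false = ++⁺ (hookDown-far h n (<⇒≤ p)) (far-sym {suc n} {c} (⇒far (suc n) c p) ∷ [])

hookDown-cong : ∀ {h g} n → (∀ d → d ≤ n → h d ≡ g d) → hookDown h n ≡ hookDown g n
hookDown-cong zero e = refl
hookDown-cong (suc n) e rewrite e n (n≤1+n n) | e (suc n) ≤-refl | hookDown-cong n (λ d q → e d (m≤n⇒m≤1+n q)) = refl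

-- The word follows the profile. When a box on a positive `c` is added, the profile drops just
-- before `c` and is level just after it, so `suc c` stands in front of the smaller letters and `c`
-- behind them. Passing `c` interchanges the two, and adding the box interchanges the drop and the
-- level step.
hookDown-pass : ∀ {h c} n → Prof h → Prof (inc c h) → c < n →
  emit c (hookDown h n) ≡ hookDown (inc c h) n × carry c (hookDown h n) ≡ c
hookDown-pass {h} {c} (suc n) p q (s≤s c≤n) with c ≟ n
hookDown-pass {h} {zero} (suc .0) p q (s≤s c≤n) | yes refl
  rewrite addable-east {h} {0} p q | ≡ᵇ-refl (h 1) | ≢⇒≡ᵇ {suc (h 1)} {h 1} 1+n≢n = refl , refl
hookDown-pass {h} {suc b} (suc .(suc b)) p q (s≤s c≤n) | yes refl
  rewrite inc-same (suc b) h | inc-diff {suc b} {suc (suc b)} h (λ e → 1+n≢n (sym e)) | inc-diff {suc b} {b} h 1+n≢n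
        | addable-south {h} {b} p q | addable-east {h} {suc b} p q
        | ≡ᵇ-refl (h (suc (suc b))) | ≢⇒≡ᵇ {suc (h (suc (suc b)))} {h (suc (suc b))} 1+n≢n
        | near-suc b
        | emit-++ (suc (suc b)) (hookDown h b) (suc b ∷ []) | carry-++ (suc (suc b)) (hookDown h b) (suc b ∷ [])
        | proj₁ (emit-far (suc (suc b)) (hookDown h b) (hookDown-far {suc (suc b)} h b ≤-refl))
        | proj₂ (emit-far (suc (suc b)) (hookDown h b) (hookDown-far {suc (suc b)} h b ≤-refl))
        | near-pred b
        | hookDown-cong {inc (suc b) h} {h} b (λ d d≤b → inc-diff {suc b} {d} h (λ { refl → 1+n≰n d≤b }))
        = refl , refl
... | no c≢n with ≤∧≢⇒< c≤n c≢n
...   | c<n rewrite inc-diff {c} {n} h c≢n | inc-diff {c} {suc n} h (λ { refl → 1+n≰n (≤-trans (n≤1+n _) c<n) }) with h n ≡ᵇ h (suc n)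
...     | true rewrite ⇒far c (suc n) (s≤s c<n) | proj₁ (hookDown-pass n p q c<n) | proj₂ (hookDown-pass n p q c<n) = refl , refl
...     | false rewrite emit-++ c (hookDown h n) (suc n ∷ []) | carry-++ c (hookDown h n) (suc n ∷ [])
          | proj₁ (hookDown-pass n p q c<n) | proj₂ (hookDown-pass n p q c<n) | ⇒far c (suc n) (s≤s c<n) = refl , refl

lower-hookDown : ∀ {h w n} → Up h w → (h ⊕ w) n ≡ 0 → lower (hookDown h n) w ≡ w
lower-hookDown {h} {[]} {n} u e = lower-[] (hookDown h n)
lower-hookDown {h} {c ∷ w} {n} v@(p ▸ u) e
  rewrite lower-∷ (hookDown h n) c w | proj₁ (hookDown-pass n p (Up-Prof u) (letter-bound v e))
        | proj₂ (hookDown-pass n p (Up-Prof u) (letter-bound v e)) = cong (c ∷_) (lower-hookDown u e)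

hookDown-∅ : ∀ n → hookDown ∅ n ≡ rowDown n
hookDown-∅ zero = refl
hookDown-∅ (suc n) = cong (suc n ∷_) (hookDown-∅ n)

-- Sliding into an empty first row of full length moves each box one step up its diagonal, so
-- contents do not change.
lower-row : ∀ {w n} → Up ∅ w → (∅ ⊕ w) n ≡ 0 → lower (rowDown n) w ≡ w
lower-row {w} {n} u e = trans (cong (λ X → lower X w) (sym (hookDown-∅ n))) (lower-hookDown u e)

-- The shape of a rectified complement

record Complete (L : ℕ) (X w : List ℕ) : Set where
  field
    grows : Up ∅ (reverse X ++ w)
    fills : ∅ ⊕ reverse X ⊕ w ≗ λ d → L ∸ d
open Complete

mid-shape : List ℕ → Shape
mid-shape X = ∅ ⊕ reverse X

Complete-swap : ∀ {L X w} → Complete L X w → Complete L w X × (∅ ⊕ reverse w ≗ compl L (mid-shape X))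
Complete-swap {L} {X} {w} C = record { grows = v ; fills = t } , m
  where
  tot : ∅ ⊕ (reverse X ++ w) ≗ λ d → L ∸ d
  tot d = trans (cong (λ g → g d) (⊕-++ ∅ (reverse X) w)) (fills C d)
  rev = Up-reverse {∅} {reverse X ++ w} {L} (grows C) (trans (tot L) (n∸n≡0 L))
  start : compl L (∅ ⊕ (reverse X ++ w)) ≗ ∅
  start d = trans (cong (L ∸ d ∸_) (tot d)) (n∸n≡0 (L ∸ d))
  eq : reverse (reverse X ++ w) ≡ reverse w ++ X
  eq = trans (reverse-++ (reverse X) w) (cong (reverse w ++_) (reverse-involutive X))
  v : Up ∅ (reverse w ++ X)
  v = subst (Up ∅) eq (Up-cong start (proj₁ rev))
  t : ∅ ⊕ reverse w ⊕ X ≗ λ d → L ∸ d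
  t d = trans (cong (λ g → g d) (trans (sym (⊕-++ ∅ (reverse w) X)) (cong (∅ ⊕_) (sym eq))))
          (trans (⊕-cong (reverse (reverse X ++ w)) (≗-sym start) d) (proj₂ rev d))
  m : ∅ ⊕ reverse w ≗ compl L (mid-shape X)
  m d = trans (⊕-reverse w d) (trans (sym (m+n∸m≡n (mid-shape X d) _)) (cong (_∸ mid-shape X d) (trans (sym (⊕-split w (mid-shape X) d)) (fills C d))))

ShapeLemma : ℕ → Set
ShapeLemma L = ∀ X w → Complete L X w → ∅ ⊕ lower X w ≗ compl L (mid-shape X)

Up-pred : ∀ {L h w} → Up h w → (∀ d → d ≤ L → 1 ≤ h d) → (h ⊕ w) (suc L) ≡ 0 → Up (λ d → pred (h d)) w
Up-pred (end p) b e = end (pred-Prof p)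
Up-pred {L} {h} (_▸_ {c} {w} p u) b e = pred-Prof p ▸ Up-cong s (Up-pred u (λ d q → ≤-trans (b d q) (⊕-mono h (c ∷ []) d)) e)
  where
  s : (λ d → pred (inc c h d)) ≗ inc c (λ d → pred (h d))
  s d with c ≟ d
  ... | no n rewrite ≢⇒≡ᵇ n = refl
  ... | yes refl rewrite ≡ᵇ-refl c with h c | b c (≤-pred (letter-bound (p ▸ u) e))
  ...   | suc k | _ = refl

mid-Prof : ∀ {L X w} → Complete L X w → Prof (mid-shape X)
mid-Prof {X = X} C = Up-Prof (Up-drop (reverse X) (grows C))

shape-full : ∀ L → ShapeLemma L → ∀ X w → Complete (suc L) X w → mid-shape X L ≡ 1 →
  ∅ ⊕ lower X w ≗ compl (suc L) (mid-shape X)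
shape-full L IH X w C full d = trans (cong (λ v → (∅ ⊕ v) d) same) (trans (IH (reverse V) w C′ d) (compl≡ d))
  where
  m = mid-shape X
  m′ : Shape
  m′ d = pred (m d)
  pm : Prof m
  pm = mid-Prof C
  uw : Up m w
  uw = Up-drop (reverse X) (grows C)
  end0 : (m ⊕ w) (suc L) ≡ 0
  end0 = trans (fills C (suc L)) (n∸n≡0 L)
  pos : ∀ d → d ≤ L → 1 ≤ m d
  pos d q = ≤-trans (≤-reflexive (sym full)) (Prof-≤ pm q)
  m>L : ∀ d → L < d → m d ≡ 0
  m>L d q = n≤0⇒n≡0 (≤-trans (Prof-≤ pm q) (≤-reflexive (⊕-zero {m} {w} end0)))
  ch = chain-exists L m′ (pred-Prof pm) (cong pred full)
  V = proj₁ ch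
  uV = proj₁ (proj₂ ch)
  eV = proj₂ (proj₂ ch)
  rrV : ∅ ⊕ reverse (reverse V) ≗ m′
  rrV d = trans (cong (λ v → (∅ ⊕ v) d) (reverse-involutive V)) (eV d)
  row+ : ∀ d → rowShape L d + m′ d ≡ m d
  row+ d with d ≤? L
  ... | yes q rewrite rowShape-≤ q with m d | pos d q
  ...   | suc k | _ = refl
  row+ d | no q rewrite rowShape-> (≰⇒> q) | m>L d (≰⇒> q) = refl
  compl≡ : ∀ d → compl L (mid-shape (reverse V)) d ≡ compl (suc L) m d
  compl≡ d with d ≤? L
  ... | yes q rewrite rrV d | +-∸-assoc 1 q with m d | pos d q
  ...   | suc k | _ = refl
  compl≡ d | no q rewrite rrV d | m>L d (≰⇒> q) | m≤n⇒m∸n≡0 (<⇒≤ (≰⇒> q)) | m≤n⇒m∸n≡0 (≰⇒> q) = refl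
  C′ : Complete L (reverse V) w
  grows C′ = subst (λ v → Up ∅ (v ++ w)) (sym (reverse-involutive V)) (Up-++ uV (Up-cong (≗-sym eV) (Up-pred uw pos end0)))
  fills C′ d = trans (⊕-cong w rrV d) (trans (⊕-split w m′ d) tot)
    where
    tot : m′ d + (∅ ⊕ w) d ≡ L ∸ d
    tot with d ≤? L
    ... | yes q = trans (cong pred (trans (cong (_+ (∅ ⊕ w) d) (trans (cong (_+ m′ d) (sym (rowShape-≤ q))) (row+ d)))
                    (trans (sym (⊕-split w m d)) (fills C d)))) (cong pred (+-∸-assoc 1 q))
    ... | no q = trans (cong₂ _+_ (cong pred (m>L d (≰⇒> q)))
                   (m+n≡0⇒n≡0 (m d) (trans (sym (⊕-split w m d)) (trans (fills C d) (m≤n⇒m∸n≡0 (≰⇒> q))))))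
                   (sym (m≤n⇒m∸n≡0 (<⇒≤ (≰⇒> q))))
  -- A chain of the same shape as `X` that builds the full first row before the rest `V`; confluence
  -- puts it in the place of `X`. Sliding through `V` is the case of the smaller staircase, and
  -- sliding through the row changes nothing.
  X₂ = reverse V ++ rowDown L
  rX₂ : reverse X₂ ≡ reverse (rowDown L) ++ V
  rX₂ = trans (reverse-++ (reverse V) (rowDown L)) (cong (reverse (rowDown L) ++_) (reverse-involutive V))
  eX₂ : ∅ ⊕ reverse X₂ ≗ m
  eX₂ d = trans (cong (λ v → (∅ ⊕ v) d) rX₂) (trans (cong (λ g → g d) (⊕-++ ∅ (reverse (rowDown L)) V))
            (trans (⊕-split V (∅ ⊕ reverse (rowDown L)) d) (trans (cong₂ _+_ (rowDown-shape L d) (eV d)) (row+ d))))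
  uX₂ : Up ∅ (reverse X₂ ++ w)
  uX₂ = Up-++ (subst (Up ∅) (sym rX₂) (Up-++ (rowDown-Up L)
          (Up-cong (λ d → trans (+-identityʳ _) (sym (rowDown-shape L d))) (below-row-Up uV (trans (eV L) (cong pred full))))))
          (Up-cong (≗-sym eX₂) uw)
  lowV = lower (reverse V) w
  uLow : Up ∅ lowV
  uLow = Up-take lowV (Up-switch (reverse V) w [] (subst (λ v → Up ∅ (reverse (reverse V) ++ v)) (sym (++-identityʳ w)) (grows C′)))
  same : lower X w ≡ lowV
  same = trans (confluence X X₂ w (grows C) uX₂ (≗-sym eX₂)) (trans (lower-++ˡ (reverse V) (rowDown L) w)
           (lower-row uLow (trans (IH (reverse V) w C′ L) (compl-zero L (mid-shape (reverse V))))))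

-- Induction on the number of rows. The full first row of the staircase belongs to the inner shape
-- or to its complement. In the former case it is stripped off by `shape-full`; in the latter the
-- two halves trade places by `lower≡upper`.
shape-lemma : ∀ L → ShapeLemma L
shape-lemma zero X w C d = trans (n≤0⇒n≡0 (≤-trans (⊕-mono (∅ ⊕ lower X w) (reverse (upper X w)) d)
    (≤-trans (≤-reflexive (trans (⊕-switch X ∅ w d) (fills C d))) (≤-reflexive (0∸n≡0 d)))))
  (sym (trans (cong (_∸ mid-shape X d) (0∸n≡0 d)) (0∸n≡0 (mid-shape X d))))
shape-lemma (suc L) X w C with mid-shape X L in e
... | suc (suc k) = ⊥-elim (1+n≰n (≤-trans (s≤s (s≤s z≤n)) (≤-trans (≤-reflexive (sym e)) (≤-trans
      (Prof-bound (mid-Prof C) (⊕-zero {mid-shape X} {w} (trans (fills C (suc L)) (n∸n≡0 L))) L)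
      (≤-reflexive (trans (+-∸-assoc 1 {L} ≤-refl) (cong suc (n∸n≡0 L))))))))
... | suc zero = shape-full L (shape-lemma L) X w C e
... | zero with Complete-swap C
-- Both halves together fill the staircase and the shape of the upper one is known from the case
-- with a full row, so subtraction gives the lower one.
...   | C′ , m = λ d → begin
    (∅ ⊕ lower X w) d ≡⟨ m+n∸n≡m _ (mid-shape X d) ⟨
    (∅ ⊕ lower X w) d + mid-shape X d ∸ mid-shape X d
      ≡⟨ cong (λ k → (∅ ⊕ lower X w) d + k ∸ mid-shape X d) (sym (trans (⊕-reverse (upper X w) d) (up d))) ⟩
    (∅ ⊕ lower X w) d + (∅ ⊕ reverse (upper X w)) d ∸ mid-shape X d
      ≡⟨ cong (_∸ mid-shape X d) (trans (sym (⊕-split (reverse (upper X w)) (∅ ⊕ lower X w) d)) (trans (⊕-switch X ∅ w d) (fills C d))) ⟩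
    compl (suc L) (mid-shape X) d ∎
  where
  open ≡-Reasoning
  up : ∅ ⊕ upper X w ≗ mid-shape X
  up d = trans (cong (λ v → (∅ ⊕ v) d) (sym (lower≡upper w X)))
    (trans (shape-full L (shape-lemma L) w X C′ (trans (m L) (trans (cong (suc L ∸ L ∸_) e) (trans (+-∸-assoc 1 {L} ≤-refl) (cong suc (n∸n≡0 L))))) d)
    (trans (compl-cong (suc L) m d) (compl-compl (Prof-bound (mid-Prof C) (⊕-zero {mid-shape X} {w} (trans (fills C (suc L)) (n∸n≡0 L)))) d)))

-- Evacuation

-- The evacuation of a chain from ∅, given by its reversed word.
evac : List ℕ → List ℕ
evac []      = []
evac (k ∷ r) = carry k (reverse (evac r)) ∷ reverse (emit k (reverse (evac r)))

-- Let `f` and `y` be the first letter and the rest of the rectified word. By confluence the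
-- rectification of `r` alone is `emit f y`, and the letter carried out of `y` must be `k`, because
-- `shape-lemma` fixes the shapes before and after. Reversing this slide gives the recursion that
-- defines `evac`.
lower-evac : ∀ {L} X w → Complete L X w → lower X w ≡ evac w
lower-evac X [] C = lower-[] X
lower-evac {L} X (k ∷ r) C = trans (lower-∷ X k r) (cong₂ _∷_
    (trans (sym (proj₂ (emit-inverse f y))) (cong₂ (λ a b → carry a (reverse b)) b≡k (sym ev-y)))
    (trans (sym (reverse-involutive y)) (cong reverse (trans (sym (proj₁ (emit-inverse f y))) (cong₂ (λ a b → emit a (reverse b)) b≡k (sym ev-y))))))
  where
  f = carry k X
  y = lower (emit k X) r
  C₂ : Complete L (k ∷ X) r
  grows C₂ = subst (Up ∅) (sym (reverse-∷-++ k X r)) (grows C)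
  fills C₂ d = trans (cong (λ g → (g ⊕ r) d) (⊕-reverse-∷ ∅ k X)) (fills C d)
  -- A chain of the shape of `k ∷ X` whose first box is `f`, obtained by switching `k` below `X`.
  X₃ = emit k X ++ f ∷ []
  rX₃ : reverse X₃ ≡ f ∷ reverse (emit k X)
  rX₃ = reverse-++ (emit k X) (f ∷ [])
  sw : f ∷ reverse (emit k X) ++ r ≡ lower X (k ∷ []) ++ reverse (upper X (k ∷ [])) ++ r
  sw = sym (cong₂ (λ a b → a ++ reverse b ++ r) (lower-[ k ] X) (upper-[ k ] X))
  u₃ : Up ∅ (reverse X₃ ++ r)
  u₃ = subst (λ v → Up ∅ (v ++ r)) (sym rX₃) (subst (Up ∅) (sym sw) (Up-switch X (k ∷ []) r (grows C)))
  e₃ : ∅ ⊕ reverse (k ∷ X) ≗ ∅ ⊕ reverse X₃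
  e₃ d = trans (cong (λ g → g d) (⊕-reverse-∷ ∅ k X)) (trans (sym (⊕-switch X ∅ (k ∷ []) d))
           (cong (λ g → g d) (trans (sym (⊕-++ ∅ (lower X (k ∷ [])) _)) (cong (∅ ⊕_) (trans (cong₂ (λ a b → a ++ reverse b) (lower-[ k ] X) (upper-[ k ] X)) (sym rX₃))))))
  ev-y : evac r ≡ emit f y
  ev-y = trans (sym (lower-evac (k ∷ X) r C₂)) (trans (confluence (k ∷ X) X₃ r (grows C₂) u₃ e₃)
           (lower-++ˡ (emit k X) (f ∷ []) r))
  m = mid-shape X
  uk : Up m (k ∷ r)
  uk = Up-drop (reverse X) (grows C)
  pk : Prof (inc k m)
  pk with uk
  ... | _ ▸ u = Up-Prof u
  zk : inc k m L ≡ 0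
  zk = ⊕-zero {inc k m} {r} (trans (fills C L) (n∸n≡0 L))
  g = ∅ ⊕ evac r
  g≗ : g ≗ compl L (inc k m)
  g≗ d = trans (cong (λ v → (∅ ⊕ v) d) (sym (lower-evac (k ∷ X) r C₂))) (trans (shape-lemma L (k ∷ X) r C₂ d)
           (cong (λ g → compl L g d) (⊕-reverse-∷ ∅ k X)))
  b = carry f y
  b≡k : b ≡ k
  b≡k = inc-injective {b} {k} g λ d → trans (cong (λ v → inc b (∅ ⊕ v) d) ev-y) (trans (⊕-emit ∅ f y d)
          (trans (cong (λ v → (∅ ⊕ v) d) (sym (lower-∷ X k r))) (trans (shape-lemma L X (k ∷ r) C d)
          (trans (sym (compl-inc {L} {k} {m} (Prof-bound pk zk k) d)) (inc-cong k (≗-sym g≗) d)))))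

-- After switching, the evacuated word sits at the bottom of the staircase with the switched inner
-- chain on top. Reading the staircase backwards makes this a complete pair again, and a second
-- switching restores `w`.
evac-involutive : ∀ {L} X w → Complete L X w → evac (reverse (evac w)) ≡ reverse w
evac-involutive {L} X w C = trans (cong (λ v → evac (reverse v)) (sym (lower-evac X w C)))
  (trans (sym (lower-evac X″ (reverse s) C″)) (trans (lower≡upper X″ (reverse s)) (proj₂ (switch-involutive X w))))
  where
  s = lower X w
  X″ = reverse (upper X w)
  C₀ : Complete L (reverse s) X″
  grows C₀ = subst₂ (λ a b → Up ∅ (a ++ b)) (sym (reverse-involutive s)) (++-identityʳ X″)
    (Up-switch X w [] (subst (λ v → Up ∅ (reverse X ++ v)) (sym (++-identityʳ w)) (grows C)))
  fills C₀ d = trans (cong (λ v → (∅ ⊕ v ⊕ X″) d) (reverse-involutive s)) (trans (⊕-switch X ∅ w d) (fills C d))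
  C″ : Complete L X″ (reverse s)
  C″ = proj₁ (Complete-swap C₀)

length-emit : ∀ s w → length (emit s w) ≡ length w
length-emit s [] = refl
length-emit s (c ∷ w) = cong suc (length-emit _ w)

length-lower : ∀ X w → length (lower X w) ≡ length w
length-lower [] w = refl
length-lower (s ∷ X) w = trans (length-lower X (emit s w)) (length-emit s w)

-- The letters of `q` enter one by one, each passing the evacuated `r` before it reaches the front.
-- Hence the end of the result is the evacuated `r` switched past `q`; the front `p` is identified
-- afterwards, with the help of its length.
evac-split : ∀ q r → Σ (List ℕ) λ p →
  evac (q ++ r) ≡ p ++ reverse (upper (reverse (evac r)) (reverse q)) × length p ≡ length q
evac-split [] r = [] , sym (trans (cong reverse (upper-[] (reverse (evac r)))) (reverse-involutive (evac r))) , refl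
evac-split (k ∷ q) r with evac-split q r
... | p , e , l = carry k Z ∷ reverse (emit (carry k H) (reverse p)) ,
    cong (carry k Z ∷_) (trans (cong reverse (trans (cong (emit k) Z≡) (emit-++ k H (reverse p))))
      (trans (reverse-++ (emit k H) _) (cong (λ v → reverse (emit (carry k H) (reverse p)) ++ reverse v) (sym H′)))) ,
    cong suc (trans (length-reverse (emit (carry k H) (reverse p))) (trans (length-emit (carry k H) (reverse p)) (trans (length-reverse p) l)))
  where
  A = reverse (evac r)
  H = upper A (reverse q)
  Z = reverse (evac (q ++ r))
  Z≡ : Z ≡ H ++ reverse p
  Z≡ = trans (cong reverse e) (trans (reverse-++ p (reverse H)) (cong (_++ reverse p) (reverse-involutive H)))
  H′ : upper A (reverse (k ∷ q)) ≡ emit k H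
  H′ = trans (cong (upper A) (reverse-∷ k q)) (trans (upper-++ʳ A (reverse q) (k ∷ [])) (upper-[ k ] H))

++-prefix : ∀ (p q : List ℕ) {u v} → length p ≡ length q → p ++ u ≡ q ++ v → p ≡ q
++-prefix [] [] l e = refl
++-prefix (x ∷ p) (y ∷ q) l e = cong₂ _∷_ (∷-injectiveˡ e) (++-prefix p q (suc-injective l) (∷-injectiveʳ e))

-- The identity on the level of contents

-- Here `u` and `t` are the contents of S and T, and `z` continues them to the staircase. The words
-- `s`, `t-J`, `t′`, `u′` are the contents of S^J, of T^J and of the two tableaux obtained by
-- switching.
module Word {L} (u t z : List ℕ) (uv : Up ∅ (u ++ t ++ z)) (tot : ∅ ⊕ u ⊕ t ⊕ z ≗ λ d → L ∸ d) where

  private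
    complete : ∀ (a b : List ℕ) → Up ∅ (a ++ b) → ∅ ⊕ a ⊕ b ≗ (λ d → L ∸ d) → Complete L b (reverse a)
    complete a b v e = proj₁ (Complete-swap (record
      { grows = subst (λ k → Up ∅ (k ++ b)) (sym (reverse-involutive a)) v
      ; fills = λ d → trans (cong (λ k → (∅ ⊕ k ⊕ b) d) (reverse-involutive a)) (e d) }))

  C-u : Complete L (t ++ z) (reverse u)
  C-u = complete u (t ++ z) uv (λ d → trans (cong (λ g → g d) (⊕-++ (∅ ⊕ u) t z)) (tot d))

  s = evac (reverse u)

  s-shape : ∅ ⊕ s ≗ ∅ ⊕ u
  s-shape d = trans (cong (λ v → (∅ ⊕ v) d) (sym (lower-evac (t ++ z) (reverse u) C-u)))
    (trans (shape-lemma L (t ++ z) (reverse u) C-u d) (trans (sym (proj₂ (Complete-swap C-u) d))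
      (trans (cong (λ v → (∅ ⊕ v) d) (reverse-involutive u)) refl)))

  s-Up : Up ∅ s
  s-Up = subst (Up ∅) (lower-evac (t ++ z) (reverse u) C-u)
    (Up-take (lower (t ++ z) (reverse u)) (Up-switch (t ++ z) (reverse u) [] (subst (λ v → Up ∅ (reverse (t ++ z) ++ v)) (sym (++-identityʳ (reverse u))) (grows C-u))))

  uv-s : Up ∅ (s ++ t ++ z)
  uv-s = Up-++ s-Up (Up-cong (≗-sym s-shape) (Up-drop u uv))

  C-st : Complete L z (reverse t ++ reverse s)
  C-st = subst (Complete L z) (reverse-++ s t)
    (complete (s ++ t) z (subst (Up ∅) (sym (++-assoc s t z)) uv-s)
      λ d → trans (cong (λ g → (g ⊕ z) d) (⊕-++ ∅ s t)) (trans (⊕-cong z (⊕-cong t s-shape) d) (tot d)))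

  u-involutive : evac (reverse s) ≡ u
  u-involutive = trans (evac-involutive (t ++ z) (reverse u) C-u) (reverse-involutive u)

  t-J : List ℕ
  t-J = lower z (reverse t)

  -- Since evacuation is an involution, `evac-split` sees `u` again as the evacuated inner part and
  -- delivers the end of the word. The front is recognized by `lower-++ʳ`, which rectifies
  -- `reverse t` first.
  evac-st : lower z (reverse t ++ reverse s) ≡ t-J ++ reverse (upper (reverse u) t)
  evac-st with evac-split (reverse t) (reverse s)
  ... | p , e , l rewrite u-involutive | reverse-involutive t =
    trans (lower-evac z _ C-st) (trans e (cong (_++ reverse (upper (reverse u) t))
      (++-prefix p t-J (trans l (sym (length-lower z (reverse t))))
        (trans (sym e) (trans (sym (lower-evac z _ C-st)) (lower-++ʳ z (reverse t) (reverse s)))))))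

  t′ u′ : List ℕ
  t′ = lower (reverse u) t
  u′ = reverse (upper (reverse u) t)

  t′u′z : Up ∅ (t′ ++ u′ ++ z)
  t′u′z = Up-switch (reverse u) t z (subst (λ v → Up ∅ (v ++ t ++ z)) (sym (reverse-involutive u)) uv)

  t′u′-shape : ∅ ⊕ t′ ⊕ u′ ≗ ∅ ⊕ u ⊕ t
  t′u′-shape d = trans (⊕-switch (reverse u) ∅ t d) (cong (λ v → (∅ ⊕ v ⊕ t) d) (reverse-involutive u))

  C-t′ : Complete L (u′ ++ z) (reverse t′)
  C-t′ = complete t′ (u′ ++ z) t′u′z
    (λ d → trans (cong (λ g → g d) (⊕-++ (∅ ⊕ t′) u′ z)) (trans (⊕-cong z t′u′-shape d) (tot d)))

  -- The chain above `t′` may be taken as `u′` followed by `z`. Sliding past `u′` undoes the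
  -- switching of `u` and `t`, and sliding past `z` then rectifies `reverse t`.
  evac-t′ : evac (reverse t′) ≡ t-J
  evac-t′ = trans (sym (lower-evac (u′ ++ z) (reverse t′) C-t′)) (trans (lower-++ˡ u′ z (reverse t′))
    (cong (lower z) (trans (lower≡upper u′ (reverse t′)) (proj₂ (switch-involutive (reverse u) t)))))

  t-J-shape : ∅ ⊕ t-J ≗ ∅ ⊕ t′
  t-J-shape d = trans (cong (λ v → (∅ ⊕ v) d) (trans (sym evac-t′) (sym (lower-evac (u′ ++ z) (reverse t′) C-t′))))
    (trans (shape-lemma L (u′ ++ z) (reverse t′) C-t′ d) (trans (sym (proj₂ (Complete-swap C-t′) d))
      (cong (λ v → (∅ ⊕ v) d) (reverse-involutive t′))))

-- Inner shapes that differ away from the tableau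

-- Move right while `h` is level, then left along the drops of `h`. On this way `g` never gains on
-- `h`, so the excess persists up to a corner.
corner-over : ∀ {h g} → Prof h → Prof g → ∀ t d → h (t + d) ≡ 0 → g d < h d → Σ ℕ λ k → Corner h k × g k < h k
corner-over p q zero d e lt = ⊥-elim (n≮0 (≤-trans lt (≤-reflexive e)))
corner-over {h} {g} p q (suc t) d e lt with p d
... | inj₁ f = corner-over p q t (suc d) (trans (cong h (+-suc t d)) e)
      (≤-trans (s≤s (Prof-≤ q (n≤1+n d))) (≤-trans lt (≤-reflexive f)))
... | inj₂ f = leftwards d f lt
  where
  leftwards : ∀ j → h j ≡ suc (h (suc j)) → g j < h j → Σ ℕ λ k → Corner h k × g k < h k
  leftwards zero e lt = 0 , (e , λ _ ()) , lt
  leftwards (suc j) e lt with p j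
  ... | inj₁ f = suc j , (e , λ { b refl → f }) , lt
  ... | inj₂ f = leftwards j f (≤-trans (s≤s (Prof-slope q 1 j)) (≤-trans (s≤s lt) (≤-reflexive (sym f))))

Agree : List ℕ → Shape → Shape → Set
Agree w h g = All (λ c → h c ≡ g c) w

Agree-inc : ∀ {w h g} c → Agree w h g → Agree w (inc c h) (inc c g)
Agree-inc c [] = []
Agree-inc {d ∷ w} {h} {g} c (e ∷ es) = (f (c ≡ᵇ d)) ∷ Agree-inc c es
  where
  f : ∀ b → (if b then suc (h d) else h d) ≡ (if b then suc (g d) else g d)
  f true = cong suc e
  f false = e

-- Adding a box on `c` determines the profile on the neighbouring diagonals from its value on `c`.
-- Two profiles that agree on `c` therefore agree beside it as well.
far-from-support : ∀ {h g k w} → Up h w → Up g w → Agree w h g → h k ≢ g k → All (λ c → near k c ≡ false) w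
far-from-support (end _) v a n = []
far-from-support {h} {g} {k} (_▸_ {c} {w} p u) (q ▸ v) (e ∷ es) n =
  far ∷ far-from-support {inc c h} {inc c g} {k} u v (Agree-inc c es) n′
  where
  c≢k : c ≢ k
  c≢k refl = n e
  n′ : inc c h k ≢ inc c g k
  n′ f = n (trans (sym (inc-diff {c} {k} h c≢k)) (trans f (inc-diff {c} {k} g c≢k)))
  far : near k c ≡ false
  far with near k c in f
  ... | false = refl
  ... | true with near⇒ k c f
  ...   | inj₁ r = ⊥-elim (c≢k (sym r))
  ...   | inj₂ (inj₁ refl) = ⊥-elim (n (trans (addable-south p (Up-Prof u)) (trans (cong suc e) (sym (addable-south q (Up-Prof v))))))
  ...   | inj₂ (inj₂ refl) = ⊥-elim (n (trans (sym (addable-east p (Up-Prof u))) (trans e (addable-east q (Up-Prof v)))))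

Up-dec : ∀ {h k w} → Up h w → Corner h k → All (λ c → near k c ≡ false) w → Up (dec k h) w
Up-dec {h} {k} {w} u c f = subst (Up (dec k h)) (proj₁ (emit-far k w f))
  (Up-take (emit k w) (Up-emit k w [] (subst (λ v → Up (dec k h) (k ∷ v)) (sym (++-identityʳ w))
    (dec-Prof (Up-Prof u) c ▸ Up-cong (≗-sym (inc-dec c)) u))))

differ : ∀ N (h g : Shape) → (∀ d → N ≤ d → h d ≡ g d) → (h ≗ g) ⊎ (Σ ℕ λ d → h d ≢ g d)
differ zero h g e = inj₁ λ d → e d z≤n
differ (suc N) h g e with h N ≟ g N
... | no n = inj₂ (N , n)
... | yes f = differ N h g λ d q → case d q
  where
  case : ∀ d → N ≤ d → h d ≡ g d
  case d q with N ≟ d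
  ... | yes refl = f
  ... | no n = e d (≤∧≢⇒< q n)

-- Inner boxes that are not below or to the left of the tableau are irrelevant.
record Dropped (X w : List ℕ) (g : Shape) : Set where
  field
    rest  : List ℕ
    valid : Up ∅ (reverse rest ++ w)
    agree : Agree w (∅ ⊕ reverse rest) g
    same  : lower X w ≡ lower rest w
    shorter : suc (length rest) ≡ length X

-- By confluence the chain may be chosen to add the box on `k` last. Being far from all of `w`, this
-- box slides through without effect.
drop-corner : ∀ X w {g} k V → Up ∅ (reverse X ++ w) → Up g w → Agree w (∅ ⊕ reverse X) g →
  Corner (∅ ⊕ reverse X) k → g k < (∅ ⊕ reverse X) k →
  Up ∅ (reverse V) → ∅ ⊕ reverse V ≗ dec k (∅ ⊕ reverse X) → Dropped X w g
drop-corner X w {g} k V u v a c lt uV eV = record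
  { rest = V ; valid = uV′ ; agree = agreeing w a fars ; same = eq ; shorter = len }
  where
  h = ∅ ⊕ reverse X
  uw : Up h w
  uw = Up-drop (reverse X) u
  fars : All (λ c → near k c ≡ false) w
  fars = far-from-support {h} {g} {k} uw v a (λ e → <-irrefl (sym e) lt)
  uV′ : Up ∅ (reverse V ++ w)
  uV′ = Up-++ uV (Up-cong (≗-sym eV) (Up-dec uw c fars))
  agreeing : ∀ w → Agree w h g → All (λ c → near k c ≡ false) w → Agree w (∅ ⊕ reverse V) g
  agreeing [] [] [] = []
  agreeing (c ∷ w) (e ∷ es) (f ∷ fs) = trans (eV c) (trans (dec-diff {k} {c} h (far-≢ f)) e) ∷ agreeing w es fs
  shape : ∅ ⊕ reverse X ≗ ∅ ⊕ reverse (k ∷ V)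
  shape e = sym (trans (cong (λ g → g e) (⊕-reverse-∷ ∅ k V)) (trans (inc-cong k eV e) (inc-dec c e)))
  uk : Up ∅ (reverse (k ∷ V) ++ w)
  uk = subst (Up ∅) (sym (reverse-∷-++ k V w))
    (Up-++ uV (Up-cong (≗-sym eV) (dec-Prof (Up-Prof uw) c ▸ Up-cong (≗-sym (inc-dec c)) uw)))
  eq : lower X w ≡ lower V w
  eq = trans (confluence X (k ∷ V) w u uk shape) (cong (lower V) (proj₁ (emit-far k w fars)))
  len : suc (length V) ≡ length X
  len = trans (sym (length-reverse (k ∷ V))) (trans (sym (same-length (reverse X) (reverse (k ∷ V)) (Up-take (reverse X) u) (Up-take (reverse (k ∷ V)) uk) shape)) (length-reverse X))

lower-drop : ∀ X w {g} → Up ∅ (reverse X ++ w) → Up g w → Agree w (∅ ⊕ reverse X) g → ∀ d → g d < (∅ ⊕ reverse X) d →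
  Dropped X w g
lower-drop X w {g} u v a d lt = at-corner (corner-over ph (Up-Prof v) N d (proj₂ (finite (reverse X)) (N + d) (m≤m+n N d)) lt)
  where
  h = ∅ ⊕ reverse X
  N = proj₁ (finite (reverse X))
  ph : Prof h
  ph = Up-Prof (Up-drop (reverse X) u)
  at-corner : (Σ ℕ λ k → Corner h k × g k < h k) → Dropped X w g
  at-corner (k , c , lt′) = at-chain (chain-exists N (dec k h) (dec-Prof ph c)
      (n≤0⇒n≡0 (≤-trans (inc-≤ k (dec k h) N) (≤-trans (≤-reflexive (inc-dec c N)) (≤-reflexive (proj₂ (finite (reverse X)) N ≤-refl))))))
    where
    at-chain : Σ (List ℕ) (λ V → Up ∅ V × ∅ ⊕ V ≗ dec k h) → Dropped X w g
    at-chain (V , uV , eV) = drop-corner X w k (reverse V) u v a c lt′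
      (subst (Up ∅) (sym (reverse-involutive V)) uV)
      (λ e → trans (cong (λ v → (∅ ⊕ v) e) (reverse-involutive V)) (eV e))

-- The inner shape of a starred tableau is determined only up to boxes that the tableau does not
-- touch, so confluence alone does not suffice. Excess corners are removed from either side until
-- the shapes coincide; `n` bounds the boxes left.
lower-independent : ∀ n X Y w → length X + length Y ≤ n → Up ∅ (reverse X ++ w) → Up ∅ (reverse Y ++ w) →
  Agree w (∅ ⊕ reverse X) (∅ ⊕ reverse Y) → lower X w ≡ lower Y w
lower-independent n X Y w l u v a = decide (differ (M + N) (∅ ⊕ reverse X) (∅ ⊕ reverse Y)
    (λ d q → trans (proj₂ (finite (reverse X)) d (≤-trans (m≤m+n M N) q)) (sym (proj₂ (finite (reverse Y)) d (≤-trans (m≤n+m N M) q)))))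
  where
  M = proj₁ (finite (reverse X))
  N = proj₁ (finite (reverse Y))
  reduceX : ∀ n → length X + length Y ≤ n → Dropped X w (∅ ⊕ reverse Y) → lower X w ≡ lower Y w
  reduceX zero l D = ⊥-elim (n≮0 (≤-trans (≤-reflexive (Dropped.shorter D)) (≤-trans (m≤m+n _ _) l)))
  reduceX (suc n) l D = trans (Dropped.same D) (lower-independent n (Dropped.rest D) Y w
    (≤-pred (≤-trans (≤-reflexive (cong (_+ length Y) (Dropped.shorter D))) l)) (Dropped.valid D) v (Dropped.agree D))
  reduceY : ∀ n → length X + length Y ≤ n → Dropped Y w (∅ ⊕ reverse X) → lower X w ≡ lower Y w
  reduceY zero l D = ⊥-elim (n≮0 (≤-trans (≤-reflexive (Dropped.shorter D)) (≤-trans (m≤n+m _ _) l)))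
  reduceY (suc n) l D = trans (lower-independent n X (Dropped.rest D) w
    (≤-pred (≤-trans (≤-reflexive (trans (sym (+-suc _ _)) (cong (length X +_) (Dropped.shorter D)))) l)) u (Dropped.valid D)
    (All.map sym (Dropped.agree D))) (sym (Dropped.same D))
  decide : (∅ ⊕ reverse X ≗ ∅ ⊕ reverse Y) ⊎ (Σ ℕ λ d → (∅ ⊕ reverse X) d ≢ (∅ ⊕ reverse Y) d) → lower X w ≡ lower Y w
  decide (inj₁ e) = confluence X Y w u v e
  decide (inj₂ (d , ne)) with <-cmp ((∅ ⊕ reverse X) d) ((∅ ⊕ reverse Y) d)
  ... | tri≈ _ e _ = ⊥-elim (ne e)
  ... | tri> _ _ lt = reduceX n l (lower-drop X w u (Up-drop (reverse Y) v) a d lt)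
  ... | tri< lt _ _ = reduceY n l (lower-drop Y w v (Up-drop (reverse X) u) (All.map sym a) d lt)

-- Tableaux as chains of labelled boxes

-- Tableaux as chains of labelled boxes: fill h w i d is the label of the box
-- in row i on the diagonal d when the boxes of w are added to h one by one.

contents : {A : Set} → List (ℕ × A) → List ℕ
contents = map proj₁

fill : {A : Set} → Shape → List (ℕ × A) → ℕ → ℕ → Maybe A
fill h []            i d = nothing
fill h ((c , x) ∷ w) i d = if (i ≡ᵇ h c) ∧ (c ≡ᵇ d) then just x else fill (inc c h) w i d

module _ {A : Set} where

  fill-hit : ∀ h c (x : A) w → fill h ((c , x) ∷ w) (h c) c ≡ just x
  fill-hit h c x w rewrite ≡ᵇ-refl (h c) | ≡ᵇ-refl c = refl

  fill-miss : ∀ h c (x : A) w {i d} → (i ≢ h c) ⊎ (c ≢ d) → fill h ((c , x) ∷ w) i d ≡ fill (inc c h) w i d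
  fill-miss h c x w (inj₁ n) rewrite ≢⇒≡ᵇ n = refl
  fill-miss h c x w {i} (inj₂ n) rewrite ≢⇒≡ᵇ n with i ≡ᵇ h c
  ... | true = refl
  ... | false = refl

  fill-cong : ∀ (w : List (ℕ × A)) {h g} → h ≗ g → ∀ i d → fill h w i d ≡ fill g w i d
  fill-cong [] e i d = refl
  fill-cong ((c , x) ∷ w) e i d rewrite e c | fill-cong w (inc-cong c e) i d = refl

  fill-low : ∀ h (w : List (ℕ × A)) {i d} → i < h d → fill h w i d ≡ nothing
  fill-low h [] lt = refl
  fill-low h ((c , x) ∷ w) {i} {d} lt = trans (fill-miss h c x w miss) (fill-low (inc c h) w (≤-trans lt (inc-≤ c h d)))
    where
    miss : (i ≢ h c) ⊎ (c ≢ d)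
    miss with c ≟ d
    ... | yes refl = inj₁ (<⇒≢ lt)
    ... | no n = inj₂ n

  fill-high : ∀ h (w : List (ℕ × A)) {i d} → (h ⊕ contents w) d ≤ i → fill h w i d ≡ nothing
  fill-high h [] le = refl
  fill-high h ((c , x) ∷ w) {i} {d} le = trans (fill-miss h c x w miss) (fill-high (inc c h) w le)
    where
    miss : (i ≢ h c) ⊎ (c ≢ d)
    miss with c ≟ d
    ... | yes refl = inj₁ λ { refl → 1+n≰n (≤-trans (≤-reflexive (sym (inc-same c h))) (≤-trans (⊕-mono (inc c h) (contents w) c) le)) }
    ... | no n = inj₂ n

  fill-box : ∀ h (w : List (ℕ × A)) {i d} → h d ≤ i → i < (h ⊕ contents w) d → Σ A λ x → fill h w i d ≡ just x
  fill-box h [] p q = ⊥-elim (1+n≰n (≤-trans q p))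
  fill-box h ((c , x) ∷ w) {i} {d} p q with c ≟ d | i ≟ h c
  ... | yes refl | yes refl = x , fill-hit h c x w
  ... | no n | _ with fill-box (inc c h) w {i} {d} (≤-trans (≤-reflexive (inc-diff h n)) p) q
  ...   | y , e = y , trans (fill-miss h c x w (inj₂ n)) e
  fill-box h ((c , x) ∷ w) {i} {d} p q | yes refl | no n
    with fill-box (inc c h) w {i} {d} (≤-trans (≤-reflexive (inc-same c h)) (≤∧≢⇒< p (λ e → n (sym e)))) q
  ... | y , e = y , trans (fill-miss h c x w (inj₁ n)) e

  fill-region : ∀ h (w : List (ℕ × A)) {i d x} → fill h w i d ≡ just x → h d ≤ i × i < (h ⊕ contents w) d
  fill-region h w {i} {d} e = ≮⇒≥ (λ lt → nj (trans (sym (fill-low h w lt)) e)) , ≰⇒> (λ le → nj (trans (sym (fill-high h w le)) e))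
    where
    nj : ∀ {x} → nothing ≡ just x → ⊥
    nj ()

  fill-++ : ∀ h (u v : List (ℕ × A)) i d → fill h (u ++ v) i d ≡ (fill h u i d <∣> fill (h ⊕ contents u) v i d)
  fill-++ h [] v i d = refl
  fill-++ h ((c , x) ∷ u) v i d with (i ≡ᵇ h c) ∧ (c ≡ᵇ d)
  ... | true = refl
  ... | false = fill-++ (inc c h) u v i d

  first : ℕ → List (ℕ × A) → Maybe A
  first c []            = nothing
  first c ((d , x) ∷ w) = if d ≡ᵇ c then just x else first c w

  fill-first : ∀ h c (w : List (ℕ × A)) → fill h w (h c) c ≡ first c w
  fill-first h c [] = refl
  fill-first h c ((d , x) ∷ w) with d ≟ c
  ... | yes refl rewrite ≡ᵇ-refl (h d) | ≡ᵇ-refl d = refl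
  ... | no n = trans (fill-miss h d x w (inj₂ n)) (trans (cong (λ i → fill (inc d h) w i c) (sym (inc-diff {d} {c} h n)))
      (trans (fill-first (inc d h) c w) (sym (first-miss w n))))
    where
    first-miss : ∀ w → d ≢ c → first c ((d , x) ∷ w) ≡ first c w
    first-miss w n rewrite ≢⇒≡ᵇ n = refl

Entry : Set
Entry = ℕ × Letter

-- Primes along a standardized word, and their behaviour under slides

-- The letters of one value v, listed in standardization order, read v′ … v′ v … v
-- with contents falling along the primed and rising along the unprimed ones.
-- The letter at the lowest content may carry a prime or not; b v records which.
data Link (b : ℤ → Bool) : Maybe Entry → Maybe Entry → Set where
  empty : Link b nothing nothing
  start : ∀ {c x} → (primed x ≡ false → b (val x) ≡ false) → Link b nothing (just (c , x))
  stop  : ∀ {c x} → (primed x ≡ true → b (val x) ≡ true) → Link b (just (c , x)) nothing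
  rise  : ∀ {c x d y} → val x ℤ.< val y → (primed x ≡ true → b (val x) ≡ true) →
          (primed y ≡ false → b (val y) ≡ false) → Link b (just (c , x)) (just (d , y))
  pp    : ∀ {c d v} → d < c → Link b (just (c , mk v true)) (just (d , mk v true))
  uu    : ∀ {c d v} → c < d → Link b (just (c , mk v false)) (just (d , mk v false))
  pu<   : ∀ {c d v} → c < d → b v ≡ true → Link b (just (c , mk v true)) (just (d , mk v false))
  pu>   : ∀ {c d v} → d < c → b v ≡ false → Link b (just (c , mk v true)) (just (d , mk v false))

data Path (b : ℤ → Bool) (m : Maybe Entry) : List Entry → Maybe Entry → Set where
  []  : ∀ {m′} → Link b m m′ → Path b m [] m′
  _∷_ : ∀ {e w m′} → Link b m (just e) → Path b (just e) w m′ → Path b m (e ∷ w) m′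

Standard : (ℤ → Bool) → List Entry → Set
Standard b w = Path b nothing w nothing

-- The exceptional pattern: hole on the main diagonal, primed letter east of it, and a letter of the
-- same value next on the diagonal. That the two letters are adjacent in the word is no restriction,
-- by `next-zero`.
Swap : ℕ → ℕ → Letter → List Entry → Set
Swap s c x w = (s ≡ 0) × (c ≡ 1) × (primed x ≡ true) × ∃ λ p → ∃ λ w′ → w ≡ (0 , mk (val x) p) ∷ w′

-- The last rule is the exceptional slide on the main diagonal.
data Tr : ℕ → List Entry → ℕ → List Entry → Set where
  nil  : ∀ {s} → Tr s [] s []
  pass : ∀ {s c x w s′ w′} → near s c ≡ false → Tr s w s′ w′ → Tr s ((c , x) ∷ w) s′ ((c , x) ∷ w′)
  move : ∀ {s c x w s′ w′} → near s c ≡ true → ¬ Swap s c x w → Tr c w s′ w′ → Tr s ((c , x) ∷ w) s′ ((s , x) ∷ w′)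
  exch : ∀ {v p w s′ w′} → Tr 0 w s′ w′ →
         Tr 0 ((1 , mk v true) ∷ (0 , mk v p) ∷ w) s′ ((0 , mk v p) ∷ (1 , mk v false) ∷ w′)

Tr-contents : ∀ {s w s′ w′} → Tr s w s′ w′ → contents w′ ≡ emit s (contents w) × s′ ≡ carry s (contents w)
Tr-contents nil = refl , refl
Tr-contents (pass {c = c} f t) rewrite f = cong (c ∷_) (proj₁ (Tr-contents t)) , proj₂ (Tr-contents t)
Tr-contents (move {s = s} f _ t) rewrite f = cong (s ∷_) (proj₁ (Tr-contents t)) , proj₂ (Tr-contents t)
Tr-contents (exch t) = cong (λ w → 0 ∷ 1 ∷ w) (proj₁ (Tr-contents t)) , proj₂ (Tr-contents t)

vals : List Entry → List ℤ
vals = map (λ e → val (proj₂ e))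

Tr-vals : ∀ {s w s′ w′} → Tr s w s′ w′ → vals w′ ≡ vals w
Tr-vals nil = refl
Tr-vals (pass {x = x} f t) = cong (val x ∷_) (Tr-vals t)
Tr-vals (move {x = x} f _ t) = cong (val x ∷_) (Tr-vals t)
Tr-vals (exch {v} t) = cong (λ w → v ∷ v ∷ w) (Tr-vals t)

Up-tail : ∀ {g c w} → Up g (c ∷ w) → Up (inc c g) w
Up-tail (_ ▸ u) = u

Up-≢ : ∀ {g s c w} → Up g (s ∷ c ∷ w) → s ≢ c
Up-≢ {g} {s} (p ▸ q ▸ u) refl = 1+n≢n (trans (sym (inc-same s g)) (trans (addable-east q (Up-Prof u))
  (trans (inc-diff {s} {suc s} g (λ e → 1+n≢n (sym e))) (sym (addable-east p q)))))

-- Two boxes of content `suc s` must have a box of content `2 + s` between them. In `no-zagzig` the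
-- missing box is the one of content `s`. Only 0, 1, 0 escapes, since no diagonal lies below 0; this
-- is why exceptions occur on the main diagonal alone.
no-zigzag : ∀ {g s w} → ¬ Up g (suc s ∷ s ∷ suc s ∷ w)
no-zigzag {g} {s} (p ▸ q ▸ r ▸ u) = 1+n≢n {g (suc s)} (trans
  (sym (trans (inc-diff {s} {suc s} (inc (suc s) g) (λ e → 1+n≢n (sym e))) (inc-same (suc s) g)))
  (trans (addable-east r (Up-Prof u)) (trans (inc-diff {s} {suc (suc s)} (inc (suc s) g) (λ ()))
  (trans (inc-diff {suc s} {suc (suc s)} g (λ e → 1+n≢n (sym e))) (sym (addable-east p q))))))

no-zagzig : ∀ {g s w} → ¬ Up g (suc s ∷ suc (suc s) ∷ suc s ∷ w)
no-zagzig {g} {s} (p ▸ q ▸ r ▸ u) = 1+n≢n (trans (cong suc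
   (sym (trans (inc-diff {suc (suc s)} {suc s} (inc (suc s) g) 1+n≢n) (inc-same (suc s) g))))
   (trans (sym (addable-south r (Up-Prof u))) (trans (inc-diff {suc (suc s)} {s} (inc (suc s) g) (λ ()))
   (trans (inc-diff {suc s} {s} g 1+n≢n) (addable-south p q)))))

-- Links compare contents only, so a letter that moves to a neighbouring diagonal keeps its link
-- with a letter that is far from one of its two positions.
same-side : ∀ a s c → near a s ≡ false → near s c ≡ true → s ≢ c → (a < c → a < s) × (c < a → s < a)
same-side a s c f n s≢c with near⇒ s c n | far⇒ a s f
... | inj₁ e | _ = ⊥-elim (s≢c e)
... | inj₂ (inj₁ refl) | inj₁ p = (λ _ → <⇒≤ p) , λ q → ⊥-elim (<-asym (<⇒≤ p) (<⇒≤ q))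
... | inj₂ (inj₁ refl) | inj₂ p = (λ q → ⊥-elim (1+n≰n (≤-trans (<⇒≤ p) (≤-pred q)))) , λ _ → <⇒≤ p
... | inj₂ (inj₂ refl) | inj₁ p = (λ _ → <⇒≤ p) , λ q → ⊥-elim (<-asym (≤-pred p) q)
... | inj₂ (inj₂ refl) | inj₂ p = (λ q → ⊥-elim (<-asym q (<⇒≤ (<⇒≤ p)))) , λ _ → <⇒≤ p

same-side′ : ∀ a s c → near a c ≡ false → near s c ≡ true → (a < c → a < s) × (c < a → s < a)
same-side′ a s c f n with near⇒ s c n | far⇒ a c f
... | inj₁ refl | _ = (λ q → q) , λ q → q
... | inj₂ (inj₁ refl) | inj₁ p = (λ _ → ≤-pred p) , λ q → ⊥-elim (<-asym (≤-pred p) (<⇒≤ q))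
... | inj₂ (inj₁ refl) | inj₂ p = (λ q → ⊥-elim (1+n≰n (≤-trans (<⇒≤ (<⇒≤ p)) (≤-pred q)))) , λ _ → <⇒≤ (<⇒≤ p)
... | inj₂ (inj₂ refl) | inj₁ p = (λ q → ≤-trans q (n≤1+n c)) , λ q → ⊥-elim (<-asym (<⇒≤ p) q)
... | inj₂ (inj₂ refl) | inj₂ p = (λ q → ⊥-elim (<-asym q (<⇒≤ p))) , λ _ → p

module _ {b : ℤ → Bool} where

  retarget : ∀ {c x d y c′ d′} → Link b (just (c , x)) (just (d , y)) → (c < d → c′ < d′) → (d < c → d′ < c′) →
    Link b (just (c′ , x)) (just (d′ , y))
  retarget (rise lt p q) f g = rise lt p q
  retarget (pp l) f g = pp (g l)
  retarget (uu l) f g = uu (f l)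
  retarget (pu< l e) f g = pu< (f l) e
  retarget (pu> l e) f g = pu> (g l) e

  bit-false : ∀ {v} → Link b (just (1 , mk v true)) (just (0 , mk v false)) → b v ≡ false
  bit-false (rise lt _ _) = ⊥-elim (ℤₚ.<-irrefl refl lt)
  bit-false (pu> _ e) = e

  swap-head : ∀ {c x v p c′} → Link b (just (c , x)) (just (1 , mk v true)) →
    Link b (just (1 , mk v true)) (just (0 , mk v p)) → (1 < c → 0 < c′) → Link b (just (c′ , x)) (just (0 , mk v p))
  swap-head {p = true} (rise lt q _) l f = rise lt q λ ()
  swap-head {p = false} (rise lt q _) l f = rise lt q λ _ → bit-false l
  swap-head {p = true} (pp l) _ f = pp (f l)
  swap-head {p = false} (pp l) l′ f = pu> (f l) (bit-false l′)

  -- A primed letter on the main diagonal is the last primed one of its value, as no smaller content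
  -- remains. The link after it therefore already records the bit `true`.
  swap-pair : ∀ {v p w} → Path b (just (0 , mk v p)) w nothing → Link b (just (0 , mk v p)) (just (1 , mk v false))
  swap-pair {p = false} _ = uu (s≤s z≤n)
  swap-pair {p = true} ([] (stop f)) = pu< (s≤s z≤n) (f refl)
  swap-pair {p = true} (rise _ f _ ∷ _) = pu< (s≤s z≤n) (f refl)
  swap-pair {p = true} (pu< _ e ∷ _) = pu< (s≤s z≤n) e

  relabel-stop : ∀ {c c′ x} → Link b (just (c , x)) nothing → Link b (just (c′ , x)) nothing
  relabel-stop (stop f) = stop f

  -- Two successive moves go in the same direction along the contents, which settles the comparison.
  -- A change of direction is excluded by the chain except at 0, 1, 0, and there the two values
  -- differ unless the slide is exceptional.
  turn : ∀ {g} s₀ c₀ c {x₀ x w v} → near s₀ c₀ ≡ true → near c₀ c ≡ true → ¬ Swap s₀ c₀ x₀ ((c , x) ∷ w) →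
    Up g (s₀ ∷ c₀ ∷ c ∷ v) → Link b (just (c₀ , x₀)) (just (c , x)) → Link b (just (s₀ , x₀)) (just (c₀ , x))
  turn s₀ c₀ c e f n u l with near⇒ s₀ c₀ e | near⇒ c₀ c f
  ... | inj₁ refl | _ = ⊥-elim (Up-≢ u refl)
  ... | inj₂ _ | inj₁ refl = ⊥-elim (Up-≢ (Up-tail u) refl)
  ... | inj₂ (inj₁ refl) | inj₂ (inj₁ refl) = retarget l (λ _ → ≤-refl) (λ q → ⊥-elim (1+n≰n (≤-trans (n≤1+n _) q)))
  ... | inj₂ (inj₂ refl) | inj₂ (inj₂ refl) = retarget l (λ q → ⊥-elim (1+n≰n (≤-trans (n≤1+n _) q))) (λ _ → ≤-refl)
  ... | inj₂ (inj₂ refl) | inj₂ (inj₁ refl) = ⊥-elim (no-zigzag u)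
  turn (suc _) _ _ e f n u l | inj₂ (inj₁ refl) | inj₂ (inj₂ refl) = ⊥-elim (no-zagzig u)
  turn zero _ _ e f n u (rise lt q r) | inj₂ (inj₁ refl) | inj₂ (inj₂ refl) = rise lt q r
  turn zero _ _ e f n u (pp _) | inj₂ (inj₁ refl) | inj₂ (inj₂ refl) = ⊥-elim (n (refl , refl , refl , _ , _ , refl))
  turn zero _ _ e f n u (pu> _ _) | inj₂ (inj₁ refl) | inj₂ (inj₂ refl) = ⊥-elim (n (refl , refl , refl , _ , _ , refl))

  mutual
    -- The three lemmas differ in the fate of the letter before `w`: it stayed, it moved from `c₀`
    -- to `s₀`, or it became the second letter of an exceptional pair. In each case its link to the
    -- next letter has to be re-established.
    after-pass : ∀ {g c₀ x₀ s w s′ w′} → near c₀ s ≡ false → Tr s w s′ w′ → Up g (s ∷ contents w) →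
      Path b (just (c₀ , x₀)) w nothing → Path b (just (c₀ , x₀)) w′ nothing
    after-pass f nil u p = p
    after-pass {g} {s = s} f (pass {c = c} e t) u (l ∷ p) = l ∷ after-pass (far-sym {s} {c} e) t (Up-tail (Up-exchange e u)) p
    after-pass {c₀ = c₀} {s = s} f (move {c = c} e n t) u (l ∷ p) =
      retarget l (proj₁ (same-side c₀ s c f e (Up-≢ u))) (proj₂ (same-side c₀ s c f e (Up-≢ u))) ∷ after-move e n t u p
    after-pass {c₀ = c₀} f (exch t) u (l ∷ l′ ∷ p) = swap-head l l′ (λ q → <-trans (s≤s z≤n) q) ∷ swap-pair p ∷ after-exch t u p

    after-move : ∀ {g s₀ c₀ x₀ w s′ w′} → near s₀ c₀ ≡ true → ¬ Swap s₀ c₀ x₀ w → Tr c₀ w s′ w′ → Up g (s₀ ∷ c₀ ∷ contents w) →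
      Path b (just (c₀ , x₀)) w nothing → Path b (just (s₀ , x₀)) w′ nothing
    after-move e n nil u ([] l) = [] (relabel-stop l)
    after-move {s₀ = s₀} {c₀} e n (pass {c = c} f t) u (l ∷ p) =
      retarget l (proj₂ ss) (proj₁ ss) ∷ after-pass (far-sym {c₀} {c} f) t (Up-tail (Up-exchange f (Up-tail u))) p
      where ss = same-side′ c s₀ c₀ (far-sym {c₀} {c} f) e
    after-move e n (move f m t) u (l ∷ p) = turn _ _ _ e f n u l ∷ after-move f m t (Up-tail u) p
    after-move {s₀ = s₀} e n (exch t) u (l ∷ l′ ∷ p) with near⇒ s₀ 0 e
    ... | inj₁ refl = ⊥-elim (Up-≢ u refl)
    ... | inj₂ (inj₂ refl) = ⊥-elim (no-zigzag u)

    after-exch : ∀ {g v p w s′ w′} → Tr 0 w s′ w′ → Up g (0 ∷ 1 ∷ 0 ∷ contents w) →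
      Path b (just (0 , mk v p)) w nothing → Path b (just (1 , mk v false)) w′ nothing
    after-exch nil u p = [] (stop λ ())
    after-exch {v = v} {p = q} (pass {c = c} {x} f t) u (l ∷ p) = passed l ∷ after-pass (far-sym {0} {c} f) t (Up-tail (Up-exchange f (Up-tail (Up-tail u)))) p
      where
      far0 : 1 < c
      far0 with far⇒ 0 c f
      ... | inj₁ r = r
      passed : Link b (just (0 , mk v q)) (just (c , x)) → Link b (just (1 , mk v false)) (just (c , x))
      passed (rise lt _ r) = rise lt (λ ()) r
      passed (uu _) = uu far0
      passed (pu< _ _) = uu far0
    after-exch (move {c = c} f n t) u (l ∷ p) with near⇒ 0 c f
    ... | inj₁ refl = ⊥-elim (Up-≢ (Up-tail (Up-tail u)) refl)
    ... | inj₂ (inj₁ refl) = ⊥-elim (no-zigzag (Up-tail u))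
    after-exch (exch t) u p = ⊥-elim (no-zigzag (Up-tail u))

  start-swap : ∀ {v p} → Link b nothing (just (1 , mk v true)) → Link b (just (1 , mk v true)) (just (0 , mk v p)) →
    Link b nothing (just (0 , mk v p))
  start-swap {p = true} _ l = start λ ()
  start-swap {p = false} _ l = start λ _ → bit-false l

  restart : ∀ {c c′ x} → Link b nothing (just (c , x)) → Link b nothing (just (c′ , x))
  restart (start f) = start f

  Tr-Standard : ∀ {g s w s′ w′} → Tr s w s′ w′ → Up g (s ∷ contents w) → Standard b w → Standard b w′
  Tr-Standard nil u p = p
  Tr-Standard {s = s} (pass {c = c} f t) u (l ∷ p) = l ∷ after-pass (far-sym {s} {c} f) t (Up-tail (Up-exchange f u)) p
  Tr-Standard (move e n t) u (l ∷ p) = restart l ∷ after-move e n t u p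
  Tr-Standard (exch t) u (l ∷ l′ ∷ p) = start-swap l l′ ∷ swap-pair p ∷ after-exch t u p

  -- With bit `false` a primed letter is followed by a letter of the same value and smaller content;
  -- an unprimed letter never is.
  no-clash : ∀ {c v u₁ u₂} → b v ≡ false → Path b (just (c , mk v true)) u₁ nothing → Path b (just (c , mk v false)) u₂ nothing →
    contents u₁ ≡ contents u₂ → vals u₁ ≡ vals u₂ → ⊥
  no-clash e ([] (stop f)) _ _ _ with trans (sym e) (f refl)
  ... | ()
  no-clash e (rise _ f _ ∷ _) _ _ _ with trans (sym e) (f refl)
  ... | ()
  no-clash e (pu< _ f ∷ _) _ _ _ with trans (sym e) f
  ... | ()
  no-clash e (pp l ∷ _) (rise lt _ _ ∷ _) c v = ℤₚ.<-irrefl (∷-injectiveˡ v) lt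
  no-clash e (pp l ∷ _) (uu l′ ∷ _) c v with ∷-injectiveˡ c
  ... | refl = <-asym l l′
  no-clash e (pu> l _ ∷ _) (rise lt _ _ ∷ _) c v = ℤₚ.<-irrefl (∷-injectiveˡ v) lt
  no-clash e (pu> l _ ∷ _) (uu l′ ∷ _) c v with ∷-injectiveˡ c
  ... | refl = <-asym l l′

  -- The prime of a letter is forced by its predecessor, by the bit of its value and by the letter
  -- after it.
  same-letter : ∀ {m c v f₁ f₂ u₁ u₂} → Link b m (just (c , mk v f₁)) → Link b m (just (c , mk v f₂)) →
    Path b (just (c , mk v f₁)) u₁ nothing → Path b (just (c , mk v f₂)) u₂ nothing →
    contents u₁ ≡ contents u₂ → vals u₁ ≡ vals u₂ → f₁ ≡ f₂
  same-letter {f₁ = true} {true} _ _ _ _ _ _ = refl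
  same-letter {f₁ = false} {false} _ _ _ _ _ _ = refl
  same-letter {f₁ = true} {false} _ (start f) p q c v = ⊥-elim (no-clash (f refl) p q c v)
  same-letter {f₁ = true} {false} _ (rise _ _ f) p q c v = ⊥-elim (no-clash (f refl) p q c v)
  same-letter {f₁ = true} {false} (rise lt _ _) (uu _) p q c v = ⊥-elim (ℤₚ.<-irrefl refl lt)
  same-letter {f₁ = true} {false} (rise lt _ _) (pu< _ _) p q c v = ⊥-elim (ℤₚ.<-irrefl refl lt)
  same-letter {f₁ = true} {false} (pp l) (pu< l′ _) p q c v = ⊥-elim (<-asym l l′)
  same-letter {f₁ = true} {false} _ (pu> _ e) p q c v = ⊥-elim (no-clash e p q c v)
  same-letter {f₁ = false} {true} (start f) _ p q c v = ⊥-elim (no-clash (f refl) q p (sym c) (sym v))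
  same-letter {f₁ = false} {true} (rise _ _ f) _ p q c v = ⊥-elim (no-clash (f refl) q p (sym c) (sym v))
  same-letter {f₁ = false} {true} (uu _) (rise lt _ _) p q c v = ⊥-elim (ℤₚ.<-irrefl refl lt)
  same-letter {f₁ = false} {true} (pu< _ _) (rise lt _ _) p q c v = ⊥-elim (ℤₚ.<-irrefl refl lt)
  same-letter {f₁ = false} {true} (pu< l _) (pp l′) p q c v = ⊥-elim (<-asym l l′)
  same-letter {f₁ = false} {true} (pu> _ e) _ p q c v = ⊥-elim (no-clash e q p (sym c) (sym v))

  Path-unique : ∀ {m w₁ w₂} → Path b m w₁ nothing → Path b m w₂ nothing → contents w₁ ≡ contents w₂ → vals w₁ ≡ vals w₂ → w₁ ≡ w₂
  Path-unique ([] _) ([] _) _ _ = refl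
  Path-unique {w₁ = (c , mk v f₁) ∷ u₁} {(c′ , mk v′ f₂) ∷ u₂} (l₁ ∷ p₁) (l₂ ∷ p₂) ec ev
    with ∷-injective ec | ∷-injective ev
  ... | refl , ec′ | refl , ev′ with same-letter l₁ l₂ p₁ p₂ ec′ ev′
  ... | refl = cong ((c , mk v f₁) ∷_) (Path-unique p₁ p₂ ec′ ev′)

-- The standardization order

-- order of two boxes of a tableau in its standardization
data _≺_ : Entry → Entry → Set where
  by-val : ∀ {c x d y} → val x ℤ.< val y → (c , x) ≺ (d , y)
  pp : ∀ {c d v} → d < c → (c , mk v true) ≺ (d , mk v true)
  uu : ∀ {c d v} → c < d → (c , mk v false) ≺ (d , mk v false)
  pu : ∀ {c d v} → (c , mk v true) ≺ (d , mk v false)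

≺-trans : ∀ {e f g} → e ≺ f → f ≺ g → e ≺ g
≺-trans (by-val p) (by-val q) = by-val (ℤₚ.<-trans p q)
≺-trans (by-val p) (pp _) = by-val p
≺-trans (by-val p) (uu _) = by-val p
≺-trans (by-val p) pu = by-val p
≺-trans (pp p) (by-val q) = by-val q
≺-trans (pp p) (pp q) = pp (<-trans q p)
≺-trans (pp p) pu = pu
≺-trans (uu p) (by-val q) = by-val q
≺-trans (uu p) (uu q) = uu (<-trans p q)
≺-trans pu (by-val q) = by-val q
≺-trans pu (uu q) = pu

Link⇒≺ : ∀ {b e f} → Link b (just e) (just f) → e ≺ f
Link⇒≺ (rise p _ _) = by-val p
Link⇒≺ (pp p) = pp p
Link⇒≺ (uu p) = uu p
Link⇒≺ (pu< _ _) = pu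
Link⇒≺ (pu> _ _) = pu

Path⇒≺ : ∀ {b e w m} → Path b (just e) w m → All (e ≺_) w
Path⇒≺ ([] _) = []
Path⇒≺ (l ∷ p) = Link⇒≺ l ∷ All.map (≺-trans (Link⇒≺ l)) (Path⇒≺ p)

first-All : ∀ {P : Entry → Set} {c x} w → All P w → first c w ≡ just x → P (c , x)
first-All {c = c} ((d , y) ∷ w) (p ∷ ps) e with d ≟ c
... | no n rewrite ≢⇒≡ᵇ n = first-All w ps e
... | yes refl rewrite ≡ᵇ-refl d with e
...   | refl = p

first-same : ∀ {A : Set} c (x : A) w → first c ((c , x) ∷ w) ≡ just x
first-same c x w rewrite ≡ᵇ-refl c = refl

first-other : ∀ {A : Set} {c d} (x : A) w → d ≢ c → first c ((d , x) ∷ w) ≡ first c w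
first-other x w n rewrite ≢⇒≡ᵇ n = refl

-- Fillings in coordinates of rows and diagonals

Grid : Set
Grid = ℕ → ℕ → Maybe Letter

-- F is supported above the main diagonal, and M i d is its entry in row i on the diagonal d
record Cells (F : Filling) (M : Grid) : Set where
  field
    cell : ∀ i d → F i (i + d) ≡ M i d
    tri  : ∀ i j → j < i → F i j ≡ nothing
open Cells

Cells-cong : ∀ {F M M′} → Cells F M → (∀ i d → M i d ≡ M′ i d) → Cells F M′
Cells-cong C e = record { cell = λ i d → trans (cell C i d) (e i d) ; tri = tri C }

+-cancelˡ-≡ᵇ : ∀ p s d → (p + s ≡ᵇ p + d) ≡ (s ≡ᵇ d)
+-cancelˡ-≡ᵇ zero s d = refl
+-cancelˡ-≡ᵇ (suc p) s d = +-cancelˡ-≡ᵇ p s d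

updG : Grid → ℕ → ℕ → Maybe Letter → Grid
updG M p s v i d = if (p ≡ᵇ i) ∧ (s ≡ᵇ d) then v else M i d

upd-Cells : ∀ {F M p j} s v → j ≡ p + s → Cells F M → Cells (upd F p j v) (updG M p s v)
cell (upd-Cells {p = p} s v refl C) i d with p ≟ i
... | yes refl rewrite ≡ᵇ-refl p | +-cancelˡ-≡ᵇ p s d | cell C p d = refl
... | no n rewrite ≢⇒≡ᵇ n = cell C i d
tri (upd-Cells {p = p} s v refl C) i j lt with p ≟ i
... | no n rewrite ≢⇒≡ᵇ n = tri C i j lt
... | yes refl rewrite ≡ᵇ-refl p | ≢⇒≡ᵇ {p + s} {j} (λ { refl → 1+n≰n (≤-trans lt (m≤m+n p s)) }) = tri C p j lt

updG-hit : ∀ M p s v → updG M p s v p s ≡ v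
updG-hit M p s v rewrite ≡ᵇ-refl p | ≡ᵇ-refl s = refl

updG-miss : ∀ M p s v {i d} → (p ≢ i) ⊎ (s ≢ d) → updG M p s v i d ≡ M i d
updG-miss M p s v (inj₁ n) rewrite ≢⇒≡ᵇ n = refl
updG-miss M p s v {i} (inj₂ n) rewrite ≢⇒≡ᵇ n with p ≡ᵇ i
... | true = refl
... | false = refl

data At (p s : ℕ) : ℕ → ℕ → Set where
  here  : At p s p s
  other : ∀ {i d} → (p ≢ i) ⊎ (s ≢ d) → At p s i d

at? : ∀ p s i d → At p s i d
at? p s i d with p ≟ i | s ≟ d
... | yes refl | yes refl = here
... | no n | _ = other (inj₁ n)
... | yes _ | no n = other (inj₂ n)

≢-flip : ∀ {p s i d : ℕ} → (p ≢ i) ⊎ (s ≢ d) → (i ≢ p) ⊎ (s ≢ d)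
≢-flip (inj₁ n) = inj₁ λ e → n (sym e)
≢-flip (inj₂ n) = inj₂ n

-- Jeu de taquin slides as transformations of words

-- In the simulation of a slide `K` holds the boxes already passed; they lie inside the current
-- shape `h`.
Hollow : Grid → Shape → Set
Hollow K h = ∀ i d → h d ≤ i → K i d ≡ nothing

<∣>-nothing : ∀ {A : Set} (x : Maybe A) → (x <∣> nothing) ≡ x
<∣>-nothing (just x) = refl
<∣>-nothing nothing = refl

<∣>-assoc : ∀ {A : Set} (x y z : Maybe A) → ((x <∣> y) <∣> z) ≡ (x <∣> (y <∣> z))
<∣>-assoc (just x) y z = refl
<∣>-assoc nothing y z = refl

module _ {A : Set} where
  fill-here : ∀ h c (x : A) w {i} → i ≡ h c → fill h ((c , x) ∷ w) i c ≡ just x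
  fill-here h c x w refl = fill-hit h c x w

  fill-other : ∀ h c (x : A) w {q i d} → q ≡ h c → (q ≢ i) ⊎ (c ≢ d) → fill h ((c , x) ∷ w) i d ≡ fill (inc c h) w i d
  fill-other h c x w refl n = fill-miss h c x w (≢-flip n)

extend : Grid → Shape → Entry → Grid
extend K h e i d = K i d <∣> fill h (e ∷ []) i d

extend-Hollow : ∀ {K h c x} → Hollow K h → Hollow (extend K h (c , x)) (inc c h)
extend-Hollow {K} {h} {c} {x} H i d p rewrite H i d (≤-trans (inc-≤ c h d) p) = fill-high h ((c , x) ∷ []) p

extend-fill : ∀ K h c x w i d → (extend K h (c , x) i d <∣> fill (inc c h) w i d) ≡ (K i d <∣> fill h ((c , x) ∷ w) i d)
extend-fill K h c x w i d = trans (<∣>-assoc (K i d) (fill h ((c , x) ∷ []) i d) (fill (inc c h) w i d))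
  (cong (K i d <∣>_) (sym (fill-++ h ((c , x) ∷ []) w i d)))

move-cells : ∀ {K h s c x w p q} → Hollow K h → s ≢ c → p ≡ h s → q ≡ inc s h c → ∀ i d →
  updG (updG (λ i d → K i d <∣> fill (inc s h) ((c , x) ∷ w) i d) p s (just x)) q c nothing i d
  ≡ (extend K h (s , x) i d <∣> fill (inc c (inc s h)) w i d)
move-cells {K} {h} {s} {c} {x} {w} H s≢c refl refl i d with at? (inc s h c) c i d
... | here rewrite updG-hit (updG (λ i d → K i d <∣> fill (inc s h) ((c , x) ∷ w) i d) (h s) s (just x)) (inc s h c) c nothing
    | H (inc s h c) c (inc-≤ s h c) | fill-miss h s x [] {inc s h c} {c} (inj₂ s≢c)
    = sym (fill-low (inc c (inc s h)) w (≤-reflexive (sym (inc-same c (inc s h)))))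
... | other n with at? (h s) s i d
...   | here rewrite updG-miss (updG (λ i d → K i d <∣> fill (inc s h) ((c , x) ∷ w) i d) (h s) s (just x)) (inc s h c) c nothing n
      | updG-hit (λ i d → K i d <∣> fill (inc s h) ((c , x) ∷ w) i d) (h s) s (just x)
      | H (h s) s ≤-refl | fill-hit h s x [] = refl
...   | other m = trans (updG-miss (updG (λ i d → K i d <∣> fill (inc s h) ((c , x) ∷ w) i d) (h s) s (just x)) (inc s h c) c nothing n)
        (trans (updG-miss (λ i d → K i d <∣> fill (inc s h) ((c , x) ∷ w) i d) (h s) s (just x) m)
        (cong₂ _<∣>_ (trans (sym (<∣>-nothing (K i d))) (cong (K i d <∣>_) (sym (fill-other h s x [] refl m))))
          (fill-other (inc s h) c x w refl n)))

swap-cells : ∀ {K h x y z t w p} → Hollow K h → p ≡ h 0 → p ≡ h 1 → ∀ i d →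
  updG (updG (updG (λ i d → K i d <∣> fill (inc 0 h) ((1 , x) ∷ (0 , y) ∷ w) i d) p 0 (just z)) p 1 (just t)) (suc p) 0 nothing i d
  ≡ (extend (extend K h (0 , z)) (inc 0 h) (1 , t) i d <∣> fill (inc 0 (inc 1 (inc 0 h))) w i d)
swap-cells {K} {h} {x} {y} {z} {t} {w} H refl e i d with at? (suc (h 0)) 0 i d
... | here rewrite updG-hit (updG (updG (λ i d → K i d <∣> fill (inc 0 h) ((1 , x) ∷ (0 , y) ∷ w) i d) (h 0) 0 (just z)) (h 0) 1 (just t)) (suc (h 0)) 0 nothing
      | H (suc (h 0)) 0 (n≤1+n (h 0)) | fill-miss h 0 z [] {suc (h 0)} {0} (inj₁ 1+n≢n) | fill-miss (inc 0 h) 1 t [] {suc (h 0)} {0} (inj₂ λ ())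
      = sym (fill-low (inc 0 (inc 1 (inc 0 h))) w ≤-refl)
... | other n with at? (h 0) 1 i d
...   | here = trans (updG-miss (updG (updG (λ i d → K i d <∣> fill (inc 0 h) ((1 , x) ∷ (0 , y) ∷ w) i d) (h 0) 0 (just z)) (h 0) 1 (just t)) (suc (h 0)) 0 nothing n)
        (trans (updG-hit (updG (λ i d → K i d <∣> fill (inc 0 h) ((1 , x) ∷ (0 , y) ∷ w) i d) (h 0) 0 (just z)) (h 0) 1 (just t)) (sym rhs))
    where
    rhs : (extend (extend K h (0 , z)) (inc 0 h) (1 , t) (h 0) 1 <∣> fill (inc 0 (inc 1 (inc 0 h))) w (h 0) 1) ≡ just t
    rhs rewrite H (h 0) 1 (≤-reflexive (sym e)) | fill-miss h 0 z [] {h 0} {1} (inj₂ λ ()) | fill-here (inc 0 h) 1 t [] {h 0} e = refl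
...   | other m with at? (h 0) 0 i d
...     | here = trans (updG-miss (updG (updG (λ i d → K i d <∣> fill (inc 0 h) ((1 , x) ∷ (0 , y) ∷ w) i d) (h 0) 0 (just z)) (h 0) 1 (just t)) (suc (h 0)) 0 nothing n)
        (trans (updG-miss (updG (λ i d → K i d <∣> fill (inc 0 h) ((1 , x) ∷ (0 , y) ∷ w) i d) (h 0) 0 (just z)) (h 0) 1 (just t) m)
        (trans (updG-hit (λ i d → K i d <∣> fill (inc 0 h) ((1 , x) ∷ (0 , y) ∷ w) i d) (h 0) 0 (just z)) (sym rhs)))
      where
      rhs : (extend (extend K h (0 , z)) (inc 0 h) (1 , t) (h 0) 0 <∣> fill (inc 0 (inc 1 (inc 0 h))) w (h 0) 0) ≡ just z
      rhs rewrite H (h 0) 0 ≤-refl | fill-hit h 0 z [] = refl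
...     | other l = trans (updG-miss (updG (updG (λ i d → K i d <∣> fill (inc 0 h) ((1 , x) ∷ (0 , y) ∷ w) i d) (h 0) 0 (just z)) (h 0) 1 (just t)) (suc (h 0)) 0 nothing n)
        (trans (updG-miss (updG (λ i d → K i d <∣> fill (inc 0 h) ((1 , x) ∷ (0 , y) ∷ w) i d) (h 0) 0 (just z)) (h 0) 1 (just t) m)
        (trans (updG-miss (λ i d → K i d <∣> fill (inc 0 h) ((1 , x) ∷ (0 , y) ∷ w) i d) (h 0) 0 (just z) l)
        (cong₂ _<∣>_ (sym (trans (cong₂ (λ a b → (K i d <∣> a) <∣> b) (fill-other h 0 z [] refl l) (fill-other (inc 0 h) 1 t [] e m))
                       (trans (<∣>-nothing (K i d <∣> nothing)) (<∣>-nothing (K i d)))))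
          (trans (fill-other (inc 0 h) 1 x ((0 , y) ∷ w) e m) (fill-other (inc 1 (inc 0 h)) 0 y w refl n)))))

-- A letter in between would have the value `v`. Primed, it would need a content below 1; unprimed,
-- it could not precede a letter of content 0 and the same value.
next-zero : ∀ {b v p w} → Path b (just (1 , mk v true)) w nothing → first 0 w ≡ just (mk v p) → ∃ λ w′ → w ≡ (0 , mk v p) ∷ w′
next-zero {w = (d , y) ∷ w} (l ∷ q) e with first-All ((d , y) ∷ w) (Path⇒≺ (l ∷ q)) e
next-zero {w = (zero , y) ∷ w} (l ∷ q) refl | _ = w , refl
next-zero {w = (suc d , y) ∷ w} (l ∷ q) e | _ with first-All w (Path⇒≺ q) e
next-zero {w = (suc d , y) ∷ w} (rise r _ _ ∷ q) e | _ | by-val s = ⊥-elim (ℤₚ.<-asym r s)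
next-zero {w = (suc d , y) ∷ w} (rise r _ _ ∷ q) e | _ | pp s = ⊥-elim (ℤₚ.<-irrefl refl r)
next-zero {w = (suc d , y) ∷ w} (rise r _ _ ∷ q) e | _ | pu = ⊥-elim (ℤₚ.<-irrefl refl r)
next-zero {w = (suc d , y) ∷ w} (pp (s≤s ()) ∷ q) e | _ | _
next-zero {w = (suc d , y) ∷ w} (pu< _ _ ∷ q) e | _ | by-val s = ⊥-elim (ℤₚ.<-irrefl refl s)
next-zero {w = (suc d , y) ∷ w} (pu> (s≤s ()) _ ∷ q) e | _ | _

nothing≢just : ∀ {A : Set} {x : A} {m : Maybe A} → m ≡ nothing → m ≡ just x → ⊥
nothing≢just refl ()

m+n≡m⇒n≡0 : ∀ m {n} → m ≡ m + n → n ≡ 0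
m+n≡m⇒n≡0 m {n} e = +-cancelˡ-≡ m n 0 (trans (sym e) (sym (+-identityʳ m)))

-- The hole is the place of a box addable to `h`, so by `addable-east` and `addable-south` its
-- neighbours are the next cells of their diagonals. They hold the first remaining letters of the
-- contents `suc s` and one less than `s`.
module HoleCells {K G w s h i} (C : Cells G (λ i d → K i d <∣> fill (inc s h) w i d)) (H : Hollow K h)
  (u : Up h (s ∷ contents w)) (ei : i ≡ h s) where

  private
    p₀ : Prof h
    p₀ = Up-Prof u
    p₁ : Prof (inc s h)
    p₁ = Up-Prof (Up-tail u)

  east-cell : G i (suc (i + s)) ≡ first (suc s) w
  east-cell = trans (cong (G i) (sym (+-suc i s))) (trans (cell C i (suc s))
    (trans (cong (_<∣> fill (inc s h) w i (suc s)) (H i (suc s) (≤-reflexive (sym eq))))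
    (trans (cong (λ k → fill (inc s h) w k (suc s)) (trans eq (sym (inc-diff {s} {suc s} h (λ e → 1+n≢n (sym e))))))
      (fill-first (inc s h) (suc s) w))))
    where
    eq : i ≡ h (suc s)
    eq = trans ei (addable-east p₀ p₁)

  south-cell : ∀ {t} → s ≡ suc t → G (suc i) (i + s) ≡ first t w
  south-cell {t} refl = trans (cong (G (suc i)) (+-suc i t)) (trans (cell C (suc i) t)
    (trans (cong (_<∣> fill (inc s h) w (suc i) t) (H (suc i) t (≤-reflexive (sym eq))))
    (trans (cong (λ k → fill (inc s h) w k t) (trans eq (sym (inc-diff {suc t} {t} h 1+n≢n)))) (fill-first (inc s h) t w))))
    where
    eq : suc i ≡ h t
    eq = trans (cong suc ei) (sym (addable-south p₀ p₁))

  south-empty : s ≡ 0 → G (suc i) (i + s) ≡ nothing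
  south-empty refl = tri C (suc i) (i + 0) (s≤s (≤-reflexive (+-identityʳ i)))

  diagonal-cell : s ≡ 0 → G (suc i) (suc i) ≡ first 0 w
  diagonal-cell refl = trans (cong (G (suc i)) (sym (+-identityʳ (suc i)))) (trans (cell C (suc i) 0)
    (trans (cong (_<∣> fill (inc 0 h) w (suc i) 0) (H (suc i) 0 (≤-trans (≤-reflexive (sym ei)) (n≤1+n i))))
    (trans (cong (λ k → fill (inc 0 h) w k 0) (cong suc ei)) (fill-first (inc 0 h) 0 w))))

-- The rule of jeu de taquin prefers the neighbour that comes first in the standardization; among
-- equal values the contents decide.
east-preferred : ∀ {c d x y} → (c , x) ≺ (d , y) → d < c → PrefEast x y
east-preferred (by-val p) q = inj₁ p
east-preferred (pp _) q = inj₂ (refl , refl)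
east-preferred pu q = inj₂ (refl , refl)
east-preferred (uu p) q = ⊥-elim (<-asym p q)

south-preferred : ∀ {c d x y} → (c , y) ≺ (d , x) → c < d → ¬ PrefEast x y
south-preferred (by-val p) q (inj₁ r) = ℤₚ.<-asym p r
south-preferred (by-val p) q (inj₂ (e , _)) = ℤₚ.<-irrefl (sym e) p
south-preferred (pp r) q _ = <-asym r q
south-preferred (uu _) q (inj₁ r) = ℤₚ.<-irrefl refl r
south-preferred pu q (inj₁ r) = ℤₚ.<-irrefl refl r

Path-tail⇒≺ : ∀ {b m e w m′} → Path b m (e ∷ w) m′ → All (e ≺_) w
Path-tail⇒≺ (_ ∷ p) = Path⇒≺ p

Slid : Grid → Shape → ℕ → List Entry → Filling → Set
Slid K h s w R = ∃ λ w′ → ∃ λ s′ → Tr s w s′ w′ × Cells R (λ i d → K i d <∣> fill h w′ i d)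

slide-empty : ∀ {G R K h s i j k} → j ≡ k → G i (suc k) ≡ nothing → G (suc i) k ≡ nothing → (i ≡ k → G i (suc i) ≡ nothing) →
  Cells G (λ i d → K i d <∣> nothing) → Slide G i j R → Slid K h s [] R
slide-empty {s = s} refl e₁ e₂ e₃ C (stop _ _) = [] , s , nil , C
slide-empty refl e₁ e₂ e₃ C (excU e _ _) = ⊥-elim (nothing≢just (e₃ refl) e)
slide-empty refl e₁ e₂ e₃ C (excP e _ _) = ⊥-elim (nothing≢just (e₃ refl) e)
slide-empty refl e₁ e₂ e₃ C (east e _ _ _) = ⊥-elim (nothing≢just e₁ e)
slide-empty refl e₁ e₂ e₃ C (south _ e _) = ⊥-elim (nothing≢just e₂ e)
slide-empty refl e₁ e₂ e₃ C (bothE e _ _ _ _) = ⊥-elim (nothing≢just e₁ e)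
slide-empty refl e₁ e₂ e₃ C (bothS e _ _ _ _) = ⊥-elim (nothing≢just e₁ e)

mutual
  -- A first letter far from the hole does not touch it and joins the passed boxes `K`. A near first
  -- letter is a neighbour of the hole, and the slide must choose it because the other neighbour
  -- comes later in the word.
  slide-fill : ∀ {b m} w s h {K G R i j} → i ≡ h s → j ≡ i + s → Hollow K h → Up h (s ∷ contents w) → Path b m w nothing →
    Cells G (λ i d → K i d <∣> fill (inc s h) w i d) → Slide G i j R → Slid K h s w R
  slide-fill [] s h {K} {G} {i = i} ei refl H u p C D =
    slide-empty {h = h} refl east-cell (southwards s refl) (λ e → trans (cong (λ k → G i (suc k)) e) east-cell) C D
    where
    open HoleCells {K} {w = []} {s} {h} C H u ei
    southwards : ∀ s′ → s ≡ s′ → G (suc i) (i + s) ≡ nothing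
    southwards zero e = south-empty e
    southwards (suc t) e = south-cell e
  slide-fill ((c , x) ∷ w) s h {K} {G} {i = i} ei ej H u p C D with near s c in f
  slide-fill ((c , x) ∷ w) s h {K} {G} ei ej H u (_ ∷ p) C D | false
    with slide-fill w s (inc c h) {extend K h (c , x)} (trans ei (sym (inc-diff {c} {s} h (λ e → far-≢ f (sym e))))) ej
           (extend-Hollow {K} {h} {c} {x} H) (Up-tail (Up-exchange f u)) p (Cells-cong C cells) D
    where
    cells : ∀ i d → (K i d <∣> fill (inc s h) ((c , x) ∷ w) i d) ≡ (extend K h (c , x) i d <∣> fill (inc s (inc c h)) w i d)
    cells i d = trans (cong (K i d <∣>_) (trans (fill-++ (inc s h) ((c , x) ∷ []) w i d) (cong₂ _<∣>_ one-box (fill-cong w (inc-comm c s h) i d))))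
                  (sym (<∣>-assoc (K i d) _ _))
      where
      one-box : fill (inc s h) ((c , x) ∷ []) i d ≡ fill h ((c , x) ∷ []) i d
      one-box rewrite inc-diff {s} {c} h (far-≢ f) = refl
  ... | w′ , s′ , t , C′ = (c , x) ∷ w′ , s′ , pass f t , Cells-cong C′ (λ i d → extend-fill K h c x w′ i d)
  slide-fill ((c , x) ∷ w) s h {K} {G} {i = i} ei refl H u p C D | true with near⇒ s c f
  ... | inj₁ refl = ⊥-elim (Up-≢ u refl)
  ... | inj₂ (inj₁ refl) = east-first D
    where
    open HoleCells {K} {w = (suc s , x) ∷ w} {s} {h} C H u ei
    E : G i (suc (i + s)) ≡ just x
    E = trans east-cell (first-same (suc s) x w)
    noSwap : ¬ Exc G i (i + s) → ¬ Swap s (suc s) x w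
    noSwap ne (refl , _ , px , q , w′ , refl) = ne (sym (+-identityʳ i) , val x ,
      trans (cong (λ k → G i (suc k)) (sym (+-identityʳ i))) (trans E (cong (λ z → just (mk (val x) z)) px)) , q ,
      diagonal-cell refl)
    moveE : ∀ {x′ R} → G i (suc (i + s)) ≡ just x′ → ¬ Exc G i (i + s) →
      Slide (upd (upd G i (i + s) (just x′)) i (suc (i + s)) nothing) i (suc (i + s)) R → Slid K h s ((suc s , x) ∷ w) R
    moveE e ne D with just-injective (trans (sym E) e)
    ... | refl = move-step (suc s) x w s h ei refl (trans ei (trans (addable-east (Up-Prof u) (Up-Prof (Up-tail u))) (sym (inc-diff {s} {suc s} h (λ e → 1+n≢n (sym e))))))
                   (sym (+-suc i s)) H u p C f (noSwap ne) D
    east-first : ∀ {R} → Slide G i (i + s) R → Slid K h s ((suc s , x) ∷ w) R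
    east-first D = east-case s refl D refl
      where
      swapped : ∀ {a q R} → s ≡ 0 → G i (suc i) ≡ just (mk a true) → G (suc i) (suc i) ≡ just (mk a q) →
        Slide (upd (upd (upd G i i (just (mk a q))) i (suc i) (just (mk a false))) (suc i) (suc i) nothing) (suc i) (suc i) R →
        Slid K h s ((suc s , x) ∷ w) R
      swapped z e₁ e₂ D = swap-step s x w h z (just-injective (trans (sym E) (trans (cong (λ k → G i (suc k)) (trans (cong (i +_) z) (+-identityʳ i))) e₁)))
        (trans (sym (trans (diagonal-cell z) (first-other {d = suc s} x w (λ ())))) e₂) ei H u p C D
      east-case : ∀ {j R} s′ → s ≡ s′ → Slide G i j R → j ≡ i + s → Slid K h s ((suc s , x) ∷ w) R
      east-case s′ _ (stop e _) refl = ⊥-elim (nothing≢just e E)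
      east-case s′ _ (excU e₁ e₂ D) q = swapped (m+n≡m⇒n≡0 i q) e₁ e₂ D
      east-case s′ _ (excP e₁ e₂ D) q = swapped (m+n≡m⇒n≡0 i q) e₁ e₂ D
      east-case s′ _ (east e _ ne D) refl = moveE e ne D
      east-case s′ _ (south e _ _) refl = ⊥-elim (nothing≢just e E)
      east-case s′ _ (bothE e _ _ ne D) refl = moveE e ne D
      east-case zero z (bothS _ e _ _ _) refl = ⊥-elim (nothing≢just (south-empty z) e)
      east-case (suc t) z (bothS e₁ e₂ np _ _) refl = ⊥-elim (np (east-preferred (subst (λ y → (suc s , y) ≺ _) (just-injective (trans (sym E) e₁))
          (first-All w (Path-tail⇒≺ p) (trans (sym (first-other {c = t} x w (λ q → 1+n≰n (≤-trans (≤-reflexive (cong suc (sym z))) (≤-trans (≤-reflexive q) (n≤1+n t)))))) (trans (sym (south-cell z)) e₂))))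
          (≤-trans (n≤1+n (suc t)) (≤-reflexive (cong suc (sym z))))))
  slide-fill ((c , x) ∷ w) (suc .c) h {K} {G} {i = i} ei refl H u p C D | true | inj₂ (inj₂ refl) = south-case D refl
    where
    s = suc c
    open HoleCells {K} {w = (c , x) ∷ w} {suc c} {h} C H u ei
    S : G (suc i) (i + suc c) ≡ just x
    S = trans (south-cell refl) (first-same c x w)
    moveS : ∀ {x′ R} → G (suc i) (i + suc c) ≡ just x′ →
      Slide (upd (upd G i (i + suc c) (just x′)) (suc i) (i + suc c) nothing) (suc i) (i + suc c) R → Slid K h (suc c) ((c , x) ∷ w) R
    moveS e D with just-injective (trans (sym S) e)
    ... | refl = move-step c x w (suc c) h ei refl (trans (cong suc ei) (trans (sym (addable-south (Up-Prof u) (Up-Prof (Up-tail u)))) (sym (inc-diff {suc c} {c} h 1+n≢n))))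
                   (+-suc i c) H u p C f (λ { (() , _) }) D
    offdiag : ∀ {A : Set} → i ≡ i + suc c → A
    offdiag q with m+n≡m⇒n≡0 i q
    ... | ()
    south-case : ∀ {j R} → Slide G i j R → j ≡ i + suc c → Slid K h (suc c) ((c , x) ∷ w) R
    south-case (stop _ e) refl = ⊥-elim (nothing≢just e S)
    south-case (excU _ _ _) q = offdiag q
    south-case (excP _ _ _) q = offdiag q
    south-case (east _ e _ _) refl = ⊥-elim (nothing≢just e S)
    south-case (south _ e D) refl = moveS e D
    south-case (bothE e₁ e₂ pe _ _) refl with just-injective (trans (sym S) e₂)
    ... | refl = ⊥-elim (south-preferred (first-All w (Path-tail⇒≺ p)
            (trans (sym (first-other {c = suc (suc c)} x w (λ q → 1+n≰n (≤-trans (n≤1+n (suc c)) (≤-reflexive (sym q)))))) (trans (sym east-cell) e₁)))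
            (n≤1+n (suc c)) pe)
    south-case (bothS _ e _ _ D) refl = moveS e D

  move-step : ∀ {b m} c x w s h {K G R i j i₂ j₂} → i ≡ h s → j ≡ i + s → i₂ ≡ inc s h c → j₂ ≡ i₂ + c → Hollow K h →
    Up h (s ∷ contents ((c , x) ∷ w)) → Path b m ((c , x) ∷ w) nothing → Cells G (λ i d → K i d <∣> fill (inc s h) ((c , x) ∷ w) i d) →
    near s c ≡ true → ¬ Swap s c x w → Slide (upd (upd G i j (just x)) i₂ j₂ nothing) i₂ j₂ R → Slid K h s ((c , x) ∷ w) R
  move-step c x w s h {K} ei ej ei₂ ej₂ H u (_ ∷ p) C f n D
    with slide-fill w c (inc s h) {extend K h (s , x)} ei₂ ej₂ (extend-Hollow {K} {h} {s} {x} H) (Up-tail u) p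
      (Cells-cong (upd-Cells c nothing ej₂ (upd-Cells s (just x) ej C)) (move-cells {K} {h} {s} {c} {x} {w} H (Up-≢ u) ei ei₂)) D
  ... | w′ , s′ , t , C′ = (s , x) ∷ w′ , s′ , move f n t , Cells-cong C′ (λ i d → extend-fill K h s x w′ i d)

  swap-step : ∀ {b m a q} s x w h {K G R i} → s ≡ 0 → x ≡ mk a true → first 0 w ≡ just (mk a q) → i ≡ h s → Hollow K h →
    Up h (s ∷ suc s ∷ contents w) → Path b m ((suc s , x) ∷ w) nothing →
    Cells G (λ i d → K i d <∣> fill (inc s h) ((suc s , x) ∷ w) i d) →
    Slide (upd (upd (upd G i i (just (mk a q))) i (suc i) (just (mk a false))) (suc i) (suc i) nothing) (suc i) (suc i) R →
    Slid K h s ((suc s , x) ∷ w) R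
  swap-step s x [] h z e () ei H u p C D
  swap-step {a = a} {q} .0 .(mk a true) (e ∷ w) h {K} {i = i} refl refl f ei H u (_ ∷ p) C D with next-zero p f | p
  ... | .w , refl | _ ∷ p₂
    with slide-fill w 0 (inc 1 (inc 0 h)) {extend (extend K h (0 , mk a q)) (inc 0 h) (1 , mk a false)} (cong suc ei) (sym (+-identityʳ (suc i)))
      (extend-Hollow {extend K h (0 , mk a q)} {inc 0 h} {1} {mk a false} (extend-Hollow {K} {h} {0} {mk a q} H)) (Up-tail (Up-tail u)) p₂
      (Cells-cong (upd-Cells 0 nothing (sym (+-identityʳ (suc i))) (upd-Cells 1 (just (mk a false)) (sym (+-comm i 1)) (upd-Cells 0 (just (mk a q)) (sym (+-identityʳ i)) C)))
        (swap-cells {K} {h} {mk a true} {mk a q} {mk a q} {mk a false} {w} H ei (trans ei (addable-east (Up-Prof u) (Up-Prof (Up-tail u)))))) D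
  ... | w′ , s′ , t , C′ = (0 , mk a q) ∷ (1 , mk a false) ∷ w′ , s′ , exch t ,
        Cells-cong C′ (λ i d → trans (extend-fill (extend K h (0 , mk a q)) (inc 0 h) 1 (mk a false) w′ i d) (extend-fill K h 0 (mk a q) ((1 , mk a false) ∷ w′) i d))

-- Profiles of strict partitions, and rectification on words

prof : List ℕ → Shape
prof []      c = 0
prof (m ∷ μ) c = if c <ᵇ m then suc (prof μ c) else prof μ c

prof-< : ∀ {m μ c} → c < m → prof (m ∷ μ) c ≡ suc (prof μ c)
prof-< q rewrite <⇒<ᵇ≡ q = refl

≥⇒<ᵇ≡ : ∀ {m n} → n ≤ m → (m <ᵇ n) ≡ false
≥⇒<ᵇ≡ {m} {zero} q = refl
≥⇒<ᵇ≡ {suc m} {suc n} (s≤s q) = ≥⇒<ᵇ≡ q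

prof-≥ : ∀ {m μ c} → m ≤ c → prof (m ∷ μ) c ≡ prof μ c
prof-≥ q rewrite ≥⇒<ᵇ≡ q = refl

strict-tail : ∀ {m μ} → IsStrict (m ∷ μ) → IsStrict μ
strict-tail (one _) = nil
strict-tail (cons _ s) = s

prof-small : ∀ {m μ c} → IsStrict (m ∷ μ) → m ≤ suc c → prof μ c ≡ 0
prof-small (one _) q = refl
prof-small {c = c} (cons {n = n} {μ} lt s) q = trans (prof-≥ {n} {μ} {c} (≤-pred (≤-trans lt q))) (prof-small s (≤-trans (≤-pred (≤-trans lt q)) (n≤1+n c)))

prof-Prof : ∀ {μ} → IsStrict μ → Prof (prof μ)
prof-Prof nil d = inj₁ refl
prof-Prof {m ∷ μ} s d with suc d <? m | d <? m
... | yes p | _ rewrite prof-< {m} {μ} p | prof-< {m} {μ} (<⇒≤ p) with prof-Prof (strict-tail s) d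
...   | inj₁ e = inj₁ (cong suc e)
...   | inj₂ e = inj₂ (cong suc e)
prof-Prof {m ∷ μ} s d | no q | yes p rewrite prof-< {m} {μ} p | prof-≥ {m} {μ} (≮⇒≥ q)
  | prof-small s (≮⇒≥ q) | prof-small s (≤-trans (≮⇒≥ q) (n≤1+n (suc d))) = inj₂ refl
prof-Prof {m ∷ μ} s d | no q | no p rewrite prof-≥ {m} {μ} (≮⇒≥ q) | prof-≥ {m} {μ} (≮⇒≥ p) = prof-Prof (strict-tail s) d

inS⇒prof : ∀ {μ} → IsStrict μ → ∀ i j → inS μ i j → Σ ℕ λ d → j ≡ i + d × i < prof μ d
inS⇒prof {m ∷ μ} s zero j p = j , refl , ≤-trans (s≤s z≤n) (≤-reflexive (sym (prof-< {m} {μ} p)))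
inS⇒prof {m ∷ μ} s (suc i) (suc j) p with inS⇒prof (strict-tail s) i j p
... | d , e , q with d <? m
...   | yes r = d , cong suc e , ≤-trans (s≤s q) (≤-reflexive (sym (prof-< {m} {μ} r)))
...   | no r = ⊥-elim (n≮0 (≤-trans q (≤-reflexive (prof-small s (≤-trans (≮⇒≥ r) (n≤1+n d))))))

prof⇒inS : ∀ {μ} → IsStrict μ → ∀ i d → i < prof μ d → inS μ i (i + d)
prof⇒inS {m ∷ μ} s i d p with d <? m
prof⇒inS {m ∷ μ} s zero d p | yes q = q
prof⇒inS {m ∷ μ} s (suc i) d p | yes q = prof⇒inS (strict-tail s) i d (≤-pred (≤-trans p (≤-reflexive (prof-< {m} {μ} q))))
prof⇒inS {m ∷ μ} s i d p | no q = ⊥-elim (n≮0 (≤-trans p (≤-reflexive (trans (prof-≥ {m} {μ} (≮⇒≥ q)) (prof-small s (≤-trans (≮⇒≥ q) (n≤1+n d)))))))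

prof-head0 : ∀ {μ} → IsStrict μ → prof μ (head0 μ) ≡ 0
prof-head0 nil = refl
prof-head0 {m ∷ μ} s = trans (prof-≥ {m} {μ} ≤-refl) (prof-small s (n≤1+n m))

inS-+ : ∀ {μ} → IsStrict μ → ∀ i d → inS μ i (i + d) → i < prof μ d
inS-+ {μ} s i d p with inS⇒prof s i (i + d) p
... | d′ , e , q = subst (λ d → i < prof μ d) (sym (+-cancelˡ-≡ i _ _ e)) q

<-ext : ∀ {m n} → (∀ i → i < m → i < n) → m ≤ n
<-ext {zero} f = z≤n
<-ext {suc m} f = f m ≤-refl

⊑⇒≤ : ∀ {μ ν} → IsStrict μ → IsStrict ν → μ ⊑ ν → ∀ d → prof μ d ≤ prof ν d
⊑⇒≤ s t f d = <-ext λ i p → inS-+ t i d (f i (i + d) (prof⇒inS s i d p))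

remove-corner : ∀ {μ μ′ ci cj} → IsStrict μ → RemoveCorner μ ci cj μ′ →
  Σ ℕ λ s → ci ≡ prof μ′ s × cj ≡ ci + s × prof μ ≗ inc s (prof μ′)
remove-corner {μ} {μ′} {ci} {cj} st (st′ , ins , nins , sub , only) with inS⇒prof st ci cj ins
... | s , refl , p = s , sym eq , refl , eqs
  where
  g≤ : prof μ′ s ≤ ci
  g≤ = ≮⇒≥ (λ q → nins (prof⇒inS st′ ci s q))
  eq : prof μ′ s ≡ ci
  eq with only (prof μ′ s) (prof μ′ s + s) (prof⇒inS st (prof μ′ s) s (≤-trans (s≤s g≤) p))
  ... | inj₁ q = ⊥-elim (<-irrefl refl (inS-+ st′ _ s q))
  ... | inj₂ (q , _) = q
  eqs : prof μ ≗ inc s (prof μ′)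
  eqs d with s ≟ d
  ... | yes refl rewrite ≡ᵇ-refl s = ≤-antisym (<-ext inside) (≤-trans (s≤s g≤) p)
    where
    inside : ∀ i → i < prof μ s → i < suc (prof μ′ s)
    inside i q with only i (i + s) (prof⇒inS st i s q)
    ... | inj₁ r = m<n⇒m<1+n (inS-+ st′ i s r)
    ... | inj₂ (r , _) = s≤s (≤-reflexive (trans r (sym eq)))
  ... | no n rewrite ≢⇒≡ᵇ n = ≤-antisym (<-ext inside) (⊑⇒≤ st′ st sub d)
    where
    inside : ∀ i → i < prof μ d → i < prof μ′ d
    inside i q with only i (i + d) (prof⇒inS st i d q)
    ... | inj₁ r = inS-+ st′ i d r
    ... | inj₂ (refl , r) = ⊥-elim (n (sym (+-cancelˡ-≡ i _ _ r)))

record Rectified (b : ℤ → Bool) (h : Shape) (w : List Entry) (R : Filling) : Set where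
  field
    X     : List ℕ
    w′    : List Entry
    valid : Up ∅ (reverse X ++ contents w)
    inner : ∅ ⊕ reverse X ≗ h
    cont  : contents w′ ≡ lower X (contents w)
    value : vals w′ ≡ vals w
    std   : Standard b w′
    cells : Cells R (fill ∅ w′)

rect-fill : ∀ {b μ F R} → Rect μ F R → IsStrict μ → ∀ w → Up (prof μ) (contents w) → Standard b w →
  Cells F (fill (prof μ) w) → Rectified b (prof μ) w R
rect-fill done st w u p C = record { X = [] ; w′ = w ; valid = u ; inner = λ _ → refl ; cont = refl ; value = refl ; std = p ; cells = C }
rect-fill {b} {μ} (step {μ′ = μ′} rc sl rest) st w u p C with remove-corner st rc
... | s , ei , ej , e with slide-fill w s (prof μ′) {λ _ _ → nothing} ei ej (λ _ _ _ → refl) u₁ p (Cells-cong C (fill-cong w e)) sl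
  where
  u₁ : Up (prof μ′) (s ∷ contents w)
  u₁ = prof-Prof (proj₁ rc) ▸ Up-cong e u
... | w₁ , s₁ , t , C₁ = record
    { X = s ∷ X ; w′ = w′
    ; valid = subst (Up ∅) (sym (reverse-∷-++ s X (contents w))) (Up-++ (Up-take (reverse X) valid) (Up-cong (≗-sym inner) u₁))
    ; inner = λ d → trans (cong (λ g → g d) (⊕-reverse-∷ ∅ s X)) (trans (inc-cong s inner d) (sym (e d)))
    ; cont = trans cont (cong (lower X) (proj₁ (Tr-contents t)))
    ; value = trans value (Tr-vals t) ; std = std ; cells = cells }
  where
  u₁ : Up (prof μ′) (s ∷ contents w)
  u₁ = prof-Prof (proj₁ rc) ▸ Up-cong e u
  uw₁ : Up (prof μ′) (contents w₁)
  uw₁ = subst (Up (prof μ′)) (sym (proj₁ (Tr-contents t))) (Up-take (emit s (contents w))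
    (Up-emit s (contents w) [] (subst (λ v → Up (prof μ′) (s ∷ v)) (sym (++-identityʳ (contents w))) u₁)))
  open Rectified (rect-fill rest (proj₁ rc) w₁ uw₁ (Tr-Standard t u₁ p) C₁)

-- The *-operation on words

starE : Entry → Entry
starE (c , x) = c , starL x

starW : List Entry → List Entry
starW w = reverse (map starE w)

-- Starring keeps contents and flips primes, so the letter of lowest content of each value, whose
-- prime the bit records, changes its bit.
starB : (ℤ → Bool) → ℤ → Bool
starB b v = not (b (ℤ.- v))

reverse-∷′ : ∀ {A : Set} (x : A) xs → reverse (x ∷ xs) ≡ reverse xs ++ x ∷ []
reverse-∷′ = unfold-reverse

contents-reverse : ∀ (w : List Entry) → contents (reverse w) ≡ reverse (contents w)
contents-reverse [] = refl
contents-reverse (e ∷ w) = trans (cong contents (reverse-∷ e w)) (trans (map-++ proj₁ (reverse w) (e ∷ []))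
  (trans (cong (_++ proj₁ e ∷ []) (contents-reverse w)) (sym (reverse-∷ (proj₁ e) (contents w)))))

contents-starE : ∀ w → contents (map starE w) ≡ contents w
contents-starE [] = refl
contents-starE (e ∷ w) = cong (proj₁ e ∷_) (contents-starE w)

contents-starW : ∀ w → contents (starW w) ≡ reverse (contents w)
contents-starW w = trans (contents-reverse (map starE w)) (cong reverse (contents-starE w))

starW-∷ : ∀ e w → starW (e ∷ w) ≡ starW w ++ starE e ∷ []
starW-∷ e w = reverse-∷ (starE e) (map starE w)

starW-++ : ∀ u v → starW (u ++ v) ≡ starW v ++ starW u
starW-++ u v = trans (cong reverse (map-++ starE u v)) (reverse-++ (map starE u) (map starE v))

val-starL : ∀ x → val (starL x) ≡ ℤ.- val x
val-starL (mk v true) = refl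
val-starL (mk v false) = refl

starL-involutive : ∀ x → starL (starL x) ≡ x
starL-involutive (mk v true) = cong (λ v → mk v true) (ℤₚ.neg-involutive v)
starL-involutive (mk v false) = cong (λ v → mk v false) (ℤₚ.neg-involutive v)

starW-involutive : ∀ w → starW (starW w) ≡ w
starW-involutive [] = refl
starW-involutive ((c , x) ∷ w) = trans (cong starW (starW-∷ (c , x) w)) (trans (starW-++ (starW w) ((c , starL x) ∷ []))
  (cong₂ _∷_ (cong (c ,_) (starL-involutive x)) (starW-involutive w)))

private
  start-bit : ∀ {b : ℤ → Bool} x → (primed x ≡ false → b (val x) ≡ false) → primed (starL x) ≡ true → starB b (val (starL x)) ≡ true
  start-bit (mk v false) f _ rewrite ℤₚ.neg-involutive v | f refl = refl
  stop-bit : ∀ {b : ℤ → Bool} x → (primed x ≡ true → b (val x) ≡ true) → primed (starL x) ≡ false → starB b (val (starL x)) ≡ false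
  stop-bit (mk v true) f _ rewrite ℤₚ.neg-involutive v | f refl = refl

starM : Maybe Entry → Maybe Entry
starM nothing = nothing
starM (just e) = just (starE e)

Link-star : ∀ {b m m′} → Link b m m′ → Link (starB b) (starM m′) (starM m)
Link-star empty = empty
Link-star {b} (start {x = x} f) = stop (start-bit {b} x f)
Link-star {b} (stop {x = x} f) = start (stop-bit {b} x f)
Link-star {b} (rise {x = x} {y = y} r f g) = rise (subst₂ ℤ._<_ (sym (val-starL y)) (sym (val-starL x)) (ℤₚ.neg-mono-< r)) (start-bit {b} y g) (stop-bit {b} x f)
Link-star (pp l) = uu l
Link-star (uu l) = pp l
Link-star {b} (pu< {v = v} l e) = pu> l (trans (cong (λ z → not (b z)) (ℤₚ.neg-involutive v)) (cong not e))
Link-star {b} (pu> {v = v} l e) = pu< l (trans (cong (λ z → not (b z)) (ℤₚ.neg-involutive v)) (cong not e))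

Path-snoc : ∀ {b m w e m′} → Path b m w (just e) → Link b (just e) m′ → Path b m (w ++ e ∷ []) m′
Path-snoc ([] l) l′ = l ∷ [] l′
Path-snoc (l ∷ p) l′ = l ∷ Path-snoc p l′

Path-star : ∀ {b m w m′} → Path b m w m′ → Path (starB b) (starM m′) (starW w) (starM m)
Path-star ([] l) = [] (Link-star l)
Path-star {b} {m} {e ∷ w} {m′} (l ∷ p) = subst (λ v → Path (starB b) (starM m′) v (starM m)) (sym (starW-∷ e w)) (Path-snoc (Path-star p) (Link-star l))

-- A diagonal `d` of the staircase has L - d cells and the reflection reverses it; this is the
-- relation between the rows `i` and `i′`.
fill-star : ∀ h w {L i i′ d} → Up h (contents w) → (h ⊕ contents w) L ≡ 0 → suc (i′ + (i + d)) ≡ L →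
  fill (compl L (h ⊕ contents w)) (starW w) i d ≡ Maybe.map starL (fill h w i′ d)
fill-star h [] u z e = refl
fill-star h ((c , x) ∷ w) {L} {i} {i′} {d} (p ▸ u) z e =
  trans (cong (λ v → fill (compl L k) v i d) (starW-∷ (c , x) w))
  (trans (fill-++ (compl L k) (starW w) ((c , starL x) ∷ []) i d)
  (trans (cong₂ _<∣>_ (fill-star (inc c h) w u z e) (fill-cong ((c , starL x) ∷ []) base i d)) (cellwise (at? (h c) c i′ d))))
  where
  k = inc c h ⊕ contents w
  g = compl L (inc c h)
  base : compl L k ⊕ contents (starW w) ≗ g
  base d = trans (cong (λ v → (compl L k ⊕ v) d) (contents-starW w)) (proj₂ (Up-reverse {L = L} u z) d)
  bound : suc (h c) ≤ L ∸ c
  bound = ≤-trans (≤-reflexive (sym (inc-same c h))) (Prof-bound (Up-Prof u) (⊕-zero {inc c h} {contents w} z) c)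
  g-c : g c ≡ L ∸ c ∸ suc (h c)
  g-c = cong (L ∸ c ∸_) (inc-same c h)
  L∸c : ∀ {i′} → suc (i′ + (i + c)) ≡ L → L ∸ c ≡ suc i′ + i
  L∸c {i′} refl = trans (cong (λ n → suc n ∸ c) (sym (+-assoc i′ i c))) (m+n∸n≡m (suc (i′ + i)) c)
  miss : (h c ≢ i′) ⊎ (c ≢ d) → (i ≢ g c) ⊎ (c ≢ d)
  miss (inj₂ m) = inj₂ m
  miss (inj₁ m) with c ≟ d
  ... | no q = inj₂ q
  ... | yes refl = inj₁ λ q → m (sym (suc-injective (+-cancelʳ-≡ i (suc i′) (suc (h c)) (trans (sym (L∸c e))
        (trans (sym (m+[n∸m]≡n bound)) (cong (suc (h c) +_) (trans (sym g-c) (sym q))))))))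
  cellwise : At (h c) c i′ d → (Maybe.map starL (fill (inc c h) w i′ d) <∣> fill g ((c , starL x) ∷ []) i d)
    ≡ Maybe.map starL (fill h ((c , x) ∷ w) i′ d)
  cellwise here rewrite fill-hit h c x w | fill-low (inc c h) w {h c} {c} (≤-reflexive (sym (inc-same c h))) =
    fill-here g c (starL x) [] (sym (trans g-c (trans (cong (_∸ suc (h c)) (L∸c e)) (m+n∸m≡n (suc (h c)) i))))
  cellwise (other n) rewrite fill-miss h c x w (≢-flip n) | fill-miss g c (starL x) [] {i} {d} (miss n) = <∣>-nothing _
compl-≤ : ∀ L h d → compl L h d ≤ L ∸ d
compl-≤ L h d = m∸n≤m (L ∸ d) (h d)

star-Cells : ∀ {F h} w {L} → Up h (contents w) → (h ⊕ contents w) L ≡ 0 → Cells F (fill h w) →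
  Cells (star L F) (fill (compl L (h ⊕ contents w)) (starW w))
cell (star-Cells {F} {h} w {L} u z C) i d with i + d <? L
... | no n rewrite ≥⇒<ᵇ≡ {i + d} {L} (≮⇒≥ n) = trans (off (i <ᵇ L)) (sym (fill-high _ (starW w) high))
  where
  off : ∀ b → (if b ∧ false then Maybe.map starL (F (L ∸ 1 ∸ (i + d)) (L ∸ 1 ∸ i)) else nothing) ≡ nothing
  off true = refl
  off false = refl
  high : (compl L (h ⊕ contents w) ⊕ contents (starW w)) d ≤ i
  high = ≤-trans (≤-reflexive (trans (cong (λ v → (compl L (h ⊕ contents w) ⊕ v) d) (contents-starW w)) (proj₂ (Up-reverse {L = L} u z) d)))
    (≤-trans (compl-≤ L h d) (m≤n+o⇒m∸n≤o L d (≤-trans (≮⇒≥ n) (≤-reflexive (+-comm i d)))))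
... | yes q rewrite <⇒<ᵇ≡ q | <⇒<ᵇ≡ {i} {L} (≤-trans (s≤s (m≤m+n i d)) q) =
  trans (cong (Maybe.map starL) (trans (cong (F i′) eq) (cell C i′ d))) (sym (fill-star h w {L} {i} {i′} {d} u z sum))
  where
  i′ = L ∸ 1 ∸ (i + d)
  sum : suc (i′ + (i + d)) ≡ L
  sum = trans (cong suc (m∸n+n≡m (∸-monoˡ-≤ 1 q))) (m+[n∸m]≡n (≤-trans (s≤s z≤n) q))
  eq : L ∸ 1 ∸ i ≡ i′ + d
  eq = trans (cong (λ n → n ∸ 1 ∸ i) (sym sum)) (trans (cong (_∸ i) (trans (cong (i′ +_) (+-comm i d)) (sym (+-assoc i′ d i)))) (m+n∸n≡m (i′ + d) i))
tri (star-Cells {F} {h} w {L} u z C) i j q with i <? L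
... | no n rewrite ≥⇒<ᵇ≡ {i} {L} (≮⇒≥ n) = refl
... | yes r rewrite <⇒<ᵇ≡ r | <⇒<ᵇ≡ (<-trans q r) = cong (Maybe.map starL) (tri C _ _ (∸-monoʳ-< q (∸-monoˡ-≤ 1 r)))

-- The operation T^J on words

Agree-cong : ∀ {w h h′ g g′} → h ≗ h′ → g ≗ g′ → Agree w h g → Agree w h′ g′
Agree-cong e f [] = []
Agree-cong e f (_∷_ {c} q qs) = trans (sym (e c)) (trans q (f c)) ∷ Agree-cong e f qs

Agree-uninc : ∀ {w h g} c → Agree w (inc c h) (inc c g) → Agree w h g
Agree-uninc c [] = []
Agree-uninc {d ∷ w} {h} {g} c (e ∷ es) = cancel (c ≡ᵇ d) e ∷ Agree-uninc c es
  where
  cancel : ∀ b → (if b then suc (h d) else h d) ≡ (if b then suc (g d) else g d) → h d ≡ g d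
  cancel true q = suc-injective q
  cancel false q = q

addable-Prof : ∀ {h c} → Prof h → h c ≡ h (suc c) → (∀ {b} → c ≡ suc b → h b ≡ suc (h c)) → Prof (inc c h)
addable-Prof {h} {c} p e f d with c ≟ d
... | yes refl = inj₂ (trans (inc-same c h) (cong suc (trans e (sym (inc-diff {c} {suc c} h (λ e → 1+n≢n (sym e)))))))
... | no n with c ≟ suc d
...   | yes refl = inj₁ (trans (inc-diff {suc d} {d} h n) (trans (f refl) (sym (inc-same (suc d) h))))
...   | no k rewrite ≢⇒≡ᵇ n | ≢⇒≡ᵇ k = p d

-- The same boxes seen as a chain over another inner shape m.
transport : ∀ (w : List Entry) {h m a : Shape} → Up h (contents w) → Prof m → Prof a → (∀ d → m d ≤ a d) →
  (∀ i d x → fill h w i d ≡ just x → m d ≤ i × i < a d) →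
  (∀ i d → m d ≤ i → i < a d → ∃ λ x → fill h w i d ≡ just x) →
  Up m (contents w) × (∀ i d → fill m w i d ≡ fill h w i d) × Agree (contents w) h m × m ⊕ contents w ≗ a
transport [] {h} {m} {a} u pm pa m≤a to from = end pm , (λ _ _ → refl) , [] , eq
  where
  eq : m ≗ a
  eq d with m≤n⇒m<n∨m≡n (m≤a d)
  ... | inj₂ e = e
  ... | inj₁ q with from (m d) d ≤-refl q
  ...   | _ , ()
transport ((c , x) ∷ w) {h} {m} {a} (p ▸ u) pm pa m≤a to from =
  result (transport w {inc c h} {inc c m} {a} u pm′ pa m≤a′ to′ from′)
  where
  box : m c ≤ h c × h c < a c
  box = to (h c) c x (fill-hit h c x w)
  low : ∀ {d} → m d < a d → h d ≤ m d
  low {d} q = ≮⇒≥ λ r → nothing≢just (fill-low h ((c , x) ∷ w) r) (proj₂ (from (m d) d ≤-refl q))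
  hc : h c ≡ m c
  hc = ≤-antisym (low (≤-trans (s≤s (proj₁ box)) (proj₂ box))) (proj₁ box)
  east-eq : m c ≡ m (suc c)
  east-eq with pm c
  ... | inj₁ e = e
  ... | inj₂ e = ⊥-elim (1+n≰n (≤-trans (≤-reflexive (trans (sym e) (trans (sym hc) (addable-east p (Up-Prof u))))) (low q)))
    where
    q : m (suc c) < a (suc c)
    q = ≤-pred (≤-trans (≤-trans (s≤s (≤-reflexive (trans (sym e) (sym hc)))) (proj₂ box)) (Prof-slope pa 1 c))
  south-eq : ∀ {b} → c ≡ suc b → m b ≡ suc (m c)
  south-eq {b} refl with pm b
  ... | inj₂ e = e
  ... | inj₁ e = ⊥-elim (1+n≰n (≤-trans (≤-reflexive (trans (sym (addable-south p (Up-Prof u))) refl)) (≤-trans (low q) (≤-reflexive (trans e (sym hc))))))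
    where
    q : m b < a b
    q = ≤-trans (s≤s (≤-reflexive (trans e (sym hc)))) (≤-trans (proj₂ box) (Prof-≤ pa (n≤1+n b)))
  pm′ : Prof (inc c m)
  pm′ = addable-Prof pm east-eq south-eq
  m≤a′ : ∀ d → inc c m d ≤ a d
  m≤a′ d with c ≟ d
  ... | yes refl = ≤-trans (≤-reflexive (trans (inc-same c m) (cong suc (sym hc)))) (proj₂ box)
  ... | no n = ≤-trans (≤-reflexive (inc-diff {c} {d} m n)) (m≤a d)
  to′ : ∀ i d y → fill (inc c h) w i d ≡ just y → inc c m d ≤ i × i < a d
  to′ i d y e with at? (h c) c i d
  ... | here = ⊥-elim (nothing≢just (fill-low (inc c h) w (≤-reflexive (sym (inc-same c h)))) e)
  ... | other n with to i d y (trans (fill-miss h c x w (≢-flip n)) e)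
  ...   | q , r with c ≟ d
  ...     | yes refl = ≤-trans (≤-reflexive (trans (inc-same c m) (trans (cong suc (sym hc)) (sym (inc-same c h))))) (proj₁ (fill-region (inc c h) w e)) , r
  ...     | no k = ≤-trans (≤-reflexive (inc-diff {c} {d} m k)) q , r
  from′ : ∀ i d → inc c m d ≤ i → i < a d → ∃ λ y → fill (inc c h) w i d ≡ just y
  from′ i d q r with from i d (≤-trans (inc-≤ c m d) q) r
  ... | y , e with at? (h c) c i d
  ...   | here = ⊥-elim (1+n≰n (≤-trans (≤-reflexive (trans (cong suc hc) (sym (inc-same c m)))) q))
  ...   | other n = y , trans (sym (fill-miss h c x w (≢-flip n))) e
  result : Up (inc c m) (contents w) × (∀ i d → fill (inc c m) w i d ≡ fill (inc c h) w i d) × Agree (contents w) (inc c h) (inc c m) × inc c m ⊕ contents w ≗ a →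
    Up m (c ∷ contents w) × (∀ i d → fill m ((c , x) ∷ w) i d ≡ fill h ((c , x) ∷ w) i d) × Agree (c ∷ contents w) h m × inc c m ⊕ contents w ≗ a
  result (v , f , ag , e) = (pm ▸ v) , same , hc ∷ Agree-uninc c ag , e
    where
    same : ∀ i d → fill m ((c , x) ∷ w) i d ≡ fill h ((c , x) ∷ w) i d
    same i d rewrite hc | f i d = refl

record JWord (b : ℤ → Bool) (w : List Entry) (z : List ℕ) (R : Filling) : Set where
  field
    word  : List Entry
    cont  : contents word ≡ lower z (reverse (contents w))
    value : vals word ≡ vals (starW w)
    std   : Standard (starB b) word
    cells : Cells R (fill ∅ word)

-- The relation `JRel` admits every skew shape with the right boxes and every order of slides. The
-- starred word is re-based on the inner shape in question by `transport`, and `lower-independent`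
-- replaces the slides by those along `z`.
J-word : ∀ {b} w {h L F R} z → Cells F (fill h w) → Up h (contents w) → (h ⊕ contents w) L ≡ 0 → Standard b w →
  JRel L F R → Up ∅ (reverse z ++ reverse (contents w)) → ∅ ⊕ reverse z ≗ compl L (h ⊕ contents w) → JWord b w z R
J-word {b} w {h} {L} {F} {R} z C u zero-L p (α , μ , sα , sμ , sub , sh , rect) uz ez = result
  (transport (starW w) {K} {prof μ} {prof α} uK (prof-Prof sμ) (prof-Prof sα) (⊑⇒≤ sμ sα sub) to from)
  where
  K = compl L (h ⊕ contents w)
  C* : Cells (star L F) (fill K (starW w))
  C* = star-Cells w u zero-L C
  uK : Up K (contents (starW w))
  uK = subst (Up K) (sym (contents-starW w)) (proj₁ (Up-reverse {L = L} u zero-L))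
  to : ∀ i d x → fill K (starW w) i d ≡ just x → prof μ d ≤ i × i < prof α d
  to i d x e with proj₁ (sh i (i + d)) (x , trans (cell C* i d) e)
  ... | q , r = ≮⇒≥ (λ l → r (prof⇒inS sμ i d l)) , inS-+ sα i d q
  from : ∀ i d → prof μ d ≤ i → i < prof α d → ∃ λ x → fill K (starW w) i d ≡ just x
  from i d q r with proj₂ (sh i (i + d)) (prof⇒inS sα i d r) (λ l → 1+n≰n (≤-trans (inS-+ sμ i d l) q))
  ... | x , e = x , trans (sym (cell C* i d)) e
  result : Up (prof μ) (contents (starW w)) × (∀ i d → fill (prof μ) (starW w) i d ≡ fill K (starW w) i d) ×
    Agree (contents (starW w)) K (prof μ) × prof μ ⊕ contents (starW w) ≗ prof α → JWord b w z R
  result (v , f , ag , _) = record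
    { word = w′
    ; cont = trans cont (trans (lower-independent (length X + length z) X z (contents (starW w)) ≤-refl valid
        (subst (λ c → Up ∅ (reverse z ++ c)) (sym (contents-starW w)) uz)
        (Agree-cong (≗-sym inner) (≗-sym ez) (All.map sym ag)))
        (cong (lower z) (contents-starW w)))
    ; value = value ; std = std ; cells = cells }
    where
    rectified : Rectified (starB b) (prof μ) (starW w) R
    rectified = rect-fill rect sμ (starW w) v (Path-star {w = w} p) (Cells-cong C* (λ i d → sym (f i d)))
    open Rectified rectified

-- Existence of bits for a sorted word

setBit : (ℤ → Bool) → ℤ → Bool → ℤ → Bool
setBit b v t z = if does (z ℤ.≟ v) then t else b z

setBit-same : ∀ b v t → setBit b v t v ≡ t
setBit-same b v t with v ℤ.≟ v
... | yes _ = refl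
... | no n = ⊥-elim (n refl)

setBit-other : ∀ b {v z} t → z ≢ v → setBit b v t z ≡ b z
setBit-other b {v} {z} t n with z ℤ.≟ v
... | yes e = ⊥-elim (n e)
... | no _ = refl

Same : (b b′ : ℤ → Bool) → Maybe Entry → Set
Same b b′ nothing = ⊤
Same b b′ (just e) = b (val (proj₂ e)) ≡ b′ (val (proj₂ e))

Link-cong : ∀ {b b′ m m′} → Same b b′ m → Same b b′ m′ → Link b m m′ → Link b′ m m′
Link-cong s t empty = empty
Link-cong s t (start f) = start λ e → trans (sym t) (f e)
Link-cong s t (stop f) = stop λ e → trans (sym s) (f e)
Link-cong s t (rise r f g) = rise r (λ e → trans (sym s) (f e)) (λ e → trans (sym t) (g e))
Link-cong s t (pp l) = pp l
Link-cong s t (uu l) = uu l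
Link-cong s t (pu< l e) = pu< l (trans (sym s) e)
Link-cong s t (pu> l e) = pu> l (trans (sym s) e)

Path-cong : ∀ {b b′ m w m′} → Same b b′ m → All (λ e → Same b b′ (just e)) w → Same b b′ m′ → Path b m w m′ → Path b′ m w m′
Path-cong s [] t ([] l) = [] (Link-cong s t l)
Path-cong s (a ∷ as) t (l ∷ p) = Link-cong s a l ∷ Path-cong a as t p

≺-val : ∀ {e f} → e ≺ f → val (proj₂ e) ℤ.≤ val (proj₂ f)
≺-val (by-val p) = ℤₚ.<⇒≤ p
≺-val (pp _) = ℤₚ.≤-refl
≺-val (uu _) = ℤₚ.≤-refl
≺-val pu = ℤₚ.≤-refl

above-same : ∀ b {v t y w} → v ℤ.< val y → ∀ {d} → All ((d , y) ≺_) w → All (λ e → Same b (setBit b v t) (just e)) w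
above-same b r [] = []
above-same b {v} {t} r (q ∷ qs) = sym (setBit-other b t (λ e → ℤₚ.<-irrefl (sym e) (ℤₚ.<-≤-trans r (≺-val q)))) ∷ above-same b r qs

-- From an unprimed `v` onwards no link consults the bit of `v`, so it may be reset. This happens
-- when a primed `v` of smaller content is put in front.
raise-bit : ∀ {b d v w} → Path b (just (d , mk v false)) w nothing → Path (setBit b v true) (just (d , mk v false)) w nothing
raise-bit ([] _) = [] (stop λ ())
raise-bit {b} (rise {y = y} r f g ∷ p) =
  rise r (λ ()) (λ e → trans (setBit-other b true (λ q → ℤₚ.<-irrefl (sym q) r)) (g e))
  ∷ Path-cong (sym (setBit-other b true (λ q → ℤₚ.<-irrefl (sym q) r))) (above-same b r (Path⇒≺ p)) _ p
raise-bit (uu l ∷ p) = uu l ∷ raise-bit p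

data Sorted : List Entry → Set where
  []  : Sorted []
  _∷_ : ∀ {e w} → All (e ≺_) w → Sorted w → Sorted (e ∷ w)

extend-bits : ∀ {b c d x y w} → c ≢ d → (c , x) ≺ (d , y) → Link b nothing (just (d , y)) → Path b (just (d , y)) w nothing →
  ∃ λ b → Standard b ((c , x) ∷ (d , y) ∷ w)
extend-bits {b} {x = x} n (by-val r) (start g) p = setBit b (val x) (primed x) ,
  start (λ e → trans (setBit-same b (val x) (primed x)) e) ∷
  rise r (λ e → trans (setBit-same b (val x) (primed x)) e) (λ e → trans (setBit-other b (primed x) (λ q → ℤₚ.<-irrefl (sym q) r)) (g e)) ∷
  Path-cong (sym (setBit-other b (primed x) (λ q → ℤₚ.<-irrefl (sym q) r))) (above-same b r (Path⇒≺ p)) _ p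
extend-bits {b} n (pp l) s p = b , start (λ ()) ∷ pp l ∷ p
extend-bits {b} n (uu l) (start g) p = b , start g ∷ uu l ∷ p
extend-bits {b} {c} {d} n (pu {v = v}) (start g) p with <-cmp c d
... | tri≈ _ e _ = ⊥-elim (n e)
... | tri> _ _ l = b , start (λ ()) ∷ pu> l (g refl) ∷ p
... | tri< l _ _ = setBit b v true , start (λ ()) ∷ pu< l (setBit-same b v true) ∷ raise-bit p

sorted-bits : ∀ {g w} → Sorted w → Up g (contents w) → ∃ λ b → Standard b w
sorted-bits [] u = (λ _ → false) , [] empty
sorted-bits {w = (c , x) ∷ []} (_ ∷ s) u = (λ _ → primed x) , start (λ e → e) ∷ [] (stop λ e → e)
sorted-bits {w = (c , x) ∷ (d , y) ∷ w} ((q ∷ _) ∷ s) u with sorted-bits s (Up-tail u)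
... | b , l ∷ p = extend-bits (Up-≢ u) q l p

-- Standardization of a shifted tableau

_≺?_ : ∀ e f → Dec (e ≺ f)
(c , mk v f) ≺? (d , mk v′ f′) with ℤₚ.<-cmp v v′
... | tri< r _ _ = yes (by-val r)
... | tri> ¬r ¬e _ = no λ { (by-val r) → ¬r r ; (pp _) → ¬e refl ; (uu _) → ¬e refl ; pu → ¬e refl }
(c , mk v true) ≺? (d , mk v true) | tri≈ ¬r refl _ with d <? c
... | yes q = yes (pp q)
... | no q = no λ { (by-val r) → ¬r r ; (pp r) → q r }
(c , mk v true) ≺? (d , mk v false) | tri≈ ¬r refl _ = yes pu
(c , mk v false) ≺? (d , mk v true) | tri≈ ¬r refl _ = no λ { (by-val r) → ¬r r }
(c , mk v false) ≺? (d , mk v false) | tri≈ ¬r refl _ with c <? d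
... | yes q = yes (uu q)
... | no q = no λ { (by-val r) → ¬r r ; (uu r) → q r }

≺-total : ∀ e f → ¬ (f ≺ e) → e ≢ f → e ≺ f
≺-total (c , mk v f) (d , mk v′ f′) n ne with ℤₚ.<-cmp v v′
... | tri< r _ _ = by-val r
... | tri> _ _ r = ⊥-elim (n (by-val r))
≺-total (c , mk v true) (d , mk v false) n ne | tri≈ _ refl _ = pu
≺-total (c , mk v false) (d , mk v true) n ne | tri≈ _ refl _ = ⊥-elim (n pu)
≺-total (c , mk v true) (d , mk v true) n ne | tri≈ _ refl _ with <-cmp c d
... | tri< q _ _ = ⊥-elim (n (pp q))
... | tri≈ _ refl _ = ⊥-elim (ne refl)
... | tri> _ _ q = pp q
≺-total (c , mk v false) (d , mk v false) n ne | tri≈ _ refl _ with <-cmp c d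
... | tri< q _ _ = uu q
... | tri≈ _ refl _ = ⊥-elim (ne refl)
... | tri> _ _ q = ⊥-elim (n (uu q))

rank-< : ∀ x y → val x ℤ.< val y → rank x ℤ.< rank y
rank-< x y r = ℤₚ.≤-<-trans (upper-rank x) (ℤₚ.<-≤-trans gap (lower-rank y))
  where
  a = ℤ.+ 2 ℤ.* val x
  b = ℤ.+ 2 ℤ.* val y
  upper-rank : ∀ x → rank x ℤ.≤ ℤ.+ 2 ℤ.* val x
  upper-rank (mk v true) = ℤₚ.i-j≤i _ (ℤ.+ 1)
  upper-rank (mk v false) = ℤₚ.≤-refl
  lower-rank : ∀ y → ℤ.+ 2 ℤ.* val y ℤ.- ℤ.+ 1 ℤ.≤ rank y
  lower-rank (mk v true) = ℤₚ.≤-refl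
  lower-rank (mk v false) = ℤₚ.i-j≤i _ (ℤ.+ 1)
  eq : ∀ z → ℤ.+ 2 ℤ.* (ℤ.+ 1 ℤ.+ z) ℤ.- ℤ.+ 1 ≡ ℤ.+ 1 ℤ.+ ℤ.+ 2 ℤ.* z
  eq = solve-∀
  gap : a ℤ.< b ℤ.- ℤ.+ 1
  gap = ℤₚ.suc[i]≤j⇒i<j (subst (ℤ._≤ b ℤ.- ℤ.+ 1) (eq (val x))
    (ℤₚ.+-monoˡ-≤ (ℤ.- ℤ.+ 1) (ℤₚ.*-monoˡ-≤-nonNeg (ℤ.+ 2) (ℤₚ.i<j⇒suc[i]≤j r))))

data Below : Letter → Letter → Set where
  less-val : ∀ {x y} → val x ℤ.< val y → Below x y
  prime-first : ∀ {v f} → Below (mk v true) (mk v f)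
  both-plain : ∀ {v} → Below (mk v false) (mk v false)

≤L⇒Below : ∀ x y → x ≤L y → Below x y
≤L⇒Below x@(mk v f) y@(mk v′ f′) r with ℤₚ.<-cmp v v′
... | tri< q _ _ = less-val q
... | tri> _ _ q = ⊥-elim (ℤₚ.<-irrefl refl (ℤₚ.<-≤-trans (rank-< y x q) r))
≤L⇒Below (mk v true) (mk v f) r | tri≈ _ refl _ = prime-first
≤L⇒Below (mk v false) (mk v false) r | tri≈ _ refl _ = both-plain
≤L⇒Below (mk v false) (mk v true) r | tri≈ _ refl _ = ⊥-elim (ℤₚ.<-irrefl refl (ℤₚ.<-≤-trans drop r))
  where
  drop : ℤ.+ 2 ℤ.* v ℤ.- ℤ.+ 1 ℤ.< ℤ.+ 2 ℤ.* v
  drop = ℤₚ.suc[i]≤j⇒i<j (ℤₚ.≤-reflexive (eq (ℤ.+ 2 ℤ.* v)))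
    where
    eq : ∀ z → ℤ.+ 1 ℤ.+ (z ℤ.- ℤ.+ 1) ≡ z
    eq = solve-∀

row-≺ : ∀ {c d x y} → c < d → (x ≡ y → primed x ≡ false) → x ≤L y → (c , x) ≺ (d , y)
row-≺ {x = x} {y} q n r with ≤L⇒Below x y r
... | less-val p = by-val p
... | both-plain = uu q
... | prime-first {f = false} = pu
... | prime-first {f = true} with n refl
...   | ()

col-≺ : ∀ {c d x y} → d < c → (x ≡ y → primed x ≡ true) → x ≤L y → (c , x) ≺ (d , y)
col-≺ {x = x} {y} q n r with ≤L⇒Below x y r
... | less-val p = by-val p
... | prime-first {f = false} = pu
... | prime-first {f = true} = pp q
... | both-plain with n refl
...   | ()

Below-antisym : ∀ {x y} → Below x y → Below y x → x ≡ y
Below-antisym (less-val p) q = ⊥-elim (ℤₚ.<-irrefl refl (ℤₚ.<-≤-trans p (below-val q)))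
  where
  below-val : ∀ {x y} → Below x y → val x ℤ.≤ val y
  below-val (less-val p) = ℤₚ.<⇒≤ p
  below-val prime-first = ℤₚ.≤-refl
  below-val both-plain = ℤₚ.≤-refl
Below-antisym prime-first (less-val q) = ⊥-elim (ℤₚ.<-irrefl refl q)
Below-antisym prime-first prime-first = refl
Below-antisym both-plain _ = refl

≺-irrefl : ∀ {e f} → e ≡ f → ¬ (e ≺ f)
≺-irrefl refl (by-val p) = ℤₚ.<-irrefl refl p
≺-irrefl refl (pp p) = <-irrefl refl p
≺-irrefl refl (uu p) = <-irrefl refl p

sumTo-mono : ∀ N {h g} → (∀ d → h d ≤ g d) → sumTo N h ≤ sumTo N g
sumTo-mono zero f = z≤n
sumTo-mono (suc N) f = +-mono-≤ (f N) (sumTo-mono N f)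

outside-inc : ∀ {d c i} {h : Shape} → (h d ≢ i) ⊎ (d ≢ c) → h c ≤ i → inc d h c ≤ i
outside-inc {d} {c} {h = h} o q with d ≟ c
... | no k = ≤-trans (≤-reflexive (inc-diff {d} {c} h k)) q
outside-inc {h = h} (inj₁ k) q | yes refl = ≤-trans (≤-reflexive (inc-same _ h)) (≤∧≢⇒< q k)
outside-inc (inj₂ k) q | yes refl = ⊥-elim (k refl)

module Standardize {lam nu T} (sν : IsStrict nu) (sλ : IsStrict lam) (sub : lam ⊑ nu) (syt : SYT nu lam T) where
  open SYT syt

  private
    n m : Shape
    n = prof nu
    m = prof lam
    L = head0 nu
    pn : Prof n
    pn = prof-Prof sν
    n-L : n L ≡ 0
    n-L = prof-head0 sν

  region : ∀ i d x → T i (i + d) ≡ just x → m d ≤ i × i < n d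
  region i d x e with proj₁ (shape i (i + d)) (x , e)
  ... | p , q = ≮⇒≥ (λ r → q (prof⇒inS sλ i d r)) , inS-+ sν i d p

  box : ∀ i d → m d ≤ i → i < n d → ∃ λ x → T i (i + d) ≡ just x
  box i d p q = proj₂ (shape i (i + d)) (prof⇒inS sν i d q) (λ r → 1+n≰n (≤-trans (inS-+ sλ i d r) p))

  record Remaining (h : Shape) (i d : ℕ) (x : Letter) : Set where
    field
      outside : h d ≤ i
      inside  : i < n d
      entry   : T i (i + d) ≡ just x
  open Remaining

  allCells : List (ℕ × ℕ)
  allCells = cartesianProduct (upTo L) (upTo L)

  allCells-∈ : ∀ {h i d x} → Remaining h i d x → (i , d) ∈ allCells
  allCells-∈ {i = i} {d} r = ∈-cartesianProduct⁺
    (∈-upTo⁺ (≤-trans (inside r) (≤-trans (Prof-bound pn n-L d) (m∸n≤m L d))))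
    (∈-upTo⁺ (≰⇒> λ q → n≮0 (≤-trans (inside r) (≤-trans (Prof-≤ pn q) (≤-reflexive n-L)))))

  Minimal : Shape → List (ℕ × ℕ) → Set
  Minimal h l = (∀ i d → (i , d) ∈ l → ∀ x → ¬ Remaining h i d x) ⊎
    (∃ λ i → ∃ λ d → ∃ λ x → Remaining h i d x × (∀ i′ d′ → (i′ , d′) ∈ l → ∀ x′ → Remaining h i′ d′ x′ → ¬ ((d′ , x′) ≺ (d , x))))

  minimal : ∀ h → (∀ d → m d ≤ h d) → ∀ l → Minimal h l
  minimal h mh [] = inj₁ λ _ _ ()
  minimal h mh ((i , d) ∷ l) with minimal h mh l | h d ≤? i | i <? n d
  ... | inj₁ none | no a | _ = inj₁ λ { _ _ (hereₐ refl) x r → a (outside r) ; i′ d′ (thereₐ p) → none i′ d′ p }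
  ... | inj₁ none | yes _ | no a = inj₁ λ { _ _ (hereₐ refl) x r → a (inside r) ; i′ d′ (thereₐ p) → none i′ d′ p }
  ... | inj₂ (i₀ , d₀ , x₀ , r₀ , f) | no a | _ = inj₂ (i₀ , d₀ , x₀ , r₀ ,
        λ { _ _ (hereₐ refl) x r → ⊥-elim (a (outside r)) ; i′ d′ (thereₐ p) → f i′ d′ p })
  ... | inj₂ (i₀ , d₀ , x₀ , r₀ , f) | yes _ | no a = inj₂ (i₀ , d₀ , x₀ , r₀ ,
        λ { _ _ (hereₐ refl) x r → ⊥-elim (a (inside r)) ; i′ d′ (thereₐ p) → f i′ d′ p })
  ... | inj₁ none | yes a | yes b with box i d (≤-trans (mh d) a) b
  ...   | x , e = inj₂ (i , d , x , record { outside = a ; inside = b ; entry = e } ,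
        λ { _ _ (hereₐ refl) y r s → ≺-irrefl (cong (d ,_) (just-injective (trans (sym (entry r)) e))) s
          ; i′ d′ (thereₐ p) y r → ⊥-elim (none i′ d′ p y r) })
  minimal h mh ((i , d) ∷ l) | inj₂ (i₀ , d₀ , x₀ , r₀ , f) | yes a | yes b with box i d (≤-trans (mh d) a) b
  ... | x , e with (d , x) ≺? (d₀ , x₀)
  ...   | yes s = inj₂ (i , d , x , record { outside = a ; inside = b ; entry = e } ,
        λ { _ _ (hereₐ refl) y r t → ≺-irrefl (cong (d ,_) (just-injective (trans (sym (entry r)) e))) t
          ; i′ d′ (thereₐ p) y r t → f i′ d′ p y r (≺-trans t s) })
  ...   | no ns = inj₂ (i₀ , d₀ , x₀ , r₀ ,
        λ { _ _ (hereₐ refl) y r t → ns (subst (λ z → (d , z) ≺ (d₀ , x₀)) (just-injective (trans (sym (entry r)) e)) t)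
          ; i′ d′ (thereₐ p) → f i′ d′ p })

  -- The box in the row of the upper and the column of the lower one would hold the same letter by
  -- monotonicity. That letter would then repeat in a row and in a column, which no letter may do,
  -- primed or not.
  antidiagonal : ∀ {h i i′ c x} → Prof h → (∀ d → m d ≤ h d) → Remaining h i c x → Remaining h i′ c x → ¬ i < i′
  antidiagonal {h} {i} {i′} {c} {x} p mh r r′ i<i′ = contra
    where
    t = i′ ∸ i
    col = i′ + c
    col≡ : i + (t + c) ≡ col
    col≡ = trans (sym (+-assoc i t c)) (cong (_+ c) (m+[n∸m]≡n (<⇒≤ i<i′)))
    in′ : i < n (t + c)
    in′ = +-cancelˡ-< t i (n (t + c)) (≤-trans (≤-reflexive (cong suc (m∸n+n≡m (<⇒≤ i<i′)))) (≤-trans (inside r′) (Prof-slope pn t c)))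
    corner = box i (t + c) (≤-trans (mh (t + c)) (≤-trans (Prof-antitone p t c) (outside r))) in′
    y = proj₁ corner
    ey : T i col ≡ just y
    ey = trans (cong (T i) (sym col≡)) (proj₂ corner)
    x≡y : x ≡ y
    x≡y = Below-antisym (≤L⇒Below x y (rowWeak i (i + c) col x y (+-monoˡ-< c i<i′) (entry r) ey))
                        (≤L⇒Below y x (colWeak i i′ col y x i<i′ ey (entry r′)))
    ex : T i col ≡ just x
    ex = trans ey (cong just (sym x≡y))
    contra : ⊥
    contra with trans (sym (rowPrim i (i + c) col x (+-monoˡ-< c i<i′) (entry r) ex)) (colUnpr i i′ col x i<i′ ex (entry r′))
    ... | ()

  record Listing (h : Shape) : Set where
    field
      word   : List Entry
      valid  : Up h (contents word)
      reach  : h ⊕ contents word ≗ n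
      agrees : ∀ i d → h d ≤ i → fill h word i d ≡ T i (i + d)
      sorted : Sorted word
      boxes  : All (λ e → ∃ λ i → Remaining h i (proj₁ e) (proj₂ e)) word

  -- A least remaining box is addable to the shape listed so far: its north and west neighbours
  -- precede it in the order, so they are no longer among the remaining boxes.
  module Least {h i d x} (ph : Prof h) (mh : ∀ d → m d ≤ h d) (hn : ∀ d → h d ≤ n d) (r : Remaining h i d x)
    (least : ∀ {i′ d′ x′} → Remaining h i′ d′ x′ → ¬ ((d′ , x′) ≺ (d , x))) where

    north-bound : i ≤ h (suc d)
    north-bound = north i r
      where
      north : ∀ i → Remaining h i d x → i ≤ h (suc d)
      north zero r = z≤n
      north (suc i₀) r with h (suc d) ≤? i₀
      ... | no q = ≰⇒> q
      ... | yes q with box i₀ (suc d) (≤-trans (mh (suc d)) q) (≤-pred (≤-trans (inside r) (Prof-slope pn 1 d)))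
      ...   | y , e = ⊥-elim (least (record { outside = q ; inside = ≤-pred (≤-trans (inside r) (Prof-slope pn 1 d)) ; entry = e })
                (col-≺ ≤-refl (λ { refl → colUnpr i₀ (suc i₀) (suc i₀ + d) y ≤-refl e′ (entry r) }) (colWeak i₀ (suc i₀) (suc i₀ + d) y x ≤-refl e′ (entry r))))
        where
        e′ : T i₀ (suc i₀ + d) ≡ just y
        e′ = trans (cong (T i₀) (sym (+-suc i₀ d))) e

    i≡h : i ≡ h d
    i≡h = ≤-antisym (≤-trans north-bound (Prof-≤ ph (n≤1+n d))) (outside r)

    east≡ : h d ≡ h (suc d)
    east≡ = ≤-antisym (≤-trans (≤-reflexive (sym i≡h)) north-bound) (Prof-≤ ph (n≤1+n d))

    south≡ : ∀ {b} → d ≡ suc b → h b ≡ suc (h d)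
    south≡ {b} refl with ph b
    ... | inj₂ e = e
    ... | inj₁ e with box i b (≤-trans (mh b) out) inn
      where
      out : h b ≤ i
      out = ≤-reflexive (trans e (sym i≡h))
      inn : i < n b
      inn = ≤-trans (inside r) (Prof-≤ pn (n≤1+n b))
    ...   | y , e₁ = ⊥-elim (least (record { outside = ≤-reflexive (trans e (sym i≡h)) ; inside = ≤-trans (inside r) (Prof-≤ pn (n≤1+n b)) ; entry = e₁ })
        (row-≺ ≤-refl (λ { refl → rowPrim i (i + b) (i + suc b) y (+-monoʳ-< i ≤-refl) e₁ (entry r) }) (rowWeak i (i + b) (i + suc b) y x (+-monoʳ-< i ≤-refl) e₁ (entry r))))

    ph′ : Prof (inc d h)
    ph′ = addable-Prof ph east≡ south≡

    mh′ : ∀ e → m e ≤ inc d h e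
    mh′ e = ≤-trans (mh e) (inc-≤ d h e)

    hn′ : ∀ e → inc d h e ≤ n e
    hn′ e with d ≟ e
    ... | yes refl = ≤-trans (≤-reflexive (trans (inc-same d h) (cong suc (sym i≡h)))) (inside r)
    ... | no q = ≤-trans (≤-reflexive (inc-diff {d} {e} h q)) (hn e)

    weaken : ∀ {i c y} → Remaining (inc d h) i c y → Remaining h i c y
    weaken {c = c} r = record { outside = ≤-trans (inc-≤ d h c) (outside r) ; inside = inside r ; entry = entry r }

    later : ∀ {i′ c y} → Remaining (inc d h) i′ c y → (d , x) ≺ (c , y)
    later {i′} {c} {y} r′ = ≺-total (d , x) (c , y) (least (weaken r′)) λ { refl →
      antidiagonal ph mh r (weaken r′) (≤-trans (≤-reflexive (trans (cong suc i≡h) (sym (inc-same d h)))) (outside r′)) }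

    listing : Listing (inc d h) → Listing h
    listing l = record
      { word = (d , x) ∷ word ; valid = ph ▸ valid ; reach = reach ; agrees = agree
      ; sorted = All.map (λ { (_ , q) → later q }) boxes ∷ sorted
      ; boxes = (i , r) ∷ All.map (λ { (i , q) → i , weaken q }) boxes }
      where
      open Listing l
      agree : ∀ i′ c → h c ≤ i′ → fill h ((d , x) ∷ word) i′ c ≡ T i′ (i′ + c)
      agree i′ c q with at? (h d) d i′ c
      ... | here = trans (fill-hit h d x word) (trans (sym (entry r)) (cong (λ k → T k (k + d)) i≡h))
      ... | other o = trans (fill-miss h d x word (≢-flip o)) (agrees i′ c (outside-inc o q))

  -- The recursion is on `k`, which bounds the number of boxes between `h` and the outer shape.
  list-boxes : ∀ k h → Prof h → (∀ d → m d ≤ h d) → (∀ d → h d ≤ n d) → sumTo L n ≤ k + sumTo L h → Listing h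
  list-boxes k h ph mh hn le with minimal h mh allCells
  ... | inj₁ none = record { word = [] ; valid = end ph ; reach = full ; agrees = λ i d q → sym (blank i d q) ; sorted = [] ; boxes = [] }
    where
    full : h ≗ n
    full d with m≤n⇒m<n∨m≡n (hn d)
    ... | inj₂ e = e
    ... | inj₁ q with box (h d) d (mh d) q
    ...   | x , e = ⊥-elim (none (h d) d (allCells-∈ r) x r)
      where
      r : Remaining h (h d) d x
      r = record { outside = ≤-refl ; inside = q ; entry = e }
    blank : ∀ i d → h d ≤ i → T i (i + d) ≡ nothing
    blank i d q with T i (i + d) in e
    ... | nothing = refl
    ... | just x = ⊥-elim (1+n≰n (≤-trans (proj₂ (region i d x e)) (≤-trans (≤-reflexive (sym (full d))) q)))
  ... | inj₂ (i , d , x , r , f) = continue k le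
    where
    open Least ph mh hn r (λ r′ → f _ _ (allCells-∈ r′) _ r′)
    d<L : d < L
    d<L = ≰⇒> λ q → n≮0 (≤-trans (inside r) (≤-trans (Prof-≤ pn q) (≤-reflexive n-L)))
    continue : ∀ k → sumTo L n ≤ k + sumTo L h → Listing h
    continue zero le = ⊥-elim (1+n≰n (≤-trans (≤-reflexive (sym (sumTo-inc L h d<L))) (≤-trans (sumTo-mono L hn′) le)))
    continue (suc k) le = listing (list-boxes k (inc d h) ph′ mh′ hn′
      (≤-trans le (≤-reflexive (trans (sym (+-suc k _)) (cong (k +_) (sym (sumTo-inc L h d<L)))))))

  record Standardization : Set where
    field
      word  : List Entry
      bits  : ℤ → Bool
      valid : Up m (contents word)
      reach : m ⊕ contents word ≗ n
      cells : Cells T (fill m word)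
      std   : Standard bits word
      inTab : All (λ e → ∃ λ i → ∃ λ j → T i j ≡ just (proj₂ e)) word

  standardization : Standardization
  standardization = record
    { word = word ; bits = proj₁ bits ; valid = valid ; reach = reach ; std = proj₂ bits
    ; cells = record { cell = inner ; tri = below-diagonal }
    ; inTab = All.map (λ { {c , x} (i , r) → i , i + c , entry r }) boxes }
    where
    open Listing (list-boxes (sumTo L n) m (prof-Prof sλ) (λ _ → ≤-refl) (⊑⇒≤ sλ sν sub) (m≤m+n _ _))
    bits = sorted-bits sorted valid
    inner : ∀ i d → T i (i + d) ≡ fill m word i d
    inner i d with m d ≤? i
    ... | yes q = sym (agrees i d q)
    ... | no q with T i (i + d) in e
    ...   | nothing = sym (fill-low m word (≰⇒> q))
    ...   | just x = ⊥-elim (q (proj₁ (region i d x e)))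
    below-diagonal : ∀ i j → j < i → T i j ≡ nothing
    below-diagonal i j q with T i j in e
    ... | nothing = refl
    ... | just x with inS⇒prof sν i j (proj₁ (proj₁ (shape i j) (x , e)))
    ...   | d , refl , _ = ⊥-elim (1+n≰n (≤-trans q (m≤m+n i d)))

-- Words with the boxes of two tableaux

-- Boxes of the two tableaux being switched, in one chain; α-entries (tag true) are
-- the a-boxes and β-entries the b-boxes.
TEntry : Set
TEntry = ℕ × (Bool × Letter)

α β : Entry → TEntry
α (c , x) = c , true , x
β (c , x) = c , false , x

pick : Bool → Maybe (Bool × Letter) → Maybe Letter
pick t nothing = nothing
pick true (just (true , x)) = just x
pick true (just (false , x)) = nothing
pick false (just (true , x)) = nothing
pick false (just (false , x)) = just x

tag : Bool → Letter → Bool × Letter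
tag t x = t , x

view : Bool → Shape → List TEntry → Grid
view t h M i d = pick t (fill h M i d)

contents-map : ∀ {f : Entry → TEntry} → (∀ e → proj₁ (f e) ≡ proj₁ e) → ∀ w → contents (map f w) ≡ contents w
contents-map g [] = refl
contents-map g (e ∷ w) = cong₂ _∷_ (g e) (contents-map g w)

contents-α : ∀ w → contents (map α w) ≡ contents w
contents-α = contents-map λ _ → refl

contents-β : ∀ w → contents (map β w) ≡ contents w
contents-β = contents-map λ _ → refl

contents-++ : ∀ {A : Set} (u v : List (ℕ × A)) → contents (u ++ v) ≡ contents u ++ contents v
contents-++ u v = map-++ proj₁ u v

fill-α : ∀ h w i d → fill h (map α w) i d ≡ Maybe.map (tag true) (fill h w i d)
fill-α h [] i d = refl
fill-α h ((c , x) ∷ w) i d with (i ≡ᵇ h c) ∧ (c ≡ᵇ d)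
... | true = refl
... | false = fill-α (inc c h) w i d

fill-β : ∀ h w i d → fill h (map β w) i d ≡ Maybe.map (tag false) (fill h w i d)
fill-β h [] i d = refl
fill-β h ((c , x) ∷ w) i d with (i ≡ᵇ h c) ∧ (c ≡ᵇ d)
... | true = refl
... | false = fill-β (inc c h) w i d

first-β : ∀ c B D → pick false (first c (map β B ++ map α D)) ≡ first c B
first-β c [] [] = refl
first-β c [] ((d , x) ∷ D) with d ≡ᵇ c
... | true = refl
... | false = first-β c [] D
first-β c ((d , x) ∷ B) D with d ≡ᵇ c
... | true = refl
... | false = first-β c B D

<∣>-just : ∀ {A : Set} (x y : Maybe A) {z} → (x <∣> y) ≡ just z → (x ≡ just z) ⊎ (x ≡ nothing × y ≡ just z)
<∣>-just (just x) y e = inj₁ e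
<∣>-just nothing y e = inj₂ (refl , e)

pick-just : ∀ t m {x} → pick t m ≡ just x → m ≡ just (t , x)
pick-just true (just (true , x)) refl = refl
pick-just false (just (false , x)) refl = refl

beyond : ∀ {A : Set} h (P : List (ℕ × A)) s X Q {i d} → inc s (h ⊕ contents P) d ≤ i →
  fill h (P ++ (s , X) ∷ Q) i d ≡ fill (inc s (h ⊕ contents P)) Q i d
beyond h P s X Q {i} {d} q = trans (fill-++ h P ((s , X) ∷ Q) i d)
  (trans (cong (_<∣> fill (h ⊕ contents P) ((s , X) ∷ Q) i d) (fill-high h P (≤-trans (inc-≤ s (h ⊕ contents P) d) q)))
    (fill-miss (h ⊕ contents P) s X Q (miss q)))
  where
  miss : inc s (h ⊕ contents P) d ≤ i → (i ≢ (h ⊕ contents P) s) ⊎ (s ≢ d)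
  miss q with s ≟ d
  ... | no n = inj₂ n
  ... | yes refl = inj₁ λ { refl → 1+n≰n (≤-trans (≤-reflexive (sym (inc-same s (h ⊕ contents P)))) q) }

module Neighbours {G h P s X B D} (C : Cells G (view false h (P ++ (s , X) ∷ (map β B ++ map α D))))
  (u : Up (h ⊕ contents P) (s ∷ contents (map β B ++ map α D))) where

  private
    g = h ⊕ contents P
    p = g s
    Q = map β B ++ map α D
    p₀ : Prof g
    p₀ = Up-Prof u
    p₁ : Prof (inc s g)
    p₁ = Up-Prof (Up-tail u)

  b-cell : ∀ i d → i ≡ inc s g d → G i (i + d) ≡ first d B
  b-cell i d e = trans (cell C i d) (trans (cong (pick false) (trans (beyond h P s X Q (≤-reflexive (sym e)))
    (trans (cong (λ k → fill (inc s g) Q k d) e) (fill-first (inc s g) d Q)))) (first-β d B D))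

  b-east : G p (suc (p + s)) ≡ first (suc s) B
  b-east = trans (cong (G p) (sym (+-suc p s))) (b-cell p (suc s)
    (trans (addable-east p₀ p₁) (sym (inc-diff {s} {suc s} g (λ e → 1+n≢n (sym e))))))

  b-south : ∀ {t} → s ≡ suc t → G (suc p) (p + s) ≡ first t B
  b-south {t} refl = trans (cong (G (suc p)) (+-suc p t)) (b-cell (suc p) t
    (trans (sym (addable-south p₀ p₁)) (sym (inc-diff {suc t} {t} g 1+n≢n))))

  b-south-empty : s ≡ 0 → G (suc p) (p + s) ≡ nothing
  b-south-empty refl = tri C (suc p) (p + 0) (s≤s (≤-reflexive (+-identityʳ p)))

  b-diagonal : s ≡ 0 → G (suc p) (suc p) ≡ first 0 B
  b-diagonal refl = trans (cong (G (suc p)) (sym (+-identityʳ (suc p)))) (b-cell (suc p) 0 refl)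

module _ {A : Set} (h : Shape) (P : List (ℕ × A)) (s : ℕ) (X : A) (c : ℕ) (Y : A) (Q : List (ℕ × A)) where
  private
    g = h ⊕ contents P

  two-first : fill h (P ++ (s , X) ∷ (c , Y) ∷ Q) (g s) s ≡ just X
  two-first = trans (fill-++ h P ((s , X) ∷ (c , Y) ∷ Q) (g s) s)
    (trans (cong (_<∣> fill g ((s , X) ∷ (c , Y) ∷ Q) (g s) s) (fill-high h P ≤-refl)) (fill-hit g s X ((c , Y) ∷ Q)))

  two-second : fill h (P ++ (s , X) ∷ (c , Y) ∷ Q) (inc s g c) c ≡ just Y
  two-second = trans (beyond h P s X ((c , Y) ∷ Q) ≤-refl) (fill-hit (inc s g) c Y Q)

  two-other : ∀ {i d} → (g s ≢ i) ⊎ (s ≢ d) → (inc s g c ≢ i) ⊎ (c ≢ d) →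
    fill h (P ++ (s , X) ∷ (c , Y) ∷ Q) i d ≡ (fill h P i d <∣> fill (inc c (inc s g)) Q i d)
  two-other {i} {d} m n = trans (fill-++ h P ((s , X) ∷ (c , Y) ∷ Q) i d)
    (cong (fill h P i d <∣>_) (trans (fill-other g s X ((c , Y) ∷ Q) refl m) (fill-other (inc s g) c Y Q refl n)))

view-move : ∀ {A h P s c x y Q q} → s ≢ c → q ≡ inc s (h ⊕ contents P) c → Cells A (view true h (P ++ α (s , x) ∷ β (c , y) ∷ Q)) →
  Cells (swapA A ((h ⊕ contents P) s) ((h ⊕ contents P) s + s) q (q + c) x) (view true h (P ++ β (s , y) ∷ α (c , x) ∷ Q))
view-move {A} {h} {P} {s} {c} {x} {y} {Q} s≢c refl C =
  Cells-cong (upd-Cells {p = inc s g c} c (just x) refl (upd-Cells {p = g s} s nothing refl C)) cells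
  where
  g = h ⊕ contents P
  M = view true h (P ++ α (s , x) ∷ β (c , y) ∷ Q)
  cells : ∀ i d → updG (updG M (g s) s nothing) (inc s g c) c (just x) i d ≡ view true h (P ++ β (s , y) ∷ α (c , x) ∷ Q) i d
  cells i d with at? (inc s g c) c i d
  ... | here = trans (updG-hit (updG M (g s) s nothing) (inc s g c) c (just x))
        (sym (cong (pick true) (two-second h P s (false , y) c (true , x) Q)))
  ... | other n with at? (g s) s i d
  ...   | here = trans (updG-miss (updG M (g s) s nothing) (inc s g c) c (just x) n) (trans (updG-hit M (g s) s nothing)
          (sym (cong (pick true) (two-first h P s (false , y) c (true , x) Q))))
  ...   | other m = trans (updG-miss (updG M (g s) s nothing) (inc s g c) c (just x) n) (trans (updG-miss M (g s) s nothing m)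
          (cong (pick true) (trans (two-other h P s (true , x) c (false , y) Q m n) (sym (two-other h P s (false , y) c (true , x) Q m n)))))

view-move-b : ∀ {B h P s c x y Q q} → s ≢ c → q ≡ inc s (h ⊕ contents P) c → Cells B (view false h (P ++ α (s , x) ∷ β (c , y) ∷ Q)) →
  Cells (swapB B ((h ⊕ contents P) s) ((h ⊕ contents P) s + s) q (q + c) y) (view false h (P ++ β (s , y) ∷ α (c , x) ∷ Q))
view-move-b {B} {h} {P} {s} {c} {x} {y} {Q} s≢c refl C =
  Cells-cong (upd-Cells {p = g s} s (just y) refl (upd-Cells {p = inc s g c} c nothing refl C)) cells
  where
  g = h ⊕ contents P
  M = view false h (P ++ α (s , x) ∷ β (c , y) ∷ Q)
  cells : ∀ i d → updG (updG M (inc s g c) c nothing) (g s) s (just y) i d ≡ view false h (P ++ β (s , y) ∷ α (c , x) ∷ Q) i d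
  cells i d with at? (g s) s i d
  ... | here = trans (updG-hit (updG M (inc s g c) c nothing) (g s) s (just y))
          (sym (cong (pick false) (two-first h P s (false , y) c (true , x) Q)))
  ... | other m with at? (inc s g c) c i d
  ...   | here = trans (updG-miss (updG M (inc s g c) c nothing) (g s) s (just y) m) (trans (updG-hit M (inc s g c) c nothing)
        (sym (cong (pick false) (two-second h P s (false , y) c (true , x) Q))))
  ...   | other n = trans (updG-miss (updG M (inc s g c) c nothing) (g s) s (just y) m) (trans (updG-miss M (inc s g c) c nothing n)
          (cong (pick false) (trans (two-other h P s (true , x) c (false , y) Q m n) (sym (two-other h P s (false , y) c (true , x) Q m n)))))

fill-far : ∀ {A : Set} h (P : List (ℕ × A)) s c X Y Q → s ≢ c → ∀ i d →
  fill h (P ++ (s , X) ∷ (c , Y) ∷ Q) i d ≡ fill h (P ++ (c , Y) ∷ (s , X) ∷ Q) i d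
fill-far h P s c X Y Q n i d = trans (fill-++ h P _ i d) (trans (cong (fill h P i d <∣>_) local) (sym (fill-++ h P _ i d)))
  where
  g = h ⊕ contents P
  local : fill g ((s , X) ∷ (c , Y) ∷ Q) i d ≡ fill g ((c , Y) ∷ (s , X) ∷ Q) i d
  sQ = (s , X) ∷ Q
  cQ = (c , Y) ∷ Q
  local with at? (g s) s i d
  ... | here = trans (fill-hit g s X cQ) (sym (trans (fill-miss g c Y sQ {g s} {s} (inj₂ λ e → n (sym e)))
        (fill-here (inc c g) s X Q (sym (inc-diff {c} {s} g λ e → n (sym e))))))
  ... | other m with at? (g c) c i d
  ...   | here = trans (fill-other g s X cQ refl m) (trans (fill-here (inc s g) c Y Q (sym (inc-diff {s} {c} g n))) (sym (fill-hit g c Y sQ)))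
  ...   | other k = trans (fill-other g s X cQ refl m) (trans (fill-other (inc s g) c Y Q (sym (inc-diff {s} {c} g n)) k)
          (trans (fill-cong Q (inc-comm c s g) i d)
          (sym (trans (fill-other g c Y sQ refl k) (fill-other (inc c g) s X Q (sym (inc-diff {c} {s} g λ e → n (sym e))) m)))))

placed : ∀ {A : Set} → Shape → List (ℕ × A) → List (ℕ × (ℕ × A))
placed h []            = []
placed h ((c , x) ∷ w) = (h c , c , x) ∷ placed (inc c h) w

placed-All : ∀ {A : Set} {P : ℕ × (ℕ × A) → Set} h w {i d x} → All P (placed h w) → fill h w i d ≡ just x → P (i , d , x)
placed-All h ((c , y) ∷ w) {i} {d} (p ∷ ps) e with at? (h c) c i d
... | here with trans (sym e) (fill-hit h c y w)
...   | refl = p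
placed-All h ((c , y) ∷ w) (p ∷ ps) e | other n = placed-All (inc c h) w ps (trans (sym (fill-miss h c y w (≢-flip n))) e)

placed-below : ∀ {A : Set} h (w : List (ℕ × A)) → All (λ { (i , c , _) → i < (h ⊕ contents w) c }) (placed h w)
placed-below h [] = []
placed-below h ((c , x) ∷ w) = ≤-trans (≤-reflexive (sym (inc-same c h))) (⊕-mono (inc c h) (contents w) c) ∷ placed-below (inc c h) w

placed-entries : ∀ {A : Set} {P : ℕ × A → Set} h w → All P w → All (λ b → P (proj₂ b)) (placed h w)
placed-entries h [] [] = []
placed-entries h ((c , x) ∷ w) (p ∷ ps) = p ∷ placed-entries (inc c h) w ps

-- Folding the second tableau through the starred first one

-- The run of the first tableau is kept starred and reversed; each box of the
-- second tableau slides through it.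
data Fold : List Entry → List TEntry → List Entry → List ℕ → Set where
  fnil : ∀ {R} → Fold R [] R []
  fa   : ∀ {R e M R′ os} → Fold (starE e ∷ R) M R′ os → Fold R (α e ∷ M) R′ os
  fb   : ∀ {R e M R₁ R′ c os} → Tr (proj₁ e) R c R₁ → Fold R₁ M R′ os → Fold R (β e ∷ M) R′ (c ∷ os)

Fold-++ : ∀ P {R M M′ R′ os} → (∀ {R os} → Fold R M′ R′ os → Fold R M R′ os) → Fold R (P ++ M′) R′ os → Fold R (P ++ M) R′ os
Fold-++ [] f p = f p
Fold-++ (_ ∷ P) f (fa p) = fa (Fold-++ P f p)
Fold-++ (_ ∷ P) f (fb t p) = fb t (Fold-++ P f p)

Fold-far : ∀ {R a b Q R′ os} → near (proj₁ a) (proj₁ b) ≡ false → Fold R (β b ∷ α a ∷ Q) R′ os → Fold R (α a ∷ β b ∷ Q) R′ os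
Fold-far {a = s , _} {c , _} f (fb t (fa p)) = fa (fb (pass (far-sym {s} {c} f) t) p)

-- The common frame of the exceptional switches: three successive boxes of contents 0, 1, 0. The
-- hypothesis `e` puts the box of content 1 into the row of the first diagonal box.
module Three (h : Shape) (P : List TEntry) (X Y Z X′ Y′ Z′ : Bool × Letter) (Q : List TEntry) (t : Bool)
  (e : (h ⊕ contents P) 0 ≡ (h ⊕ contents P) 1) where

  g : Shape
  g = h ⊕ contents P

  p : ℕ
  p = g 0

  word : Bool × Letter → Bool × Letter → Bool × Letter → List TEntry
  word X Y Z = P ++ (0 , X) ∷ (1 , Y) ∷ (0 , Z) ∷ Q

  first-box : ∀ X Y Z → fill h (word X Y Z) p 0 ≡ just X
  first-box X Y Z = two-first h P 0 X 1 Y ((0 , Z) ∷ Q)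

  second-box : ∀ X Y Z → fill h (word X Y Z) p 1 ≡ just Y
  second-box X Y Z = trans (cong (λ k → fill h (word X Y Z) k 1) e) (two-second h P 0 X 1 Y ((0 , Z) ∷ Q))

  third-box : ∀ X Y Z → fill h (word X Y Z) (suc p) 0 ≡ just Z
  third-box X Y Z = trans (two-other h P 0 X 1 Y ((0 , Z) ∷ Q) {suc p} {0} (inj₁ λ q → 1+n≢n (sym q)) (inj₂ λ ()))
    (trans (cong (_<∣> fill (inc 1 (inc 0 g)) ((0 , Z) ∷ Q) (suc p) 0) (fill-high h P (n≤1+n p))) (fill-hit (inc 1 (inc 0 g)) 0 Z Q))

  data Elsewhere (i d : ℕ) : Set where
    elsewhere : (p ≢ i) ⊎ (0 ≢ d) → (p ≢ i) ⊎ (1 ≢ d) → (suc p ≢ i) ⊎ (0 ≢ d) → Elsewhere i d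

  other-box : ∀ {i d} → Elsewhere i d → ∀ X Y Z →
    fill h (word X Y Z) i d ≡ (fill h P i d <∣> fill (inc 0 (inc 1 (inc 0 g))) Q i d)
  other-box {i} {d} (elsewhere a b c) X Y Z = trans (two-other h P 0 X 1 Y ((0 , Z) ∷ Q) a (row b))
    (cong (fill h P i d <∣>_) (fill-other (inc 1 (inc 0 g)) 0 Z Q refl c))
    where
    row : (p ≢ i) ⊎ (1 ≢ d) → (g 1 ≢ i) ⊎ (1 ≢ d)
    row (inj₁ n) = inj₁ λ q → n (trans e q)
    row (inj₂ n) = inj₂ n

  rewritten : ∀ (N : Grid) → N p 0 ≡ pick t (just X′) → N p 1 ≡ pick t (just Y′) → N (suc p) 0 ≡ pick t (just Z′) →
    (∀ i d → Elsewhere i d → N i d ≡ view t h (word X Y Z) i d) → ∀ i d → N i d ≡ view t h (word X′ Y′ Z′) i d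
  rewritten N e₁ e₂ e₃ f i d with at? p 0 i d
  ... | here = trans e₁ (sym (cong (pick t) (first-box X′ Y′ Z′)))
  ... | other a with at? p 1 i d
  ...   | here = trans e₂ (sym (cong (pick t) (second-box X′ Y′ Z′)))
  ...   | other b with at? (suc p) 0 i d
  ...     | here = trans e₃ (sym (cong (pick t) (third-box X′ Y′ Z′)))
  ...     | other c = trans (f i d (elsewhere a b c))
              (cong (pick t) (trans (other-box (elsewhere a b c) X Y Z) (sym (other-box (elsewhere a b c) X′ Y′ Z′))))

p≢1+p : ∀ {p} → p ≢ suc p
p≢1+p q = 1+n≢n (sym q)

module DoubleMove {h : Shape} {P Q : List TEntry} (e : (h ⊕ contents P) 0 ≡ (h ⊕ contents P) 1) where
  private
    p = (h ⊕ contents P) 0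

  S3-A : ∀ {A x b q} → Cells A (view true h (P ++ α (0 , x) ∷ β (1 , mk b true) ∷ β (0 , mk b q) ∷ Q)) →
    Cells (upd (upd A p p nothing) (suc p) (suc p) (just x)) (view true h (P ++ β (0 , mk b q) ∷ β (1 , mk b false) ∷ α (0 , x) ∷ Q))
  S3-A {A} {x} {b} {q} C = Cells-cong (upd-Cells {p = suc p} 0 (just x) (sym (+-identityʳ (suc p))) (upd-Cells {p = p} 0 nothing (sym (+-identityʳ p)) C))
    (rewritten (updG (updG M p 0 nothing) (suc p) 0 (just x))
      (trans (updG-miss (updG M p 0 nothing) (suc p) 0 (just x) (inj₁ 1+n≢n)) (updG-hit M p 0 nothing))
      (trans (updG-miss (updG M p 0 nothing) (suc p) 0 (just x) (inj₂ λ ())) (trans (updG-miss M p 0 nothing (inj₂ λ ())) (cong (pick true) (second-box (true , x) (false , mk b true) (false , mk b q)))))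
      (updG-hit (updG M p 0 nothing) (suc p) 0 (just x))
      λ { i d (elsewhere a _ c) → trans (updG-miss (updG M p 0 nothing) (suc p) 0 (just x) c) (updG-miss M p 0 nothing a) })
    where
    open Three h P (true , x) (false , mk b true) (false , mk b q) (false , mk b q) (false , mk b false) (true , x) Q true e hiding (p)
    M = view true h (P ++ α (0 , x) ∷ β (1 , mk b true) ∷ β (0 , mk b q) ∷ Q)

  S3-B : ∀ {B x b q} → Cells B (view false h (P ++ α (0 , x) ∷ β (1 , mk b true) ∷ β (0 , mk b q) ∷ Q)) →
    Cells (upd (upd (upd B (suc p) (suc p) nothing) p p (just (mk b q))) p (suc p) (just (mk b false)))
      (view false h (P ++ β (0 , mk b q) ∷ β (1 , mk b false) ∷ α (0 , x) ∷ Q))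
  S3-B {B} {x} {b} {q} C = Cells-cong (upd-Cells {p = p} 1 (just (mk b false)) (sym (+-comm p 1))
      (upd-Cells {p = p} 0 (just (mk b q)) (sym (+-identityʳ p)) (upd-Cells {p = suc p} 0 nothing (sym (+-identityʳ (suc p))) C)))
    (rewritten N₃
      (trans (updG-miss N₂ p 1 (just (mk b false)) (inj₂ λ ())) (updG-hit N₁ p 0 (just (mk b q))))
      (updG-hit N₂ p 1 (just (mk b false)))
      (trans (updG-miss N₂ p 1 (just (mk b false)) (inj₂ λ ())) (trans (updG-miss N₁ p 0 (just (mk b q)) (inj₁ p≢1+p)) (updG-hit M (suc p) 0 nothing)))
      λ { i d (elsewhere a b′ c) → trans (updG-miss N₂ p 1 (just (mk b false)) b′) (trans (updG-miss N₁ p 0 (just (mk b q)) a) (updG-miss M (suc p) 0 nothing c)) })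
    where
    open Three h P (true , x) (false , mk b true) (false , mk b q) (false , mk b q) (false , mk b false) (true , x) Q false e hiding (p)
    M = view false h (P ++ α (0 , x) ∷ β (1 , mk b true) ∷ β (0 , mk b q) ∷ Q)
    N₁ = updG M (suc p) 0 nothing
    N₂ = updG N₁ p 0 (just (mk b q))
    N₃ = updG N₂ p 1 (just (mk b false))

  S4-A : ∀ {A x a y} → Cells A (view true h (P ++ α (0 , x) ∷ α (1 , mk a false) ∷ β (0 , y) ∷ Q)) →
    Cells (upd (upd (upd A p p nothing) p (suc p) (just (mk a true))) (suc p) (suc p) (just x))
      (view true h (P ++ β (0 , y) ∷ α (1 , mk a true) ∷ α (0 , x) ∷ Q))
  S4-A {A} {x} {a} {y} C = Cells-cong (upd-Cells {p = suc p} 0 (just x) (sym (+-identityʳ (suc p)))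
      (upd-Cells {p = p} 1 (just (mk a true)) (sym (+-comm p 1)) (upd-Cells {p = p} 0 nothing (sym (+-identityʳ p)) C)))
    (rewritten N₃
      (trans (updG-miss N₂ (suc p) 0 (just x) (inj₁ 1+n≢n)) (trans (updG-miss N₁ p 1 (just (mk a true)) (inj₂ λ ())) (updG-hit M p 0 nothing)))
      (trans (updG-miss N₂ (suc p) 0 (just x) (inj₂ λ ())) (updG-hit N₁ p 1 (just (mk a true))))
      (updG-hit N₂ (suc p) 0 (just x))
      λ { i d (elsewhere a′ b c) → trans (updG-miss N₂ (suc p) 0 (just x) c) (trans (updG-miss N₁ p 1 (just (mk a true)) b) (updG-miss M p 0 nothing a′)) })
    where
    open Three h P (true , x) (true , mk a false) (false , y) (false , y) (true , mk a true) (true , x) Q true e hiding (p)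
    M = view true h (P ++ α (0 , x) ∷ α (1 , mk a false) ∷ β (0 , y) ∷ Q)
    N₁ = updG M p 0 nothing
    N₂ = updG N₁ p 1 (just (mk a true))
    N₃ = updG N₂ (suc p) 0 (just x)

  S4-B : ∀ {B x a y} → Cells B (view false h (P ++ α (0 , x) ∷ α (1 , mk a false) ∷ β (0 , y) ∷ Q)) →
    Cells (upd (upd B (suc p) (suc p) nothing) p p (just y)) (view false h (P ++ β (0 , y) ∷ α (1 , mk a true) ∷ α (0 , x) ∷ Q))
  S4-B {B} {x} {a} {y} C = Cells-cong (upd-Cells {p = p} 0 (just y) (sym (+-identityʳ p)) (upd-Cells {p = suc p} 0 nothing (sym (+-identityʳ (suc p))) C))
    (rewritten (updG N₁ p 0 (just y))
      (updG-hit N₁ p 0 (just y))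
      (trans (updG-miss N₁ p 0 (just y) (inj₂ λ ())) (trans (updG-miss M (suc p) 0 nothing (inj₂ λ ())) (cong (pick false) (second-box (true , x) (true , mk a false) (false , y)))))
      (trans (updG-miss N₁ p 0 (just y) (inj₁ p≢1+p)) (updG-hit M (suc p) 0 nothing))
      λ { i d (elsewhere a′ _ c) → trans (updG-miss N₁ p 0 (just y) a′) (updG-miss M (suc p) 0 nothing c) })
    where
    open Three h P (true , x) (true , mk a false) (false , y) (false , y) (true , mk a true) (true , x) Q false e hiding (p)
    M = view false h (P ++ α (0 , x) ∷ α (1 , mk a false) ∷ β (0 , y) ∷ Q)
    N₁ = updG M (suc p) 0 nothing

-- Commutation of far boxes

-- Two listings of the same boxes that agree up to exchanging far boxes of the two tableaux.
record _≈_ (M M′ : List TEntry) : Set where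
  field
    fill-same  : ∀ h i d → fill h M i d ≡ fill h M′ i d
    Up-same : ∀ {h} → Up h (contents M) → Up h (contents M′)
    Fold-back  : ∀ {R R′ os} → Fold R M′ R′ os → Fold R M R′ os
open _≈_

≈-refl : ∀ {M} → M ≈ M
≈-refl = record { fill-same = λ _ _ _ → refl ; Up-same = λ u → u ; Fold-back = λ f → f }

≈-≡ : ∀ {M M′} → M ≡ M′ → M ≈ M′
≈-≡ refl = ≈-refl

≈-trans : ∀ {M M′ M″} → M ≈ M′ → M′ ≈ M″ → M ≈ M″
≈-trans p q = record { fill-same = λ h i d → trans (fill-same p h i d) (fill-same q h i d) ; Up-same = λ u → Up-same q (Up-same p u) ; Fold-back = λ f → Fold-back p (Fold-back q f) }

Up-prefix : ∀ u {h v v′} → (∀ {g} → Up g v → Up g v′) → Up h (u ++ v) → Up h (u ++ v′)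
Up-prefix [] f p = f p
Up-prefix (c ∷ u) f (q ▸ p) = q ▸ Up-prefix u f p

≈-far : ∀ P a b Q → near (proj₁ a) (proj₁ b) ≡ false → (P ++ α a ∷ β b ∷ Q) ≈ (P ++ β b ∷ α a ∷ Q)
≈-far P (s , x) (c , y) Q f = record
  { fill-same = λ h → fill-far h P s c (true , x) (false , y) Q (far-≢ f)
  ; Up-same = λ u → subst (Up _) (sym (contents-++ P _)) (Up-prefix (contents P) (Up-exchange f) (subst (Up _) (contents-++ P _) u))
  ; Fold-back = Fold-++ P (Fold-far f) }

≈-prefix : ∀ P {M M′} → M ≈ M′ → (P ++ M) ≈ (P ++ M′)
≈-prefix P {M} {M′} q = record
  { fill-same = λ h i d → trans (fill-++ h P M i d) (trans (cong (fill h P i d <∣>_) (fill-same q (h ⊕ contents P) i d)) (sym (fill-++ h P M′ i d)))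
  ; Up-same = λ u → subst (Up _) (sym (contents-++ P M′)) (Up-prefix (contents P) (Up-same q) (subst (Up _) (contents-++ P M) u))
  ; Fold-back = Fold-++ P (Fold-back q) }

≈-pass : ∀ a Z W → All (λ e → near (proj₁ a) (proj₁ e) ≡ false) Z → (α a ∷ (map β Z ++ W)) ≈ (map β Z ++ α a ∷ W)
≈-pass a [] W [] = ≈-refl
≈-pass a (b ∷ Z) W (f ∷ fs) = ≈-trans (≈-far [] a b (map β Z ++ W) f) (≈-prefix (β b ∷ []) (≈-pass a Z W fs))

Fold-split : ∀ P {R M R′ os} → Fold R (P ++ M) R′ os →
  ∃ λ R₁ → ∃ λ os₁ → ∃ λ os₂ → Fold R P R₁ os₁ × Fold R₁ M R′ os₂ × os ≡ os₁ ++ os₂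
Fold-split [] f = _ , [] , _ , fnil , f , refl
Fold-split (_ ∷ P) (fa f) with Fold-split P f
... | R₁ , o₁ , o₂ , p , q , e = R₁ , o₁ , o₂ , fa p , q , e
Fold-split (_ ∷ P) (fb t f) with Fold-split P f
... | R₁ , o₁ , o₂ , p , q , e = R₁ , _ ∷ o₁ , o₂ , fb t p , q , cong (_ ∷_) e

Fold-join : ∀ {P R M R₁ R′ os₁ os₂} → Fold R P R₁ os₁ → Fold R₁ M R′ os₂ → Fold R (P ++ M) R′ (os₁ ++ os₂)
Fold-join fnil g = g
Fold-join (fa f) g = fa (Fold-join f g)
Fold-join (fb t f) g = fb t (Fold-join f g)

Fold-at : ∀ P {R M M′ R′ os} → (∀ {R₁ o₁ o₂} → Fold R P R₁ o₁ → Fold R₁ M′ R′ o₂ → Fold R₁ M R′ o₂) → Fold R (P ++ M′) R′ os → Fold R (P ++ M) R′ os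
Fold-at P f q with Fold-split P q
... | R₁ , o₁ , o₂ , p , r , e = subst (Fold _ _ _) (sym e) (Fold-join p (f p r))

-- The emitted contents followed by the folded run form a chain again. Patterns in the folded run
-- can thus be excluded by the geometry of chains.
Up-Fold : ∀ {R P R′ os h} v → Fold R P R′ os → Up h (reverse (contents R) ++ contents P ++ v) → Up h (os ++ reverse (contents R′) ++ v)
Up-Fold v fnil u = u
Up-Fold v (fa {R} {e} {M} f) u = Up-Fold v f (subst (Up _) (sym (reverse-∷-++ (proj₁ e) (contents R) (contents M ++ v))) u)
Up-Fold v (fb {R} {e} {M} {R₁} {os = os} t f) u with Up-switch (contents R) (proj₁ e ∷ []) (contents M ++ v) u
... | w rewrite lower-[ proj₁ e ] (contents R) | upper-[ proj₁ e ] (contents R) | sym (proj₁ (Tr-contents t)) | sym (proj₂ (Tr-contents t)) with w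
... | p ▸ w′ = p ▸ Up-Fold v f w′

Tr-no-zero : ∀ {s w s′ w′} → Tr s w s′ w′ → s ≢ 0 → All (λ e → proj₁ e ≢ 0) w → All (λ e → proj₁ e ≢ 0) w′ × s′ ≢ 0
Tr-no-zero nil n a = a , n
Tr-no-zero (pass f t) n (p ∷ a) with Tr-no-zero t n a
... | q , r = p ∷ q , r
Tr-no-zero (move f m t) n (p ∷ a) with Tr-no-zero t p a
... | q , r = n ∷ q , r
Tr-no-zero (exch t) n a = ⊥-elim (n refl)

Fold-no-zero : ∀ {R P R′ os} → Fold R P R′ os → All (λ c → c ≢ 0) (contents P) → All (λ e → proj₁ e ≢ 0) R → All (λ e → proj₁ e ≢ 0) R′
Fold-no-zero fnil a b = b
Fold-no-zero (fa f) (p ∷ a) b = Fold-no-zero f a (p ∷ b)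
Fold-no-zero (fb t f) (p ∷ a) b = Fold-no-zero f a (proj₁ (Tr-no-zero t p b))

no-occurrence : ∀ h w d → (h ⊕ w) d ≤ h d → All (λ c → c ≢ d) w
no-occurrence h [] d q = []
no-occurrence h (c ∷ w) d q with c ≟ d
... | yes refl = ⊥-elim (1+n≰n (≤-trans (≤-reflexive (sym (inc-same c h))) (≤-trans (⊕-mono (inc c h) w c) q)))
... | no n = n ∷ no-occurrence (inc c h) w d (≤-trans q (≤-reflexive (sym (inc-diff {c} {d} h n))))

swap? : ∀ s c x w → Dec (Swap s c x w)
swap? (suc s) c x w = no λ { (() , _) }
swap? zero zero x w = no λ { (_ , () , _) }
swap? zero (suc (suc c)) x w = no λ { (_ , () , _) }
swap? zero (suc zero) (mk v false) w = no λ { (_ , _ , () , _) }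
swap? zero (suc zero) (mk v true) [] = no λ { (_ , _ , _ , _ , _ , ()) }
swap? zero (suc zero) (mk v true) ((suc d , y) ∷ w) = no λ { (_ , _ , _ , _ , _ , ()) }
swap? zero (suc zero) (mk v true) ((zero , mk u p) ∷ w) with u ℤ.≟ v
... | yes refl = yes (refl , refl , refl , p , w , refl)
... | no n = no λ { (_ , _ , _ , _ , _ , refl) → n refl }

-- Provides a completion for invariants that quantify over all completed slides. The recursion is on
-- the length because `exch` consumes two letters.
Tr-exists : ∀ s w → ∃ λ s′ → ∃ λ w′ → Tr s w s′ w′
Tr-exists s w = go (length w) s w ≤-refl
  where
  go : ∀ n s w → length w ≤ n → ∃ λ s′ → ∃ λ w′ → Tr s w s′ w′
  go n s [] q = s , [] , nil
  go (suc n) s ((c , x) ∷ w) (s≤s q) with near s c in f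
  ... | false with go n s w q
  ...   | s′ , w′ , t = s′ , _ , pass f t
  go (suc n) s ((c , x) ∷ w) (s≤s q) | true with swap? s c x w
  ... | no m with go n c w q
  ...   | s′ , w′ , t = s′ , _ , move f m t
  go (suc n) s ((c , mk v f′) ∷ w) (s≤s q) | true | yes (refl , refl , refl , p , w₂ , refl) with go n 0 w₂ (≤-trans (n≤1+n _) q)
  ... | s′ , w′ , t = s′ , _ , exch t

<∣>-nothingˡ : ∀ {A : Set} {x y : Maybe A} → x ≡ nothing → (x <∣> y) ≡ y
<∣>-nothingˡ refl = refl

no-α : ∀ (m : Maybe Letter) {x} → Maybe.map (tag false) m ≡ just (true , x) → ⊥
no-α (just y) ()
no-α nothing ()

no-β : ∀ (m : Maybe Letter) {x} → Maybe.map (tag true) m ≡ just (false , x) → ⊥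
no-β (just y) ()
no-β nothing ()

map-true : ∀ (m : Maybe Letter) {x} → Maybe.map (tag true) m ≡ just (true , x) → m ≡ just x
map-true (just y) refl = refl

false≢true : false ≡ true → ⊥
false≢true ()

column : ∀ {F M i j x} → Cells F M → F i j ≡ just x → ∃ λ d → j ≡ i + d × M i d ≡ just x
column {F} {M} {i} {j} C e with i ≤? j
... | yes q = j ∸ i , sym (m+[n∸m]≡n q) , trans (sym (cell C i (j ∸ i))) (trans (cong (F i) (m+[n∸m]≡n q)) e)
... | no q = ⊥-elim (nothing≢just (tri C i j (≰⇒> q)) e)

Path-suffix : ∀ {b m} u {e v m′} → Path b m (u ++ e ∷ v) m′ → Path b (just e) v m′
Path-suffix [] (_ ∷ p) = p
Path-suffix (_ ∷ u) (_ ∷ p) = Path-suffix u p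

-- Invariant of a switching process for one letter on each side

module Switching (h : Shape) (k l : ℤ) (bits : ℤ → Bool) where

  Val : ℤ → Entry → Set
  Val v e = val (proj₂ e) ≡ v

  prefix : List Entry → List Entry → List TEntry
  prefix rr B = map α (reverse rr) ++ map β B

  suffix : List Entry → List Entry → List TEntry
  suffix B D = map β B ++ map α D

  state : List Entry → List Entry → Entry → List Entry → List Entry → List TEntry
  state rr B₁ a B₂ D = prefix rr B₁ ++ α a ∷ suffix B₂ D

  before : List Entry → List Entry → Shape
  before rr B = h ⊕ contents (prefix rr B)

  -- the boxes still to be moved lie to the left of (above) the moving one
  Ahead : List Entry → ℕ → ℕ → Letter → Set
  Ahead rr p q x =
    (primed x ≡ false → All (λ b → primed (proj₂ (proj₂ b)) ≡ false → proj₁ b + proj₁ (proj₂ b) < q) (placed h (reverse rr))) ×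
    (primed x ≡ true → All (λ b → primed (proj₂ (proj₂ b)) ≡ true × proj₁ b < p) (placed h (reverse rr)))

  Ahead-mono : ∀ {rr p p′ q q′ x} → p ≤ p′ → q ≤ q′ → Ahead rr p q x → Ahead rr p′ q′ x
  Ahead-mono p≤ q≤ (f , g) = (λ e → All.map (λ r u → ≤-trans (r u) q≤) (f e)) ,
    (λ e → All.map (λ { (r , u) → r , ≤-trans u p≤ }) (g e))

  data Falling : List Entry → Set where
    []  : Falling []
    _∷_ : ∀ {e w} → All (_≺ e) w → Falling w → Falling (e ∷ w)

  -- A snapshot with the a-box `a` on its way: `rr` are the waiting a-boxes, the next one to move
  -- first; `B₁` are the b-boxes already passed, `B₂` those ahead, and `D` the finished a-boxes. The
  -- field `completed` expresses that the first reading, once the current slide is finished, gives a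
  -- standard b-run.
  record Inv (rr B₁ : List Entry) (a : Entry) (B₂ D : List Entry) (vs : List ℤ) : Set where
    s = proj₁ a
    x = proj₂ a
    g = before rr B₁
    p = g s
    field
      valid     : Up h (contents (state rr B₁ a B₂ D))
      valA      : All (Val k) (a ∷ rr)
      valB      : All (Val l) (B₁ ++ B₂)
      falling   : Falling rr
      ahead     : Ahead rr p (p + s) x
      completed : ∀ {s′ w′} → Tr s B₂ s′ w′ → Standard bits (B₁ ++ w′)
      rest      : ∃ λ m → Path bits m B₂ nothing
      -- With `a` on content 1, a diagonal b-box that was just passed is not followed by another
      -- one: that pattern belongs to an exceptional switch, which is carried out as a whole.
      history   : s ≡ 1 → ∀ {B₀ y y′ B₃} → B₁ ≡ B₀ ++ (0 , y) ∷ [] → B₂ ≢ (0 , y′) ∷ B₃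
      values    : vals (B₁ ++ B₂) ≡ vs

    valid-at : Up g (s ∷ contents (suffix B₂ D))
    valid-at = Up-drop (contents (prefix rr B₁)) (subst (Up h) (contents-++ (prefix rr B₁) _) valid)

    prof-g : Prof g
    prof-g = Up-Prof valid-at

    -- The shape filled by everything except the finished a-boxes.
    kD : Shape
    kD = inc s g ⊕ contents (map β B₂)

    prof-kD : Prof kD
    prof-kD = Up-Prof (Up-drop (contents (map β B₂)) (subst (Up (inc s g)) (contents-++ (map β B₂) (map α D)) (Up-tail valid-at)))

    g≤kD : ∀ d → g d ≤ kD d
    g≤kD d = ≤-trans (inc-≤ s g d) (⊕-mono (inc s g) (contents (map β B₂)) d)

    locate : ∀ {i d z} → fill h (state rr B₁ a B₂ D) i d ≡ just (true , z) →
      (fill h (reverse rr) i d ≡ just z) ⊎ (i ≡ p × d ≡ s × z ≡ x) ⊎ (kD d ≤ i)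
    locate {i} {d} e with <∣>-just (fill h (prefix rr B₁) i d) _ (trans (sym (fill-++ h (prefix rr B₁) _ i d)) e)
    ... | inj₁ e₁ with <∣>-just (fill h (map α (reverse rr)) i d) _ (trans (sym (fill-++ h (map α (reverse rr)) (map β B₁) i d)) e₁)
    ...   | inj₁ e₂ = inj₁ (map-true (fill h (reverse rr) i d) (trans (sym (fill-α h (reverse rr) i d)) e₂))
    ...   | inj₂ (_ , e₂) = ⊥-elim (no-α (fill (h ⊕ contents (map α (reverse rr))) B₁ i d) (trans (sym (fill-β (h ⊕ contents (map α (reverse rr))) B₁ i d)) e₂))
    locate {i} {d} e | inj₂ (_ , e₁) with at? p s i d
    ... | here with trans (sym e₁) (fill-hit g s (true , x) (suffix B₂ D))
    ...   | refl = inj₂ (inj₁ (refl , refl , refl))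
    locate {i} {d} e | inj₂ (_ , e₁) | other n
      with <∣>-just (fill (inc s g) (map β B₂) i d) _ (trans (sym (fill-++ (inc s g) (map β B₂) (map α D) i d)) (trans (sym (fill-other g s (true , x) (suffix B₂ D) refl n)) e₁))
    ... | inj₁ e₂ = ⊥-elim (no-α (fill (inc s g) B₂ i d) (trans (sym (fill-β (inc s g) B₂ i d)) e₂))
    ... | inj₂ (_ , e₂) = inj₂ (inj₂ (proj₁ (fill-region kD (map α D) e₂)))

    b-before : ∀ {i d y} → view false h (state rr B₁ a B₂ D) i d ≡ just y → i < kD d
    b-before {i} {d} {y} e = ≰⇒> λ q → no-β (fill kD D i d) (trans (sym (fill-α kD D i d)) (trans (sym (reduce q)) (pick-just false _ e)))
      where
      reduce : kD d ≤ i → fill h (state rr B₁ a B₂ D) i d ≡ fill kD (map α D) i d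
      reduce q = trans (beyond h (prefix rr B₁) s (true , x) (suffix B₂ D) (≤-trans (⊕-mono (inc s g) (contents (map β B₂)) d) q))
        (trans (fill-++ (inc s g) (map β B₂) (map α D) i d) (<∣>-nothingˡ (fill-high (inc s g) (map β B₂) q)))

    module _ {A B} (CA : Cells A (view true h (state rr B₁ a B₂ D))) (CB : Cells B (view false h (state rr B₁ a B₂ D))) where

      -- All b-boxes lie inside `kD`, and the cells east and south of a cell outside `kD` are
      -- outside as well.
      settled : ∀ {i d} → kD d ≤ i → ¬ (IsBox B i (suc (i + d)) ⊎ IsBox B (suc i) (i + d))
      settled {i} {d} q (inj₁ (y , e)) = 1+n≰n (≤-trans (b-before (trans (sym (cell CB i (suc d))) (trans (cong (B i) (+-suc i d)) e)))
        (≤-trans (Prof-≤ prof-kD (n≤1+n d)) q))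
      settled {i} {zero} q (inj₂ (y , e)) = nothing≢just (tri CB (suc i) (i + 0) (s≤s (≤-reflexive (+-identityʳ i)))) e
      settled {i} {suc d} q (inj₂ (y , e)) = 1+n≰n (≤-trans (b-before (trans (sym (cell CB (suc i) d)) (trans (cong (B (suc i)) (sym (+-suc i d))) e)))
        (≤-trans (Prof-slope prof-kD 1 d) (s≤s q)))

      a-cell : A p (p + s) ≡ just x
      a-cell = trans (cell CA p s) (cong (pick true) (trans (fill-++ h (prefix rr B₁) _ p s)
        (trans (<∣>-nothingˡ (fill-high h (prefix rr B₁) ≤-refl)) (fill-hit g s (true , x) (suffix B₂ D)))))

      -- Finished a-boxes face no b-box. By `ahead` the waiting ones lose against `a`: when `a` is
      -- unprimed, the unprimed ones are further west; when it is primed, they are all primed and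
      -- further north.
      chosen : (IsBox B p (suc (p + s)) ⊎ IsBox B (suc p) (p + s)) → ∀ {i j} → Chosen A B i j → i ≡ p × j ≡ p + s
      chosen nb {i} {j} (unpr {c} (e , nb′) most) with column CA e
      ... | d , refl , e₁ with locate (pick-just true _ e₁)
      ...   | inj₂ (inj₁ (refl , refl , _)) = refl , refl
      ...   | inj₂ (inj₂ q) = ⊥-elim (settled q nb′)
      ...   | inj₁ e₂ = ⊥-elim (absurd (primed x) refl)
        where
        absurd : ∀ t → primed x ≡ t → ⊥
        absurd false px = 1+n≰n (≤-trans (placed-All h (reverse rr) (proj₁ ahead px) e₂ refl)
          (most p (p + s) (val x) (trans a-cell (cong (λ t → just (mk (val x) t)) px) , nb)))
        absurd true px with proj₁ (placed-All h (reverse rr) (proj₂ ahead px) e₂)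
        ... | ()
      chosen nb {i} {j} (prim {c} none (e , nb′) most) with column CA e
      ... | d , refl , e₁ with locate (pick-just true _ e₁)
      ...   | inj₂ (inj₁ (refl , refl , _)) = refl , refl
      ...   | inj₂ (inj₂ q) = ⊥-elim (settled q nb′)
      ...   | inj₁ e₂ = ⊥-elim (absurd (primed x) refl)
        where
        absurd : ∀ t → primed x ≡ t → ⊥
        absurd false px = none p (p + s) (val x) (trans a-cell (cong (λ t → just (mk (val x) t)) px) , nb)
        absurd true px = 1+n≰n (≤-trans (proj₂ (placed-All h (reverse rr) (proj₂ ahead px) e₂))
          (most p (p + s) (val x) (trans a-cell (cong (λ t → just (mk (val x) t)) px) , nb)))

  recast : ∀ {F M M′} t → M ≡ M′ → Cells F (view t h M) → Cells F (view t h M′)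
  recast t refl C = C

  refold : ∀ {R R′ M M′ os} → M ≡ M′ → Fold R M R′ os → Fold R M′ R′ os
  refold refl F = F

  -- The outcome of one switch. The field `back` extends a fold of the new state to the old one, so
  -- the second reading is assembled from the end of the process.
  record Next (M : List TEntry) (A B : Filling) (vs : List ℤ) : Set where
    field
      rr B₁ : List Entry
      a     : Entry
      B₂ D  : List Entry
      inv   : Inv rr B₁ a B₂ D vs
      CA    : Cells A (view true h (state rr B₁ a B₂ D))
      CB    : Cells B (view false h (state rr B₁ a B₂ D))
      back  : ∀ {R os} → Fold [] (state rr B₁ a B₂ D) R os → Fold [] M R os

  prefix-snoc : ∀ rr B b Z → prefix rr (B ++ b ∷ []) ++ Z ≡ prefix rr B ++ β b ∷ Z
  prefix-snoc rr B b Z = trans (++-assoc (map α (reverse rr)) (map β (B ++ b ∷ [])) Z)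
    (trans (cong (map α (reverse rr) ++_) (trans (cong (_++ Z) (map-++ β B (b ∷ []))) (++-assoc (map β B) (β b ∷ []) Z)))
      (sym (++-assoc (map α (reverse rr)) (map β B) (β b ∷ Z))))

  before-snoc : ∀ rr B b → before rr (B ++ b ∷ []) ≡ inc (proj₁ b) (before rr B)
  before-snoc rr B b = trans (cong (λ M → h ⊕ contents M) (trans (sym (++-identityʳ _)) (prefix-snoc rr B b [])))
    (trans (cong (h ⊕_) (contents-++ (prefix rr B) (β b ∷ []))) (⊕-++ h (contents (prefix rr B)) (proj₁ b ∷ [])))

  Path-rest : ∀ {e B} → (∃ λ m → Path bits m (e ∷ B) nothing) → Path bits (just e) B nothing
  Path-rest (_ , _ ∷ p) = p

  ∷ʳ-last : ∀ {A : Set} (u v : List A) {e f} → u ++ e ∷ [] ≡ v ++ f ∷ [] → e ≡ f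
  ∷ʳ-last u v q = ∷ʳ-injectiveʳ u v q

  snoc-++ : ∀ {A : Set} (u : List A) e v → (u ++ e ∷ []) ++ v ≡ u ++ e ∷ v
  snoc-++ u e v = ++-assoc u (e ∷ []) v

  -- A far b-box is passed without any switch: the fillings stay and only the listing changes.
  module Far {rr B₁ s x c y B₃ D vs} (f : near s c ≡ false) (inv : Inv rr B₁ (s , x) ((c , y) ∷ B₃) D vs) where
    open Inv inv hiding (s; x)

    M′ : List TEntry
    M′ = state rr (B₁ ++ (c , y) ∷ []) (s , x) B₃ D

    equiv : state rr B₁ (s , x) ((c , y) ∷ B₃) D ≈ M′
    equiv = ≈-trans (≈-far (prefix rr B₁) (s , x) (c , y) (suffix B₃ D) f) (≈-≡ (sym (prefix-snoc rr B₁ (c , y) _)))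

    row : before rr (B₁ ++ (c , y) ∷ []) s ≡ p
    row = trans (cong (λ k → k s) (before-snoc rr B₁ (c , y))) (inc-diff {c} {s} g (λ e → far-≢ f (sym e)))

    inv′ : Inv rr (B₁ ++ (c , y) ∷ []) (s , x) B₃ D vs
    inv′ = record
      { valid = _≈_.Up-same equiv valid
      ; valA = valA
      ; valB = subst (All (Val l)) (sym (snoc-++ B₁ (c , y) B₃)) valB
      ; falling = falling
      ; ahead = Ahead-mono {rr} {x = x} (≤-reflexive (sym row)) (≤-reflexive (cong (_+ s) (sym row))) ahead
      ; completed = λ {s′} {w′} t → subst (Standard bits) (sym (snoc-++ B₁ (c , y) w′)) (completed (pass f t))
      ; rest = _ , Path-rest rest
      ; history = λ e₁ {B₀} e _ → far-0 (∷ʳ-last B₁ B₀ e) e₁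
      ; values = trans (cong vals (snoc-++ B₁ (c , y) B₃)) values }
      where
      far-0 : ∀ {z} → (c , y) ≡ (0 , z) → s ≢ 1
      far-0 e e′ = false≢true (trans (sym f) (cong₂ near e′ (cong proj₁ e)))

  module Move {rr B₁ s x c y B₃ D vs A B} (f : near s c ≡ true) (inv : Inv rr B₁ (s , x) ((c , y) ∷ B₃) D vs)
    (CA : Cells A (view true h (state rr B₁ (s , x) ((c , y) ∷ B₃) D)))
    (CB : Cells B (view false h (state rr B₁ (s , x) ((c , y) ∷ B₃) D)))
    (noSwap : ¬ Swap s c y B₃) where
    open Inv inv hiding (s; x)

    s≢c : s ≢ c
    s≢c = Up-≢ valid-at

    east-row : c ≡ suc s → p ≡ inc s g c
    east-row refl = trans (addable-east prof-g (Up-Prof (Up-tail valid-at))) (sym (inc-diff {s} {suc s} g p≢1+p))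

    south-row : s ≡ suc c → suc p ≡ inc s g c
    south-row refl = trans (sym (addable-south prof-g (Up-Prof (Up-tail valid-at)))) (sym (inc-diff {suc c} {c} g 1+n≢n))

    private
      new-row : before rr (B₁ ++ (s , y) ∷ []) c ≡ inc s g c
      new-row = cong (λ k → k c) (before-snoc rr B₁ (s , y))

      further : p ≤ inc s g c × p + s ≤ inc s g c + c
      further with near⇒ s c f
      ... | inj₁ e = ⊥-elim (s≢c e)
      ... | inj₂ (inj₁ e) = ≤-reflexive (east-row (sym e)) , +-mono-≤ (≤-reflexive (east-row (sym e))) (≤-trans (n≤1+n s) (≤-reflexive e))
      ... | inj₂ (inj₂ refl) = ≤-trans (n≤1+n p) (≤-reflexive (south-row refl)) ,
              ≤-trans (≤-reflexive (+-suc p c)) (+-monoˡ-≤ c (≤-reflexive (south-row refl)))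

      same-contents : contents (state rr B₁ (s , x) ((c , y) ∷ B₃) D) ≡ contents (state rr (B₁ ++ (s , y) ∷ []) (c , x) B₃ D)
      same-contents = trans (contents-++ (prefix rr B₁) _) (trans (sym (contents-++ (prefix rr B₁) _)) (cong contents (sym (prefix-snoc rr B₁ (s , y) (α (c , x) ∷ suffix B₃ D)))))

      reval : ∀ (B₁ : List Entry) → All (Val l) (B₁ ++ (c , y) ∷ B₃) → All (Val l) ((B₁ ++ (s , y) ∷ []) ++ B₃)
      reval [] (v ∷ vs) = v ∷ vs
      reval (b ∷ B) (v ∷ vs) = v ∷ reval B vs

      same-vals : ∀ (B₁ : List Entry) → vals ((B₁ ++ (s , y) ∷ []) ++ B₃) ≡ vals (B₁ ++ (c , y) ∷ B₃)
      same-vals [] = refl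
      same-vals (b ∷ B) = cong (val (proj₂ b) ∷_) (same-vals B)

    val-y : val y ≡ l
    val-y with ++⁻ʳ B₁ valB
    ... | v ∷ _ = v

    val-B₃ : All (Val l) B₃
    val-B₃ with ++⁻ʳ B₁ valB
    ... | _ ∷ v = v

    inv′ : Inv rr (B₁ ++ (s , y) ∷ []) (c , x) B₃ D vs
    inv′ = record
      { valid = subst (Up h) same-contents valid
      ; valA = head-val valA
      ; valB = reval B₁ valB
      ; falling = falling
      ; ahead = Ahead-mono {rr} {x = x} (≤-trans (proj₁ further) (≤-reflexive (sym new-row))) (≤-trans (proj₂ further) (≤-reflexive (cong (_+ c) (sym new-row)))) ahead
      ; completed = λ {s′} {w′} t → subst (Standard bits) (sym (snoc-++ B₁ (s , y) w′)) (completed (move f noSwap t))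
      ; rest = _ , Path-rest rest
      ; history = λ { c≡1 {B₀} e refl → noSwap (swapped c≡1 (sym (cong proj₁ (∷ʳ-last B₀ B₁ (sym e)))) (Path-rest rest) val-B₃) }
      ; values = trans (same-vals B₁) values }
      where
      head-val : All (Val k) ((s , x) ∷ rr) → All (Val k) ((c , x) ∷ rr)
      head-val (v ∷ vs) = v ∷ vs
      swapped : ∀ {y′ B₄} → c ≡ 1 → s ≡ 0 → Path bits (just (c , y)) ((0 , y′) ∷ B₄) nothing → All (Val l) ((0 , y′) ∷ B₄) → Swap s c y ((0 , y′) ∷ B₄)
      swapped refl refl (pp _ ∷ _) _ = refl , refl , refl , _ , _ , refl
      swapped refl refl (pu> _ _ ∷ _) _ = refl , refl , refl , _ , _ , refl
      swapped refl refl (rise r _ _ ∷ _) (v ∷ _) = ⊥-elim (ℤₚ.<-irrefl (trans val-y (sym v)) r)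

    -- In the second reading the b-box goes past the starred `x`, and `guard` says that this is not
    -- the exceptional slide.
    next-state : ∀ {q} → q ≡ inc s g c →
      (∀ {R₁ o₁} → Fold [] (prefix rr B₁) R₁ o₁ → ¬ Swap c s (starL x) R₁) →
      Next (state rr B₁ (s , x) ((c , y) ∷ B₃) D) (swapA A p (p + s) q (q + c) x) (swapB B p (p + s) q (q + c) y) vs
    next-state e guard = record
      { rr = rr ; B₁ = B₁ ++ (s , y) ∷ [] ; a = c , x ; B₂ = B₃ ; D = D ; inv = inv′
      ; CA = recast true (sym (prefix-snoc rr B₁ (s , y) (α (c , x) ∷ suffix B₃ D))) (view-move {P = prefix rr B₁} s≢c e CA)
      ; CB = recast false (sym (prefix-snoc rr B₁ (s , y) (α (c , x) ∷ suffix B₃ D))) (view-move-b {P = prefix rr B₁} s≢c e CB)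
      ; back = λ F → Fold-at (prefix rr B₁) (λ G → λ { (fb t (fa r)) → fa (fb (move (trans (near-sym c s) f) (guard G) t) r) })
                 (refold (prefix-snoc rr B₁ (s , y) (α (c , x) ∷ suffix B₃ D)) F) }

  -- The switch S3: an exceptional slide through the b-run, but two ordinary moves in the starred
  -- a-run.
  module Exchange {rr B₁ x b q B₄ D vs A B} (inv : Inv rr B₁ (0 , x) ((1 , mk b true) ∷ (0 , mk b q) ∷ B₄) D vs)
    (CA : Cells A (view true h (state rr B₁ (0 , x) ((1 , mk b true) ∷ (0 , mk b q) ∷ B₄) D)))
    (CB : Cells B (view false h (state rr B₁ (0 , x) ((1 , mk b true) ∷ (0 , mk b q) ∷ B₄) D))) where
    open Inv inv hiding (s; x)

    level : g 0 ≡ g 1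
    level = addable-east prof-g (Up-Prof (Up-tail valid-at))

    B₁′ = (B₁ ++ (0 , mk b q) ∷ []) ++ (1 , mk b false) ∷ []

    split : ∀ Z → prefix rr B₁′ ++ Z ≡ prefix rr B₁ ++ β (0 , mk b q) ∷ β (1 , mk b false) ∷ Z
    split Z = trans (prefix-snoc rr (B₁ ++ (0 , mk b q) ∷ []) (1 , mk b false) Z) (prefix-snoc rr B₁ (0 , mk b q) (β (1 , mk b false) ∷ Z))

    split-++ : ∀ Z → B₁′ ++ Z ≡ B₁ ++ (0 , mk b q) ∷ (1 , mk b false) ∷ Z
    split-++ Z = trans (snoc-++ (B₁ ++ (0 , mk b q) ∷ []) (1 , mk b false) Z) (snoc-++ B₁ (0 , mk b q) ((1 , mk b false) ∷ Z))

    reval : ∀ (B₁ : List Entry) → All (Val l) (B₁ ++ (1 , mk b true) ∷ (0 , mk b q) ∷ B₄) → All (Val l) (B₁ ++ (0 , mk b q) ∷ (1 , mk b false) ∷ B₄)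
    reval [] (u ∷ v ∷ vs) = v ∷ u ∷ vs
    reval (_ ∷ B) (v ∷ vs) = v ∷ reval B vs

    same-vals : ∀ (B₁ : List Entry) → vals (B₁ ++ (0 , mk b q) ∷ (1 , mk b false) ∷ B₄) ≡ vals (B₁ ++ (1 , mk b true) ∷ (0 , mk b q) ∷ B₄)
    same-vals [] = refl
    same-vals (b ∷ B) = cong (val (proj₂ b) ∷_) (same-vals B)

    new-row : before rr B₁′ 0 ≡ suc p
    new-row = trans (cong (λ k → k 0) (before-snoc rr (B₁ ++ (0 , mk b q) ∷ []) (1 , mk b false)))
      (trans (inc-diff {1} {0} (before rr (B₁ ++ (0 , mk b q) ∷ [])) (λ ())) (cong (λ k → k 0) (before-snoc rr B₁ (0 , mk b q))))

    inv′ : Inv rr B₁′ (0 , x) B₄ D vs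
    inv′ = record
      { valid = subst (Up h) (trans (contents-++ (prefix rr B₁) _) (trans (sym (contents-++ (prefix rr B₁) _)) (cong contents (sym (split (α (0 , x) ∷ suffix B₄ D)))))) valid
      ; valA = valA
      ; valB = subst (All (Val l)) (sym (split-++ B₄)) (reval B₁ valB)
      ; falling = falling
      ; ahead = Ahead-mono {rr} {x = x} (≤-trans (n≤1+n p) (≤-reflexive (sym new-row))) (+-monoˡ-≤ 0 (≤-trans (n≤1+n p) (≤-reflexive (sym new-row)))) ahead
      ; completed = λ {s′} {w′} t → subst (Standard bits) (sym (split-++ w′)) (completed (exch t))
      ; rest = _ , Path-rest (_ , Path-rest rest)
      ; history = λ ()
      ; values = trans (cong vals (split-++ B₄)) (trans (same-vals B₁) values) }

    -- If the run began on the main diagonal after the first of the two b-boxes has passed, its head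
    -- had content 0 or 1 before. Next to the contents 0, 1 that follow in the chain this is a
    -- repetition or a zigzag.
    free : ∀ {R₁ o₁ c₁ R₂} → Fold [] (prefix rr B₁) R₁ o₁ → Tr 0 R₁ c₁ R₂ → ¬ Swap 0 1 (starL x) R₂
    free {R₁} {o₁} F t (_ , _ , _ , z , w , refl) = head-zero R₁ t (Up-Fold (0 ∷ 1 ∷ contents (suffix ((0 , mk b q) ∷ B₄) D)) F
        (subst (Up h) (contents-++ (prefix rr B₁) _) valid))
      where
      peel : ∀ o c r {v} → Up h (o ++ reverse (c ∷ r) ++ v) → ∃ λ g → Up g (c ∷ v)
      peel o c r {v} u = _ , Up-drop (reverse r) (subst (Up _) (reverse-∷-++ c r v) (Up-drop o u))
      head-zero : ∀ R → Tr 0 R _ ((0 , mk (val (starL x)) z) ∷ w) → Up h (o₁ ++ reverse (contents R) ++ 0 ∷ 1 ∷ contents (suffix ((0 , mk b q) ∷ B₄) D)) → ⊥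
      head-zero ((.0 , _) ∷ R) (pass () _) u
      head-zero ((c , _) ∷ R) (move n _ _) u with near⇒ 0 c n | peel o₁ c (contents R) u
      ... | inj₁ refl | _ , v = Up-≢ v refl
      ... | inj₂ (inj₁ refl) | _ , v = no-zigzag v
      head-zero ((.1 , _) ∷ R) (exch _) u with peel o₁ 1 (contents R) u
      ... | _ , v = no-zigzag v

    next-state : Next (state rr B₁ (0 , x) ((1 , mk b true) ∷ (0 , mk b q) ∷ B₄) D)
      (upd (upd A p p nothing) (suc p) (suc p) (just x))
      (upd (upd (upd B (suc p) (suc p) nothing) p p (just (mk b q))) p (suc p) (just (mk b false))) vs
    next-state = record
      { rr = rr ; B₁ = B₁′ ; a = 0 , x ; B₂ = B₄ ; D = D ; inv = inv′
      ; CA = recast true (sym (split (α (0 , x) ∷ suffix B₄ D))) (DoubleMove.S3-A {h} {prefix rr B₁} {suffix B₄ D} level {A} {x} {b} {q} CA)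
      ; CB = recast false (sym (split (α (0 , x) ∷ suffix B₄ D))) (DoubleMove.S3-B {h} {prefix rr B₁} {suffix B₄ D} level {B} {x} {b} {q} CB)
      ; back = λ F → Fold-at (prefix rr B₁) (λ G → λ { (fb t (fb t′ (fa r))) →
                   fa (fb (move refl (λ { (() , _) }) t) (fb (move refl (free G t) t′) r)) })
                 (refold (split (α (0 , x) ∷ suffix B₄ D)) F) }

-- Insertion of a box, far letters and diagonal letters

⊕-inc : ∀ c h v → inc c h ⊕ v ≗ inc c (h ⊕ v)
⊕-inc c h [] d = refl
⊕-inc c h (e ∷ v) d = trans (⊕-cong v (inc-comm e c h) d) (⊕-inc c (inc e h) v d)

⊕-insert : ∀ h u c v → h ⊕ (u ++ c ∷ v) ≗ inc c (h ⊕ (u ++ v))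
⊕-insert h [] c v = ⊕-inc c h v
⊕-insert h (e ∷ u) c v = ⊕-insert (inc e h) u c v

placed-++ : ∀ {A : Set} h (u v : List (ℕ × A)) → placed h (u ++ v) ≡ placed h u ++ placed (h ⊕ contents u) v
placed-++ h [] v = refl
placed-++ h ((c , x) ∷ u) v = cong (_ ∷_) (placed-++ (inc c h) u v)

far-0 : ∀ {c} → c ≢ 0 → c ≢ 1 → near 0 c ≡ false
far-0 {zero} n m = ⊥-elim (n refl)
far-0 {suc zero} n m = ⊥-elim (m refl)
far-0 {suc (suc c)} n m = refl

Tr-far : ∀ s w → All (λ e → near s (proj₁ e) ≡ false) w → Tr s w s w
Tr-far s [] [] = nil
Tr-far s (e ∷ w) (f ∷ fs) = pass f (Tr-far s w fs)

Tr-pass : ∀ {s u v s′ w′} → All (λ e → near s (proj₁ e) ≡ false) u → Tr s v s′ w′ → Tr s (u ++ v) s′ (u ++ w′)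
Tr-pass [] t = t
Tr-pass (f ∷ fs) t = pass f (Tr-pass fs t)

contents-All : ∀ {A : Set} {P : ℕ → Set} (w : List (ℕ × A)) → All P (contents w) → All (λ e → P (proj₁ e)) w
contents-All [] [] = []
contents-All (e ∷ w) (p ∷ ps) = p ∷ contents-All w ps

All-contents : ∀ {A : Set} {P : ℕ → Set} (w : List (ℕ × A)) → All (λ e → P (proj₁ e)) w → All P (contents w)
All-contents [] [] = []
All-contents (e ∷ w) (p ∷ ps) = p ∷ All-contents w ps

fill-none : ∀ {A : Set} h (w : List (ℕ × A)) {i d} → All (λ e → proj₁ e ≢ d) w → fill h w i d ≡ nothing
fill-none h [] [] = refl
fill-none h ((c , x) ∷ w) (n ∷ ns) = trans (fill-miss h c x w (inj₂ n)) (fill-none (inc c h) w ns)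

last-zero : ∀ (w : List Entry) → All (λ e → proj₁ e ≢ 0) w ⊎
  (∃ λ u → ∃ λ y → ∃ λ v → w ≡ u ++ (0 , y) ∷ v × All (λ e → proj₁ e ≢ 0) v)
last-zero [] = inj₁ []
last-zero ((c , x) ∷ w) with last-zero w
... | inj₂ (u , y , v , e , a) = inj₂ ((c , x) ∷ u , y , v , cong ((c , x) ∷_) e , a)
last-zero ((zero , x) ∷ w) | inj₁ a = inj₂ ([] , x , w , refl , a)
last-zero ((suc c , x) ∷ w) | inj₁ a = inj₁ ((λ ()) ∷ a)

reverse⁺ : ∀ {A : Set} {P : A → Set} {w} → All P w → All P (reverse w)
reverse⁺ [] = []
reverse⁺ {P = P} {e ∷ w} (p ∷ ps) = subst (All P) (sym (reverse-∷′ e w)) (++⁺ (reverse⁺ ps) (p ∷ []))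

-- Moves from content 1 to the main diagonal, and the switches S4 and S7

module SwitchingSteps (h : Shape) (k l : ℤ) (bits : ℤ → Bool) where
  open Switching h k l bits

  -- After a diagonal letter the later letters of the same value are unprimed with rising contents,
  -- so nothing of positive content fits in before content 1.
  ascending : ∀ {y c x v} → Val l (0 , y) → Val l (c , x) → (0 , y) ≺ (c , x) → Val l (1 , v) → (c , x) ≺ (1 , v) → c ≡ 0
  ascending refl e (by-val r) _ _ = ⊥-elim (ℤₚ.<-irrefl (sym e) r)
  ascending refl e (uu _) f (by-val r) = ⊥-elim (ℤₚ.<-irrefl (sym f) r)
  ascending refl e (uu _) f (uu q) = n≤0⇒n≡0 (≤-pred q)
  ascending refl e pu f (by-val r) = ⊥-elim (ℤₚ.<-irrefl (sym f) r)
  ascending refl e pu f (uu q) = n≤0⇒n≡0 (≤-pred q)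

  -- Where an a-box of content 1 faces a b-box south of it, its western
  -- neighbour is an a-box unless the run to be folded avoids the diagonal.
  module Guard {rr B₁ x y B₃ D vs A} (inv : Inv rr B₁ (1 , x) ((0 , y) ∷ B₃) D vs)
    (CA : Cells A (view true h (state rr B₁ (1 , x) ((0 , y) ∷ B₃) D))) where
    open Inv inv hiding (s; x)

    g-0 : g 0 ≡ suc p
    g-0 = addable-south prof-g (Up-Prof (Up-tail valid-at))

    -- Consider the last diagonal letter of `B₁`. At the end of `B₁` it contradicts `history`.
    -- Otherwise `y`, which the completed slide puts on content 1, forces the letter after it onto
    -- the diagonal by `ascending`.
    no-b : ∀ {z} → fill (h ⊕ contents (map α (reverse rr))) (map β B₁) p 0 ≡ just (false , z) → ⊥
    no-b {z} e with last-zero B₁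
    ... | inj₁ a = nothing≢just (fill-none _ (map β B₁) (contents-All (map β B₁) (subst (All (λ c → c ≢ 0)) (sym (contents-β B₁)) (All-contents B₁ a)))) e
    ... | inj₂ (u , y₁ , [] , q , _) = history refl q refl
    ... | inj₂ (u , y₁ , (c , x₁) ∷ v , q , n ∷ _) = n (ascending (proj₁ vals-l) (proj₁ (proj₂ vals-l)) (first-link path) (proj₂ (proj₂ vals-l)) (to-last path))
      where
      t = Tr-exists 0 B₃
      std : Standard bits (B₁ ++ (1 , y) ∷ proj₁ (proj₂ t))
      std = completed (move refl (λ { (() , _) }) (proj₂ (proj₂ t)))
      path : Path bits (just (0 , y₁)) ((c , x₁) ∷ (v ++ (1 , y) ∷ proj₁ (proj₂ t))) nothing
      path = Path-suffix u (subst (λ w → Path bits nothing w nothing) (trans (cong (_++ (1 , y) ∷ proj₁ (proj₂ t)) q) (++-assoc u ((0 , y₁) ∷ (c , x₁) ∷ v) _)) std)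
      first-link : ∀ {w} → Path bits (just (0 , y₁)) ((c , x₁) ∷ w) nothing → (0 , y₁) ≺ (c , x₁)
      first-link (r ∷ _) = Link⇒≺ r
      to-last : ∀ {w} → Path bits (just (0 , y₁)) ((c , x₁) ∷ (v ++ (1 , y) ∷ w)) nothing → (c , x₁) ≺ (1 , y)
      to-last (_ ∷ r) with ++⁻ʳ v (Path⇒≺ r)
      ... | z ∷ _ = z
      vals-l : Val l (0 , y₁) × Val l (c , x₁) × Val l (1 , y)
      vals-l with ++⁻ʳ u (subst (All (Val l)) q (++⁻ˡ B₁ valB)) | ++⁻ʳ B₁ valB
      ... | a ∷ b ∷ _ | d ∷ _ = a , b , d

    guard : (∀ z → A p p ≢ just z) → ∀ {R₁ o₁ z w} → Fold [] (prefix rr B₁) R₁ o₁ → R₁ ≢ (0 , z) ∷ w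
    guard none F refl with h 0 ≤? p
    ... | no q with Fold-no-zero F (no-occurrence h (contents (prefix rr B₁)) 0 (≤-trans (≤-reflexive g-0) (≰⇒> q))) []
    ...   | n ∷ _ = n refl
    guard none F refl | yes q with fill-box h (prefix rr B₁) q (≤-reflexive (sym g-0))
    ... | (true , z) , e = none z (trans (cong (A p) (sym (+-identityʳ p))) (trans (cell CA p 0)
            (cong (pick true) (trans (fill-++ h (prefix rr B₁) _ p 0) (cong (_<∣> fill g (α (1 , x) ∷ suffix ((0 , y) ∷ B₃) D) p 0) e)))))
    ... | (false , z) , e with <∣>-just (fill h (map α (reverse rr)) p 0) _ (trans (sym (fill-++ h (map α (reverse rr)) (map β B₁) p 0)) e)
    ...   | inj₁ e₁ = no-β (fill h (reverse rr) p 0) (trans (sym (fill-α h (reverse rr) p 0)) e₁)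
    ...   | inj₂ (_ , e₁) = no-b e₁

  -- If the diagonal a-box were not the last waiting one, the last waiting letter would be unprimed,
  -- and by the slope of the profile its column would not lie west of that of `x`, against `Ahead`.
  diagonal-last : ∀ rr {p x z} → All (Val k) rr → Falling rr → primed x ≡ false →
    (∀ {c y rr₀} → rr ≡ (c , y) ∷ rr₀ → Prof (h ⊕ contents (reverse rr₀))) →
    Ahead rr p (p + 1) x → fill h (reverse rr) p 0 ≡ just z →
    ∃ λ rr₀ → rr ≡ (0 , z) ∷ rr₀ × p ≡ (h ⊕ contents (reverse rr₀)) 0
  diagonal-last ((c , y) ∷ rr) {p} {x} {z} (v ∷ vs) (f ∷ _) ux pf ah e
    with <∣>-just (fill h (reverse rr) p 0) _ (trans (sym (trans (cong (λ w → fill h w p 0) (reverse-∷ (c , y) rr)) (fill-++ h (reverse rr) ((c , y) ∷ []) p 0))) e)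
  ... | inj₂ (_ , e₁) with at? ((h ⊕ contents (reverse rr)) c) c p 0
  ...   | here with trans (sym e₁) (fill-hit (h ⊕ contents (reverse rr)) 0 y [])
  ...     | refl = rr , refl , refl
  diagonal-last ((c , y) ∷ rr) {p} (v ∷ vs) (f ∷ _) ux pf ah e | inj₂ (_ , e₁) | other n
    = ⊥-elim (nothing≢just (fill-miss (h ⊕ contents (reverse rr)) c y [] (≢-flip n)) e₁)
  diagonal-last ((c , y) ∷ rr) {p} {x} {z} (v ∷ vs) (f ∷ _) ux pf ah e | inj₁ e₁ =
    ⊥-elim (1+n≰n (≤-trans (proj₂ (fill-region h (reverse rr) e₁)) (≤-trans (Prof-slope (pf refl) c 0)
      (≤-trans (≤-reflexive (trans (+-comm c _) (cong (λ q → (h ⊕ contents (reverse rr)) q + c) (+-identityʳ c))))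
        (≤-pred (≤-trans col-bound (≤-reflexive (+-comm p 1))))))))
    where
    zk : val z ≡ k
    zk = placed-All h (reverse rr) (placed-entries h (reverse rr) (reverse⁺ vs)) e₁
    z≺y : (0 , z) ≺ (c , y)
    z≺y = placed-All h (reverse rr) (placed-entries h (reverse rr) (reverse⁺ f)) e₁
    plain : (0 , z) ≺ (c , y) → primed y ≡ false
    plain (by-val r) = ⊥-elim (ℤₚ.<-irrefl (trans zk (sym v)) r)
    plain (uu _) = refl
    plain pu = refl
    col-bound : (h ⊕ contents (reverse rr)) c + c < p + 1
    col-bound with ++⁻ʳ (placed h (reverse rr)) (subst (All _) (trans (cong (placed h) (reverse-∷ (c , y) rr)) (placed-++ h (reverse rr) ((c , y) ∷ []))) (proj₁ ah ux))
    ... | r ∷ _ = r (plain z≺y)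

  -- Here the moving box keeps its cell and acquires a prime, while the waiting diagonal box `z` is
  -- finished at once; the two change their order. Before the switch `z` is listed next to the
  -- moving box, and afterwards it is listed behind the remaining b-boxes; all b-boxes it crosses in
  -- this relisting are far from the main diagonal.
  module Turn {rr rr₀ B₁ z v y B₃ D vs A B} (inv : Inv rr B₁ (1 , mk v false) ((0 , y) ∷ B₃) D vs)
    (CA : Cells A (view true h (state rr B₁ (1 , mk v false) ((0 , y) ∷ B₃) D)))
    (CB : Cells B (view false h (state rr B₁ (1 , mk v false) ((0 , y) ∷ B₃) D)))
    (er : rr ≡ (0 , z) ∷ rr₀) (p≡ : before rr B₁ 1 ≡ (h ⊕ contents (reverse rr₀)) 0) where
    open Inv inv hiding (s; x)

    reverse-rr : reverse rr ≡ reverse rr₀ ++ (0 , z) ∷ []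
    reverse-rr = trans (cong reverse er) (reverse-∷′ (0 , z) rr₀)

    U W : List TEntry
    U = map α (reverse rr₀)
    W = α (1 , mk v false) ∷ suffix ((0 , y) ∷ B₃) D
    g₁ gP : Shape
    g₁ = h ⊕ contents U
    gP = before rr₀ B₁

    g₁-0 : g₁ 0 ≡ p
    g₁-0 = trans (cong (λ w → (h ⊕ w) 0) (contents-α (reverse rr₀))) (sym p≡)

    listed : state rr B₁ (1 , mk v false) ((0 , y) ∷ B₃) D ≡ U ++ α (0 , z) ∷ (map β B₁ ++ W)
    listed = trans (cong (λ w → (map α w ++ map β B₁) ++ W) reverse-rr)
      (trans (cong (λ w → (w ++ map β B₁) ++ W) (map-++ α (reverse rr₀) ((0 , z) ∷ [])))
      (trans (++-assoc (U ++ α (0 , z) ∷ []) (map β B₁) W) (++-assoc U (α (0 , z) ∷ []) (map β B₁ ++ W))))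

    up₁ : Up g₁ (0 ∷ contents (map β B₁ ++ W))
    up₁ = Up-drop (contents U) (subst (Up h) (trans (cong contents listed) (contents-++ U _)) valid)

    g-split : g ≗ inc 0 gP
    g-split d = trans (cong (λ w → (h ⊕ w) d) eq) (trans (⊕-insert h (contents U) 0 (contents (map β B₁)) d)
      (cong (λ w → inc 0 (h ⊕ w) d) (sym (contents-++ U (map β B₁)))))
      where
      eq : contents (prefix rr B₁) ≡ contents U ++ 0 ∷ contents (map β B₁)
      eq = trans (cong contents (trans (cong (λ w → map α w ++ map β B₁) reverse-rr)
        (trans (cong (_++ map β B₁) (map-++ α (reverse rr₀) ((0 , z) ∷ []))) (++-assoc U (α (0 , z) ∷ []) (map β B₁))))) (contents-++ U _)

    g-0 : g 0 ≡ suc p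
    g-0 = addable-south prof-g (Up-Prof (Up-tail valid-at))

    gP-0 : gP 0 ≡ p
    gP-0 = suc-injective (trans (sym (g-split 0)) g-0)

    gP-1 : gP 1 ≡ p
    gP-1 = sym (g-split 1)

    level : gP 0 ≡ gP 1
    level = trans gP-0 (sym gP-1)

    gP≡ : gP ≡ g₁ ⊕ contents (map β B₁)
    gP≡ = trans (cong (h ⊕_) (contents-++ U (map β B₁))) (⊕-++ h (contents U) (contents (map β B₁)))

    far-B₁ : All (λ e → near 0 (proj₁ e) ≡ false) B₁
    far-B₁ = zip (contents-All B₁ (subst (All (λ c → c ≢ 0)) (contents-β B₁) (no-occurrence g₁ (contents (map β B₁)) 0
                 (≤-reflexive (trans (cong (λ k → k 0) (sym gP≡)) (trans gP-0 (sym g₁-0)))))))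
               (contents-All B₁ (subst (All (λ c → c ≢ 1)) (contents-β B₁) (no-occurrence g₁ (contents (map β B₁)) 1
                 (≤-reflexive (trans (cong (λ k → k 1) (sym gP≡)) (trans gP-1 (trans (sym g₁-0) (addable-east (Up-Prof up₁) (Up-Prof (Up-tail up₁))))))))))
      where
      zip : ∀ {w} → All (λ e → proj₁ e ≢ 0) w → All (λ e → proj₁ e ≢ 1) w → All (λ (e : Entry) → near 0 (proj₁ e) ≡ false) w
      zip [] [] = []
      zip {(c , _) ∷ _} (a ∷ as) (b ∷ bs) = far-0 {c} a b ∷ zip as bs

    val-l : Val l (0 , y) × All (Val l) B₃
    val-l with ++⁻ʳ B₁ valB
    ... | a ∷ b = a , b

    -- The chain forbids the contents 0 and 1 directly after the contents 1, 0. From there on the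
    -- contents of the b-run only rise.
    far-B₃ : ∀ B₃ → Up g (1 ∷ 0 ∷ contents (suffix B₃ D)) → Path bits (just (0 , y)) B₃ nothing → All (Val l) B₃ →
      All (λ e → near 0 (proj₁ e) ≡ false) B₃
    far-B₃ [] u p _ = []
    far-B₃ ((c , x₁) ∷ B₃) u (r ∷ q) (vx ∷ vB) = far-0 {c} c≢0 c≢1 ∷ later B₃ vB (Path⇒≺ q)
      where
      c≢0 : c ≢ 0
      c≢0 e = Up-≢ (Up-tail u) (sym e)
      c≢1 : c ≢ 1
      c≢1 refl = no-zigzag u
      far-later : ∀ {c′ x′} → val x′ ≡ l → (0 , y) ≺ (c , x₁) → (c , x₁) ≺ (c′ , x′) → near 0 c′ ≡ false
      far-later e (by-val r) _ = ⊥-elim (ℤₚ.<-irrefl (trans (proj₁ val-l) (sym vx)) r)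
      far-later e _ (by-val r) = ⊥-elim (ℤₚ.<-irrefl (trans vx (sym e)) r)
      far-later {c′} e (uu _) (uu o) = far-0 {c′} (λ { refl → n≮0 o }) (λ { refl → c≢0 (n≤0⇒n≡0 (≤-pred o)) })
      far-later {c′} e pu (uu o) = far-0 {c′} (λ { refl → n≮0 o }) (λ { refl → c≢0 (n≤0⇒n≡0 (≤-pred o)) })
      later : ∀ w → All (Val l) w → All ((c , x₁) ≺_) w → All (λ e → near 0 (proj₁ e) ≡ false) w
      later [] [] [] = []
      later (e ∷ w) (v ∷ vs) (o ∷ os) = far-later v (Link⇒≺ r) o ∷ later w vs os

    fars : All (λ e → near 0 (proj₁ e) ≡ false) B₃
    fars = far-B₃ B₃ valid-at (Path-rest rest) (proj₂ val-l)

    M₂ M₃ M₄ : List TEntry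
    M₂ = prefix rr₀ B₁ ++ α (0 , z) ∷ W
    M₃ = prefix rr₀ B₁ ++ β (0 , y) ∷ α (1 , mk v true) ∷ α (0 , z) ∷ suffix B₃ D
    M₄ = state rr₀ (B₁ ++ (0 , y) ∷ []) (1 , mk v true) B₃ ((0 , z) ∷ D)

    to-M₂ : state rr B₁ (1 , mk v false) ((0 , y) ∷ B₃) D ≈ M₂
    to-M₂ = ≈-trans (≈-≡ listed) (≈-trans (≈-prefix U (≈-pass (0 , z) B₁ W far-B₁)) (≈-≡ (sym (++-assoc U (map β B₁) (α (0 , z) ∷ W)))))

    to-M₄ : M₃ ≈ M₄
    to-M₄ = ≈-trans (≈-trans (≈-≡ (sym (++-assoc (prefix rr₀ B₁) (β (0 , y) ∷ α (1 , mk v true) ∷ []) (α (0 , z) ∷ (map β B₃ ++ map α D)))))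
        (≈-trans (≈-prefix (prefix rr₀ B₁ ++ β (0 , y) ∷ α (1 , mk v true) ∷ []) (≈-pass (0 , z) B₃ (map α D) fars))
          (≈-≡ (++-assoc (prefix rr₀ B₁) (β (0 , y) ∷ α (1 , mk v true) ∷ []) (map β B₃ ++ α (0 , z) ∷ map α D)))))
      (≈-≡ (sym (prefix-snoc rr₀ B₁ (0 , y) (α (1 , mk v true) ∷ suffix B₃ ((0 , z) ∷ D)))))

    valid-M₄ : Up h (contents M₄)
    valid-M₄ = _≈_.Up-same to-M₄ (subst (Up h) (trans (contents-++ (prefix rr₀ B₁) _) (sym (contents-++ (prefix rr₀ B₁) _))) (_≈_.Up-same to-M₂ valid))

    val-v : v ≡ k
    val-v with subst (λ r → All (Val k) (_ ∷ r)) er valA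
    ... | e ∷ _ = e

    val-z : val z ≡ k
    val-z with subst (λ r → All (Val k) (_ ∷ r)) er valA
    ... | _ ∷ e ∷ _ = e

    val-rr₀ : All (Val k) rr₀
    val-rr₀ with subst (λ r → All (Val k) (_ ∷ r)) er valA
    ... | _ ∷ _ ∷ e = e

    falling-0 : All (_≺ (0 , z)) rr₀
    falling-0 with subst Falling er falling
    ... | e ∷ _ = e

    falling-rr₀ : Falling rr₀
    falling-rr₀ with subst Falling er falling
    ... | _ ∷ e = e

    new-row : before rr₀ (B₁ ++ (0 , y) ∷ []) 1 ≡ p
    new-row = trans (cong (λ k → k 1) (before-snoc rr₀ B₁ (0 , y))) gP-1

    ahead′ : Ahead rr₀ (before rr₀ (B₁ ++ (0 , y) ∷ []) 1) (before rr₀ (B₁ ++ (0 , y) ∷ []) 1 + 1) (mk v true)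
    ahead′ = (λ ()) , λ _ → combine (placed h (reverse rr₀)) (placed-below h (reverse rr₀))
        (placed-entries h (reverse rr₀) (reverse⁺ falling-0)) (placed-entries h (reverse rr₀) (reverse⁺ val-rr₀))
      where
      row-bound : ∀ {i c} → i < (h ⊕ contents (reverse rr₀)) c → i < before rr₀ (B₁ ++ (0 , y) ∷ []) 1
      row-bound {i} {c} q = ≤-trans q (≤-trans (≤-reflexive (cong (λ w → (h ⊕ w) c) (sym (contents-α (reverse rr₀)))))
        (≤-trans (Prof-≤ (Up-Prof up₁) z≤n) (≤-reflexive (trans g₁-0 (sym new-row)))))
      primed-first : ∀ {c x} → val x ≡ k → (c , x) ≺ (0 , z) → primed x ≡ true
      primed-first e (by-val r) = ⊥-elim (ℤₚ.<-irrefl (trans e (sym val-z)) r)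
      primed-first e (pp _) = refl
      primed-first e pu = refl
      combine : ∀ w → All (λ { (i , c , _) → i < (h ⊕ contents (reverse rr₀)) c }) w → All (λ b → proj₂ b ≺ (0 , z)) w →
        All (λ b → Val k (proj₂ b)) w →
        All (λ b → primed (proj₂ (proj₂ b)) ≡ true × proj₁ b < before rr₀ (B₁ ++ (0 , y) ∷ []) 1) w
      combine [] [] [] [] = []
      combine (_ ∷ w) (a ∷ as) (b ∷ bs) (c ∷ cs) = (primed-first c b , row-bound a) ∷ combine w as bs cs

    -- For the b-run the switch amounts to two ordinary slides: the box on content 1 takes the place
    -- of `y` and passes the rest, then `z` brings `y` back to the main diagonal and goes on from
    -- content 1. The old invariant covers the former and `Tr-Standard` the latter.
    completed′ : ∀ {s′ w′} → Tr 1 B₃ s′ w′ → Standard bits ((B₁ ++ (0 , y) ∷ []) ++ w′)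
    completed′ {s′} {w′} t = subst (Standard bits) (sym (snoc-++ B₁ (0 , y) w′))
      (Tr-Standard {g = g₁} (Tr-pass far-B₁ (move refl (not-swap fars) t)) up₂ (completed (move refl (λ { (() , _) }) (Tr-far 0 B₃ fars))))
      where
      not-swap : ∀ {B₃} → All (λ e → near 0 (proj₁ e) ≡ false) B₃ → ¬ Swap 0 1 y B₃
      not-swap (() ∷ _) (_ , _ , _ , _ , _ , refl)
      shorten : ∀ {g} → Up g (1 ∷ 0 ∷ contents (suffix B₃ D)) → Up g (1 ∷ contents B₃)
      shorten {g} (q ▸ u) = q ▸ subst (Up (inc 1 g)) (proj₁ (emit-far 0 (contents B₃) (All-contents B₃ fars)))
        (Up-take (emit 0 (contents B₃)) (Up-emit 0 (contents B₃) (contents (map α D))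
          (subst (λ w → Up (inc 1 g) (0 ∷ w)) (trans (contents-++ (map β B₃) (map α D)) (cong (_++ contents (map α D)) (contents-β B₃))) u)))
      up₂ : Up g₁ (0 ∷ contents (B₁ ++ (1 , y) ∷ B₃))
      up₂ = subst (λ w → Up g₁ (0 ∷ w)) (trans (cong (_++ 1 ∷ contents B₃) (contents-β B₁)) (sym (contents-++ B₁ ((1 , y) ∷ B₃))))
        (Up-prefix (0 ∷ contents (map β B₁)) shorten (subst (λ w → Up g₁ (0 ∷ w)) (contents-++ (map β B₁) W) up₁))

    inv′ : Inv rr₀ (B₁ ++ (0 , y) ∷ []) (1 , mk v true) B₃ ((0 , z) ∷ D) vs
    inv′ = record
      { valid = valid-M₄ ; valA = val-v ∷ val-rr₀ ; valB = subst (All (Val l)) (sym (snoc-++ B₁ (0 , y) B₃)) valB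
      ; falling = falling-rr₀ ; ahead = ahead′ ; completed = completed′ ; rest = _ , Path-rest rest
      ; history = λ _ _ → not-zero fars
      ; values = trans (cong vals (snoc-++ B₁ (0 , y) B₃)) values }
      where
      not-zero : ∀ {B₃ y′ B₄} → All (λ e → near 0 (proj₁ e) ≡ false) B₃ → B₃ ≢ (0 , y′) ∷ B₄
      not-zero (() ∷ _) refl

    turn-back : ∀ {R R′ os z v} → val z ≡ v → Fold R (β (0 , y) ∷ α (1 , mk v true) ∷ α (0 , z) ∷ suffix B₃ D) R′ os →
      Fold R (α (0 , z) ∷ α (1 , mk v false) ∷ β (0 , y) ∷ suffix B₃ D) R′ os
    turn-back {z = mk _ true} refl (fb t (fa (fa r))) = fa (fa (fb (exch t) r))
    turn-back {z = mk _ false} refl (fb t (fa (fa r))) = fa (fa (fb (exch t) r))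

    next-state : Next (state rr B₁ (1 , mk v false) ((0 , y) ∷ B₃) D)
      (upd (upd (upd A p p nothing) p (suc p) (just (mk v true))) (suc p) (suc p) (just z))
      (upd (upd B (suc p) (suc p) nothing) p p (just y)) vs
    next-state = record
      { rr = rr₀ ; B₁ = B₁ ++ (0 , y) ∷ [] ; a = 1 , mk v true ; B₂ = B₃ ; D = (0 , z) ∷ D ; inv = inv′
      ; CA = Cells-cong (subst (λ q → Cells (upd (upd (upd A q q nothing) q (suc q) (just (mk v true))) (suc q) (suc q) (just z)) (view true h M₃)) gP-0
               (DoubleMove.S4-A {h} {prefix rr₀ B₁} {suffix B₃ D} level {A} {z} {v} {y} (Cells-cong CA λ i d → cong (pick true) (_≈_.fill-same to-M₂ h i d))))
               λ i d → cong (pick true) (_≈_.fill-same to-M₄ h i d)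
      ; CB = Cells-cong (subst (λ q → Cells (upd (upd B (suc q) (suc q) nothing) q q (just y)) (view false h M₃)) gP-0
               (DoubleMove.S4-B {h} {prefix rr₀ B₁} {suffix B₃ D} level {B} {z} {v} {y} (Cells-cong CB λ i d → cong (pick false) (_≈_.fill-same to-M₂ h i d))))
               λ i d → cong (pick false) (_≈_.fill-same to-M₄ h i d)
      ; back = λ F → _≈_.Fold-back to-M₂ (Fold-at (prefix rr₀ B₁) (λ _ r → turn-back (trans val-z (sym val-v)) r) (_≈_.Fold-back to-M₄ F)) }

-- Running the switching process for one letter on each side

module SwitchingRun (h : Shape) (k l : ℤ) (bits : ℤ → Bool) where
  open Switching h k l bits
  open SwitchingSteps h k l bits

  val-irrefl : ∀ {x y} → val x ≡ l → val y ≡ l → ¬ (val x ℤ.< val y)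
  val-irrefl e f r = ℤₚ.<-irrefl (trans e (sym f)) r

  next-zero-box : ∀ {y B₃ z} → y ≡ mk (val y) true → Path bits (just (1 , y)) B₃ nothing → first 0 B₃ ≡ just z → val z ≡ val y →
    ∃ λ B₄ → B₃ ≡ (0 , mk (val y) (primed z)) ∷ B₄
  next-zero-box {mk v true} refl p e refl = next-zero p e

  starL-primed : ∀ {x} → primed (starL x) ≡ true → primed x ≡ false
  starL-primed {mk v false} _ = refl

  -- The first near b-box ahead is the east or the south neighbour of the moving box. The order of
  -- the b-run then rules out every switch that would need the other neighbour to come earlier.
  module Advance {rr B₁ s x c y B₃ D vs A B} (f : near s c ≡ true) (inv : Inv rr B₁ (s , x) ((c , y) ∷ B₃) D vs)
    (CA : Cells A (view true h (state rr B₁ (s , x) ((c , y) ∷ B₃) D)))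
    (CB : Cells B (view false h (state rr B₁ (s , x) ((c , y) ∷ B₃) D))) where
    open Inv inv hiding (s; x)
    open Neighbours {B} {h} {prefix rr B₁} {s} {true , x} {(c , y) ∷ B₃} {D} CB valid-at

    val-y : val y ≡ l
    val-y with ++⁻ʳ B₁ valB
    ... | e ∷ _ = e

    val-B₃ : All (Val l) B₃
    val-B₃ with ++⁻ʳ B₁ valB
    ... | _ ∷ e = e

    order : ∀ {d z} → d ≢ c → first d ((c , y) ∷ B₃) ≡ just z → (c , y) ≺ (d , z) × val z ≡ l
    order {d} n e = first-All B₃ (Path⇒≺ (Path-rest rest)) e′ , first-All B₃ val-B₃ e′
      where
      e′ = trans (sym (first-other {c = d} {c} y B₃ λ q → n (sym q))) e

    x-is : ∀ {z} → A p (p + s) ≡ just z → x ≡ z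
    x-is e = just-injective (trans (sym (a-cell CA CB)) e)

    module East (e : suc s ≡ c) where
      E : B p (suc (p + s)) ≡ just y
      E = trans b-east (trans (cong (λ d → first d ((c , y) ∷ B₃)) e) (first-same c y B₃))

      candidate : IsBox B p (suc (p + s)) ⊎ IsBox B (suc p) (p + s)
      candidate = inj₁ (y , E)

      south-blocked : ∀ {z} s′ → s ≡ s′ → primed y ≡ false → ¬ (B (suc p) (p + s) ≡ just z)
      south-blocked zero q u e′ = nothing≢just (b-south-empty q) e′
      south-blocked {z} (suc t) q u e′ = impossible {y} u val-y (proj₁ o) (proj₂ o)
        where
        t<c : t < c
        t<c = ≤-trans (≤-trans (≤-reflexive (sym q)) (n≤1+n s)) (≤-reflexive e)
        o = order {t} (<⇒≢ t<c) (trans (sym (b-south q)) e′)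
        impossible : ∀ {y z} → primed y ≡ false → val y ≡ l → (c , y) ≺ (t , z) → val z ≡ l → ⊥
        impossible {y} {z} u e (by-val r) v = val-irrefl {y} {z} e v r
        impossible u e (uu r) v = <-asym t<c r

      move-east : ∀ {z w} → A p (p + s) ≡ just z → B p (suc (p + s)) ≡ just w → ¬ Swap s c y B₃ →
        Next (state rr B₁ (s , x) ((c , y) ∷ B₃) D) (swapA A p (p + s) p (suc (p + s)) z) (swapB B p (p + s) p (suc (p + s)) w) vs
      move-east e₁ e₂ n with x-is e₁ | just-injective (trans (sym E) e₂)
      ... | refl | refl = subst (λ q → Next (state rr B₁ (s , x) ((c , y) ∷ B₃) D) (swapA A p (p + s) p q x) (swapB B p (p + s) p q y) vs) (trans (cong (p +_) (sym e)) (+-suc p s))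
            (Move.next-state f inv CA CB n (Move.east-row f inv CA CB n (sym e)) λ { _ (z , _) → 1+n≢0 (trans e z) })

      exchange-east : ∀ {z b w} → s ≡ 0 → A p p ≡ just z → B p (suc p) ≡ just (mk b true) → B (suc p) (suc p) ≡ just w →
        Next (state rr B₁ (s , x) ((c , y) ∷ B₃) D) (upd (upd A p p nothing) (suc p) (suc p) (just z))
          (upd (upd (upd B (suc p) (suc p) nothing) p p (just w)) p (suc p) (just (mk b false))) vs
      exchange-east {z} {b} {w} s≡0 e₁ e₂ e₃ = build s≡0 e (x-is (trans (cong (A p) p+s≡p) e₁)) y≡ w≡ (proj₂ found) inv CA CB
        where
        p+s≡p : p + s ≡ p
        p+s≡p = trans (cong (p +_) s≡0) (+-identityʳ p)
        y≡ : y ≡ mk b true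
        y≡ = just-injective (trans (sym E) (trans (cong (λ k → B p (suc k)) p+s≡p) e₂))
        first-w : first 0 B₃ ≡ just w
        first-w = trans (sym (first-other {c = 0} {c} y B₃ λ q → 1+n≢0 (trans e q))) (trans (sym (b-diagonal s≡0)) e₃)
        val-w : val w ≡ val y
        val-w = trans (first-All B₃ val-B₃ first-w) (sym val-y)
        w≡ : w ≡ mk (val y) (primed w)
        w≡ = cong (λ v → mk v (primed w)) val-w
        found : ∃ λ B₄ → B₃ ≡ (0 , mk (val y) (primed w)) ∷ B₄
        found = next-zero-box (trans y≡ (cong (λ y → mk (val y) true) (sym y≡)))
          (subst (λ d → Path bits (just (d , y)) B₃ nothing) (trans (sym e) (cong suc s≡0)) (Path-rest rest)) first-w val-w
        build : ∀ {s c x y B₃ B₄} → s ≡ 0 → suc s ≡ c → x ≡ z → y ≡ mk b true → w ≡ mk (val y) (primed w) → B₃ ≡ (0 , mk (val y) (primed w)) ∷ B₄ →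
          (inv : Inv rr B₁ (s , x) ((c , y) ∷ B₃) D vs) → Cells A (view true h (state rr B₁ (s , x) ((c , y) ∷ B₃) D)) →
          Cells B (view false h (state rr B₁ (s , x) ((c , y) ∷ B₃) D)) →
          Next (state rr B₁ (s , x) ((c , y) ∷ B₃) D) (upd (upd A (before rr B₁ s) (before rr B₁ s) nothing) (suc (before rr B₁ s)) (suc (before rr B₁ s)) (just z))
            (upd (upd (upd B (suc (before rr B₁ s)) (suc (before rr B₁ s)) nothing) (before rr B₁ s) (before rr B₁ s) (just w)) (before rr B₁ s) (suc (before rr B₁ s)) (just (mk b false))) vs
        build refl refl refl refl w≡ refl inv CA CB rewrite w≡ = Exchange.next-state inv CA CB

      switch : ∀ {i j A′ B′} → SwitchAt A B i j A′ B′ → i ≡ p → j ≡ p + s → Next (state rr B₁ (s , x) ((c , y) ∷ B₃) D) A′ B′ vs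
      switch (S3 e₁ e₂ e₃) refl q = exchange-east (m+n≡m⇒n≡0 p q) e₁ e₂ e₃
      switch (S4 e₁ e₂ e₃ e₄) refl q = ⊥-elim (nothing≢just e₄ (trans (cong (λ k → B p (suc k)) q) E))
      switch (S7 {b = b} e₁ e₂ e₃ e₄) refl q = ⊥-elim (south-blocked s refl
        (cong primed (just-injective (trans (sym E) (trans (cong (λ k → B p (suc k)) (sym q)) e₄)))) (trans (cong (B (suc p)) (sym q)) e₃))
      switch (S5 e₁ e₂ e₃) refl refl = move-east e₁ e₂ λ { (z , _) → nothing≢just (b-south-empty z) e₃ }
      switch (S6 e₁ e₂ e₃ _) refl refl = ⊥-elim (south-blocked s refl (cong primed (just-injective (trans (sym E) e₂))) e₃)
      -- An exceptional pattern would put a b-box on the next cell of the main diagonal, and the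
      -- side condition of S1 excludes this.
      switch (S1 e₁ e₂ e₃ n) refl refl = move-east e₁ e₂ λ { (z , _ , py , q , w , r) → n (trans (cong (p +_) z) (+-identityʳ p) ,
        trans (cong primed (just-injective (trans (sym e₂) E))) py , mk (val y) q ,
        trans (b-diagonal z) (trans (first-other {c = 0} {c} y B₃ λ o → 1+n≢0 (trans e o)) (trans (cong (first 0) r) (first-same 0 (mk (val y) q) w)))) }
      switch (S2 e₁ e₂ _ _) refl refl = ⊥-elim (nothing≢just e₂ E)

    module South (e : s ≡ suc c) where
      S : B (suc p) (p + s) ≡ just y
      S = trans (b-south e) (first-same c y B₃)

      candidate : IsBox B p (suc (p + s)) ⊎ IsBox B (suc p) (p + s)
      candidate = inj₂ (y , S)

      c<1+s : c < suc s
      c<1+s = ≤-trans (≤-reflexive (sym e)) (n≤1+n s)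

      east-blocked : ∀ {b} → ¬ (B p (suc (p + s)) ≡ just (mk b true))
      east-blocked {b} e′ = impossible {y} val-y (proj₁ o) (proj₂ o)
        where
        o = order {suc s} (λ q → <⇒≢ c<1+s (sym q)) (trans (sym b-east) e′)
        impossible : ∀ {y} → val y ≡ l → (c , y) ≺ (suc s , mk b true) → b ≡ l → ⊥
        impossible {y} u (by-val r) v = val-irrefl {y} {mk b true} u v r
        impossible u (pp r) v = <-asym c<1+s r

      move-south : ∀ {z w} → A p (p + s) ≡ just z → B (suc p) (p + s) ≡ just w → ¬ S4cond A p (p + s) z →
        Next (state rr B₁ (s , x) ((c , y) ∷ B₃) D) (swapA A p (p + s) (suc p) (p + s) z) (swapB B p (p + s) (suc p) (p + s) w) vs
      move-south e₁ e₂ n with x-is e₁ | just-injective (trans (sym S) e₂)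
      ... | refl | refl = subst (λ q → Next (state rr B₁ (s , x) ((c , y) ∷ B₃) D) (swapA A p (p + s) (suc p) q x) (swapB B p (p + s) (suc p) q y) vs)
              (trans (sym (+-suc p c)) (cong (p +_) (sym e)))
              -- An exceptional slide in the second reading requires an unprimed `x` and a run that
              -- starts on the main diagonal. An a-box west of `x` would make this S4 or S7, against
              -- `n`; without one, `Guard.guard` keeps the run off the diagonal.
              (Move.next-state f inv CA CB noSwap (Move.south-row f inv CA CB noSwap e) λ { F (c≡0 , _ , px , z , w , r) →
                guarded c≡0 e inv CA (λ a e′ → n (trans (cong (p +_) (trans e (cong suc c≡0))) (+-comm p 1) , starL-primed px , a , e′)) F r })
        where
        noSwap : ¬ Swap s c y B₃
        noSwap (z , _) = 1+n≢0 (trans (sym e) z)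
        guarded : ∀ {s c y B₃} → c ≡ 0 → s ≡ suc c → (inv : Inv rr B₁ (s , x) ((c , y) ∷ B₃) D vs) →
          Cells A (view true h (state rr B₁ (s , x) ((c , y) ∷ B₃) D)) →
          (∀ z → A (before rr B₁ s) (before rr B₁ s) ≢ just z) → ∀ {R₁ o₁ z w} → Fold [] (prefix rr B₁) R₁ o₁ → R₁ ≢ (0 , z) ∷ w
        guarded refl refl inv CA none = Guard.guard inv CA none

      turn-south : ∀ {a z w} → s ≡ 1 → A p (suc p) ≡ just (mk a false) → A p p ≡ just z → B (suc p) (suc p) ≡ just w →
        Next (state rr B₁ (s , x) ((c , y) ∷ B₃) D)
          (upd (upd (upd A p p nothing) p (suc p) (just (mk a true))) (suc p) (suc p) (just z))
          (upd (upd B (suc p) (suc p) nothing) p p (just w)) vs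
      turn-south {a} {z} {w} s≡1 e₁ e₂ e₃ = build s≡1 (suc-injective (trans (sym e) s≡1)) (x-is (trans (cong (A p) p+s) e₁))
          (just-injective (trans (sym S) (trans (cong (B (suc p)) p+s) e₃))) inv CA CB located
        where
        p+s : p + s ≡ suc p
        p+s = trans (cong (p +_) s≡1) (+-comm p 1)
        e₂′ : view true h (state rr B₁ (s , x) ((c , y) ∷ B₃) D) p 0 ≡ just z
        e₂′ = trans (sym (cell CA p 0)) (trans (cong (A p) (+-identityʳ p)) e₂)
        g-0 : g 0 ≡ suc p
        g-0 = trans (addable-south {g} {0} prof-g (subst (λ t → Prof (inc t g)) s≡1 (Up-Prof (Up-tail valid-at)))) (cong (λ t → suc (g t)) (sym s≡1))
        located : fill h (reverse rr) p 0 ≡ just z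
        located with locate (pick-just true _ e₂′)
        ... | inj₁ q = q
        ... | inj₂ (inj₁ (_ , q , _)) = ⊥-elim (1+n≢0 (trans (sym s≡1) (sym q)))
        ... | inj₂ (inj₂ q) = ⊥-elim (1+n≰n (≤-trans (≤-reflexive (sym g-0)) (≤-trans (g≤kD 0) q)))
        build : ∀ {s c x y} → s ≡ 1 → c ≡ 0 → x ≡ mk a false → y ≡ w →
          (inv : Inv rr B₁ (s , x) ((c , y) ∷ B₃) D vs) → Cells A (view true h (state rr B₁ (s , x) ((c , y) ∷ B₃) D)) →
          Cells B (view false h (state rr B₁ (s , x) ((c , y) ∷ B₃) D)) → fill h (reverse rr) (before rr B₁ s) 0 ≡ just z →
          Next (state rr B₁ (s , x) ((c , y) ∷ B₃) D)
            (upd (upd (upd A (before rr B₁ s) (before rr B₁ s) nothing) (before rr B₁ s) (suc (before rr B₁ s)) (just (mk a true))) (suc (before rr B₁ s)) (suc (before rr B₁ s)) (just z))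
            (upd (upd B (suc (before rr B₁ s)) (suc (before rr B₁ s)) nothing) (before rr B₁ s) (before rr B₁ s) (just w)) vs
        build refl refl refl refl inv CA CB q with diagonal-last rr {before rr B₁ 1} {mk a false} {z} (tail-val {1 , mk a false} (Inv.valA inv)) (Inv.falling inv) refl (λ {c} {y} {rr₀} → prof-at {c} {y} {rr₀}) (Inv.ahead inv) q
          where
          tail-val : ∀ {e rr} → All (Val k) (e ∷ rr) → All (Val k) rr
          tail-val (_ ∷ v) = v
          prof-at : ∀ {c y rr₀} → rr ≡ (c , y) ∷ rr₀ → Prof (h ⊕ contents (reverse rr₀))
          prof-at {c} {y} {rr₀} refl = Prof-cong (λ d → cong (λ w → (h ⊕ w) d) (contents-α (reverse rr₀)))
            (Up-Prof (Up-drop (contents (map α (reverse rr₀))) (subst (Up h) (trans (cong contents (trans (++-assoc (map α (reverse rr)) (map β B₁) _)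
              (trans (cong (λ w → map α w ++ _) (reverse-∷′ (c , y) rr₀)) (trans (cong (_++ _) (map-++ α (reverse rr₀) ((c , y) ∷ []))) (++-assoc (map α (reverse rr₀)) _ _)))))
              (contents-++ (map α (reverse rr₀)) _)) (Inv.valid inv))))
        ... | rr₀ , er , p≡ = Turn.next-state inv CA CB er p≡

      switch : ∀ {i j A′ B′} → SwitchAt A B i j A′ B′ → i ≡ p → j ≡ p + s → Next (state rr B₁ (s , x) ((c , y) ∷ B₃) D) A′ B′ vs
      switch (S3 e₁ e₂ e₃) refl q = ⊥-elim (1+n≢0 (trans (sym e) (m+n≡m⇒n≡0 p q)))
      switch (S4 e₁ e₂ e₃ e₄) refl q = turn-south (+-cancelˡ-≡ p s 1 (trans (sym q) (+-comm 1 p))) e₁ e₂ e₃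
      switch (S7 e₁ e₂ e₃ e₄) refl q = turn-south (+-cancelˡ-≡ p s 1 (trans (sym q) (+-comm 1 p))) e₁ e₂ e₃
      switch (S5 e₁ e₂ e₃) refl refl = ⊥-elim (east-blocked e₂)
      switch (S6 e₁ e₂ e₃ n) refl refl = move-south e₁ e₃ n
      switch (S1 e₁ e₂ e₃ n) refl refl = ⊥-elim (nothing≢just e₃ S)
      switch (S2 e₁ e₂ e₃ n) refl refl = move-south e₁ e₃ n

    candidate : IsBox B p (suc (p + s)) ⊎ IsBox B (suc p) (p + s)
    candidate with near⇒ s c f
    ... | inj₁ e = ⊥-elim (Up-≢ valid-at e)
    ... | inj₂ (inj₁ e) = East.candidate e
    ... | inj₂ (inj₂ e) = South.candidate e

    advance : ∀ {i j A′ B′} → Chosen A B i j → SwitchAt A B i j A′ B′ → Next (state rr B₁ (s , x) ((c , y) ∷ B₃) D) A′ B′ vs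
    advance ch sw with chosen CA CB candidate ch | near⇒ s c f
    ... | _ | inj₁ e = ⊥-elim (Up-≢ valid-at e)
    ... | ei , ej | inj₂ (inj₁ e) = East.switch e sw ei ej
    ... | ei , ej | inj₂ (inj₂ e) = South.switch e sw ei ej

  record Result (M : List TEntry) (A B : Filling) (vs : List ℤ) : Set where
    field
      Bf Df  : List Entry
      CA     : Cells A (view true h (map β Bf ++ map α Df))
      CB     : Cells B (view false h (map β Bf ++ map α Df))
      fold   : Fold [] M (starW Df) (contents Bf)
      std    : Standard bits Bf
      values : vals Bf ≡ vs

  Fold-α : ∀ {R} D → Fold R (map α D) (starW D ++ R) []
  Fold-α [] = fnil
  Fold-α {R} (e ∷ D) = fa (subst (λ w → Fold (starE e ∷ R) (map α D) w [])
    (trans (sym (++-assoc (starW D) (starE e ∷ []) R)) (cong (_++ R) (sym (starW-∷ e D)))) (Fold-α D))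

  Fold-settled : ∀ B D → Fold [] (map β B ++ map α D) (starW D) (contents B)
  Fold-settled [] D = subst (λ w → Fold [] (map α D) w []) (++-identityʳ (starW D)) (Fold-α D)
  Fold-settled (e ∷ B) D = fb nil (Fold-settled B D)

  transfer : ∀ {M M′ A B vs} → (∀ {R os} → Fold [] M′ R os → Fold [] M R os) → Result M′ A B vs → Result M A B vs
  transfer f r = record { Bf = Bf ; Df = Df ; CA = CA ; CB = CB ; fold = f fold ; std = std ; values = values }
    where open Result r

  -- Within one value the order fixes how contents compare: they rise along unprimed letters and
  -- fall along primed ones. The slope of the profile turns this into smaller columns, its
  -- monotonicity into smaller rows.
  sorted-ahead : ∀ rr {s x} → Prof (h ⊕ contents (reverse rr)) → All (Val k) rr → val x ≡ k → All (_≺ (s , x)) rr →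
    Ahead rr ((h ⊕ contents (reverse rr)) s) ((h ⊕ contents (reverse rr)) s + s) x
  sorted-ahead rr {s} {x} prof-g₁ val-rr vx f = (λ u → columns u (placed h (reverse rr)) regions order values) , (λ u → rows u (placed h (reverse rr)) regions order values)
    where
    g₁ = h ⊕ contents (reverse rr)
    regions = placed-below h (reverse rr)
    order = placed-entries h (reverse rr) (reverse⁺ f)
    values = placed-entries h (reverse rr) (reverse⁺ val-rr)
    col-less : ∀ {i c y} → primed x ≡ false → i < g₁ c → (c , y) ≺ (s , x) → val y ≡ k → primed y ≡ false → i + c < g₁ s + s
    col-less u q (by-val r) e _ = ⊥-elim (ℤₚ.<-irrefl (trans e (sym vx)) r)
    col-less {i} {c} u q (uu o) e _ = ≤-trans (+-monoˡ-≤ c q) (≤-trans (+-monoˡ-≤ c (Prof-slope prof-g₁ (s ∸ c) c))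
      (≤-reflexive (trans (+-assoc (s ∸ c) (g₁ (s ∸ c + c)) c) (trans (cong (λ t → s ∸ c + (g₁ t + c)) (m∸n+n≡m (<⇒≤ o)))
        (trans (+-comm (s ∸ c) (g₁ s + c)) (trans (+-assoc (g₁ s) c (s ∸ c)) (cong (g₁ s +_) (m+[n∸m]≡n (<⇒≤ o)))))))))
    row-less : ∀ {i c y} → primed x ≡ true → i < g₁ c → (c , y) ≺ (s , x) → val y ≡ k → primed y ≡ true × i < g₁ s
    row-less u q (by-val r) e = ⊥-elim (ℤₚ.<-irrefl (trans e (sym vx)) r)
    row-less u q (pp o) e = refl , ≤-trans q (Prof-≤ prof-g₁ (<⇒≤ o))
    columns : primed x ≡ false → ∀ w → All (λ { (i , c , _) → i < g₁ c }) w → All (λ b → proj₂ b ≺ (s , x)) w → All (λ b → Val k (proj₂ b)) w →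
      All (λ b → primed (proj₂ (proj₂ b)) ≡ false → proj₁ b + proj₁ (proj₂ b) < g₁ s + s) w
    columns u [] [] [] [] = []
    columns u (_ ∷ w) (a ∷ as) (b ∷ bs) (c ∷ cs) = col-less u a b c ∷ columns u w as bs cs
    rows : primed x ≡ true → ∀ w → All (λ { (i , c , _) → i < g₁ c }) w → All (λ b → proj₂ b ≺ (s , x)) w → All (λ b → Val k (proj₂ b)) w →
      All (λ b → primed (proj₂ (proj₂ b)) ≡ true × proj₁ b < g₁ s) w
    rows u [] [] [] [] = []
    rows u (_ ∷ w) (a ∷ as) (b ∷ bs) (c ∷ cs) = row-less u a b c ∷ rows u w as bs cs

  initial : ∀ {rr a B D vs} → Up h (contents (state rr [] a B D)) → All (Val k) (a ∷ rr) → All (Val l) B → Falling (a ∷ rr) →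
    Standard bits B → vals B ≡ vs → Inv rr [] a B D vs
  initial {rr} {a} {B} {D} valid (va ∷ vrr) valB (lead ∷ frr) st values = record
    { valid = valid ; valA = va ∷ vrr ; valB = valB ; falling = frr
    ; ahead = subst (λ g → Ahead rr (g (proj₁ a)) (g (proj₁ a) + proj₁ a) (proj₂ a)) (sym before≡)
        (sorted-ahead rr (subst Prof before≡ (Up-Prof valid-at)) vrr va lead)
    ; completed = λ t → Tr-Standard t (Up-take (proj₁ a ∷ contents B) (subst (Up (before rr [])) (cong (proj₁ a ∷_)
        (trans (contents-++ (map β B) (map α D)) (cong (_++ contents (map α D)) (contents-β B)))) valid-at)) st
    ; rest = nothing , st
    ; history = λ _ {B₀} e → ⊥-elim ([]≢snoc B₀ e)
    ; values = values }
    where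
    valid-at : Up (before rr []) (proj₁ a ∷ contents (suffix B D))
    valid-at = Up-drop (contents (prefix rr [])) (subst (Up h) (contents-++ (prefix rr []) _) valid)
    before≡ : before rr [] ≡ h ⊕ contents (reverse rr)
    before≡ = cong (h ⊕_) (trans (cong contents (++-identityʳ (map α (reverse rr)))) (contents-α (reverse rr)))
    []≢snoc : ∀ B₀ {e : Entry} → [] ≢ B₀ ++ e ∷ []
    []≢snoc [] ()
    []≢snoc (_ ∷ _) ()

  -- With no b-box ahead the a-box is finished, and the next waiting one starts in front of the
  -- whole b-run.
  module Pop {a′ rr B₁ a D vs} (inv : Inv (a′ ∷ rr) B₁ a [] D vs) where
    private
      module I = Inv inv

    state-eq : state (a′ ∷ rr) B₁ a [] D ≡ state rr [] a′ B₁ (a ∷ D)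
    state-eq = trans (cong (λ w → (map α w ++ map β B₁) ++ map α (a ∷ D)) (reverse-∷′ a′ rr))
      (trans (cong (λ w → (w ++ map β B₁) ++ map α (a ∷ D)) (map-++ α (reverse rr) (a′ ∷ [])))
      (trans (++-assoc (map α (reverse rr) ++ α a′ ∷ []) (map β B₁) (map α (a ∷ D)))
      (trans (++-assoc (map α (reverse rr)) (α a′ ∷ []) (suffix B₁ (a ∷ D)))
        (cong (_++ α a′ ∷ suffix B₁ (a ∷ D)) (sym (++-identityʳ (map α (reverse rr))))))))

    inv′ : Inv rr [] a′ B₁ (a ∷ D) vs
    inv′ = initial (subst (λ M → Up h (contents M)) state-eq I.valid) (tail-val I.valA) (subst (All (Val l)) (++-identityʳ B₁) I.valB) I.falling
      (subst (Standard bits) (++-identityʳ B₁) (I.completed nil)) (trans (cong vals (sym (++-identityʳ B₁))) I.values)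
      where
      tail-val : ∀ {e w} → All (Val k) (e ∷ w) → All (Val k) w
      tail-val (_ ∷ v) = v

  finished : ∀ {B₁ a D A B A″ B″ vs} → Inv [] B₁ a [] D vs → Cells A (view true h (state [] B₁ a [] D)) →
    Cells B (view false h (state [] B₁ a [] D)) → Process A B A″ B″ → Result (state [] B₁ a [] D) A″ B″ vs
  finished {B₁} {a} {D} inv CA CB (fin _) = record
    { Bf = B₁ ; Df = a ∷ D ; CA = CA ; CB = CB ; fold = Fold-settled B₁ (a ∷ D)
    ; std = subst (Standard bits) (++-identityʳ B₁) (Inv.completed inv nil)
    ; values = trans (cong vals (sym (++-identityʳ B₁))) (Inv.values inv) }
  finished {B₁} {a} {D} {A} {B} inv CA CB (next ch _ _) = ⊥-elim (impossible ch)
    where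
    open Inv inv
    open Neighbours {B} {h} {prefix [] B₁} {s} {true , x} {[]} {D} CB valid-at
    south-nothing : ∀ s′ → s ≡ s′ → B (suc p) (p + s) ≡ nothing
    south-nothing zero e = b-south-empty e
    south-nothing (suc t) e = b-south e
    stuck : ∀ {i j z} → A i j ≡ just z → ¬ (IsBox B i (suc j) ⊎ IsBox B (suc i) j)
    stuck e nb with column CA e
    ... | d , refl , e₁ with locate (pick-just true _ e₁)
    ...   | inj₂ (inj₂ q) = settled CA CB q nb
    stuck e (inj₁ (y , e₂)) | d , refl , e₁ | inj₂ (inj₁ (refl , refl , _)) = nothing≢just b-east e₂
    stuck e (inj₂ (y , e₂)) | d , refl , e₁ | inj₂ (inj₁ (refl , refl , _)) = nothing≢just (south-nothing s refl) e₂
    impossible : ∀ {i j} → Chosen A B i j → ⊥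
    impossible (unpr (e , nb) _) = stuck e nb
    impossible (prim _ (e , nb) _) = stuck e nb

  -- Passing a far b-box and finishing an a-box use no step of the process. The recursion descends
  -- lexicographically on the process, the waiting a-boxes and the b-boxes ahead.
  run : ∀ rr B₁ a B₂ D {A B A″ B″ vs} → Inv rr B₁ a B₂ D vs → Cells A (view true h (state rr B₁ a B₂ D)) →
    Cells B (view false h (state rr B₁ a B₂ D)) → Process A B A″ B″ → Result (state rr B₁ a B₂ D) A″ B″ vs
  run [] B₁ a [] D inv CA CB proc = finished inv CA CB proc
  run (a′ ∷ rr) B₁ a [] D inv CA CB proc = transfer (λ F → refold (sym (Pop.state-eq inv)) F)
    (run rr [] a′ B₁ (a ∷ D) (Pop.inv′ inv) (recast true (Pop.state-eq inv) CA) (recast false (Pop.state-eq inv) CB) proc)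
  run rr B₁ (s , x) ((c , y) ∷ B₃) D inv CA CB proc with near s c in f
  ... | false = transfer (_≈_.Fold-back (Far.equiv f inv)) (run rr (B₁ ++ (c , y) ∷ []) (s , x) B₃ D (Far.inv′ f inv)
        (Cells-cong CA λ i d → cong (pick true) (_≈_.fill-same (Far.equiv f inv) h i d))
        (Cells-cong CB λ i d → cong (pick false) (_≈_.fill-same (Far.equiv f inv) h i d)) proc)
  run rr B₁ (s , x) ((c , y) ∷ B₃) D inv CA CB (fin full) | true =
    ⊥-elim (full _ _ _ (Inv.a-cell inv CA CB , Advance.candidate f inv CA CB))
  run rr B₁ (s , x) ((c , y) ∷ B₃) D inv CA CB (next ch sw proc) | true = continue (Advance.advance f inv CA CB ch sw)
    where
    continue : _ → _
    continue N = transfer (Next.back N) (run (Next.rr N) (Next.B₁ N) (Next.a N) (Next.B₂ N) (Next.D N) (Next.inv N) (Next.CA N) (Next.CB N) proc)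

-- Outcome of one process

vals-++ : ∀ u w → vals (u ++ w) ≡ vals u ++ vals w
vals-++ u w = map-++ (λ e → val (proj₂ e)) u w

vals-starW : ∀ w → vals (starW w) ≡ reverse (map ℤ.-_ (vals w))
vals-starW [] = refl
vals-starW (e ∷ w) = trans (cong vals (starW-∷ e w)) (trans (vals-++ (starW w) (starE e ∷ []))
  (trans (cong₂ (λ u v → u ++ v ∷ []) (vals-starW w) (val-starL (proj₂ e))) (sym (reverse-∷ (ℤ.- val (proj₂ e)) (map ℤ.-_ (vals w))))))

Fold-starred : ∀ {R M R′ os} u → Fold R (map α u ++ M) R′ os → Fold (starW u ++ R) M R′ os
Fold-starred [] f = f
Fold-starred {R} {M} {R′} {os} (e ∷ u) (fa f) =
  subst (λ w → Fold w M R′ os) (trans (sym (++-assoc (starW u) (starE e ∷ []) R)) (cong (_++ R) (sym (starW-∷ e u)))) (Fold-starred u f)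

Fold-contents : ∀ {R R′ os} t → Fold R (map β t) R′ os →
  contents R′ ≡ upper (contents R) (contents t) × os ≡ lower (contents R) (contents t) × vals R′ ≡ vals R
Fold-contents {R} [] fnil = sym (upper-[] (contents R)) , sym (lower-[] (contents R)) , refl
Fold-contents {R} ((c , y) ∷ t) (fb {R₁ = R₁} tr f) with Fold-contents t f | Tr-contents tr
... | p , q , r | e₁ , e₂ =
  trans p (trans (cong (λ w → upper w (contents t)) e₁) (sym (upper-∷ (contents R) c (contents t)))) ,
  trans (cong₂ _∷_ e₂ (trans q (cong (λ w → lower w (contents t)) e₁))) (sym (lower-∷ (contents R) c (contents t))) ,
  trans r (Tr-vals tr)

Fold-Standard : ∀ {b R R′ os h L} t → Up h (reverse (contents R) ++ contents t) → (h ⊕ (reverse (contents R) ++ contents t)) L ≡ 0 →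
  Fold R (map β t) R′ os → Standard b R → Standard b R′
Fold-Standard [] u z fnil p = p
Fold-Standard {R = R} {h = h} {L} ((c , y) ∷ t) u z (fb {R₁ = R₁} {c = c′} tr f) p =
  Fold-Standard t (Up-tail (subst (Up h) word (Up-switch X (c ∷ []) (contents t) u)))
    (trans (trans (sym (cong (λ w → (h ⊕ w) L) word)) (shape L)) z) f
    (Tr-Standard tr (subst (Up _) (trans (reverse-++ (reverse X) (c ∷ [])) (cong (c ∷_) (reverse-involutive X)))
      (proj₁ (Up-reverse {L = L} prefix-up (⊕-zero {h ⊕ (reverse X ++ c ∷ [])} {contents t} (trans (cong (λ g → g L) (trans (sym (⊕-++ h (reverse X ++ c ∷ []) (contents t)))
        (cong (h ⊕_) (++-assoc (reverse X) (c ∷ []) (contents t))))) z))))) p)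
  where
  X = contents R
  word : lower X (c ∷ []) ++ reverse (upper X (c ∷ [])) ++ contents t ≡ c′ ∷ reverse (contents R₁) ++ contents t
  word = cong₂ (λ a b → a ++ reverse b ++ contents t) (trans (lower-[ c ] X) (cong (_∷ []) (sym (proj₂ (Tr-contents tr)))))
    (trans (upper-[ c ] X) (sym (proj₁ (Tr-contents tr))))
  prefix-up : Up h (reverse X ++ c ∷ [])
  prefix-up = Up-take (reverse X ++ c ∷ []) (subst (Up h) (sym (++-assoc (reverse X) (c ∷ []) (contents t))) u)
  shape : h ⊕ (lower X (c ∷ []) ++ reverse (upper X (c ∷ [])) ++ contents t) ≗ h ⊕ (reverse X ++ c ∷ contents t)
  shape d = trans (cong (λ g → g d) (trans (⊕-++ h (lower X (c ∷ [])) _) (⊕-++ (h ⊕ lower X (c ∷ [])) (reverse (upper X (c ∷ []))) (contents t))))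
    (trans (⊕-cong (contents t) (⊕-switch X h (c ∷ [])) d) (cong (λ g → g d) (trans (sym (⊕-++ (h ⊕ reverse X) (c ∷ []) (contents t))) (sym (⊕-++ h (reverse X) (c ∷ contents t))))))

starB-involutive : ∀ b v → starB (starB b) v ≡ b v
starB-involutive b v = trans (not-involutive (b (ℤ.- (ℤ.- v)))) (cong b (ℤₚ.neg-involutive v))

Standard-cong : ∀ {b b′ w} → (∀ v → b v ≡ b′ v) → Standard b w → Standard b′ w
Standard-cong e = Path-cong _ (All.universal (λ _ → e _) _) _

Standard-star : ∀ {b w} → Standard b w → Standard (starB b) (starW w)
Standard-star = Path-star

record Block (h : Shape) (bits ba : ℤ → Bool) (u t : List Entry) (A B : Filling) : Set where
  field
    Bf Df : List Entry
    cellsA : Cells A (view true h (map β Bf ++ map α Df))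
    cellsB : Cells B (view false h (map β Bf ++ map α Df))
    contB  : contents Bf ≡ lower (reverse (contents u)) (contents t)
    contD  : contents Df ≡ reverse (upper (reverse (contents u)) (contents t))
    stdB   : Standard bits Bf
    stdD   : Standard ba Df
    valsB  : vals Bf ≡ vals t
    valsD  : vals Df ≡ vals u

module BlockSwitch (h : Shape) (k l : ℤ) (bits ba : ℤ → Bool) where
  open Switching h k l bits
  open SwitchingRun h k l bits

  Falling-snoc : ∀ {w e} → Falling w → All (e ≺_) w → Falling (w ++ e ∷ [])
  Falling-snoc [] [] = [] ∷ []
  Falling-snoc (f ∷ fs) (p ∷ ps) = ++⁺ f (p ∷ []) ∷ Falling-snoc fs ps

  Path⇒Falling : ∀ {m w} → Path ba m w nothing → Falling (reverse w)
  Path⇒Falling ([] _) = []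
  Path⇒Falling {w = e ∷ w} (_ ∷ p) = subst Falling (sym (reverse-∷ e w)) (Falling-snoc (Path⇒Falling p) (reverse⁺ (Path⇒≺ p)))

  module _ {A B A″ B″ u t L} (valid : Up h (contents u ++ contents t)) (zero-L : (h ⊕ (contents u ++ contents t)) L ≡ 0)
    (valU : All (Val k) u) (valT : All (Val l) t) (stdU : Standard ba u) (stdT : Standard bits t)
    (CA : Cells A (view true h (map α u ++ map β t))) (CB : Cells B (view false h (map α u ++ map β t))) (proc : Process A B A″ B″) where

    start-eq : ∀ a rr → reverse (a ∷ rr) ≡ u → map α u ++ map β t ≡ state rr [] a t []
    start-eq a rr refl = trans (cong (_++ map β t) (trans (cong (map α) (reverse-∷ a rr)) (map-++ α (reverse rr) (a ∷ []))))
      (trans (++-assoc (map α (reverse rr)) (α a ∷ []) (map β t)) (cong₂ (λ x y → x ++ α a ∷ y) (sym (++-identityʳ (map α (reverse rr)))) (sym (++-identityʳ (map β t)))))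

    result : ∀ r → reverse r ≡ u → Result (map α u ++ map β t) A″ B″ (vals t)
    result (a ∷ rr) refl = subst (λ M → Result M A″ B″ (vals t)) (sym e)
      (run rr [] a t [] (initial (subst (Up h) (trans (cong₂ _++_ (sym (contents-α u)) (sym (contents-β t))) (trans (sym (contents-++ (map α u) (map β t))) (cong contents e))) valid)
        (subst (All (Val k)) (reverse-involutive (a ∷ rr)) (reverse⁺ valU)) valT (subst Falling (reverse-involutive (a ∷ rr)) (Path⇒Falling stdU)) stdT refl)
        (recast true e CA) (recast false e CB) proc)
      where e = start-eq a rr refl
    result [] refl = idle proc CA CB
      where
      no-box : ∀ {i j x} → A i j ≡ just x → ⊥
      no-box e with column CA e
      ... | d , _ , e₁ = no-α (fill h t _ d) (trans (sym (fill-β h t _ d)) (pick-just true _ e₁))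
      idle : Process A B A″ B″ → Cells A (view true h (map β t)) → Cells B (view false h (map β t)) → Result (map β t) A″ B″ (vals t)
      idle (fin _) CA CB = record { Bf = t ; Df = [] ; CA = recast {M = map β t} true (sym (++-identityʳ (map β t))) CA ; CB = recast {M = map β t} false (sym (++-identityʳ (map β t))) CB
        ; fold = subst (λ M → Fold [] M [] (contents t)) (++-identityʳ (map β t)) (Fold-settled t []) ; std = stdT ; values = refl }
      idle (next (unpr (e , _) _) _ _) _ _ = ⊥-elim (no-box e)
      idle (next (prim _ (e , _) _) _ _) _ _ = ⊥-elim (no-box e)

    -- The b-run is taken from the first reading. The a-run is the starred run after all b-boxes
    -- have slid through it, starred back; this is how its contents, values and primes are known.
    switch-block : Block h bits ba u t A″ B″
    switch-block = record
      { Bf = R.Bf ; Df = R.Df ; cellsA = R.CA ; cellsB = R.CB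
      ; contB = trans (proj₁ (proj₂ counts)) (cong (λ w → lower w (contents t)) starred)
      ; contD = trans (cong contents (sym (starW-involutive R.Df))) (trans (contents-starW (starW R.Df))
          (cong reverse (trans (proj₁ counts) (cong (λ w → upper w (contents t)) starred))))
      ; stdB = R.std
      ; stdD = subst (Standard ba) (starW-involutive R.Df) (Standard-cong (starB-involutive ba) (Standard-star
          (Fold-Standard t (subst (Up h) whole valid) (trans (sym (cong (λ w → (h ⊕ w) L) whole)) zero-L) run-u (subst (Standard (starB ba)) (sym (++-identityʳ (starW u))) (Standard-star stdU)))))
      ; valsB = R.values
      ; valsD = trans (cong vals (sym (starW-involutive R.Df))) (trans (vals-starW (starW R.Df)) (trans (cong (λ v → reverse (map ℤ.-_ v)) (trans (proj₂ (proj₂ counts)) (cong vals (++-identityʳ (starW u)))))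
          (trans (sym (vals-starW (starW u))) (cong vals (starW-involutive u))))) }
      where
      module R = Result (result (reverse u) (reverse-involutive u))
      run-u : Fold (starW u ++ []) (map β t) (starW R.Df) (contents R.Bf)
      run-u = Fold-starred u R.fold
      counts = Fold-contents t run-u
      starred : contents (starW u ++ []) ≡ reverse (contents u)
      starred = trans (cong contents (++-identityʳ (starW u))) (contents-starW u)
      whole : contents u ++ contents t ≡ reverse (contents (starW u ++ [])) ++ contents t
      whole = cong (_++ contents t) (sym (trans (cong reverse starred) (reverse-involutive (contents u))))

-- Restriction of the fillings to one letter

keep drop : ℕ → Maybe Letter → Maybe Letter
keep k nothing = nothing
keep k (just x) = if does (val x ℤ.≟ ℤ.+ k) then just x else nothing
drop k nothing = nothing
drop k (just x) = if does (val x ℤ.≟ ℤ.+ k) then nothing else just x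

restrict-keep : ∀ k F i j → restrict k F i j ≡ keep k (F i j)
restrict-keep k F i j with F i j
... | nothing = refl
... | just x = refl

delete-drop : ∀ k F i j → delete k F i j ≡ drop k (F i j)
delete-drop k F i j with F i j
... | nothing = refl
... | just x = refl

∪F-<∣> : ∀ F G i j → (F ∪F G) i j ≡ (F i j <∣> G i j)
∪F-<∣> F G i j with F i j
... | nothing = refl
... | just x = refl

Disjoint : {A : Set} → Maybe A → Maybe A → Set
Disjoint m n = ∀ {x} → m ≡ just x → n ≡ nothing

pick-<∣> : ∀ t m n → Disjoint m n → pick t (m <∣> n) ≡ (pick t m <∣> pick t n)
pick-<∣> t nothing n f = refl
pick-<∣> true (just (true , x)) n f = refl
pick-<∣> true (just (false , x)) n f = sym (cong (pick true) (f refl))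
pick-<∣> false (just (true , x)) n f = sym (cong (pick false) (f refl))
pick-<∣> false (just (false , x)) n f = refl

view-++ : ∀ t h P Q i d → view t h (P ++ Q) i d ≡ (view t h P i d <∣> view t (h ⊕ contents P) Q i d)
view-++ t h P Q i d = trans (cong (pick t) (fill-++ h P Q i d))
  (pick-<∣> t (fill h P i d) _ λ e → fill-low (h ⊕ contents P) Q (proj₂ (fill-region h P e)))

view-disjoint : ∀ t h P Q {g} i d → (∀ e → (h ⊕ contents P) e ≤ g e) → Disjoint (view t h P i d) (view t g Q i d)
view-disjoint t h P Q {g} i d q e = cong (pick t) (fill-low g Q (≤-trans (proj₂ (fill-region h P (pick-just t _ e))) (q d)))

view-All : ∀ {P : Letter → Set} t h M {i d x} → All (λ e → proj₁ (proj₂ e) ≡ t → P (proj₂ (proj₂ e))) M → view t h M i d ≡ just x → P x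
view-All t h M ps e = placed-All h M (placed-entries h M ps) (pick-just t _ e) refl

keep-same : ∀ {k x} → val x ≡ ℤ.+ k → keep k (just x) ≡ just x × drop k (just x) ≡ nothing
keep-same {k} {x} e with val x ℤ.≟ ℤ.+ k
... | yes _ = refl , refl
... | no n = ⊥-elim (n e)

keep-other : ∀ {k x} → val x ≢ ℤ.+ k → keep k (just x) ≡ nothing × drop k (just x) ≡ just x
keep-other {k} {x} n with val x ℤ.≟ ℤ.+ k
... | yes e = ⊥-elim (n e)
... | no _ = refl , refl

Values : (ℤ → Set) → Maybe Letter → Set
Values P m = ∀ {x} → m ≡ just x → P (val x)

keep-middle : ∀ k a m c → Values (_≢ ℤ.+ k) a → Values (_≡ ℤ.+ k) m → Values (_≢ ℤ.+ k) c → Disjoint a m → keep k (a <∣> (m <∣> c)) ≡ m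
keep-middle k (just x) m c p q r d = trans (proj₁ (keep-other {k} {x} (p refl))) (sym (d refl))
keep-middle k nothing (just y) c p q r d = proj₁ (keep-same {k} {y} (q refl))
keep-middle k nothing nothing (just z) p q r d = proj₁ (keep-other {k} {z} (r refl))
keep-middle k nothing nothing nothing p q r d = refl

drop-middle : ∀ k a m c m′ → Values (_≢ ℤ.+ k) a → Values (_≡ ℤ.+ k) m → Values (_≢ ℤ.+ k) c → Disjoint m c → Disjoint m′ c →
  (drop k (a <∣> (m <∣> c)) <∣> m′) ≡ (a <∣> (m′ <∣> c))
drop-middle k (just x) m c m′ p q r d e = cong (_<∣> m′) (proj₂ (keep-other {k} {x} (p refl)))
drop-middle k nothing (just y) c m′ p q r d e = trans (cong (_<∣> m′) (proj₂ (keep-same {k} {y} (q refl)))) (sym (trans (cong (m′ <∣>_) (d refl)) (<∣>-nothing m′)))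
drop-middle k nothing nothing (just z) nothing p q r d e = cong (_<∣> nothing) (proj₂ (keep-other {k} {z} (r refl)))
drop-middle k nothing nothing (just z) (just w) p q r d e = ⊥-elim (nothing≢just (e refl) refl)
drop-middle k nothing nothing nothing nothing p q r d e = refl
drop-middle k nothing nothing nothing (just w) p q r d e = refl

-- Outside `M` no box with tag `t` has the value `k`, so restriction cuts out exactly this block.
-- The new block leads to the same shape, so the boxes of `Q` keep their cells.
module Replace {F P M Q} (t : Bool) (k : ℕ) (C : Cells F (view t ∅ (P ++ M ++ Q)))
  (outer-P : All (λ e → proj₁ (proj₂ e) ≡ t → val (proj₂ (proj₂ e)) ≢ ℤ.+ k) P)
  (outer-Q : All (λ e → proj₁ (proj₂ e) ≡ t → val (proj₂ (proj₂ e)) ≢ ℤ.+ k) Q)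
  (inner-M : All (λ e → proj₁ (proj₂ e) ≡ t → val (proj₂ (proj₂ e)) ≡ ℤ.+ k) M) where

  h : Shape
  h = ∅ ⊕ contents P

  three : ∀ M i d → view t ∅ (P ++ M ++ Q) i d ≡ (view t ∅ P i d <∣> (view t h M i d <∣> view t (h ⊕ contents M) Q i d))
  three M i d = trans (view-++ t ∅ P (M ++ Q) i d) (cong (view t ∅ P i d <∣>_) (view-++ t h M Q i d))

  values-P : ∀ i d → Values (_≢ ℤ.+ k) (view t ∅ P i d)
  values-P i d = view-All {λ x → val x ≢ ℤ.+ k} t ∅ P outer-P

  values-M : ∀ i d → Values (_≡ ℤ.+ k) (view t h M i d)
  values-M i d = view-All {λ x → val x ≡ ℤ.+ k} t h M inner-M

  values-Q : ∀ i d → Values (_≢ ℤ.+ k) (view t (h ⊕ contents M) Q i d)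
  values-Q i d = view-All {λ x → val x ≢ ℤ.+ k} t (h ⊕ contents M) Q outer-Q

  restricted : Cells (restrict k F) (view t h M)
  cell restricted i d = trans (restrict-keep k F i (i + d)) (trans (cong (keep k) (trans (cell C i d) (three M i d))) (keep-middle k _ _ _ (values-P i d) (values-M i d) (values-Q i d) (view-disjoint t ∅ P M i d λ _ → ≤-refl)))
  tri restricted i j q = trans (restrict-keep k F i j) (cong (keep k) (tri C i j q))

  replaced : ∀ {A′ M′} → h ⊕ contents M′ ≗ h ⊕ contents M → Cells A′ (view t h M′) → Cells (delete k F ∪F A′) (view t ∅ (P ++ M′ ++ Q))
  cell (replaced {A′} {M′} e C′) i d = trans (∪F-<∣> (delete k F) A′ i (i + d))
    (trans (cong₂ _<∣>_ (trans (delete-drop k F i (i + d)) (cong (drop k) (trans (cell C i d) (three M i d)))) (cell C′ i d))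
    (trans (drop-middle k _ _ _ _ (values-P i d) (values-M i d) (values-Q i d) (view-disjoint t h M Q i d λ _ → ≤-refl) (view-disjoint t h M′ Q i d λ c → ≤-reflexive (e c)))
    (trans (cong (λ v → view t ∅ P i d <∣> (view t h M′ i d <∣> v)) (cong (pick t) (fill-cong Q (λ c → sym (e c)) i d)))
      (sym (three M′ i d)))))
  tri (replaced {A′} {M′} e C′) i j q = trans (∪F-<∣> (delete k F) A′ i j)
    (cong₂ _<∣>_ (trans (delete-drop k F i j) (cong (drop k) (tri C i j q))) (tri C′ i j q))

open Block

-- Cutting and joining words by values

All-vals : ∀ {P : ℤ → Set} u w → vals u ≡ vals w → All (λ e → P (val (proj₂ e))) u → All (λ e → P (val (proj₂ e))) w
All-vals [] [] _ [] = []
All-vals {P} (_ ∷ u) (_ ∷ w) e (p ∷ ps) = subst P (∷-injectiveˡ e) p ∷ All-vals u w (∷-injectiveʳ e) ps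

Under AtLeast : ℤ → List Entry → Set
Under v = All (λ e → val (proj₂ e) ℤ.< v)
AtLeast v = All (λ e → v ℤ.≤ val (proj₂ e))

record Split (b : ℤ → Bool) (v : ℤ) (m : Maybe Entry) (w : List Entry) : Set where
  constructor splitting
  field
    lo hi : List Entry
    whole : w ≡ lo ++ hi
    low   : Under v lo
    high  : AtLeast v hi
    stdL  : Path b m lo nothing
    stdH  : Standard b hi

data Lower (v : ℤ) : Maybe Entry → Set where
  none : Lower v nothing
  some : ∀ {e} → val (proj₂ e) ℤ.< v → Lower v (just e)

-- A link `rise` consists of the condition at the end of the old value and the condition at the
-- start of the new one. Words can therefore be cut, and by `link-join` glued, wherever the value
-- increases.
link-break : ∀ {b v m e} → Lower v m → v ℤ.≤ val (proj₂ e) → Link b m (just e) → Link b m nothing × Link b nothing (just e)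
link-break none q (start f) = empty , start f
link-break (some p) q (rise r f g) = stop f , start g
link-break (some p) q (pp _) = ⊥-elim (ℤₚ.<-irrefl refl (ℤₚ.<-≤-trans p q))
link-break (some p) q (uu _) = ⊥-elim (ℤₚ.<-irrefl refl (ℤₚ.<-≤-trans p q))
link-break (some p) q (pu< _ _) = ⊥-elim (ℤₚ.<-irrefl refl (ℤₚ.<-≤-trans p q))
link-break (some p) q (pu> _ _) = ⊥-elim (ℤₚ.<-irrefl refl (ℤₚ.<-≤-trans p q))

split-at : ∀ {b} v {m} w → Lower v m → Path b m w nothing → Split b v m w
split-at v [] lo p = splitting [] [] refl [] [] p ([] empty)
split-at v (e ∷ w) lo (l ∷ p) with val (proj₂ e) ℤ.<? v
... | no n with link-break lo (ℤₚ.≮⇒≥ n) l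
...   | l₁ , l₂ = splitting [] (e ∷ w) refl [] (ℤₚ.≮⇒≥ n ∷ All.map (λ o → ℤₚ.≤-trans (ℤₚ.≮⇒≥ n) (≺-val o)) (Path⇒≺ p)) ([] l₁) (l₂ ∷ p)
split-at v (e ∷ w) lo (l ∷ p) | yes q with split-at v w (some q) p
... | splitting u r refl a c s t = splitting (e ∷ u) r refl (q ∷ a) c (l ∷ s) t

link-join : ∀ {b v m e} → Lower v m → v ℤ.≤ val (proj₂ e) → Link b m nothing → Link b nothing (just e) → Link b m (just e)
link-join none q _ l = l
link-join (some p) q (stop f) (start g) = rise (ℤₚ.<-≤-trans p q) f g

Path-join : ∀ {b v m} u w → Lower v m → Under v u → AtLeast v w → Path b m u nothing → Standard b w → Path b m (u ++ w) nothing
Path-join [] [] lo [] [] p ([] empty) = p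
Path-join [] (e ∷ w) lo [] (q ∷ _) ([] l) (l′ ∷ p) = link-join lo q l l′ ∷ p
Path-join (e ∷ u) w lo (a ∷ as) c (l ∷ p) s = l ∷ Path-join u w (some a) as c p s

-- Switching all pairs of letters

record Config (L : ℕ) (S T : Filling) (W : List TEntry) : Set where
  field
    CS    : Cells S (view true ∅ W)
    CT    : Cells T (view false ∅ W)
    valid : Up ∅ (contents W)
    zeroL : (∅ ⊕ contents W) L ≡ 0

Config-cast : ∀ {L S T W W′} → W ≡ W′ → Config L S T W → Config L S T W′
Config-cast refl c = c

Up-middle : ∀ p a t q {h} → Up h (p ++ (a ++ t) ++ q) → Up h (p ++ (lower (reverse a) t ++ reverse (upper (reverse a) t)) ++ q)
Up-middle p a t q {h} u = subst (λ w → Up h (p ++ w)) (sym (++-assoc (lower (reverse a) t) _ q))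
  (Up-prefix p (Up-switch (reverse a) t q) (subst (λ w → Up h (p ++ w)) (trans (++-assoc a t q) (cong (_++ t ++ q) (sym (reverse-involutive a)))) u))

⊕-middle : ∀ h a t → h ⊕ (lower (reverse a) t ++ reverse (upper (reverse a) t)) ≗ h ⊕ (a ++ t)
⊕-middle h a t d = trans (cong (λ g → g d) (⊕-++ h (lower (reverse a) t) _)) (trans (⊕-switch (reverse a) h t d)
  (cong (λ g → g d) (trans (cong (λ w → h ⊕ w ⊕ t) (reverse-involutive a)) (sym (⊕-++ h a t)))))

Tagged : Bool → (ℤ → Set) → List TEntry → Set
Tagged t P = All (λ e → proj₁ (proj₂ e) ≡ t → P (val (proj₂ (proj₂ e))))

module Step {L S T} (k l : ℕ) (bits ba : ℤ → Bool) (P : List TEntry) (u t : List Entry) (Q : List TEntry)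
  (C : Config L S T (P ++ (map α u ++ map β t) ++ Q))
  (PA : Tagged true (_≢ ℤ.+ k) P) (QA : Tagged true (_≢ ℤ.+ k) Q) (PB : Tagged false (_≢ ℤ.+ l) P) (QB : Tagged false (_≢ ℤ.+ l) Q)
  (valU : All (λ e → val (proj₂ e) ≡ ℤ.+ k) u) (valT : All (λ e → val (proj₂ e) ≡ ℤ.+ l) t) (stdU : Standard ba u) (stdT : Standard bits t)
  {A′ B′} (proc : Process (restrict k S) (restrict l T) A′ B′) where

  private
    h = ∅ ⊕ contents P
    M = map α u ++ map β t

    tag-α : ∀ {R : ℤ → Set} u t → All (λ e → R (val (proj₂ e))) u → Tagged true R (map α u ++ map β t)
    tag-α [] [] _ = []
    tag-α [] (_ ∷ t) _ = (λ ()) ∷ tag-α [] t []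
    tag-α (_ ∷ u) t (p ∷ ps) = (λ _ → p) ∷ tag-α u t ps

    tag-β : ∀ {R : ℤ → Set} u t → All (λ e → R (val (proj₂ e))) t → Tagged false R (map α u ++ map β t)
    tag-β [] [] [] = []
    tag-β [] (_ ∷ t) (p ∷ ps) = (λ _ → p) ∷ tag-β [] t ps
    tag-β (_ ∷ u) t ps = (λ ()) ∷ tag-β u t ps

    module RA = Replace {S} {P} {M} {Q} true k (Config.CS C) PA QA (tag-α u t valU)
    module RB = Replace {T} {P} {M} {Q} false l (Config.CT C) PB QB (tag-β u t valT)

    contents-M : contents M ≡ contents u ++ contents t
    contents-M = trans (contents-++ (map α u) (map β t)) (cong₂ _++_ (contents-α u) (contents-β t))

    spread : ∀ M → contents (P ++ M ++ Q) ≡ contents P ++ contents M ++ contents Q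
    spread M = trans (contents-++ P (M ++ Q)) (cong (contents P ++_) (contents-++ M Q))

    valid-all : Up ∅ (contents P ++ (contents u ++ contents t) ++ contents Q)
    valid-all = subst (Up ∅) (trans (spread M) (cong (λ w → contents P ++ w ++ contents Q) contents-M)) (Config.valid C)

    zero-all : ((h ⊕ (contents u ++ contents t)) ⊕ contents Q) L ≡ 0
    zero-all = trans (cong (λ g → g L) (trans (sym (⊕-++ h (contents u ++ contents t) (contents Q))) (trans (sym (⊕-++ ∅ (contents P) _))
      (cong (∅ ⊕_) (sym (trans (spread M) (cong (λ w → contents P ++ w ++ contents Q) contents-M))))))) (Config.zeroL C)

  block : Block h bits ba u t A′ B′
  block = BlockSwitch.switch-block h (ℤ.+ k) (ℤ.+ l) bits ba {L = L}
    (Up-take (contents u ++ contents t) (Up-drop (contents P) valid-all))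
    (⊕-zero {h ⊕ (contents u ++ contents t)} {contents Q} zero-all)
    valU valT stdU stdT RA.restricted RB.restricted proc

  M′ : List TEntry
  M′ = map β (Bf block) ++ map α (Df block)

  private
    contents-M′ : contents M′ ≡ lower (reverse (contents u)) (contents t) ++ reverse (upper (reverse (contents u)) (contents t))
    contents-M′ = trans (contents-++ (map β (Bf block)) (map α (Df block))) (cong₂ _++_ (trans (contents-β (Bf block)) (contB block)) (trans (contents-α (Df block)) (contD block)))

    shape-M′ : ∀ g → g ⊕ contents M′ ≗ g ⊕ contents M
    shape-M′ g d = trans (cong (λ w → (g ⊕ w) d) contents-M′) (trans (⊕-middle g (contents u) (contents t) d) (cong (λ w → (g ⊕ w) d) (sym contents-M)))

  config : Config L (delete k S ∪F A′) (delete l T ∪F B′) (P ++ M′ ++ Q)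
  config = record
    { CS = RA.replaced {M′ = M′} (shape-M′ h) (cellsA block) ; CT = RB.replaced {M′ = M′} (shape-M′ h) (cellsB block)
    ; valid = subst (Up ∅) (sym (trans (spread M′) (cong (λ w → contents P ++ w ++ contents Q) contents-M′))) (Up-middle (contents P) (contents u) (contents t) (contents Q) valid-all)
    ; zeroL = trans (cong (λ g → g L) (trans (cong (∅ ⊕_) (spread M′)) (trans (⊕-++ ∅ (contents P) _) (⊕-++ h (contents M′) (contents Q)))))
        (trans (⊕-cong (contents Q) (shape-M′ h) L) (trans (cong (λ w → (h ⊕ w ⊕ contents Q) L) contents-M) zero-all)) }

α-true : ∀ {R : ℤ → Set} u → All (λ e → R (val (proj₂ e))) u → Tagged true R (map α u)
α-true u ps = map⁺ (All.map (λ p _ → p) ps)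

β-false : ∀ {R : ℤ → Set} u → All (λ e → R (val (proj₂ e))) u → Tagged false R (map β u)
β-false u ps = map⁺ (All.map (λ p _ → p) ps)

α-false : ∀ {R : ℤ → Set} u → Tagged false R (map α u)
α-false u = map⁺ (All.universal (λ _ ()) u)

β-true : ∀ {R : ℤ → Set} u → Tagged true R (map β u)
β-true u = map⁺ (All.universal (λ _ ()) u)

Under⇒≢ : ∀ {v} u → Under v u → All (λ e → val (proj₂ e) ≢ v) u
Under⇒≢ u = All.map ℤₚ.<⇒≢

AtLeast⇒≢ : ∀ {n} u → AtLeast (ℤ.+ suc n) u → All (λ e → val (proj₂ e) ≢ ℤ.+ n) u
AtLeast⇒≢ u = All.map λ q e → ℤₚ.<-irrefl (sym e) (ℤₚ.<-≤-trans (ℤ.+<+ ≤-refl) q)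

Between⇒≡ : ∀ {n} u → AtLeast (ℤ.+ n) u → Under (ℤ.+ suc n) u → All (λ e → val (proj₂ e) ≡ ℤ.+ n) u
Between⇒≡ [] [] [] = []
Between⇒≡ (_ ∷ u) (p ∷ ps) (q ∷ qs) = ℤₚ.≤-antisym (ℤₚ.i<j⇒i≤pred[j] q) p ∷ Between⇒≡ u ps qs

empty-range : ∀ {v} u → AtLeast v u → Under v u → u ≡ []
empty-range [] [] [] = refl
empty-range (_ ∷ _) (p ∷ _) (q ∷ _) = ⊥-elim (ℤₚ.<-irrefl refl (ℤₚ.<-≤-trans q p))

-- The state inside the double loop: `U` are the smaller letters of S, not yet moved; `A` is the
-- current one, past the letters `T₁` of T and still below `T₂`; `D` are the larger letters of S,
-- already past all of T.
conf : List Entry → List Entry → List Entry → List Entry → List Entry → List TEntry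
conf U T₁ A T₂ D = (map α U ++ map β T₁) ++ (map α A ++ map β T₂) ++ map α D

data Consecutive (a : ℕ) : List ℕ → ℕ → Set where
  []  : Consecutive a [] a
  _∷_ : ∀ {ls b} → (ℓ : ℕ) → {suc a ≡ ℓ} → Consecutive (suc a) ls b → Consecutive a (ℓ ∷ ls) b

consecutive : ∀ N → Consecutive 0 (map suc (upTo N)) N
consecutive N = subst (λ w → Consecutive 0 w N) (sym (map-applyUpTo (λ n → n) suc N)) (go N 0 suc λ i → refl)
  where
  go : ∀ n a f → (∀ i → f i ≡ suc (a + i)) → Consecutive a (applyUpTo f n) (a + n)
  go zero a f e = subst (Consecutive a []) (sym (+-identityʳ a)) []
  go (suc n) a f e = _∷_ (f 0) {trans (cong suc (sym (+-identityʳ a))) (sym (e 0))}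
    (subst (Consecutive (suc a) _) (sym (+-suc a n)) (go n (suc a) (λ i → f (suc i)) λ i → trans (e (suc i)) (cong suc (+-suc a i))))

module Loops (L N : ℕ) (bits ba : ℤ → Bool) where

  module _ (k : ℕ) (U D : List Entry) (belowU : Under (ℤ.+ k) U) (aboveD : AtLeast (ℤ.+ suc k) D) {ps : List (ℕ × ℕ)} {S″ T″ : Filling} where

    record Inner (T₁ A T₂ : List Entry) : Set where
      field
        Tf Af  : List Entry
        {S′ T′} : Filling
        loop   : Loop ps S′ T′ S″ T″
        config : Config L S′ T′ (conf U (T₁ ++ Tf) Af [] D)
        contT  : contents Tf ≡ lower (reverse (contents A)) (contents T₂)
        contA  : contents Af ≡ reverse (upper (reverse (contents A)) (contents T₂))
        stdT   : Standard bits Tf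
        stdA   : Standard ba Af
        valsT  : vals Tf ≡ vals T₂
        valsA  : vals Af ≡ vals A

    inner : ∀ {a b ls S T} T₁ A T₂ → Consecutive a ls b → Under (ℤ.+ suc a) T₁ → AtLeast (ℤ.+ suc a) T₂ → Under (ℤ.+ suc b) T₂ →
      All (λ e → val (proj₂ e) ≡ ℤ.+ k) A → Standard ba A → Standard bits T₂ →
      Config L S T (conf U T₁ A T₂ D) → Loop (map (λ l → (k , l)) ls ++ ps) S T S″ T″ → Inner T₁ A T₂
    inner T₁ A T₂ [] b₁ a₂ b₂ vA sA sT C loop with empty-range T₂ a₂ b₂
    ... | refl = record { Tf = [] ; Af = A ; loop = loop
        ; config = Config-cast (cong (λ w → conf U w A [] D) (sym (++-identityʳ T₁))) C
        ; contT = sym (lower-[] (reverse (contents A))) ; contA = sym (trans (cong reverse (upper-[] (reverse (contents A)))) (reverse-involutive (contents A)))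
        ; stdT = [] empty ; stdA = sA ; valsT = refl ; valsA = refl }
    inner {a} T₁ A T₂ (_∷_ ℓ {refl} cs) b₁ a₂ b₂ vA sA sT C (lcons proc loop) with split-at (ℤ.+ suc (suc a)) T₂ none sT
    ... | splitting B R refl low high sB sR = record
      { Tf = B′ ++ I.Tf ; Af = I.Af ; loop = I.loop
      ; config = Config-cast (cong (λ w → conf U w I.Af [] D) (++-assoc T₁ B′ I.Tf)) I.config
      ; contT = trans (contents-++ B′ I.Tf) (trans (cong₂ _++_ (contB K) (trans I.contT (cong (λ w → lower w (contents R)) reversed)))
          (trans (sym (lower-++ʳ X (contents B) (contents R))) (cong (lower X) (sym (contents-++ B R)))))
      ; contA = trans I.contA (cong reverse (trans (cong (λ w → upper w (contents R)) reversed) (trans (sym (upper-++ʳ X (contents B) (contents R)))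
          (cong (upper X) (sym (contents-++ B R))))))
      ; stdT = Path-join B′ I.Tf none lowBf (All-vals {ℤ._≤_ (ℤ.+ suc (suc a))} R I.Tf (sym I.valsT) high) (stdB K) I.stdT
      ; stdA = I.stdA
      ; valsT = trans (vals-++ B′ I.Tf) (trans (cong₂ _++_ (valsB K) I.valsT) (sym (vals-++ B R)))
      ; valsA = trans I.valsA (valsD K) }
      where
      X = reverse (contents A)
      P = map α U ++ map β T₁
      Q = map β R ++ map α D
      eq₁ : conf U T₁ A (B ++ R) D ≡ P ++ (map α A ++ map β B) ++ Q
      eq₁ = cong (P ++_) (trans (cong (λ w → (map α A ++ w) ++ map α D) (map-++ β B R))
        (trans (cong (_++ map α D) (sym (++-assoc (map α A) (map β B) (map β R)))) (++-assoc (map α A ++ map β B) (map β R) (map α D))))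
      valB = Between⇒≡ B (++⁻ˡ B a₂) low
      module St = Step (k) (suc a) bits ba P A B Q (Config-cast eq₁ C)
        (++⁺ (α-true U (Under⇒≢ U belowU)) (β-true T₁)) (++⁺ (β-true R) (α-true D (AtLeast⇒≢ D aboveD)))
        (++⁺ (α-false U) (β-false T₁ (Under⇒≢ T₁ b₁))) (++⁺ (β-false R (AtLeast⇒≢ R high)) (α-false D)) vA valB sA sB proc
      K = St.block
      B′ = Bf K
      A′ = Df K
      eq₂ : P ++ (map β B′ ++ map α A′) ++ Q ≡ conf U (T₁ ++ B′) A′ R D
      eq₂ = trans (cong (P ++_) (++-assoc (map β B′) (map α A′) Q)) (trans (sym (++-assoc P (map β B′) (map α A′ ++ Q)))
        (cong₂ _++_ (trans (++-assoc (map α U) (map β T₁) (map β B′)) (cong (map α U ++_) (sym (map-++ β T₁ B′)))) (sym (++-assoc (map α A′) (map β R) (map α D)))))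
      lowBf : Under (ℤ.+ suc (suc a)) B′
      lowBf = All-vals {ℤ._< (ℤ.+ suc (suc a))} B B′ (sym (valsB K)) low
      module I = Inner (inner (T₁ ++ B′) A′ R cs (++⁺ (All.map (λ q → ℤₚ.<-trans q (ℤ.+<+ ≤-refl)) b₁) lowBf)
        high (++⁻ʳ B b₂) (All-vals {_≡ ℤ.+ k} A A′ (sym (valsD K)) vA) (stdD K) sR (Config-cast eq₂ St.config) loop)
      reversed : reverse (contents A′) ≡ upper X (contents B)
      reversed = trans (cong reverse (contD K)) (reverse-involutive _)

  record Outer (U t D : List Entry) (S″ T″ : Filling) : Set where
    field
      Tf Sf : List Entry
      config : Config L S″ T″ (map β Tf ++ map α Sf)
      contT  : contents Tf ≡ lower (reverse (contents U)) (contents t)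
      contD  : contents Sf ≡ reverse (upper (reverse (contents U)) (contents t)) ++ contents D
      stdT   : Standard bits Tf
      stdD   : Standard ba Sf
      valsT  : vals Tf ≡ vals t
      valsD  : vals Sf ≡ vals U ++ vals D

  -- The larger letters of S move before the smaller ones, in agreement with the reversed inner
  -- chain, which begins with them. The contributions of successive letters are glued by `lower-++ˡ`
  -- and `upper-++ˡ`.
  outer : ∀ n U t D {S T S″ T″} → AtLeast (ℤ.+ 1) U → Under (ℤ.+ suc n) U → AtLeast (ℤ.+ suc n) D → AtLeast (ℤ.+ 1) t → Under (ℤ.+ suc N) t →
    Standard ba U → Standard bits t → Standard ba D → Config L S T (conf U t [] [] D) →
    Loop (concatMap (λ k → map (λ l → (k , l)) (map suc (upTo N))) (map suc (downFrom n))) S T S″ T″ → Outer U t D S″ T″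
  outer zero U t D aU bU aD at bt sU st sD C loop with empty-range U aU bU
  outer zero U t D aU bU aD at bt sU st sD C lnil | refl = record
    { Tf = t ; Sf = D ; config = C ; contT = refl ; contD = refl
    ; stdT = st ; stdD = sD ; valsT = refl ; valsD = refl }
  outer (suc n) U t D aU bU aD at bt sU st sD C loop with split-at (ℤ.+ suc n) U none sU
  ... | splitting V A refl low high sV sA = record
      { Tf = O.Tf ; Sf = O.Sf ; config = O.config
      ; contT = trans O.contT (trans (cong (lower (reverse (contents V))) I.contT)
          (trans (sym (lower-++ˡ (reverse (contents A)) (reverse (contents V)) (contents t))) (cong (λ w → lower w (contents t)) (sym reversed))))
      ; contD = trans O.contD (trans (cong₂ (λ v w → reverse (upper (reverse (contents V)) v) ++ w) I.contT (trans (contents-++ I.Af D) (cong (_++ contents D) I.contA)))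
          (trans (sym (++-assoc (reverse (upper Y (lower X (contents t)))) (reverse (upper X (contents t))) (contents D)))
            (cong (_++ contents D) (trans (sym (reverse-++ (upper X (contents t)) (upper Y (lower X (contents t)))))
              (cong reverse (trans (sym (upper-++ˡ X Y (contents t))) (cong (λ w → upper w (contents t)) (sym reversed))))))))
      ; stdT = O.stdT ; stdD = O.stdD
      ; valsT = trans O.valsT I.valsT
      ; valsD = trans O.valsD (trans (cong (vals V ++_) (trans (vals-++ I.Af D) (cong (_++ vals D) I.valsA)))
          (trans (sym (++-assoc (vals V) (vals A) (vals D))) (cong (_++ vals D) (sym (vals-++ V A))))) }
    where
    X = reverse (contents A)
    Y = reverse (contents V)
    reversed : reverse (contents (V ++ A)) ≡ X ++ Y
    reversed = trans (cong reverse (contents-++ V A)) (reverse-++ (contents V) (contents A))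
    valA = Between⇒≡ A high (++⁻ʳ V bU)
    eq₁ : conf (V ++ A) t [] [] D ≡ conf V [] A t D
    eq₁ = trans (cong (λ w → (w ++ map β t) ++ map α D) (map-++ α V A)) (trans (cong (_++ map α D) (++-assoc (map α V) (map α A) (map β t)))
      (trans (++-assoc (map α V) (map α A ++ map β t) (map α D)) (cong (_++ (map α A ++ map β t) ++ map α D) (sym (++-identityʳ (map α V))))))
    module I = Inner (inner (suc n) V D low aD [] A t (consecutive N) [] at bt valA sA st (Config-cast eq₁ C) loop)
    eq₂ : conf V I.Tf I.Af [] D ≡ conf V I.Tf [] [] (I.Af ++ D)
    eq₂ = cong ((map α V ++ map β I.Tf) ++_) (trans (cong (_++ map α D) (++-identityʳ (map α I.Af))) (sym (map-++ α I.Af D)))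
    lowA : Under (ℤ.+ suc (suc n)) I.Af
    lowA = All-vals {ℤ._< (ℤ.+ suc (suc n))} A I.Af (sym I.valsA) (++⁻ʳ V bU)
    highA : AtLeast (ℤ.+ suc n) I.Af
    highA = All-vals {ℤ._≤_ (ℤ.+ suc n)} A I.Af (sym I.valsA) high
    module O = Outer (outer n V I.Tf (I.Af ++ D) (++⁻ˡ V aU) low
      (++⁺ highA (All.map (λ q → ℤₚ.≤-trans (ℤ.+≤+ (n≤1+n (suc n))) q) aD))
      (All-vals {ℤ._≤_ (ℤ.+ 1)} t I.Tf (sym I.valsT) at) (All-vals {ℤ._< (ℤ.+ suc N)} t I.Tf (sym I.valsT) bt)
      sV I.stdT (Path-join I.Af D none lowA aD I.stdA sD) (Config-cast eq₂ I.config) I.loop)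

-- From profiles and words back to shapes and fillings

parts-exist : ∀ L m → Prof m → m L ≡ 0 → ∃ λ μ → IsStrict μ × head0 μ ≤ L × prof μ ≗ m
parts-exist zero m p e = [] , nil , z≤n , λ d → sym (n≤0⇒n≡0 (≤-trans (Prof-≤ p (z≤n {d})) (≤-reflexive e)))
parts-exist (suc L) m p e with p L
... | inj₁ f with parts-exist L m p (trans f e)
...   | μ , s , q , r = μ , s , ≤-trans q (n≤1+n L) , r
parts-exist (suc L) m p e | inj₂ f with parts-exist L (λ d → pred (m d)) (pred-Prof p) (cong pred (trans f (cong suc e)))
... | μ , s , q , r = suc L ∷ μ , strict μ s q , ≤-refl , profile
  where
  strict : ∀ μ → IsStrict μ → head0 μ ≤ L → IsStrict (suc L ∷ μ)
  strict [] _ _ = one (s≤s z≤n)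
  strict (n ∷ μ) s q = cons (s≤s q) s
  profile : prof (suc L ∷ μ) ≗ m
  profile d with d <? suc L
  ... | yes l = trans (prof-< {suc L} {μ} l) (trans (cong suc (r d)) (suc-pred (m d)
          {{>-nonZero (≤-trans (≤-trans (s≤s z≤n) (≤-reflexive (sym f))) (Prof-≤ p (≤-pred l)))}}))
  ... | no n = trans (prof-≥ {suc L} {μ} (≮⇒≥ n)) (trans (r d) (trans (cong pred (outside d (≮⇒≥ n))) (sym (outside d (≮⇒≥ n)))))
    where
    outside : ∀ d → suc L ≤ d → m d ≡ 0
    outside d l = n≤0⇒n≡0 (≤-trans (Prof-≤ p l) (≤-reflexive e))

prof⇒⊑ : ∀ {μ ν} → IsStrict μ → IsStrict ν → (∀ d → prof μ d ≤ prof ν d) → μ ⊑ ν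
prof⇒⊑ s t q i j b with inS⇒prof s i j b
... | d , refl , r = prof⇒inS t i d (≤-trans r (q d))

Cells-≐ : ∀ {F G M} → Cells F M → Cells G M → F ≐ G
Cells-≐ {F} {G} C D i j with i ≤? j
... | yes q = trans (cong (F i) (sym (m+[n∸m]≡n q))) (trans (cell C i (j ∸ i)) (trans (sym (cell D i (j ∸ i))) (cong (G i) (m+[n∸m]≡n q))))
... | no q = trans (tri C i j (≰⇒> q)) (sym (tri D i j (≰⇒> q)))

fill-ShapeOf : ∀ {F κ μ} w → IsStrict κ → IsStrict μ → Cells F (fill (prof μ) w) → prof μ ⊕ contents w ≗ prof κ → ShapeOf F κ μ
fill-ShapeOf {F} {κ} {μ} w sκ sμ C e i j = to , from
  where
  to : IsBox F i j → inS κ i j × ¬ inS μ i j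
  to (x , q) with column C q
  ... | d , refl , r with fill-region (prof μ) w r
  ...   | a , b = prof⇒inS sκ i d (≤-trans b (≤-reflexive (e d))) , λ c → 1+n≰n (≤-trans (inS-+ sμ i d c) a)
  from : inS κ i j → ¬ inS μ i j → IsBox F i j
  from a b with inS⇒prof sκ i j a
  ... | d , refl , r with fill-box (prof μ) w {i} {d} (≮⇒≥ λ q → b (prof⇒inS sμ i d q)) (≤-trans r (≤-reflexive (sym (e d))))
  ...   | x , q = x , trans (cell C i d) q

∪F-Cells : ∀ {F G h} u w → Cells F (fill h u) → Cells G (fill (h ⊕ contents u) w) → Cells (F ∪F G) (fill h (u ++ w))
cell (∪F-Cells {F} {G} {h} u w C D) i d = trans (∪F-<∣> F G i (i + d)) (trans (cong₂ _<∣>_ (cell C i d) (cell D i d)) (sym (fill-++ h u w i d)))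
tri (∪F-Cells {F} {G} u w C D) i j q = trans (∪F-<∣> F G i j) (cong₂ _<∣>_ (tri C i j q) (tri D i j q))

-- A chain from `h` up to the staircase. Read backwards it is a chain of the complement, which
-- serves as inner shape of the starred tableau.
record Completion (L : ℕ) (h : Shape) : Set where
  field
    z     : List ℕ
    valid : Up h z
    total : h ⊕ z ≗ λ d → L ∸ d
    back  : Up ∅ (reverse z)
    inner : ∅ ⊕ reverse z ≗ compl L h

completion : ∀ {L h} → Prof h → h L ≡ 0 → Completion L h
completion {L} {h} p e with chain-exists L (compl L h) (compl-Prof p e) (compl-zero L h)
... | z , u , q = record
  { z = reverse z
  ; valid = Up-cong base (proj₁ reversed)
  ; total = λ d → trans (⊕-cong (reverse z) (≗-sym base) d) (proj₂ reversed d)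
  ; back = subst (Up ∅) (sym (reverse-involutive z)) u
  ; inner = λ d → trans (cong (λ w → (∅ ⊕ w) d) (reverse-involutive z)) (q d) }
  where
  reversed = Up-reverse {L = L} u (trans (q L) (compl-zero L h))
  base : compl L (∅ ⊕ z) ≗ h
  base d = trans (compl-cong L q d) (compl-compl (Prof-bound p e) d)

module Starred {L h b F R} (w : List Entry) (κ : Completion L (h ⊕ contents w)) (C : Cells F (fill h w)) (u : Up h (contents w))
  (zero-L : (h ⊕ contents w) L ≡ 0) (p : Standard b w) (j : JRel L F R) where
  open Completion κ

  reversed = Up-reverse {L = L} u zero-L

  uz : Up ∅ (reverse z ++ reverse (contents w))
  uz = Up-++ back (Up-cong (≗-sym inner) (proj₁ reversed))

  starred : JWord b w z R
  starred = J-word w z C u zero-L p j uz inner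

  evacuated : h ≗ ∅ → contents (JWord.word starred) ≡ evac (reverse (contents w))
  evacuated e = trans (JWord.cont starred) (lower-evac z (reverse (contents w)) (record { grows = uz
    ; fills = λ d → trans (⊕-cong (reverse (contents w)) inner d) (trans (proj₂ reversed d) (compl-cong L e d)) }))

view-α : ∀ h w i d → view true h (map α w) i d ≡ fill h w i d
view-α h w i d = trans (cong (pick true) (fill-α h w i d)) (untag (fill h w i d))
  where
  untag : ∀ m → pick true (Maybe.map (tag true) m) ≡ m
  untag nothing = refl
  untag (just _) = refl

view-β : ∀ h w i d → view false h (map β w) i d ≡ fill h w i d
view-β h w i d = trans (cong (pick false) (fill-β h w i d)) (untag (fill h w i d))
  where
  untag : ∀ m → pick false (Maybe.map (tag false) m) ≡ m
  untag nothing = refl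
  untag (just _) = refl

view-α-none : ∀ h w i d → view false h (map α w) i d ≡ nothing
view-α-none h w i d = trans (cong (pick false) (fill-α h w i d)) (mismatch (fill h w i d))
  where
  mismatch : ∀ m → pick false (Maybe.map (tag true) m) ≡ nothing
  mismatch nothing = refl
  mismatch (just _) = refl

view-β-none : ∀ h w i d → view true h (map β w) i d ≡ nothing
view-β-none h w i d = trans (cong (pick true) (fill-β h w i d)) (mismatch (fill h w i d))
  where
  mismatch : ∀ m → pick true (Maybe.map (tag false) m) ≡ nothing
  mismatch nothing = refl
  mismatch (just _) = refl

view-αβ : ∀ h u t → (∀ i d → view true h (map α u ++ map β t) i d ≡ fill h u i d) ×
  (∀ i d → view false h (map α u ++ map β t) i d ≡ fill (h ⊕ contents u) t i d)
view-αβ h u t =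
  (λ i d → trans (view-++ true h (map α u) (map β t) i d) (trans (cong₂ _<∣>_ (view-α h u i d) (view-β-none (h ⊕ contents (map α u)) t i d)) (<∣>-nothing _))) ,
  (λ i d → trans (view-++ false h (map α u) (map β t) i d) (trans (cong₂ _<∣>_ (view-α-none h u i d) (view-β (h ⊕ contents (map α u)) t i d))
    (cong (λ w → fill (h ⊕ w) t i d) (contents-α u))))

view-βα : ∀ h t u → (∀ i d → view false h (map β t ++ map α u) i d ≡ fill h t i d) ×
  (∀ i d → view true h (map β t ++ map α u) i d ≡ fill (h ⊕ contents t) u i d)
view-βα h t u =
  (λ i d → trans (view-++ false h (map β t) (map α u) i d) (trans (cong₂ _<∣>_ (view-β h t i d) (view-α-none (h ⊕ contents (map β t)) u i d)) (<∣>-nothing _))) ,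
  (λ i d → trans (view-++ true h (map β t) (map α u) i d) (trans (cong₂ _<∣>_ (view-β-none h t i d) (view-α (h ⊕ contents (map β t)) u i d))
    (cong (λ w → fill (h ⊕ w) u i d) (contents-β t))))

negative positive : Maybe Letter → Maybe Letter
negative nothing = nothing
negative (just x) = if does (val x ℤ.<? ℤ.+ 0) then just x else nothing
positive nothing = nothing
positive (just x) = if does (ℤ.+ 0 ℤ.<? val x) then just x else nothing

negPart-negative : ∀ F i j → negPart F i j ≡ negative (F i j)
negPart-negative F i j with F i j
... | nothing = refl
... | just x = refl

posPart-positive : ∀ F i j → posPart F i j ≡ positive (F i j)
posPart-positive F i j with F i j
... | nothing = refl
... | just x = refl

signs-negative : ∀ {x} → val x ℤ.< ℤ.+ 0 → negative (just x) ≡ just x × positive (just x) ≡ nothing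
signs-negative {x} q with val x ℤ.<? ℤ.+ 0 | ℤ.+ 0 ℤ.<? val x
... | no n | _ = ⊥-elim (n q)
... | yes _ | yes r = ⊥-elim (ℤₚ.<-asym q r)
... | yes _ | no _ = refl , refl

signs-positive : ∀ {x} → ℤ.+ 0 ℤ.< val x → negative (just x) ≡ nothing × positive (just x) ≡ just x
signs-positive {x} q with val x ℤ.<? ℤ.+ 0 | ℤ.+ 0 ℤ.<? val x
... | _ | no n = ⊥-elim (n q)
... | yes r | yes _ = ⊥-elim (ℤₚ.<-asym q r)
... | no _ | yes _ = refl , refl

sign-split : ∀ m n → Values (ℤ._< ℤ.+ 0) m → Values (ℤ.+ 0 ℤ.<_) n → Disjoint m n → negative (m <∣> n) ≡ m × positive (m <∣> n) ≡ n
sign-split (just x) n p q d = proj₁ (signs-negative {x} (p refl)) , trans (proj₂ (signs-negative {x} (p refl))) (sym (d refl))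
sign-split nothing (just y) p q d = signs-positive {y} (q refl)
sign-split nothing nothing p q d = refl , refl

fill-All : ∀ {P : Entry → Set} h w {i d x} → All P w → fill h w i d ≡ just x → P (d , x)
fill-All h w ps e = placed-All h w (placed-entries h w ps) e

Completion-cong : ∀ {L h g} → h ≗ g → Completion L h → Completion L g
Completion-cong {L} e κ = record { z = z ; valid = Up-cong e valid ; total = λ d → trans (⊕-cong z (≗-sym e) d) (total d)
  ; back = back ; inner = λ d → trans (inner d) (compl-cong L e d) }
  where open Completion κ

positive-val : ∀ {v} → ℤ.+ 1 ℤ.≤ v → ℤ.+ 0 ℤ.< v
positive-val = ℤₚ.suc[i]≤j⇒i<j

star-Under : ∀ w → AtLeast (ℤ.+ 1) w → Under (ℤ.+ 0) (starW w)
star-Under w ps = reverse⁺ (map⁺ (All.map (λ {e} q → subst (ℤ._< ℤ.+ 0) (sym (val-starL (proj₂ e))) (ℤₚ.neg-mono-< (positive-val q))) ps))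

vals-starW-cong : ∀ u w → vals u ≡ vals w → vals (starW u) ≡ vals (starW w)
vals-starW-cong u w e = trans (vals-starW u) (trans (cong (λ v → reverse (map ℤ.-_ v)) e) (sym (vals-starW w)))

-- Starring turns the positive letters into negative ones, so one function can carry the bits of both tableaux.
glue : (bS bT : ℤ → Bool) → ℤ → Bool
glue bS bT v = if does (v ℤ.<? ℤ.+ 0) then starB bS v else bT v

glue-negative : ∀ bS bT {v} → v ℤ.< ℤ.+ 0 → glue bS bT v ≡ starB bS v
glue-negative bS bT {v} q with v ℤ.<? ℤ.+ 0
... | yes _ = refl
... | no n = ⊥-elim (n q)

glue-positive : ∀ bS bT {v} → ℤ.+ 0 ℤ.< v → glue bS bT v ≡ bT v
glue-positive bS bT {v} q with v ℤ.<? ℤ.+ 0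
... | yes r = ⊥-elim (ℤₚ.<-asym q r)
... | no _ = refl

-- Comparison of the two sides

module Assembly {lam nu : List ℕ} {S T : Filling} (sλ : IsStrict lam) (sν : IsStrict nu) (sub : lam ⊑ nu)
  (sytS : SYT lam [] S) (sytT : SYT nu lam T) {SJ B TJ : Filling}
  (jS : JRel (head0 lam) S SJ) (jB : JRel (head0 nu) (SJ ∪F T) B) (jT : JRel (head0 nu) T TJ)
  (N : ℕ) (boundS : Bounded N S) (boundT : Bounded N T) {TS ST : Filling} (switch : Switch N S T TS ST) where

  module US = Standardize.Standardization (Standardize.standardization sλ nil (λ _ _ ()) sytS)
  module UT = Standardize.Standardization (Standardize.standardization sν sλ sub sytT)

  u = contents US.word
  t = contents UT.word
  L = head0 nu

  positive-S : AtLeast (ℤ.+ 1) US.word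
  positive-S = All.map (λ { (i , j , e) → SYT.entries sytS i j _ e }) US.inTab

  positive-T : AtLeast (ℤ.+ 1) UT.word
  positive-T = All.map (λ { (i , j , e) → SYT.entries sytT i j _ e }) UT.inTab

  bounded-S : Under (ℤ.+ suc N) US.word
  bounded-S = All.map (λ { (i , j , e) → ℤₚ.i≤pred[j]⇒i<j (boundS i j _ e) }) US.inTab

  bounded-T : Under (ℤ.+ suc N) UT.word
  bounded-T = All.map (λ { (i , j , e) → ℤₚ.i≤pred[j]⇒i<j (boundT i j _ e) }) UT.inTab

  κ : Completion L (prof nu)
  κ = completion (prof-Prof sν) (prof-head0 sν)

  open Completion κ using (z)

  ut-shape : ∅ ⊕ u ⊕ t ≗ prof nu
  ut-shape d = trans (⊕-cong t US.reach d) (UT.reach d)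

  utz : Up ∅ (u ++ t ++ z)
  utz = Up-++ US.valid (Up-cong (≗-sym US.reach) (Up-++ UT.valid (Up-cong (≗-sym UT.reach) (Completion.valid κ))))

  module W = Word {L} u t z utz (λ d → trans (⊕-cong z ut-shape d) (Completion.total κ d))

  module JS = Starred {head0 lam} US.word (Completion-cong (≗-sym US.reach) (completion (prof-Prof sλ) (prof-head0 sλ)))
    US.cells US.valid (trans (US.reach (head0 lam)) (prof-head0 sλ)) US.std jS
  module SW = JWord JS.starred

  contents-s : contents SW.word ≡ W.s
  contents-s = JS.evacuated λ _ → refl

  module JT = Starred {L} UT.word (Completion-cong (≗-sym UT.reach) κ) UT.cells UT.valid (trans (UT.reach L) (prof-head0 sν)) UT.std jT
  module TW = JWord JT.starred

  st : List Entry
  st = SW.word ++ UT.word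

  contents-st : contents st ≡ W.s ++ t
  contents-st = trans (contents-++ SW.word UT.word) (cong (_++ t) contents-s)

  bits : ℤ → Bool
  bits = glue US.bits UT.bits

  under-s : Under (ℤ.+ 0) SW.word
  under-s = All-vals {ℤ._< (ℤ.+ 0)} (starW US.word) SW.word (sym SW.value) (star-Under US.word positive-S)

  std-st : Standard bits st
  std-st = Path-join SW.word UT.word none under-s (All.map (ℤₚ.≤-trans (ℤ.+≤+ z≤n)) positive-T)
    (Path-cong tt (All.map (λ q → sym (glue-negative US.bits UT.bits q)) under-s) tt SW.std)
    (Path-cong tt (All.map (λ q → sym (glue-positive US.bits UT.bits (positive-val q))) positive-T) tt UT.std)

  s-base : prof lam ≗ ∅ ⊕ contents SW.word
  s-base d = trans (sym (US.reach d)) (trans (sym (W.s-shape d)) (cong (λ w → (∅ ⊕ w) d) (sym contents-s)))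

  st-shape : ∅ ⊕ contents st ≗ prof nu
  st-shape d = trans (cong (λ w → (∅ ⊕ w) d) (contents-++ SW.word UT.word)) (trans (cong (λ g → g d) (⊕-++ ∅ (contents SW.word) t))
    (trans (⊕-cong t (≗-sym s-base) d) (UT.reach d)))

  module JB = Starred {L} {∅} st (Completion-cong (≗-sym st-shape) κ)
    (∪F-Cells SW.word UT.word SW.cells (Cells-cong UT.cells (fill-cong UT.word s-base)))
    (subst (Up ∅) (sym contents-st) (Up-take (W.s ++ t) (subst (Up ∅) (sym (++-assoc W.s t z)) W.uv-s)))
    (trans (st-shape L) (prof-head0 sν)) std-st jB
  module BW = JWord JB.starred

  open Loops L N UT.bits US.bits

  initial-view = view-αβ ∅ US.word UT.word

  switched : Outer US.word UT.word [] ST TS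
  switched = outer N US.word UT.word [] positive-S bounded-S [] positive-T bounded-T US.std UT.std ([] empty)
    (Config-cast (sym (++-identityʳ (map α US.word ++ map β UT.word))) (record
      { CS = Cells-cong US.cells (λ i d → sym (proj₁ initial-view i d))
      ; CT = Cells-cong UT.cells (λ i d → trans (fill-cong UT.word (≗-sym US.reach) i d) (sym (proj₂ initial-view i d)))
      ; valid = subst (Up ∅) (sym contents-ut) (Up-take (u ++ t) (subst (Up ∅) (sym (++-assoc u t z)) utz))
      ; zeroL = trans (cong (λ w → (∅ ⊕ w) L) contents-ut) (trans (cong (λ g → g L) (⊕-++ ∅ u t)) (trans (ut-shape L) (prof-head0 sν))) }))
    switch
    where
    contents-ut : contents (map α US.word ++ map β UT.word) ≡ u ++ t
    contents-ut = trans (contents-++ (map α US.word) (map β UT.word)) (cong₂ _++_ (contents-α US.word) (contents-β UT.word))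
  module O = Outer switched

  contents-Sf : contents O.Sf ≡ W.u′
  contents-Sf = trans O.contD (++-identityʳ W.u′)

  vals-Sf : vals O.Sf ≡ vals US.word
  vals-Sf = trans O.valsD (++-identityʳ (vals US.word))

  positive-Sf : AtLeast (ℤ.+ 1) O.Sf
  positive-Sf = All-vals {ℤ._≤_ (ℤ.+ 1)} US.word O.Sf (sym vals-Sf) positive-S

  under-t : Under (ℤ.+ 0) TW.word
  under-t = All-vals {ℤ._< (ℤ.+ 0)} (starW UT.word) TW.word (sym TW.value) (star-Under UT.word positive-T)

  -- On negative values the bits are those of T starred, as in T^J. On positive values they are
  -- those of S starred twice, hence the original ones, which switching has preserved.
  std-B : Standard (starB bits) (TW.word ++ O.Sf)
  std-B = Path-join TW.word O.Sf none under-t (All.map (ℤₚ.≤-trans (ℤ.+≤+ z≤n)) positive-Sf)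
    (Path-cong tt (All.map (λ q → cong not (sym (glue-positive US.bits UT.bits (ℤₚ.neg-mono-< q)))) under-t) tt TW.std)
    (Path-cong tt (All.map (λ {e} q → sym (trans (cong not (glue-negative US.bits UT.bits (ℤₚ.neg-mono-< (positive-val q)))) (starB-involutive US.bits (val (proj₂ e))))) positive-Sf) tt O.stdD)

  -- The contents agree by `W.evac-st`, the values because starring negates and reverses them, and
  -- the bits by `std-B`; these data determine a standardized word.
  B-word : BW.word ≡ TW.word ++ O.Sf
  B-word = Path-unique BW.std std-B
    (trans BW.cont (trans (cong (lower z) (trans (cong reverse contents-st) (reverse-++ W.s t))) (trans W.evac-st
      (trans (cong₂ _++_ (sym TW.cont) (sym contents-Sf)) (sym (contents-++ TW.word O.Sf))))))
    (trans BW.value (trans (cong vals (starW-++ SW.word UT.word)) (trans (vals-++ (starW UT.word) (starW SW.word))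
      (trans (cong₂ _++_ (sym TW.value) (trans (vals-starW-cong SW.word (starW US.word) SW.value) (trans (cong vals (starW-involutive US.word)) (sym vals-Sf))))
        (sym (vals-++ TW.word O.Sf))))))

  cells-B : Cells B (fill ∅ (TW.word ++ O.Sf))
  cells-B = subst (λ w → Cells B (fill ∅ w)) B-word BW.cells

  m : Shape
  m = ∅ ⊕ contents O.Tf

  final-view = view-βα ∅ O.Tf O.Sf

  cells-TS : Cells TS (fill ∅ O.Tf)
  cells-TS = Cells-cong (Config.CT O.config) (proj₁ final-view)

  cells-ST : Cells ST (fill m O.Sf)
  cells-ST = Cells-cong (Config.CS O.config) (proj₂ final-view)

  valid-Tf : Up ∅ (contents O.Tf)
  valid-Tf = subst (Up ∅) (sym O.contT) (Up-take W.t′ W.t′u′z)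

  final-shape : m ⊕ contents O.Sf ≗ prof nu
  final-shape d = trans (cong₂ (λ v w → (∅ ⊕ v ⊕ w) d) O.contT contents-Sf) (trans (W.t′u′-shape d) (ut-shape d))

  tJ-shape : ∅ ⊕ contents TW.word ≗ m
  tJ-shape d = trans (cong (λ w → (∅ ⊕ w) d) TW.cont) (trans (W.t-J-shape d) (cong (λ w → (∅ ⊕ w) d) (sym O.contT)))

  cells-ST′ : Cells ST (fill (∅ ⊕ contents TW.word) O.Sf)
  cells-ST′ = Cells-cong cells-ST (fill-cong O.Sf (≗-sym tJ-shape))

  union : B ≐ (TJ ∪F ST)
  union = Cells-≐ cells-B (∪F-Cells TW.word O.Sf TW.cells cells-ST′)

  parts : ∃ λ μ → IsStrict μ × head0 μ ≤ L × prof μ ≗ m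
  parts = parts-exist L m (Up-end (contents O.Tf) valid-Tf) (⊕-zero {m} {contents O.Sf} (trans (final-shape L) (prof-head0 sν)))

  mu : List ℕ
  mu = proj₁ parts

  sμ : IsStrict mu
  sμ = proj₁ (proj₂ parts)

  prof-mu : prof mu ≗ m
  prof-mu = proj₂ (proj₂ (proj₂ parts))

  mu⊑nu : mu ⊑ nu
  mu⊑nu = prof⇒⊑ sμ sν λ d → ≤-trans (≤-reflexive (prof-mu d)) (≤-trans (⊕-mono m (contents O.Sf) d) (≤-reflexive (final-shape d)))

  shape-TS : ShapeOf TS mu []
  shape-TS = fill-ShapeOf O.Tf sμ nil cells-TS (≗-sym prof-mu)

  shape-ST : ShapeOf ST nu mu
  shape-ST = fill-ShapeOf O.Sf sν sμ (Cells-cong cells-ST (fill-cong O.Sf (≗-sym prof-mu)))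
    (λ d → trans (⊕-cong (contents O.Sf) prof-mu d) (final-shape d))

  -- The tableau `TS` is starred within the smaller size `head0 mu`, not within that of `nu`. Since
  -- `evac` refers to no staircase, `W.evac-t′` still identifies the result with T^J. The two parts
  -- of `B` then separate by sign.
  module Recovered {TSJ : Filling} (j : JRel (head0 mu) TS TSJ) where
    module JM = Starred {head0 mu} {∅} O.Tf (Completion-cong prof-mu (completion (prof-Prof sμ) (prof-head0 sμ)))
      cells-TS valid-Tf (trans (sym (prof-mu (head0 mu))) (prof-head0 sμ)) O.stdT j
    module MW = JWord JM.starred

    same-word : MW.word ≡ TW.word
    same-word = Path-unique MW.std TW.std
      (trans (JM.evacuated λ _ → refl) (trans (cong (λ w → evac (reverse w)) O.contT) (trans W.evac-t′ (sym TW.cont))))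
      (trans MW.value (trans (vals-starW-cong O.Tf UT.word O.valsT) (sym TW.value)))

    cells-TSJ : Cells TSJ (fill ∅ TW.word)
    cells-TSJ = subst (λ w → Cells TSJ (fill ∅ w)) same-word MW.cells

    sign : ∀ i d → negative (B i (i + d)) ≡ fill ∅ TW.word i d × positive (B i (i + d)) ≡ fill (∅ ⊕ contents TW.word) O.Sf i d
    sign i d = subst (λ x → negative x ≡ fill ∅ TW.word i d × positive x ≡ fill (∅ ⊕ contents TW.word) O.Sf i d)
      (sym (trans (cell cells-B i d) (fill-++ ∅ TW.word O.Sf i d)))
      (sign-split (fill ∅ TW.word i d) (fill (∅ ⊕ contents TW.word) O.Sf i d) (fill-All {λ e → val (proj₂ e) ℤ.< ℤ.+ 0} ∅ TW.word under-t)
        (fill-All {λ e → ℤ.+ 0 ℤ.< val (proj₂ e)} (∅ ⊕ contents TW.word) O.Sf (All.map positive-val positive-Sf))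
        λ e → fill-low (∅ ⊕ contents TW.word) O.Sf (proj₂ (fill-region ∅ TW.word e)))

    negative-part : negPart B ≐ TSJ
    negative-part = Cells-≐ (record
      { cell = λ i d → trans (negPart-negative B i (i + d)) (proj₁ (sign i d))
      ; tri = λ i j q → trans (negPart-negative B i j) (cong negative (tri cells-B i j q)) }) cells-TSJ

    positive-part : posPart B ≐ ST
    positive-part = Cells-≐ (record
      { cell = λ i d → trans (posPart-positive B i (i + d)) (proj₂ (sign i d))
      ; tri = λ i j q → trans (posPart-positive B i j) (cong positive (tri cells-B i j q)) }) cells-ST′

theorem5p6 : (lam nu : List ℕ) (S T : Filling) →
    IsStrict lam → IsStrict nu → lam ⊑ nu →
    SYT lam [] S → SYT nu lam T →
    (SJ B TJ : Filling) →
    JRel (head0 lam) S SJ →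
    JRel (head0 nu) (SJ ∪F T) B →
    JRel (head0 nu) T TJ →
    (N : ℕ) → Bounded N S → Bounded N T →
    (TS ST : Filling) → Switch N S T TS ST →
    (B ≐ (TJ ∪F ST)) ×
    Σ (List ℕ) (λ mu → IsStrict mu × mu ⊑ nu × ShapeOf TS mu [] × ShapeOf ST nu mu ×
      ((TSJ : Filling) → JRel (head0 mu) TS TSJ → (negPart B ≐ TSJ) × (posPart B ≐ ST)))
theorem5p6 lam nu S T sλ sν sub sytS sytT SJ B TJ jS jB jT N boundS boundT TS ST switch =
  A.union , A.mu , A.sμ , A.mu⊑nu , A.shape-TS , A.shape-ST , λ TSJ j → A.Recovered.negative-part j , A.Recovered.positive-part j
  where module A = Assembly sλ sν sub sytS sytT jS jB jT N boundS boundT switch
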